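{- Let $(L,Q)$ and $(L',Q')$ be isospectral definite ternary quadratic lattices over $A=\mathbb F_q[t]$ whose successive minima $(\mu_1,\mu_2,\mu_3)$ satisfy $\mu_1<\mu_2<\mu_3$ and $\mu_1\equiv\mu_3\pmod 2$. If $q>\max\{2+\mu_3-\mu_2,\ 2+\mu_2-\mu_1\}$, then $(L,Q)$ and $(L',Q')$ are isometric.
   Context: $\mathbb F_q$ is a finite field with $q$ odd, $A=\mathbb F_q[t]$, $K=\mathbb F_q(t)$, $K_\infty=\mathbb F_q((1/t))$. For $x\in K$, $\deg x$ is the degree of the numerator minus that of the denominator, $\deg 0=-\infty$. A quadratic lattice $(L,Q)$ over $A$ is a free $A$-module of finite rank with a $K$-valued quadratic form $Q$; $B(\mathbf x,\mathbf y)=Q(\mathbf x+\mathbf y)-Q(\mathbf x)-Q(\mathbf y)$. Ternary means rank 3; definite means $Q$ anisotropic over $K_\infty$. The Gram matrix of a basis $\mathbf v_1,\dots,\mathbf v_n$ is $(m_{ij})$, $m_{ij}=\frac12B(\mathbf v_i,\mathbf v_j)$; a basis is reduced if $\deg m_{ii}\le\deg m_{jj}$ for $i\le j$ and $\deg m_{ij}<\deg m_{ii}$ for $i<j$. Definite lattices have reduced bases and $(\deg m_{11},\dots,\deg m_{nn})$ is independent of the reduced basis: these are the successive minima. $R(L,Q,a)=|\{\mathbf v\in L:Q(\mathbf v)=a\}|$; isospectral means $R(L,Q,a)=R(L',Q',a)$ for all $a\in K$. Isometric means there is an $A$-module isomorphism $\sigma:L\to L'$ with $Q'\circ\sigma=Q$.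 -}

module Defs where

open import Data.Nat as ℕ using (ℕ; zero; suc)
open import Data.Integer as ℤ using (ℤ; +_; -[1+_])
open import Data.Fin as Fin using (Fin; zero; suc)
open import Data.List using (List; []; _∷_; length; map)
open import Data.List.Relation.Unary.Any using (Any)
open import Data.List.Relation.Unary.AllPairs using (AllPairs)
open import Data.Maybe using (Maybe; just; nothing)
open import Data.Bool using (if_then_else_)
open import Data.Product using (Σ; ∃; _×_; _,_)
open import Data.Unit using (⊤)
open import Data.Empty using (⊥)
open import Relation.Nullary using (¬_; yes; no)
open import Relation.Binary.PropositionalEquality using (_≡_)
open import Relation.Binary.Definitions using (DecidableEquality)
open import Algebra.Structures using (IsCommutativeRing)
open import Function.Bundles using (_↔_)

record FiniteField : Set₁ where
  infixl 6 _+_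
  infixl 7 _*_
  field
    Carrier           : Set
    _+_ _*_           : Carrier → Carrier → Carrier
    -_                : Carrier → Carrier
    0# 1#             : Carrier
    isCommutativeRing : IsCommutativeRing _≡_ _+_ _*_ -_ 0# 1#
    0≢1               : ¬ (0# ≡ 1#)
    inverse           : ∀ x → ¬ (x ≡ 0#) → ∃ λ y → x * y ≡ 1#
    _≟_               : DecidableEquality Carrier
    size              : ℕ
    enumeration       : Carrier ↔ Fin size

module Over (𝔽 : FiniteField) where
  open FiniteField 𝔽

  -- A = F_q[t]: coefficient lists (c₀ ∷ c₁ ∷ …) meaning Σ cᵢ tⁱ,
  -- compared up to trailing zeros.

  Poly : Set
  Poly = List Carrier

  coeff : Poly → ℕ → Carrier
  coeff []       _       = 0#
  coeff (c ∷ _)  zero    = c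
  coeff (_ ∷ cs) (suc i) = coeff cs i

  infix 4 _≈ₚ_
  _≈ₚ_ : Poly → Poly → Set
  p ≈ₚ r = ∀ i → coeff p i ≡ coeff r i

  infixl 6 _+ₚ_
  _+ₚ_ : Poly → Poly → Poly
  []      +ₚ r       = r
  (a ∷ p) +ₚ []      = a ∷ p
  (a ∷ p) +ₚ (b ∷ r) = (a + b) ∷ (p +ₚ r)

  infixl 7 _*ₚ_
  _*ₚ_ : Poly → Poly → Poly
  []      *ₚ r = []
  (a ∷ p) *ₚ r = map (a *_) r +ₚ (0# ∷ (p *ₚ r))

  0ₚ 1ₚ : Poly
  0ₚ = []
  1ₚ = 1# ∷ []

  -- degree of a polynomial; nothing stands for deg 0 = -∞
  degₚ : Poly → Maybe ℕ
  degₚ []       = nothing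
  degₚ (c ∷ cs) with degₚ cs
  ... | just k  = just (suc k)
  ... | nothing with c ≟ 0#
  ...   | yes _ = nothing
  ...   | no  _ = just 0

  -- K = F_q(t): fractions num/den (a fraction is a genuine element of K
  -- when its denominator is nonzero, see ValidK).

  record Frac : Set where
    constructor _/_
    field
      num den : Poly
  open Frac public

  ValidK : Frac → Set
  ValidK x = ¬ (den x ≈ₚ 0ₚ)

  infix 4 _≈ₖ_
  _≈ₖ_ : Frac → Frac → Set
  x ≈ₖ y = num x *ₚ den y ≈ₚ num y *ₚ den x

  infixl 6 _+ₖ_
  _+ₖ_ : Frac → Frac → Frac
  x +ₖ y = (num x *ₚ den y +ₚ num y *ₚ den x) / (den x *ₚ den y)

  infixl 7 _*ₖ_
  _*ₖ_ : Frac → Frac → Frac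
  x *ₖ y = (num x *ₚ num y) / (den x *ₚ den y)

  ιₖ : Poly → Frac
  ιₖ p = p / 1ₚ

  -- deg x = deg numerator - deg denominator; nothing stands for -∞
  degₖ : Frac → Maybe ℤ
  degₖ x with degₚ (num x) | degₚ (den x)
  ... | just a  | just b = just (+ a ℤ.- + b)
  ... | _       | _      = nothing

  infix 4 _<ᵈ_ _≤ᵈ_
  _<ᵈ_ : Maybe ℤ → Maybe ℤ → Set
  nothing <ᵈ just _  = ⊤
  just a  <ᵈ just b  = a ℤ.< b
  _       <ᵈ nothing = ⊥

  _≤ᵈ_ : Maybe ℤ → Maybe ℤ → Set
  nothing ≤ᵈ _       = ⊤
  just a  ≤ᵈ just b  = a ℤ.≤ b
  just _  ≤ᵈ nothing = ⊥

  -- K_∞ = F_q((1/t)): a Laurent series (top , co) stands for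
  -- Σ_{k ≥ 0} co k · t^(top - k).

  record Laurent : Set where
    constructor laurent
    field
      top : ℤ
      co  : ℕ → Carrier
  open Laurent public

  coeff∞ : Laurent → ℤ → Carrier
  coeff∞ x j with top x ℤ.- j
  ... | + n      = co x n
  ... | -[1+ _ ] = 0#

  infix 4 _≈∞_
  _≈∞_ : Laurent → Laurent → Set
  x ≈∞ y = ∀ j → coeff∞ x j ≡ coeff∞ y j

  0∞ : Laurent
  0∞ = laurent (+ 0) (λ _ → 0#)

  infixl 6 _+∞_
  _+∞_ : Laurent → Laurent → Laurent
  x +∞ y = laurent m (λ k → coeff∞ x (m ℤ.- + k) + coeff∞ y (m ℤ.- + k))
    where m = top x ℤ.⊔ top y

  sumTo : (ℕ → Carrier) → ℕ → Carrier
  sumTo f zero    = f 0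
  sumTo f (suc k) = sumTo f k + f (suc k)

  infixl 7 _*∞_
  _*∞_ : Laurent → Laurent → Laurent
  x *∞ y = laurent (top x ℤ.+ top y)
                   (λ k → sumTo (λ i → co x i * co y (k ℕ.∸ i)) k)

  ι∞ₚ : Poly → Laurent
  ι∞ₚ p = laurent (+ length p)
                  (λ k → if k ℕ.≤ᵇ length p then coeff p (length p ℕ.∸ k) else 0#)

  IsImage∞ : Frac → Laurent → Set
  IsImage∞ x y = ι∞ₚ (den x) *∞ y ≈∞ ι∞ₚ (num x)

  Σ₃ : {X : Set} → (X → X → X) → (Fin 3 → X) → X
  Σ₃ _⊕_ f = f zero ⊕ (f (suc zero) ⊕ f (suc (suc zero)))

  Vec₃ : Set → Set
  Vec₃ X = Fin 3 → X

  Mat₃ : Set → Set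
  Mat₃ X = Fin 3 → Fin 3 → X

  infix 4 _≈ᵥ_
  _≈ᵥ_ : Vec₃ Poly → Vec₃ Poly → Set
  u ≈ᵥ v = ∀ i → u i ≈ₚ v i

  _·ₘ_ : Mat₃ Poly → Mat₃ Poly → Mat₃ Poly
  (U ·ₘ V) i j = Σ₃ _+ₚ_ (λ k → U i k *ₚ V k j)

  _·ᵥ_ : Mat₃ Poly → Vec₃ Poly → Vec₃ Poly
  (U ·ᵥ v) i = Σ₃ _+ₚ_ (λ k → U i k *ₚ v k)

  Iₘ : Mat₃ Poly
  Iₘ zero          zero          = 1ₚ
  Iₘ (suc zero)    (suc zero)    = 1ₚ
  Iₘ (suc (suc zero)) (suc (suc zero)) = 1ₚ
  Iₘ _             _             = 0ₚ

  infix 4 _≈ₘ_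
  _≈ₘ_ : Mat₃ Poly → Mat₃ Poly → Set
  U ≈ₘ V = ∀ i j → U i j ≈ₚ V i j

  Invertible : Mat₃ Poly → Set
  Invertible U = Σ (Mat₃ Poly) λ V → (U ·ₘ V ≈ₘ Iₘ) × (V ·ₘ U ≈ₘ Iₘ)

  col : Mat₃ Poly → Fin 3 → Vec₃ Poly
  col U j i = U i j

  -- Ternary quadratic lattices over A: L = A³ with the K-valued quadratic
  -- form Q(x) = Σᵢⱼ mᵢⱼ xᵢ xⱼ given by its symmetric Gram matrix
  -- mᵢⱼ = ½ B(eᵢ, eⱼ) ∈ K with respect to the standard basis.

  record TernaryLattice : Set where
    field
      gram      : Mat₃ Frac
      gramValid : ∀ i j → ValidK (gram i j)
      gramSym   : ∀ i j → gram i j ≈ₖ gram j i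
  open TernaryLattice public

  halfB : TernaryLattice → Vec₃ Poly → Vec₃ Poly → Frac
  halfB L x y = Σ₃ _+ₖ_ (λ i → Σ₃ _+ₖ_ (λ j → gram L i j *ₖ ιₖ (x i *ₚ y j)))

  Q : TernaryLattice → Vec₃ Poly → Frac
  Q L x = halfB L x x

  IsotropicOverK∞ : TernaryLattice → Set
  IsotropicOverK∞ L =
    Σ (Vec₃ Laurent) λ x → ¬ (∀ i → x i ≈∞ 0∞) ×
    Σ (Mat₃ Laurent) λ m → (∀ i j → IsImage∞ (gram L i j) (m i j)) ×
      (Σ₃ _+∞_ (λ i → Σ₃ _+∞_ (λ j → m i j *∞ (x i *∞ x j))) ≈∞ 0∞)

  Definite : TernaryLattice → Set
  Definite L = ¬ IsotropicOverK∞ L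

  gramOf : TernaryLattice → Mat₃ Poly → Mat₃ Frac
  gramOf L U i j = halfB L (col U i) (col U j)

  Reduced : Mat₃ Frac → Set
  Reduced g = (∀ i j → i Fin.≤ j → degₖ (g i i) ≤ᵈ degₖ (g j j))
            × (∀ i j → i Fin.< j → degₖ (g i j) <ᵈ degₖ (g i i))

  SuccessiveMinima : TernaryLattice → ℤ → ℤ → ℤ → Set
  SuccessiveMinima L μ₁ μ₂ μ₃ =
    Σ (Mat₃ Poly) λ U → Invertible U × Reduced (gramOf L U) ×
      (degₖ (gramOf L U zero zero) ≡ just μ₁) ×
      (degₖ (gramOf L U (suc zero) (suc zero)) ≡ just μ₂) ×
      (degₖ (gramOf L U (suc (suc zero)) (suc (suc zero))) ≡ just μ₃)

  RepNumber : TernaryLattice → Frac → ℕ → Set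
  RepNumber L a n =
    Σ (List (Vec₃ Poly)) λ xs → (length xs ≡ n) ×
      AllPairs (λ u v → ¬ (u ≈ᵥ v)) xs ×
      (∀ v → (Q L v ≈ₖ a → Any (v ≈ᵥ_) xs) × (Any (v ≈ᵥ_) xs → Q L v ≈ₖ a))

  Isospectral : TernaryLattice → TernaryLattice → Set
  Isospectral L L' = ∀ a → ValidK a → ∀ n →
    (RepNumber L a n → RepNumber L' a n) × (RepNumber L' a n → RepNumber L a n)

  Isometric : TernaryLattice → TernaryLattice → Set
  Isometric L L' = Σ (Mat₃ Poly) λ U → Invertible U × (∀ v → Q L' (U ·ᵥ v) ≈ₖ Q L v)

{-# OPTIONS --safe #-}
module Submission where

-- Clearing denominators, the Gram matrices of reduced bases become polynomial matrices with diagonal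
-- a, d, g and upper entries b, e, f. A binary subform whose discriminant is a square in K∞ has an isotropic
-- vector; hence definiteness forces the second minimum to have the parity opposite to the others and
-- -a₀g₀ to be a nonsquare, where a₀, g₀ are leading coefficients. Counting representations of all values up
-- to a given degree and composing Q with an F_q-linear functional χ on polynomials gives quadratic forms over
-- F_q with equal value distributions. Squares in one variable can be cancelled from such a distribution
-- (convolving with a second, negated square yields a hyperbolic plane), which is Gaussian elimination without
-- matching the variables of the two forms. When two variables (ξ , c) remain, whose top coefficient is the
-- anisotropic form X = a₀ξ² + g₀c², summing Y/X over (ξ , c) ≢ 0 recovers the coefficient of c² in Y. The
-- eliminated entries are rational in χ: varying one coordinate of χ at a time moves exactly one pivot and so
-- peels off one correction term after the other. This gives a, d, g and shows that b, e, f agree up to signs,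
-- where f can change sign alone only if b or e vanishes; hence sign changes of the basis match the forms.

open import Defs
open import Algebra.Bundles using (CommutativeRing)

-- Equal representation numbers match values with multiplicity, but give no map between the vectors
-- that take them. Counting becomes usable because anisotropy at infinity turns deg Q(v) ≤ W into a
-- condition on each coefficient of v separately: tⁱvⱼ has weight μⱼ + 2i, and exactly the
-- combinations of monomials of weight at most W occur. So one F_q-space, depending only on the
-- minima, carries the counts of both forms. Ordering monomials by weight makes peeling work. An
-- entry pairing weights x and y has degree at most (x + y)/2, so in the Gram matrix of the first i
-- + 1 monomials the power of t given by the i-th weight occurs only in the last diagonal entry.
-- Moving χ at that power shifts one pivot linearly. Three points then kill a quadratic polynomial;
-- one exceptional value and the pole must be avoided as well, hence q ≥ 5, which an odd q > 3
-- satisfies. Represented values fix leading coefficients only up to squares, so the second basis is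
-- rescaled beforehand: a and d₀ by means of representing vectors, g₀ by comparing the nonsquares
-- -a₀g₀.

module IntegerCoefficients {c ℓ} (R : CommutativeRing c ℓ) where
  open import Data.Nat as ℕ using (ℕ; zero; suc)
  open import Data.Integer as ℤ using (ℤ; +_; -[1+_])
  import Data.Integer.Properties as ℤₚ
  import Data.Nat.Properties as ℕₚ
  open import Data.Maybe using (Maybe; just; nothing)
  open import Relation.Nullary using (yes; no)
  import Relation.Binary.PropositionalEquality as ≡
  import Algebra.Solver.Ring
  open import Algebra.Solver.Ring.AlmostCommutativeRing using (fromCommutativeRing; _-Raw-AlmostCommutative⟶_)
  open CommutativeRing R
  open import Algebra.Properties.Semiring.Mult semiring
    using (_×_; ×-homo-+; ×1-homo-*)
  open import Algebra.Properties.Ring ring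
    using (-‿distribˡ-*; -‿distribʳ-*; -‿+-comm; -0#≈0#; -‿involutive)
  open import Relation.Binary.Reasoning.Setoid setoid

  -- With ℤ as coefficient ring the solver can compare coefficients and cancel opposite terms in any
  -- commutative ring, even in the ring of power series, whose equality is not decidable.
  ⟦_⟧ᶻ : ℤ → Carrier
  ⟦ + n ⟧ᶻ      = n × 1#
  ⟦ -[1+ n ] ⟧ᶻ = - (suc n × 1#)

  ⊖-homo : ∀ m n → ⟦ m ℤ.⊖ n ⟧ᶻ ≈ m × 1# + - (n × 1#)
  ⊖-homo m       zero    = sym (trans (+-congˡ -0#≈0#) (+-identityʳ _))
  ⊖-homo zero    (suc n) = sym (+-identityˡ _)
  ⊖-homo (suc m) (suc n) = begin
    ⟦ suc m ℤ.⊖ suc n ⟧ᶻ              ≡⟨ ≡.cong ⟦_⟧ᶻ (ℤₚ.[1+m]⊖[1+n]≡m⊖n m n) ⟩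
    ⟦ m ℤ.⊖ n ⟧ᶻ                      ≈⟨ ⊖-homo m n ⟩
    m × 1# + - (n × 1#)               ≈⟨ +-congʳ (sym (+-identityˡ _)) ⟩
    0# + m × 1# + - (n × 1#)          ≈⟨ +-congʳ (+-congʳ (sym (-‿inverseʳ 1#))) ⟩
    1# + - 1# + m × 1# + - (n × 1#)   ≈⟨ +-congʳ (trans (+-assoc _ _ _)
                                           (trans (+-congˡ (+-comm _ _)) (sym (+-assoc _ _ _)))) ⟩
    1# + m × 1# + - 1# + - (n × 1#)   ≈⟨ +-assoc _ _ _ ⟩
    1# + m × 1# + (- 1# + - (n × 1#)) ≈⟨ +-congˡ (-‿+-comm _ _) ⟩
    1# + m × 1# + - (1# + n × 1#)     ∎

  +ᶻ-homo : ∀ i j → ⟦ i ℤ.+ j ⟧ᶻ ≈ ⟦ i ⟧ᶻ + ⟦ j ⟧ᶻ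
  +ᶻ-homo (+ m)      (+ n)      = ×-homo-+ 1# m n
  +ᶻ-homo (+ m)      -[1+ n ]   = ⊖-homo m (suc n)
  +ᶻ-homo -[1+ m ]   (+ n)      = trans (⊖-homo n (suc m)) (+-comm _ _)
  +ᶻ-homo -[1+ m ]   -[1+ n ]   = trans (-‿cong
    (trans (reflexive (≡.cong (_× 1#) (≡.cong suc (≡.sym (ℕₚ.+-suc m n)))))
           (×-homo-+ 1# (suc m) (suc n)))) (sym (-‿+-comm _ _))

  -ᶻ-homo : ∀ i → ⟦ ℤ.- i ⟧ᶻ ≈ - ⟦ i ⟧ᶻ
  -ᶻ-homo (+ zero)  = sym -0#≈0#
  -ᶻ-homo (+ suc n) = refl
  -ᶻ-homo -[1+ n ]  = sym (-‿involutive _)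

  *ᶻ-homo : ∀ i j → ⟦ i ℤ.* j ⟧ᶻ ≈ ⟦ i ⟧ᶻ * ⟦ j ⟧ᶻ
  *ᶻ-homo (+ m)    (+ n)    = trans (reflexive (≡.cong ⟦_⟧ᶻ (≡.sym (ℤₚ.pos-* m n)))) (×1-homo-* m n)
  *ᶻ-homo (+ m)    -[1+ n ] = begin
    ⟦ + m ℤ.* -[1+ n ] ⟧ᶻ         ≡⟨ ≡.cong ⟦_⟧ᶻ (≡.sym (ℤₚ.neg-distribʳ-* (+ m) (+ suc n))) ⟩
    ⟦ ℤ.- (+ m ℤ.* + suc n) ⟧ᶻ    ≈⟨ -ᶻ-homo (+ m ℤ.* + suc n) ⟩
    - ⟦ + m ℤ.* + suc n ⟧ᶻ        ≈⟨ -‿cong (*ᶻ-homo (+ m) (+ suc n)) ⟩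
    - (m × 1# * (suc n × 1#))     ≈⟨ -‿distribʳ-* _ _ ⟩
    m × 1# * - (suc n × 1#)       ∎
  *ᶻ-homo -[1+ m ] (+ n)    = begin
    ⟦ -[1+ m ] ℤ.* + n ⟧ᶻ         ≡⟨ ≡.cong ⟦_⟧ᶻ (≡.sym (ℤₚ.neg-distribˡ-* (+ suc m) (+ n))) ⟩
    ⟦ ℤ.- (+ suc m ℤ.* + n) ⟧ᶻ    ≈⟨ -ᶻ-homo (+ suc m ℤ.* + n) ⟩
    - ⟦ + suc m ℤ.* + n ⟧ᶻ        ≈⟨ -‿cong (*ᶻ-homo (+ suc m) (+ n)) ⟩
    - (suc m × 1# * (n × 1#))     ≈⟨ -‿distribˡ-* _ _ ⟩
    - (suc m × 1#) * (n × 1#)     ∎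
  *ᶻ-homo -[1+ m ] -[1+ n ] = begin
    (suc m ℕ.* suc n) × 1#             ≈⟨ ×1-homo-* (suc m) (suc n) ⟩
    suc m × 1# * (suc n × 1#)          ≈⟨ sym (-‿involutive _) ⟩
    - - (suc m × 1# * (suc n × 1#))    ≈⟨ -‿cong (-‿distribˡ-* _ _) ⟩
    - (- (suc m × 1#) * (suc n × 1#))  ≈⟨ -‿distribʳ-* _ _ ⟩
    - (suc m × 1#) * - (suc n × 1#)    ∎

  private
    morphism : ℤ.+-*-rawRing -Raw-AlmostCommutative⟶ fromCommutativeRing R
    morphism = record
      { ⟦_⟧ = ⟦_⟧ᶻ ; +-homo = +ᶻ-homo ; *-homo = *ᶻ-homo ; -‿homo = -ᶻ-homo
      ; 0-homo = refl ; 1-homo = +-identityʳ 1# }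

    coeff? : ∀ i j → Maybe (⟦ i ⟧ᶻ ≈ ⟦ j ⟧ᶻ)
    coeff? i j with i ℤ.≟ j
    ... | yes i≡j = just (reflexive (≡.cong ⟦_⟧ᶻ i≡j))
    ... | no  _   = nothing

  open Algebra.Solver.Ring ℤ.+-*-rawRing (fromCommutativeRing R) morphism coeff? public
    using (solve; _:=_; _:+_; _:*_; _:-_; :-_; con)

open import Algebra.Structures using (IsCommutativeRing; IsCommutativeMonoid)
open import Data.Bool using (if_then_else_)
open import Data.Empty using (⊥-elim; ⊥)
open import Data.Fin as Fin using (Fin; zero; suc)
open import Data.Integer as ℤ using (ℤ; -[1+_])
open import Data.Integer.Divisibility using (_∣_)
import Data.Integer.Properties as ℤₚ
import Data.Integer.Solver
open import Data.List as List using (List; []; _∷_; map; length; _++_; foldr; filter; cartesianProductWith; allFin)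
open import Data.List.Membership.Propositional using (_∈_; _∉_; find; lose)
open import Data.List.Membership.Propositional.Properties using (∈-∃++; ∈-filter⁺; ∈-filter⁻; ∈-map⁺; ∈-allFin; ∈-cartesianProductWith⁺; ∈-cartesianProductWith⁻)
open import Data.List.Properties using (length-map; length-tabulate)
open import Data.List.Relation.Binary.Permutation.Propositional as Perm using (_↭_; ↭-sym; ↭-trans)
open import Data.List.Relation.Binary.Permutation.Propositional.Properties as Permₚ using (filter-↭; ↭-length; ∈-resp-↭)
open import Data.List.Relation.Unary.All as All using (All; []; _∷_)
open import Data.List.Relation.Unary.All.Properties using (¬All⇒Any¬)
open import Data.List.Relation.Unary.AllPairs as AllPairs using ([]; _∷_; AllPairs)
import Data.List.Relation.Unary.AllPairs.Properties as AllPairs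
open import Data.List.Relation.Unary.Any as Any using (here; there; Any)
import Data.List.Relation.Unary.Any.Properties as Any
open import Data.List.Relation.Unary.Unique.Propositional using (Unique)
import Data.List.Relation.Unary.Unique.Propositional.Properties as Unique
open import Data.Maybe using (just; nothing)
open import Data.Maybe.Properties using (just-injective)
open import Data.Nat as ℕ using (ℕ; zero; suc; _≤_; z≤n; s≤s; _<_; _%_)
import Data.Nat.DivMod as DivMod
import Data.Nat.Divisibility as ℕ∣
import Data.Nat.Properties as ℕₚ
open import Data.Nat.Solver using (module +-*-Solver)
open import Data.Product using (_,_; proj₁; proj₂; _×_; ∃; ∃₂; Σ)
open import Data.Sum as Sum using (_⊎_; inj₁; inj₂)
open import Data.Unit using (⊤; tt)
open import Data.Vec as Vec using (Vec; []; _∷_)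
import Data.Vec.Properties as Vec
open import Function using (_∘_)
open import Function.Bundles using (Inverse)
open import Level using (0ℓ)
open import Relation.Binary.Definitions using (DecidableEquality; tri<; tri≈; tri>)
open import Relation.Binary.PropositionalEquality using (_≡_; refl; sym; trans; cong; cong₂; module ≡-Reasoning; _≢_; subst; subst₂)
open import Relation.Nullary using (¬_; yes; no; Dec)
open import Relation.Unary using (Decidable)

-- The field, power series over it, and the polynomial ring.

module FieldTheory (𝔽 : FiniteField) where
  open FiniteField 𝔽 public
  open Over 𝔽 public

  F-ring : CommutativeRing 0ℓ 0ℓ
  F-ring = record { isCommutativeRing = isCommutativeRing }

  open IsCommutativeRing isCommutativeRing public
    using (+-assoc; +-comm; +-identityˡ; +-identityʳ; *-assoc; *-comm; *-identityˡ; *-identityʳ;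
           distribˡ; distribʳ; zeroˡ; zeroʳ; -‿inverseˡ; -‿inverseʳ)
  module F-solver = IntegerCoefficients F-ring

  -- The value 0 at 0 makes the scaling law `inv-*` hold without exception, so that sums of
  -- quotients may run over all pairs, the origin included.
  inv : Carrier → Carrier
  inv x with x ≟ 0#
  ... | yes _  = 0#
  ... | no x≢0 = proj₁ (inverse x x≢0)

  inv-inverseʳ : ∀ {x} → ¬ x ≡ 0# → x * inv x ≡ 1#
  inv-inverseʳ {x} x≢0 with x ≟ 0#
  ... | yes x≡0 = ⊥-elim (x≢0 x≡0)
  ... | no x≢0′ = proj₂ (inverse x x≢0′)

  *-cancelˡ : ∀ {x y z} → ¬ x ≡ 0# → x * y ≡ x * z → y ≡ z
  *-cancelˡ {x} {y} {z} x≢0 eq = begin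
    y                ≡⟨ sym (*-identityˡ y) ⟩
    1# * y           ≡⟨ cong (_* y) (sym (inv-inverseʳ x≢0)) ⟩
    x * inv x * y    ≡⟨ F.solve 3 (λ x i y → x F.:* i F.:* y F.:= i F.:* (x F.:* y)) refl x (inv x) y ⟩
    inv x * (x * y)  ≡⟨ cong (inv x *_) eq ⟩
    inv x * (x * z)  ≡⟨ F.solve 3 (λ x i y → i F.:* (x F.:* y) F.:= x F.:* i F.:* y) refl x (inv x) z ⟩
    x * inv x * z    ≡⟨ cong (_* z) (inv-inverseʳ x≢0) ⟩
    1# * z           ≡⟨ *-identityˡ z ⟩
    z                ∎
    where open ≡-Reasoning
          module F = F-solver

  *-≢0 : ∀ {x y} → ¬ x ≡ 0# → ¬ y ≡ 0# → ¬ x * y ≡ 0#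
  *-≢0 x≢0 y≢0 xy≡0 = y≢0 (*-cancelˡ x≢0 (trans xy≡0 (sym (zeroʳ _))))

  Series : Set
  Series = ℕ → Carrier

  infix 4 _≗_
  _≗_ : Series → Series → Set
  f ≗ g = ∀ n → f n ≡ g n

  infixl 6 _⊕_
  _⊕_ : Series → Series → Series
  (f ⊕ g) n = f n + g n

  ⊝_ : Series → Series
  (⊝ f) n = - f n

  0ˢ 1ˢ : Series
  0ˢ _       = 0#
  1ˢ zero    = 1#
  1ˢ (suc _) = 0#

  infixl 7 _⊛_
  -- The Cauchy product, by recursion on the index: splitting off the constant coefficient of the
  -- left factor avoids finite sums and makes the ring laws structural inductions.
  _⊛_ : Series → Series → Series
  (f ⊛ g) zero    = f 0 * g 0
  (f ⊛ g) (suc n) = f 0 * g (suc n) + ((f ∘ suc) ⊛ g) n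

  ⊛-cong : ∀ {f f′ g g′} → f ≗ f′ → g ≗ g′ → f ⊛ g ≗ f′ ⊛ g′
  ⊛-cong p q zero    = cong₂ _*_ (p 0) (q 0)
  ⊛-cong p q (suc n) = cong₂ _+_ (cong₂ _*_ (p 0) (q (suc n))) (⊛-cong (p ∘ suc) q n)

  ⊛-zeroˡ : ∀ g → 0ˢ ⊛ g ≗ 0ˢ
  ⊛-zeroˡ g zero    = zeroˡ _
  ⊛-zeroˡ g (suc n) = trans (cong₂ _+_ (zeroˡ _) (⊛-zeroˡ g n)) (+-identityˡ _)

  ⊛-identityˡ : ∀ g → 1ˢ ⊛ g ≗ g
  ⊛-identityˡ g zero    = *-identityˡ _
  ⊛-identityˡ g (suc n) = trans (cong₂ _+_ (*-identityˡ _) (⊛-zeroˡ g n)) (+-identityʳ _)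

  ⊛-distribʳ : ∀ h f g → (f ⊕ g) ⊛ h ≗ (f ⊛ h) ⊕ (g ⊛ h)
  ⊛-distribʳ h f g zero    = distribʳ _ _ _
  ⊛-distribʳ h f g (suc n) = trans (cong₂ _+_ (distribʳ _ _ _) (⊛-distribʳ h (f ∘ suc) (g ∘ suc) n))
    (solve 4 (λ a b c d → (a :+ b) :+ (c :+ d) := (a :+ c) :+ (b :+ d)) refl _ _ _ _)
    where open F-solver

  ⊛-scaleˡ : ∀ c f g → ((λ n → c * f n) ⊛ g) ≗ λ n → c * (f ⊛ g) n
  ⊛-scaleˡ c f g zero    = *-assoc _ _ _
  ⊛-scaleˡ c f g (suc n) = trans (cong₂ _+_ (*-assoc _ _ _) (⊛-scaleˡ c (f ∘ suc) g n))
    (sym (distribˡ _ _ _))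

  -- The same recursion started from the other end; commutativity comes from playing it against the
  -- defining one.
  ⊛-unfoldʳ : ∀ f g n → (f ⊛ g) (suc n) ≡ (f ⊛ (g ∘ suc)) n + f (suc n) * g 0
  ⊛-unfoldʳ f g zero    = refl
  ⊛-unfoldʳ f g (suc n) = trans (cong (f 0 * g (suc (suc n)) +_) (⊛-unfoldʳ (f ∘ suc) g n))
    (sym (+-assoc _ _ _))

  ⊛-comm : ∀ f g → f ⊛ g ≗ g ⊛ f
  ⊛-comm f g zero    = *-comm _ _
  ⊛-comm f g (suc n) = trans (cong (f 0 * g (suc n) +_) (⊛-comm (f ∘ suc) g n))
    (trans (solve 3 (λ a b c → a :* b :+ c := c :+ b :* a) refl (f 0) (g (suc n)) _)
           (sym (⊛-unfoldʳ g f n)))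
    where open F-solver

  ⊛-assoc : ∀ f g h → (f ⊛ g) ⊛ h ≗ f ⊛ (g ⊛ h)
  ⊛-assoc f g h zero    = *-assoc _ _ _
  ⊛-assoc f g h (suc n) = begin
    f 0 * g 0 * h (suc n) + ((λ k → f 0 * g (suc k) + ((f ∘ suc) ⊛ g) k) ⊛ h) n
      ≡⟨ cong (f 0 * g 0 * h (suc n) +_) (⊛-distribʳ h _ _ n) ⟩
    f 0 * g 0 * h (suc n) + (((λ k → f 0 * g (suc k)) ⊛ h) n + (((f ∘ suc) ⊛ g) ⊛ h) n)
      ≡⟨ cong₂ (λ x y → f 0 * g 0 * h (suc n) + (x + y)) (⊛-scaleˡ (f 0) (g ∘ suc) h n)
               (⊛-assoc (f ∘ suc) g h n) ⟩
    f 0 * g 0 * h (suc n) + (f 0 * ((g ∘ suc) ⊛ h) n + ((f ∘ suc) ⊛ (g ⊛ h)) n)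
      ≡⟨ solve 5 (λ a b c d e → a :* b :* c :+ (a :* d :+ e) := a :* (b :* c :+ d) :+ e) refl _ _ _ _ _ ⟩
    f 0 * (g 0 * h (suc n) + ((g ∘ suc) ⊛ h) n) + ((f ∘ suc) ⊛ (g ⊛ h)) n ∎
    where open F-solver
          open ≡-Reasoning

  S-ring : CommutativeRing 0ℓ 0ℓ
  S-ring = record
    { Carrier = Series ; _≈_ = _≗_ ; _+_ = _⊕_ ; _*_ = _⊛_ ; -_ = ⊝_ ; 0# = 0ˢ ; 1# = 1ˢ
    ; isCommutativeRing = record
      { isRing = record
        { +-isAbelianGroup = record
          { isGroup = record
            { isMonoid = record
              { isSemigroup = record
                { isMagma = record
                  { isEquivalence = record
                    { refl = λ _ → refl ; sym = λ p n → sym (p n) ; trans = λ p q n → trans (p n) (q n) }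
                  ; ∙-cong = λ p q n → cong₂ _+_ (p n) (q n) }
                ; assoc = λ f g h n → +-assoc _ _ _ }
              ; identity = (λ f n → +-identityˡ _) , (λ f n → +-identityʳ _) }
            ; inverse = (λ f n → -‿inverseˡ _) , (λ f n → -‿inverseʳ _)
            ; ⁻¹-cong = λ p n → cong -_ (p n) }
          ; comm = λ f g n → +-comm _ _ }
        ; *-cong = ⊛-cong
        ; *-assoc = ⊛-assoc
        ; *-identity = ⊛-identityˡ , (λ f n → trans (⊛-comm f 1ˢ n) (⊛-identityˡ f n))
        ; distrib = (λ f g h n → trans (⊛-comm f (g ⊕ h) n) (trans (⊛-distribʳ f g h n)
                       (cong₂ _+_ (⊛-comm g f n) (⊛-comm h f n)))) , ⊛-distribʳ }
      ; *-comm = ⊛-comm } }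

  module S = CommutativeRing S-ring
  module S-solver = IntegerCoefficients S-ring

  coeff-+ : ∀ p r → coeff (p +ₚ r) ≗ coeff p ⊕ coeff r
  coeff-+ []      r       n       = sym (+-identityˡ _)
  coeff-+ (a ∷ p) []      n       = sym (+-identityʳ _)
  coeff-+ (a ∷ p) (b ∷ r) zero    = refl
  coeff-+ (a ∷ p) (b ∷ r) (suc n) = coeff-+ p r n

  coeff-scale : ∀ c p n → coeff (map (c *_) p) n ≡ c * coeff p n
  coeff-scale c []      n       = sym (zeroʳ c)
  coeff-scale c (a ∷ p) zero    = refl
  coeff-scale c (a ∷ p) (suc n) = coeff-scale c p n

  coeff-* : ∀ p r → coeff (p *ₚ r) ≗ coeff p ⊛ coeff r
  coeff-* []      r n       = sym (⊛-zeroˡ (coeff r) n)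
  coeff-* (a ∷ p) r zero    = trans (coeff-+ (map (a *_) r) (0# ∷ (p *ₚ r)) 0)
    (trans (+-identityʳ _) (coeff-scale a r 0))
  coeff-* (a ∷ p) r (suc n) = trans (coeff-+ (map (a *_) r) (0# ∷ (p *ₚ r)) (suc n))
    (cong₂ _+_ (coeff-scale a r (suc n)) (coeff-* p r n))

  -ₚ_ : Poly → Poly
  -ₚ p = map -_ p

  -0≡0 : - 0# ≡ 0#
  -0≡0 = F-solver.solve 0 (F-solver.:- F-solver.con (ℤ.+ 0) F-solver.:= F-solver.con (ℤ.+ 0)) refl
    where import Data.Integer as ℤ

  coeff-neg : ∀ p n → coeff (-ₚ p) n ≡ - coeff p n
  coeff-neg []      n       = sym -0≡0
  coeff-neg (a ∷ p) zero    = refl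
  coeff-neg (a ∷ p) (suc n) = coeff-neg p n

  coeff-1 : coeff 1ₚ ≗ 1ˢ
  coeff-1 zero    = refl
  coeff-1 (suc n) = refl

  +ₚ-cong : ∀ {p p′ r r′} → p ≈ₚ p′ → r ≈ₚ r′ → p +ₚ r ≈ₚ p′ +ₚ r′
  +ₚ-cong {p} {p′} {r} {r′} e f n = trans (coeff-+ p r n)
    (trans (cong₂ _+_ (e n) (f n)) (sym (coeff-+ p′ r′ n)))

  *ₚ-cong : ∀ {p p′ r r′} → p ≈ₚ p′ → r ≈ₚ r′ → p *ₚ r ≈ₚ p′ *ₚ r′
  *ₚ-cong {p} {p′} {r} {r′} e f n = trans (coeff-* p r n)
    (trans (⊛-cong e f n) (sym (coeff-* p′ r′ n)))

  P-ring : CommutativeRing 0ℓ 0ℓ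
  P-ring = record
    { Carrier = Poly ; _≈_ = _≈ₚ_ ; _+_ = _+ₚ_ ; _*_ = _*ₚ_ ; -_ = -ₚ_ ; 0# = 0ₚ ; 1# = 1ₚ
    ; isCommutativeRing = record
      { isRing = record
        { +-isAbelianGroup = record
          { isGroup = record
            { isMonoid = record
              { isSemigroup = record
                { isMagma = record
                  { isEquivalence = record
                    { refl = λ _ → refl ; sym = λ p n → sym (p n) ; trans = λ p q n → trans (p n) (q n) }
                  ; ∙-cong = λ {p} {p′} {r} {r′} → +ₚ-cong {p} {p′} {r} {r′} }
                ; assoc = λ p r s n → trans (coeff-+ (p +ₚ r) s n) (trans (cong (_+ coeff s n) (coeff-+ p r n))
                    (trans (+-assoc _ _ _) (sym (trans (coeff-+ p (r +ₚ s) n)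
                      (cong (coeff p n +_) (coeff-+ r s n)))))) }
              ; identity = (λ p n → refl) , (λ p n → trans (coeff-+ p [] n) (+-identityʳ _)) }
            ; inverse = (λ p n → trans (coeff-+ (-ₚ p) p n) (trans (cong (_+ coeff p n) (coeff-neg p n)) (-‿inverseˡ _)))
                      , (λ p n → trans (coeff-+ p (-ₚ p) n) (trans (cong (coeff p n +_) (coeff-neg p n)) (-‿inverseʳ _)))
            ; ⁻¹-cong = λ {p} {r} e n → trans (coeff-neg p n) (trans (cong -_ (e n)) (sym (coeff-neg r n))) }
          ; comm = λ p r n → trans (coeff-+ p r n) (trans (+-comm _ _) (sym (coeff-+ r p n))) }
        ; *-cong = λ {p} {p′} {r} {r′} → *ₚ-cong {p} {p′} {r} {r′}
        ; *-assoc = λ p r s n → trans (coeff-* (p *ₚ r) s n) (trans (⊛-cong (coeff-* p r) (λ _ → refl) n)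
            (trans (⊛-assoc _ _ _ n) (sym (trans (coeff-* p (r *ₚ s) n) (⊛-cong (λ _ → refl) (coeff-* r s) n)))))
        ; *-identity = (λ p n → trans (coeff-* 1ₚ p n) (trans (⊛-cong coeff-1 (λ _ → refl) n) (⊛-identityˡ _ n)))
                     , (λ p n → trans (coeff-* p 1ₚ n) (trans (⊛-comm (coeff p) (coeff 1ₚ) n)
                                  (trans (⊛-cong coeff-1 (λ _ → refl) n) (⊛-identityˡ _ n))))
        ; distrib = (λ p r s n → trans (coeff-* p (r +ₚ s) n) (trans (⊛-cong (λ _ → refl) (coeff-+ r s) n)
                       (trans (S.distribˡ (coeff p) (coeff r) (coeff s) n)
                         (sym (trans (coeff-+ (p *ₚ r) (p *ₚ s) n) (cong₂ _+_ (coeff-* p r n) (coeff-* p s n)))))))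
                  , (λ s p r n → trans (coeff-* (p +ₚ r) s n) (trans (⊛-cong (coeff-+ p r) (λ _ → refl) n)
                       (trans (⊛-distribʳ (coeff s) (coeff p) (coeff r) n)
                         (sym (trans (coeff-+ (p *ₚ s) (r *ₚ s) n) (cong₂ _+_ (coeff-* p s n) (coeff-* r s n))))))) }
      ; *-comm = λ p r n → trans (coeff-* p r n) (trans (⊛-comm _ _ n) (sym (coeff-* r p n))) } }

  module P = CommutativeRing P-ring
  module P-solver = IntegerCoefficients P-ring

-- Finite sums in a commutative monoid, and lists up to permutation.

module Summation {M : Set} {_∙_ : M → M → M} {ε : M} (isCM : IsCommutativeMonoid _≡_ _∙_ ε) where
  open IsCommutativeMonoid isCM using (assoc; comm; identityˡ; identityʳ)

  ∑ : ∀ {A : Set} → List A → (A → M) → M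
  ∑ xs f = foldr (λ x s → f x ∙ s) ε xs

  interchange : ∀ a b c d → (a ∙ b) ∙ (c ∙ d) ≡ (a ∙ c) ∙ (b ∙ d)
  interchange a b c d = trans (assoc a b _) (trans (cong (a ∙_)
    (trans (sym (assoc b c d)) (trans (cong (_∙ d) (comm b c)) (assoc c b d)))) (sym (assoc a c _)))

  ∑-cong : ∀ {A : Set} (xs : List A) {f g : A → M} → (∀ x → f x ≡ g x) → ∑ xs f ≡ ∑ xs g
  ∑-cong []       e = refl
  ∑-cong (x ∷ xs) e = cong₂ _∙_ (e x) (∑-cong xs e)

  ∑-ε : ∀ {A : Set} (xs : List A) → ∑ xs (λ _ → ε) ≡ ε
  ∑-ε []       = refl
  ∑-ε (x ∷ xs) = trans (identityˡ _) (∑-ε xs)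

  ∑-∙ : ∀ {A : Set} (xs : List A) (f g : A → M) → ∑ xs (λ x → f x ∙ g x) ≡ ∑ xs f ∙ ∑ xs g
  ∑-∙ []       f g = sym (identityˡ ε)
  ∑-∙ (x ∷ xs) f g = trans (cong ((f x ∙ g x) ∙_) (∑-∙ xs f g)) (interchange _ _ _ _)

  ∑-swap : ∀ {A B : Set} (xs : List A) (ys : List B) (f : A → B → M) →
           ∑ xs (λ x → ∑ ys (f x)) ≡ ∑ ys (λ y → ∑ xs (λ x → f x y))
  ∑-swap []       ys f = sym (∑-ε ys)
  ∑-swap (x ∷ xs) ys f = trans (cong (∑ ys (f x) ∙_) (∑-swap xs ys f)) (sym (∑-∙ ys _ _))

  ∑-++ : ∀ {A : Set} (xs ys : List A) (f : A → M) → ∑ (xs ++ ys) f ≡ ∑ xs f ∙ ∑ ys f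
  ∑-++ []       ys f = sym (identityˡ _)
  ∑-++ (x ∷ xs) ys f = trans (cong (f x ∙_) (∑-++ xs ys f)) (sym (assoc _ _ _))

  ∑-map : ∀ {A B : Set} (g : A → B) (xs : List A) (f : B → M) → ∑ (map g xs) f ≡ ∑ xs (f ∘ g)
  ∑-map g []       f = refl
  ∑-map g (x ∷ xs) f = cong (f (g x) ∙_) (∑-map g xs f)

  ∑-product : ∀ {A B C : Set} (g : A → B → C) (xs : List A) (ys : List B) (f : C → M) →
              ∑ (cartesianProductWith g xs ys) f ≡ ∑ xs (λ x → ∑ ys (λ y → f (g x y)))
  ∑-product g []       ys f = refl
  ∑-product g (x ∷ xs) ys f = trans (∑-++ (map (g x) ys) _ f) (cong₂ _∙_ (∑-map (g x) ys f) (∑-product g xs ys f))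

  ∑-↭ : ∀ {A : Set} {xs ys : List A} (f : A → M) → xs ↭ ys → ∑ xs f ≡ ∑ ys f
  ∑-↭ f Perm.refl         = refl
  ∑-↭ f (Perm.prep x p)   = cong (f x ∙_) (∑-↭ f p)
  ∑-↭ f (Perm.swap {ys = ys} x y p) = trans (cong (λ s → f x ∙ (f y ∙ s)) (∑-↭ f p))
    (trans (sym (assoc _ _ _)) (trans (cong (_∙ ∑ ys f) (comm (f x) (f y))) (assoc _ _ _)))
  ∑-↭ f (Perm.trans p q)  = trans (∑-↭ f p) (∑-↭ f q)

  ∑-cong-∈ : ∀ {A : Set} (xs : List A) {f g : A → M} → (∀ {x} → x ∈ xs → f x ≡ g x) → ∑ xs f ≡ ∑ xs g
  ∑-cong-∈ []       e = refl
  ∑-cong-∈ (x ∷ xs) e = cong₂ _∙_ (e (here refl)) (∑-cong-∈ xs (e ∘ there))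

  -- A Kronecker delta with weight m. In ℕ it serves as an indicator for counting, in the field it
  -- picks one term out of a sum.
  select : ∀ {A : Set} → DecidableEquality A → A → A → M → M
  select _≟_ x y m with x ≟ y
  ... | yes _ = m
  ... | no  _ = ε

  select-≡ : ∀ {A : Set} (_≟_ : DecidableEquality A) x m → select _≟_ x x m ≡ m
  select-≡ _≟_ x m with x ≟ x
  ... | yes _   = refl
  ... | no x≢x = ⊥-elim (x≢x refl)

  select-≢ : ∀ {A : Set} (_≟_ : DecidableEquality A) {x y} m → x ≢ y → select _≟_ x y m ≡ ε
  select-≢ _≟_ {x} {y} m x≢y with x ≟ y
  ... | yes x≡y = ⊥-elim (x≢y x≡y)
  ... | no _    = refl

  ∑-select : ∀ {A : Set} (_≟_ : DecidableEquality A) {xs : List A} {x} → Unique xs → x ∈ xs →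
             (w : A → M) → ∑ xs (λ y → select _≟_ x y (w y)) ≡ w x
  ∑-select _≟_ {x ∷ xs} (px ∷ u) (here refl) w = trans
    (cong₂ _∙_ (select-≡ _≟_ x (w x))
      (trans (∑-cong-∈ xs (λ y∈ → select-≢ _≟_ _ (All.lookup px y∈))) (∑-ε xs)))
    (identityʳ _)
  ∑-select _≟_ {y ∷ xs} (py ∷ u) (there x∈) w = trans
    (cong₂ _∙_ (select-≢ _≟_ (w y) (λ x≡y → All.lookup py x∈ (sym x≡y))) (∑-select _≟_ u x∈ w))
    (identityˡ _)

Unique-∷-split : ∀ {A : Set} {x : A} as {bs} → Unique (as ++ x ∷ bs) → Unique (as ++ bs) × x ∉ as ++ bs
Unique-∷-split {x = x} [] (px ∷ u) = u , λ x∈ → All.lookup px x∈ refl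
Unique-∷-split {x = x} (a ∷ as) {bs} (pa ∷ u) =
  (All.tabulate (λ {z} z∈ → All.lookup pa (∈-resp-↭ (↭-sym (Permₚ.shift x as bs)) (there z∈))) ∷ proj₁ rec)
  , λ { (here x≡a) → All.lookup pa (∈-resp-↭ (↭-sym (Permₚ.shift x as bs)) (here refl)) (sym x≡a)
      ; (there x∈) → proj₂ rec x∈ }
  where rec = Unique-∷-split as u

∈-drop-mid : ∀ {A : Set} {x z : A} as {bs} → z ∈ as ++ x ∷ bs → z ≢ x → z ∈ as ++ bs
∈-drop-mid {x = x} as {bs} z∈ z≢x with ∈-resp-↭ (Permₚ.shift x as bs) z∈
... | here z≡x = ⊥-elim (z≢x z≡x)
... | there z∈′ = z∈′

-- This is what allows a sum over the field to be reindexed along a bijection: the image of the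
-- enumeration is again free of repetitions and complete.
unique∧set⇒↭ : ∀ {A : Set} {xs ys : List A} → Unique xs → Unique ys →
               (∀ {z} → z ∈ xs → z ∈ ys) → (∀ {z} → z ∈ ys → z ∈ xs) → xs ↭ ys
unique∧set⇒↭ {ys = []}     []       _  to from = Perm.refl
unique∧set⇒↭ {ys = y ∷ ys} []       _  to from with () ← from (here refl)
unique∧set⇒↭ {xs = x ∷ xs} (px ∷ u) u′ to from with ∈-∃++ (to (here refl))
... | as , bs , refl = ↭-trans (Perm.prep x (unique∧set⇒↭ u (proj₁ split)
        (λ z∈ → ∈-drop-mid as (to (there z∈)) (λ z≡x → All.lookup px z∈ (sym z≡x)))
        λ z∈ → back z∈ (from (∈-resp-↭ (↭-sym (Permₚ.shift x as bs)) (there z∈)))))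
      (↭-sym (Permₚ.shift x as bs))
  where
  split = Unique-∷-split as u′
  back : ∀ {z} → z ∈ as ++ bs → z ∈ x ∷ xs → z ∈ xs
  back z∈ (here refl) = ⊥-elim (proj₂ split z∈)
  back z∈ (there z∈xs)  = z∈xs

unique⊆⇒length≤ : ∀ {A : Set} {xs ys : List A} → Unique xs → (∀ {z} → z ∈ xs → z ∈ ys) →
                  length xs ≤ length ys
unique⊆⇒length≤ []       _  = z≤n
unique⊆⇒length≤ {xs = x ∷ xs} (px ∷ u) to with ∈-∃++ (to (here refl))
... | as , bs , refl = subst (suc (length xs) ≤_) (sym (↭-length (Permₚ.shift x as bs)))
        (s≤s (unique⊆⇒length≤ u λ z∈ → ∈-drop-mid as (to (there z∈)) (λ z≡x → All.lookup px z∈ (sym z≡x))))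

module _ {A : Set} (_≟_ : DecidableEquality A) where
  multiplicity : A → List A → ℕ
  multiplicity a xs = length (filter (a ≟_) xs)

  private
    ↭-multiplicity : ∀ a {xs ys} → xs ↭ ys → multiplicity a xs ≡ multiplicity a ys
    ↭-multiplicity a p = ↭-length (filter-↭ (a ≟_) p)

    multiplicity-∷-cancel : ∀ a x {xs ys} → multiplicity a (x ∷ xs) ≡ multiplicity a (x ∷ ys) →
                            multiplicity a xs ≡ multiplicity a ys
    multiplicity-∷-cancel a x e with a ≟ x
    ... | yes _ = ℕₚ.suc-injective e
    ... | no  _ = e

    multiplicity-head : ∀ x xs → multiplicity x (x ∷ xs) ≢ 0
    multiplicity-head x xs e with x ≟ x
    ... | yes _   with () ← e
    ... | no x≢x = x≢x refl

    multiplicity⇒∈ : ∀ x ys → multiplicity x ys ≢ 0 → x ∈ ys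
    multiplicity⇒∈ x ys nz with filter (x ≟_) ys in eq
    ... | []     = ⊥-elim (nz refl)
    ... | z ∷ zs with ∈-filter⁻ (x ≟_) {xs = ys} (subst (z ∈_) (sym eq) (here refl))
    ...   | z∈ , refl = z∈

  -- The head of the first list has positive multiplicity, so it occurs in the second and can be
  -- removed from both. Applied to lists of values, it turns equal representation numbers into equal
  -- sums for every weight function.
  multiplicities⇒↭ : ∀ xs ys → (∀ a → multiplicity a xs ≡ multiplicity a ys) → xs ↭ ys
  multiplicities⇒↭ []       []       e = Perm.refl
  multiplicities⇒↭ []       (y ∷ ys) e = ⊥-elim (multiplicity-head y ys (sym (e y)))
  multiplicities⇒↭ (x ∷ xs) ys       e
    with ∈-∃++ (multiplicity⇒∈ x ys (λ z → multiplicity-head x xs (trans (e x) z)))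
  ... | as , bs , refl = ↭-trans (Perm.prep x (multiplicities⇒↭ xs (as ++ bs) λ a →
          multiplicity-∷-cancel a x (trans (e a) (↭-multiplicity a (Permₚ.shift x as bs)))))
        (↭-sym (Permₚ.shift x as bs))

-- Counting in a finite field of odd order.

module FieldCounting (𝔽 : FiniteField) (odd : FiniteField.size 𝔽 ℕ.% 2 ≡ 1) where
  open FieldTheory 𝔽
  open F-solver
  open IsCommutativeRing isCommutativeRing using (+-isCommutativeMonoid)

  module N = Summation ℕₚ.+-0-isCommutativeMonoid
  module F = Summation +-isCommutativeMonoid

  private
    from : Fin size → Carrier
    from = Inverse.from enumeration

  elems : List Carrier
  elems = map from (allFin size)

  ∈-elems : ∀ x → x ∈ elems
  ∈-elems x = subst (_∈ elems) (Inverse.strictlyInverseʳ enumeration x)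
    (∈-map⁺ from (∈-allFin (Inverse.to enumeration x)))

  elems-unique : Unique elems
  elems-unique = Unique.map⁺ (λ {i} {j} e → trans (sym (Inverse.strictlyInverseˡ enumeration i))
    (trans (cong (Inverse.to enumeration) e) (Inverse.strictlyInverseˡ enumeration j)))
    (Unique.allFin⁺ size)

  length-elems : length elems ≡ size
  length-elems = trans (length-map from (allFin size)) (length-tabulate {n = size} (λ i → i))

  any-elem? : ∀ {P : Carrier → Set} → Decidable P → Dec (∃ P)
  any-elem? P? with Any.any? P? elems
  ... | yes p = yes (proj₁ (find p) , proj₂ (proj₂ (find p)))
  ... | no ¬p = no λ { (x , px) → ¬p (lose (∈-elems x) px) }

  open import Data.List.Membership.DecPropositional _≟_ using (_∈?_)

  avoid : ∀ xs → length xs < size → ∃ λ x → x ∉ xs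
  avoid xs len with All.all? (_∈? xs) elems
  ... | yes all∈ = ⊥-elim (ℕₚ.<⇒≱ len (subst (_≤ length xs) length-elems
          (unique⊆⇒length≤ elems-unique (All.lookup all∈))))
  ... | no ¬all with find (¬All⇒Any¬ (_∈? xs) elems ¬all)
  ...   | x , _ , x∉ = x , x∉

  module Reindex (π π⁻¹ : Carrier → Carrier)
                 (ππ⁻¹ : ∀ x → π (π⁻¹ x) ≡ x) (π⁻¹π : ∀ x → π⁻¹ (π x) ≡ x) where
    perm = unique∧set⇒↭
      (Unique.map⁺ {f = π} (λ {x} {y} e → trans (sym (π⁻¹π x)) (trans (cong π⁻¹ e) (π⁻¹π y))) elems-unique)
      elems-unique (λ {z} _ → ∈-elems z)
      (λ {z} _ → subst (_∈ map π elems) (ππ⁻¹ z) (∈-map⁺ π (∈-elems (π⁻¹ z))))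

    N-reindex : ∀ (f : Carrier → ℕ) → N.∑ elems (f ∘ π) ≡ N.∑ elems f
    N-reindex f = trans (sym (N.∑-map π elems f)) (N.∑-↭ f perm)

    F-reindex : ∀ (f : Carrier → Carrier) → F.∑ elems (f ∘ π) ≡ F.∑ elems f
    F-reindex f = trans (sym (F.∑-map π elems f)) (F.∑-↭ f perm)

  module Translate (a : Carrier) = Reindex (_+ a) (_+ - a)
    (λ x → solve 2 (λ x a → x :+ :- a :+ a := x) refl x a)
    (λ x → solve 2 (λ x a → x :+ a :+ :- a := x) refl x a)

  module Scale (a : Carrier) (a≢0 : a ≢ 0#) = Reindex (a *_) (inv a *_)
    (λ x → trans (sym (*-assoc _ _ _)) (trans (cong (_* x) (inv-inverseʳ a≢0)) (*-identityˡ x)))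
    (λ x → trans (sym (*-assoc _ _ _)) (trans (cong (_* x) (trans (*-comm _ _) (inv-inverseʳ a≢0))) (*-identityˡ x)))

  N-∑-const : ∀ n → N.∑ elems (λ _ → n) ≡ size ℕ.* n
  N-∑-const n = trans (go elems) (cong (ℕ._* n) length-elems)
    where
    go : ∀ (xs : List Carrier) → N.∑ xs (λ _ → n) ≡ length xs ℕ.* n
    go []       = refl
    go (x ∷ xs) = cong (n ℕ.+_) (go xs)

  N-∑-*ˡ : ∀ {A : Set} k (xs : List A) f → N.∑ xs (λ x → k ℕ.* f x) ≡ k ℕ.* N.∑ xs f
  N-∑-*ˡ k []       f = sym (ℕₚ.*-zeroʳ k)
  N-∑-*ˡ k (x ∷ xs) f = trans (cong (k ℕ.* f x ℕ.+_) (N-∑-*ˡ k xs f)) (sym (ℕₚ.*-distribˡ-+ k (f x) _))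

  N-∑-mono : ∀ {A : Set} (xs : List A) {f g : A → ℕ} → (∀ x → f x ≤ g x) → N.∑ xs f ≤ N.∑ xs g
  N-∑-mono []       le = z≤n
  N-∑-mono (x ∷ xs) le = ℕₚ.+-mono-≤ (le x) (N-∑-mono xs le)

  F-∑-*ˡ : ∀ {A : Set} k (xs : List A) f → F.∑ xs (λ x → k * f x) ≡ k * F.∑ xs f
  F-∑-*ˡ k []       f = sym (zeroʳ k)
  F-∑-*ˡ k (x ∷ xs) f = trans (cong (k * f x +_) (F-∑-*ˡ k xs f)) (sym (distribˡ k (f x) _))

  -- Distributions are compared by counts in ℕ, while the conic argument sums in the field; this
  -- homomorphism carries the one to the other.
  nat : ℕ → Carrier
  nat zero    = 0#
  nat (suc n) = 1# + nat n

  nat-+ : ∀ m n → nat (m ℕ.+ n) ≡ nat m + nat n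
  nat-+ zero    n = sym (+-identityˡ _)
  nat-+ (suc m) n = trans (cong (1# +_) (nat-+ m n)) (sym (+-assoc _ _ _))

  nat-∑ : ∀ {A : Set} (xs : List A) f → nat (N.∑ xs f) ≡ F.∑ xs (nat ∘ f)
  nat-∑ []       f = refl
  nat-∑ (x ∷ xs) f = trans (nat-+ (f x) _) (cong (nat (f x) +_) (nat-∑ xs f))

  -- Translating by 1 permutes the summands of Σ x.
  F-∑-1 : F.∑ elems (λ _ → 1#) ≡ 0#
  F-∑-1 = begin
    s                ≡⟨ solve 2 (λ s t → s := (t :+ s) :+ :- t) refl s t ⟩
    (t + s) + - t    ≡⟨ cong (_+ - t) (trans (sym (F.∑-∙ elems (λ x → x) (λ _ → 1#))) (F-reindex (λ x → x))) ⟩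
    t + - t          ≡⟨ -‿inverseʳ t ⟩
    0#               ∎
    where
    open ≡-Reasoning
    open Translate 1#
    s = F.∑ elems (λ _ → 1#)
    t = F.∑ elems (λ x → x)

  nat-size : nat size ≡ 0#
  nat-size = trans (cong nat (sym (trans (N-∑-const 1) (ℕₚ.*-identityʳ size))))
    (trans (nat-∑ elems (λ _ → 1)) (trans (F.∑-cong elems (λ _ → +-identityʳ 1#)) F-∑-1))

  -- If 2 vanished, every even multiple of 1 would vanish and the odd number q would map to 1,
  -- whereas q times 1 is 0.
  1+1≢0 : 1# + 1# ≢ 0#
  1+1≢0 2≡0 = 0≢1 (trans (sym nat-size) (trans (cong nat size≡)
    (trans (nat-+ 1 (half ℕ.* 2)) (trans (cong₂ _+_ (+-identityʳ 1#) (even half)) (+-identityʳ 1#)))))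
    where
    half = size ℕ./ 2
    size≡ : size ≡ 1 ℕ.+ half ℕ.* 2
    size≡ = trans (DivMod.m≡m%n+[m/n]*n size 2) (cong (ℕ._+ half ℕ.* 2) odd)
    even : ∀ h → nat (h ℕ.* 2) ≡ 0#
    even zero    = refl
    even (suc h) = trans (sym (+-assoc _ _ _)) (trans (cong₂ _+_ 2≡0 (even h)) (+-identityʳ 0#))

  two half : Carrier
  two  = 1# + 1#
  half = inv two

  two-half : two * half ≡ 1#
  two-half = inv-inverseʳ 1+1≢0

  x+x≡0⇒x≡0 : ∀ {x} → x + x ≡ 0# → x ≡ 0#
  x+x≡0⇒x≡0 {x} e = *-cancelˡ 1+1≢0 (trans (trans (distribʳ x 1# 1#)
    (cong₂ _+_ (*-identityˡ x) (*-identityˡ x))) (trans e (sym (zeroʳ _))))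

  square-roots : ∀ {x y} → x * x ≡ y * y → x ≡ y ⊎ x ≡ - y
  square-roots {x} {y} e with (x + - y) ≟ 0#
  ... | yes x-y≡0 = inj₁ (trans (solve 2 (λ x y → x := (x :+ :- y) :+ y) refl x y)
                      (trans (cong (_+ y) x-y≡0) (+-identityˡ y)))
  ... | no  x-y≢0 = inj₂ (trans (solve 2 (λ x y → x := (x :+ y) :+ :- y) refl x y)
                      (trans (cong (_+ - y) x+y≡0) (+-identityˡ _)))
    where
    x+y≡0 : x + y ≡ 0#
    x+y≡0 = *-cancelˡ x-y≢0 (trans (solve 2 (λ x y → (x :+ :- y) :* (x :+ y) := x :* x :+ :- (y :* y)) refl x y)
      (trans (cong (_+ - (y * y)) e) (trans (-‿inverseʳ _) (sym (zeroʳ _)))))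

  δ : Carrier → Carrier → ℕ
  δ x y = N.select _≟_ x y 1

  ∑-δ : ∀ x → N.∑ elems (δ x) ≡ 1
  ∑-δ x = N.∑-select _≟_ elems-unique (∈-elems x) (λ _ → 1)

  fibre : (Carrier → Carrier) → Carrier → ℕ
  fibre f t = N.∑ elems (λ x → δ (f x) t)

  ∑-fibre : ∀ f → N.∑ elems (fibre f) ≡ size
  ∑-fibre f = trans (N.∑-swap elems elems (λ t x → δ (f x) t)) (trans (N.∑-cong elems (λ x → ∑-δ (f x)))
    (trans (N-∑-const 1) (ℕₚ.*-identityʳ size)))

  fibre-∅ : ∀ (f : Carrier → Carrier) t → ¬ (∃ λ x → f x ≡ t) → fibre f t ≡ 0
  fibre-∅ f t ∄ = trans (N.∑-cong elems (λ x → N.select-≢ _≟_ 1 (λ e → ∄ (x , e)))) (N.∑-ε elems)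

  image? : ∀ (f : Carrier → Carrier) t → Dec (∃ λ x → f x ≡ t)
  image? f t = any-elem? (λ x → f x ≟ t)

  private
    δ≤ : ∀ {x y} {P : ℕ} → (x ≡ y → 1 ≤ P) → δ x y ≤ P
    δ≤ {x} {y} h with x ≟ y
    ... | yes e = h e
    ... | no _  = z≤n

  fibre-≤1 : ∀ f t x₀ → (∀ x → f x ≡ t → x ≡ x₀) → fibre f t ≤ 1
  fibre-≤1 f t x₀ h = subst (fibre f t ≤_) (∑-δ x₀) (N-∑-mono elems λ x →
    δ≤ (λ e → ℕₚ.≤-reflexive (sym (trans (cong (δ x₀) (h x e)) (N.select-≡ _≟_ x₀ 1)))))

  fibre-≤2 : ∀ f t → (∀ {x y} → f x ≡ f y → x ≡ y ⊎ x ≡ - y) → fibre f t ≤ 2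
  fibre-≤2 f t even with image? f t
  ... | no ∄ = subst (_≤ 2) (sym (fibre-∅ f t ∄)) z≤n
  ... | yes (x₀ , e₀) = ℕₚ.≤-trans (N-∑-mono elems bound) (ℕₚ.≤-reflexive
          (trans (N.∑-∙ elems (δ x₀) (δ (- x₀))) (cong₂ ℕ._+_ (∑-δ x₀) (∑-δ (- x₀)))))
    where
    bound : ∀ x → δ (f x) t ≤ δ x₀ x ℕ.+ δ (- x₀) x
    bound x = δ≤ λ e → case (even (trans e (sym e₀)))
      where
      case : x ≡ x₀ ⊎ x ≡ - x₀ → 1 ≤ δ x₀ x ℕ.+ δ (- x₀) x
      case (inj₁ refl) = ℕₚ.≤-trans (ℕₚ.≤-reflexive (sym (N.select-≡ _≟_ x₀ 1))) (ℕₚ.m≤m+n _ _)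
      case (inj₂ refl) = ℕₚ.≤-trans (ℕₚ.≤-reflexive (sym (N.select-≡ _≟_ (- x₀) 1))) (ℕₚ.m≤n+m _ _)

  ax²-even : ∀ {a} → a ≢ 0# → ∀ {x y} → a * (x * x) ≡ a * (y * y) → x ≡ y ⊎ x ≡ - y
  ax²-even a≢0 e = square-roots (*-cancelˡ a≢0 e)

  x²≡0⇒x≡0 : ∀ {x} → x * x ≡ 0# → x ≡ 0#
  x²≡0⇒x≡0 {x} e with x ≟ 0#
  ... | yes x≡0 = x≡0
  ... | no  x≢0 = ⊥-elim (*-≢0 x≢0 x≢0 e)

  ax²≡0⇒x≡0 : ∀ {a x} → a ≢ 0# → a * (x * x) ≡ 0# → x ≡ 0#
  ax²≡0⇒x≡0 a≢0 e = x²≡0⇒x≡0 (*-cancelˡ a≢0 (trans e (sym (zeroʳ _))))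

  fibre-ax²-0 : ∀ {a} → a ≢ 0# → fibre (λ x → a * (x * x)) 0# ≤ 1
  fibre-ax²-0 a≢0 = fibre-≤1 _ 0# 0# (λ x → ax²≡0⇒x≡0 a≢0)

  -- If aξ² + bη² never took the value s, the 2q elements aξ² and s - bη² would cover each t ≢ 0
  -- at most twice and 0 at most once.
  binary-universal : ∀ {a b} s → a ≢ 0# → b ≢ 0# → ∃₂ λ x y → a * (x * x) + b * (y * y) ≡ s
  binary-universal {a} {b} s a≢0 b≢0
    with any-elem? (λ x → any-elem? (λ y → (a * (x * x) + b * (y * y)) ≟ s))
  ... | yes (x , y , e) = x , y , e
  ... | no ∄ = ⊥-elim (ℕₚ.<⇒≱ (ℕₚ.≤-reflexive refl) (ℕₚ.≤-trans (ℕₚ.≤-reflexive total) (N-∑-mono elems bound′)))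
    where
    f g : Carrier → Carrier
    f x = a * (x * x)
    g y = s + - (b * (y * y))
    disjoint : ∀ x y → f x ≢ g y
    disjoint x y e = ∄ (x , y , trans (cong (_+ b * (y * y)) e)
      (solve 2 (λ s t → s :+ :- t :+ t := s) refl s (b * (y * y))))
    g-even : ∀ {x y} → g x ≡ g y → x ≡ y ⊎ x ≡ - y
    g-even {x} {y} e = ax²-even b≢0 (trans (solve 2 (λ s t → t := s :+ :- (s :+ :- t)) refl s (b * (x * x)))
      (trans (cong (λ u → s + - u) e) (solve 2 (λ s t → s :+ :- (s :+ :- t) := t) refl s (b * (y * y)))))
    f0 : f 0# ≡ 0#
    f0 = trans (cong (a *_) (zeroˡ 0#)) (zeroʳ a)
    bound : ∀ t → fibre f t ℕ.+ fibre g t ≤ 2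
    bound t with image? f t
    ... | yes (x , e) = subst (_≤ 2) (sym (trans (cong (fibre f t ℕ.+_)
            (fibre-∅ g t (λ { (y , e′) → disjoint x y (trans e (sym e′)) }))) (ℕₚ.+-identityʳ _)))
            (fibre-≤2 f t (ax²-even a≢0))
    ... | no ∄x = subst (λ k → k ℕ.+ fibre g t ≤ 2) (sym (fibre-∅ f t ∄x)) (fibre-≤2 g t g-even)
    -- Adding the indicator of 0 turns the sharper bound at 0 into the uniform bound 2, against a
    -- total of 2q + 1.
    bound′ : ∀ t → fibre f t ℕ.+ fibre g t ℕ.+ δ 0# t ≤ 2
    bound′ t with 0# ≟ t
    ... | no _     = subst (_≤ 2) (sym (ℕₚ.+-identityʳ _)) (bound t)
    ... | yes refl = ℕₚ.+-monoˡ-≤ 1 (subst (_≤ 1) (sym (trans (cong (fibre f 0# ℕ.+_)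
            (fibre-∅ g 0# (λ { (y , e′) → disjoint 0# y (trans f0 (sym e′)) }))) (ℕₚ.+-identityʳ _)))
            (fibre-ax²-0 a≢0))
    total : suc (N.∑ elems (λ _ → 2)) ≡ N.∑ elems (λ t → fibre f t ℕ.+ fibre g t ℕ.+ δ 0# t)
    total = sym (trans (N.∑-∙ elems _ (δ 0#)) (trans (cong₂ ℕ._+_
      (trans (N.∑-∙ elems (fibre f) (fibre g)) (trans (cong₂ ℕ._+_ (∑-fibre f) (∑-fibre g)) (sym q2))) (∑-δ 0#))
      (ℕₚ.+-comm _ 1)))
      where
      q2 : N.∑ elems (λ _ → 2) ≡ size ℕ.+ size
      q2 = trans (N-∑-const 2) (trans (ℕₚ.*-comm size 2) (cong (size ℕ.+_) (ℕₚ.+-identityʳ size)))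

  IsSquare : Carrier → Set
  IsSquare u = ∃ λ s → s * s ≡ u

  1<size : 1 < size
  1<size = subst (1 <_) length-elems (unique⊆⇒length≤ {xs = 0# ∷ 1# ∷ []}
    ((0≢1 All.∷ All.[]) AllPairs.∷ (All.[] AllPairs.∷ AllPairs.[])) (λ {z} _ → ∈-elems z))
    where import Data.List.Relation.Unary.AllPairs as AllPairs

  -- Otherwise the 3q elements x², ux², vx² would cover each t ≢ 0 at most twice.
  nonsquare-ratio : ∀ {u v} → ¬ IsSquare u → ¬ IsSquare v → ∃ λ s → u * (s * s) ≡ v
  nonsquare-ratio {u} {v} ¬u ¬v with image? (λ s → u * (s * s)) v
  ... | yes p = p
  ... | no ∄  = ⊥-elim (ℕₚ.<⇒≱ (ℕₚ.+-monoʳ-< (size ℕ.+ size) 1<size)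
                  (subst₂′ total sum≤ (N-∑-mono elems bound)))
    where
    subst₂′ : ∀ {a b c d : ℕ} → a ≡ b → c ≡ d → a ≤ c → b ≤ d
    subst₂′ refl refl p = p
    f g h : Carrier → Carrier
    f x = 1# * (x * x)
    g x = u * (x * x)
    h x = v * (x * x)
    u≢0 : u ≢ 0#
    u≢0 e = ¬u (0# , trans (zeroˡ 0#) (sym e))
    v≢0 : v ≢ 0#
    v≢0 e = ¬v (0# , trans (zeroˡ 0#) (sym e))
    1≢0 : 1# ≢ 0#
    1≢0 e = 0≢1 (sym e)
    ratio : ∀ {a b x y t} → t ≢ 0# → a * (x * x) ≡ t → b * (y * y) ≡ t → a * ((x * inv y) * (x * inv y)) ≡ b
    ratio {a} {b} {x} {y} {t} t≢0 e e′ = begin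
      a * ((x * inv y) * (x * inv y))   ≡⟨ solve 3 (λ a x i → a :* ((x :* i) :* (x :* i)) := a :* (x :* x) :* (i :* i)) refl a x (inv y) ⟩
      a * (x * x) * (inv y * inv y)     ≡⟨ cong (_* (inv y * inv y)) (trans e (sym e′)) ⟩
      b * (y * y) * (inv y * inv y)     ≡⟨ solve 3 (λ b y i → b :* (y :* y) :* (i :* i) := b :* ((y :* i) :* (y :* i))) refl b y (inv y) ⟩
      b * ((y * inv y) * (y * inv y))   ≡⟨ cong (λ z → b * (z * z)) (inv-inverseʳ y≢0) ⟩
      b * (1# * 1#)                     ≡⟨ trans (cong (b *_) (*-identityˡ 1#)) (*-identityʳ b) ⟩
      b                                 ∎
      where
      open ≡-Reasoning
      y≢0 : y ≢ 0#
      y≢0 y≡0 = t≢0 (trans (sym e′) (trans (cong (λ z → b * (z * z)) y≡0) (trans (cong (b *_) (zeroˡ 0#)) (zeroʳ b))))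
    bound≢0 : ∀ t → t ≢ 0# → fibre f t ℕ.+ fibre g t ℕ.+ fibre h t ≤ 2
    bound≢0 t t≢0 with image? f t | image? g t | image? h t
    ... | yes (x , e) | yes (y , e′) | _ = ⊥-elim (¬u (_ , trans (sym (*-identityˡ _)) (ratio t≢0 e e′)))
    ... | yes (x , e) | no _ | yes (y , e′) = ⊥-elim (¬v (_ , trans (sym (*-identityˡ _)) (ratio t≢0 e e′)))
    ... | no _ | yes (x , e) | yes (y , e′) = ⊥-elim (∄ (_ , ratio t≢0 e e′))
    ... | yes _ | no n₂ | no n₃ rewrite fibre-∅ g t n₂ | fibre-∅ h t n₃ | ℕₚ.+-identityʳ (fibre f t)
                                      | ℕₚ.+-identityʳ (fibre f t) = fibre-≤2 f t (ax²-even 1≢0)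
    ... | no n₁ | yes _ | no n₃ rewrite fibre-∅ f t n₁ | fibre-∅ h t n₃ | ℕₚ.+-identityʳ (fibre g t) =
                                      fibre-≤2 g t (ax²-even u≢0)
    ... | no n₁ | no n₂ | _ rewrite fibre-∅ f t n₁ | fibre-∅ g t n₂ = fibre-≤2 h t (ax²-even v≢0)
    -- The value 0 is hit once by each of the three maps and so exceeds the bound 2 by one. The
    -- total 3q ≤ 2q + 1 then contradicts q > 1.
    bound : ∀ t → fibre f t ℕ.+ fibre g t ℕ.+ fibre h t ≤ 2 ℕ.+ δ 0# t
    bound t with 0# ≟ t
    ... | no 0≢t   = bound≢0 t (λ e → 0≢t (sym e))
    ... | yes refl = ℕₚ.+-mono-≤ (ℕₚ.+-mono-≤ (fibre-ax²-0 1≢0) (fibre-ax²-0 u≢0)) (fibre-ax²-0 v≢0)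
    total : N.∑ elems (λ t → fibre f t ℕ.+ fibre g t ℕ.+ fibre h t) ≡ size ℕ.+ size ℕ.+ size
    total = trans (N.∑-∙ elems _ (fibre h)) (cong₂ ℕ._+_
      (trans (N.∑-∙ elems (fibre f) (fibre g)) (cong₂ ℕ._+_ (∑-fibre f) (∑-fibre g))) (∑-fibre h))
    sum≤ : N.∑ elems (λ t → 2 ℕ.+ δ 0# t) ≡ size ℕ.+ size ℕ.+ 1
    sum≤ = trans (N.∑-∙ elems (λ _ → 2) (δ 0#)) (cong₂ ℕ._+_
      (trans (N-∑-const 2) (trans (ℕₚ.*-comm size 2) (cong (size ℕ.+_) (ℕₚ.+-identityʳ size)))) (∑-δ 0#))

-- Joint distributions of values, cancellation of squares, and conics.

module Distributions (𝔽 : FiniteField) (odd : FiniteField.size 𝔽 ℕ.% 2 ≡ 1) where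
  open FieldTheory 𝔽
  open FieldCounting 𝔽 odd
  open F-solver

  private
    instance
      size-nonZero : ℕ.NonZero size
      size-nonZero = ℕ.>-nonZero (ℕₚ.<-trans (ℕ.s≤s ℕ.z≤n) 1<size)

  -- d(x² - y²) is a hyperbolic plane, on which every value but 0 is taken equally often.
  hyperbolic-sum : ∀ {d} → d ≢ 0# → (w : Carrier → ℕ) (s : Carrier) →
    N.∑ elems (λ y → N.∑ elems (λ x → w (d * (x * x) + (- (d * (y * y)) + s)))) ℕ.+ N.∑ elems w
    ≡ size ℕ.* w s ℕ.+ size ℕ.* N.∑ elems w
  hyperbolic-sum {d} d≢0 w s = begin
    N.∑ elems (λ y → N.∑ elems (λ x → w (d * (x * x) + (- (d * (y * y)) + s)))) ℕ.+ W
      -- With x = u + y the difference d(x² - y²) becomes d u (u + 2y); in the step after this one,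
      -- v = u + 2y replaces y, for which 2 must be invertible.
      ≡⟨ cong (ℕ._+ W) (N.∑-cong elems λ y → trans
           (sym (Reindex.N-reindex (_+ y) (_+ - y) (Tr y) (Tr′ y) (λ x → w (d * (x * x) + (- (d * (y * y)) + s)))))
           (N.∑-cong elems λ u → cong w (solve 4 (λ d u y s →
             d :* ((u :+ y) :* (u :+ y)) :+ (:- (d :* (y :* y)) :+ s) := d :* u :* (u :+ (y :+ y)) :+ s)
             refl d u y s))) ⟩
    N.∑ elems (λ y → N.∑ elems (λ u → w (d * u * (u + (y + y)) + s))) ℕ.+ W
      ≡⟨ cong (ℕ._+ W) (trans (N.∑-swap elems elems _) (N.∑-cong elems λ u →
           Reindex.N-reindex (λ y → u + (y + y)) (λ v → half * (v + - u)) (D u) (D′ u)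
             (λ v → w (d * u * v + s)))) ⟩
    N.∑ elems (λ u → g u) ℕ.+ W
      ≡⟨ cong (N.∑ elems g ℕ.+_) (sym (N.∑-select _≟_ elems-unique (∈-elems 0#) (λ _ → W))) ⟩
    N.∑ elems g ℕ.+ N.∑ elems (λ u → N.select _≟_ 0# u W)
      ≡⟨ sym (N.∑-∙ elems g _) ⟩
    N.∑ elems (λ u → g u ℕ.+ N.select _≟_ 0# u W)
      ≡⟨ N.∑-cong elems pointwise ⟩
    N.∑ elems (λ u → N.select _≟_ 0# u (size ℕ.* w s) ℕ.+ W)
      ≡⟨ N.∑-∙ elems _ _ ⟩
    N.∑ elems (λ u → N.select _≟_ 0# u (size ℕ.* w s)) ℕ.+ N.∑ elems (λ _ → W)
      ≡⟨ cong₂ ℕ._+_ (N.∑-select _≟_ elems-unique (∈-elems 0#) _) (N-∑-const W) ⟩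
    size ℕ.* w s ℕ.+ size ℕ.* W ∎
    where
    open ≡-Reasoning
    W = N.∑ elems w
    g : Carrier → ℕ
    g u = N.∑ elems (λ v → w (d * u * v + s))
    Tr : ∀ y x → x + - y + y ≡ x
    Tr y x = solve 2 (λ x y → x :+ :- y :+ y := x) refl x y
    Tr′ : ∀ y x → x + y + - y ≡ x
    Tr′ y x = solve 2 (λ x y → x :+ y :+ :- y := x) refl x y
    twice : ∀ z → half * z + half * z ≡ z
    twice z = trans (sym (distribʳ z half half)) (trans (cong (_* z)
      (trans (sym (cong₂ _+_ (*-identityˡ half) (*-identityˡ half))) (trans (sym (distribʳ half 1# 1#)) two-half)))
      (*-identityˡ z))
    D : ∀ u v → u + (half * (v + - u) + half * (v + - u)) ≡ v
    D u v = trans (cong (u +_) (twice _)) (solve 2 (λ u v → u :+ (v :+ :- u) := v) refl u v)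
    D′ : ∀ u y → half * (u + (y + y) + - u) ≡ y
    D′ u y = trans (solve 3 (λ h u y → h :* (u :+ (y :+ y) :+ :- u) := h :* y :+ h :* y) refl half u y) (twice y)
    -- For u = 0 every v gives the value s; for any other u the map from v to d u v + s is a
    -- bijection. The extra `W` on the left avoids a subtraction in ℕ.
    pointwise : ∀ u → g u ℕ.+ N.select _≟_ 0# u W ≡ N.select _≟_ 0# u (size ℕ.* w s) ℕ.+ W
    pointwise u with 0# ≟ u
    ... | yes refl = cong (ℕ._+ W) (trans (N.∑-cong elems λ v → cong w
                       (solve 3 (λ z v s → z :* v :+ s := s :+ z :* v) refl (d * 0#) v s)) (trans
                       (N.∑-cong elems λ v → cong w (trans (cong (λ z → s + z * v) (zeroʳ d))
                         (trans (cong (s +_) (zeroˡ v)) (+-identityʳ s)))) (N-∑-const (w s))))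
    ... | no 0≢u = trans (ℕₚ.+-identityʳ _) (trans
                     (Scale.N-reindex (d * u) (*-≢0 d≢0 (λ e → 0≢u (sym e))) (λ v → w (v + s)))
                     (Translate.N-reindex s w))

  -- Arbitrary weights test the joint distribution of the value f and a label z. The label lets the
  -- top coefficient of the form travel along while the value is being reduced.
  SameDistribution : {Y Z : Set} → List Y → (f f′ : Y → Carrier) (z z′ : Y → Z) → Set
  SameDistribution {Z = Z} ys f f′ z z′ =
    (w : Carrier → Z → ℕ) → N.∑ ys (λ y → w (f y) (z y)) ≡ N.∑ ys (λ y → w (f′ y) (z′ y))

  -- After a second variable with the opposite square is adjoined on both sides, `hyperbolic-sum`
  -- gives q times the wanted sum plus q - 1 times `ΣW`. The latter depends on the labels only and
  -- agrees on both sides because `same` applies to weights that ignore the value; then q is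
  -- cancelled in ℕ.
  cancel-square : ∀ {Y Z : Set} {d} → d ≢ 0# → (ys : List Y) {f f′ : Y → Carrier} {z z′ : Y → Z} →
    ((w : Carrier → Z → ℕ) → N.∑ elems (λ x → N.∑ ys (λ y → w (d * (x * x) + f y) (z y)))
                           ≡ N.∑ elems (λ x → N.∑ ys (λ y → w (d * (x * x) + f′ y) (z′ y)))) →
    SameDistribution ys f f′ z z′
  cancel-square {Y} {Z} {d} d≢0 ys {f} {f′} {z} {z′} same w =
    ℕₚ.*-cancelˡ-≡ _ _ size (ℕₚ.+-cancelʳ-≡ (size ℕ.* ΣW z) _ _ (begin
      size ℕ.* N.∑ ys (λ y → w (f y) (z y)) ℕ.+ size ℕ.* ΣW z
        ≡⟨ sym (convolve f z) ⟩
      C f z ℕ.+ ΣW z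
        ≡⟨ cong₂ ℕ._+_ C≡ ΣW≡ ⟩
      C f′ z′ ℕ.+ ΣW z′
        ≡⟨ convolve f′ z′ ⟩
      size ℕ.* N.∑ ys (λ y → w (f′ y) (z′ y)) ℕ.+ size ℕ.* ΣW z′
        ≡⟨ cong (λ t → size ℕ.* N.∑ ys (λ y → w (f′ y) (z′ y)) ℕ.+ size ℕ.* t) (sym ΣW≡) ⟩
      size ℕ.* N.∑ ys (λ y → w (f′ y) (z′ y)) ℕ.+ size ℕ.* ΣW z ∎))
    where
    open ≡-Reasoning
    W : Z → ℕ
    W t = N.∑ elems (λ s → w s t)
    ΣW : (Y → Z) → ℕ
    ΣW z = N.∑ ys (W ∘ z)
    C : (Y → Carrier) → (Y → Z) → ℕ
    C f z = N.∑ elems (λ x̃ → N.∑ elems (λ x → N.∑ ys (λ y →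
              w (- (d * (x̃ * x̃)) + (d * (x * x) + f y)) (z y))))
    C≡ : C f z ≡ C f′ z′
    C≡ = N.∑-cong elems λ x̃ → same (λ s t → w (- (d * (x̃ * x̃)) + s) t)
    ΣW≡ : ΣW z ≡ ΣW z′
    ΣW≡ = ℕₚ.*-cancelˡ-≡ _ _ size (trans (sym (N-∑-const (ΣW z)))
      (trans (same (λ _ → W)) (N-∑-const (ΣW z′))))
    convolve : ∀ f z → C f z ℕ.+ ΣW z ≡ size ℕ.* N.∑ ys (λ y → w (f y) (z y)) ℕ.+ size ℕ.* ΣW z
    convolve f z = begin
      C f z ℕ.+ ΣW z
        ≡⟨ cong (ℕ._+ ΣW z) (trans (N.∑-cong elems (λ x̃ → N.∑-swap elems ys _)) (N.∑-swap elems ys _)) ⟩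
      N.∑ ys (λ y → N.∑ elems (λ x̃ → N.∑ elems (λ x → w (- (d * (x̃ * x̃)) + (d * (x * x) + f y)) (z y)))) ℕ.+ ΣW z
        ≡⟨ sym (N.∑-∙ ys _ _) ⟩
      N.∑ ys (λ y → N.∑ elems (λ x̃ → N.∑ elems (λ x → w (- (d * (x̃ * x̃)) + (d * (x * x) + f y)) (z y))) ℕ.+ W (z y))
        ≡⟨ N.∑-cong ys (λ y → trans
             (cong (ℕ._+ W (z y)) (N.∑-cong elems λ x̃ → N.∑-cong elems λ x → cong (λ s → w s (z y))
               (solve 3 (λ a b c → a :+ (b :+ c) := b :+ (a :+ c)) refl (- (d * (x̃ * x̃))) (d * (x * x)) (f y))))
             (hyperbolic-sum d≢0 (λ s → w s (z y)) (f y))) ⟩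
      N.∑ ys (λ y → size ℕ.* w (f y) (z y) ℕ.+ size ℕ.* W (z y))
        ≡⟨ trans (N.∑-∙ ys _ _) (cong₂ ℕ._+_ (N-∑-*ˡ size ys _) (N-∑-*ˡ size ys _)) ⟩
      size ℕ.* N.∑ ys (λ y → w (f y) (z y)) ℕ.+ size ℕ.* ΣW z ∎

  -- ΣY/X over (ξ , c) ≢ 0 depends linearly on the coefficients of Y, and a similitude of the
  -- anisotropic form X shows that the coefficient of c² in Y enters with weight -1/(2g) ≢ 0.
  module Conic {a g} (anisotropic : ∀ ξ c → a * (ξ * ξ) + g * (c * c) ≡ 0# → ξ ≡ 0# × c ≡ 0#) where
    open ≡-Reasoning

    X : Carrier → Carrier → Carrier
    X ξ c = a * (ξ * ξ) + g * (c * c)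

    private
      0²  : 0# * 0# ≡ 0#
      0²  = zeroˡ 0#

      a≢0 : a ≢ 0#
      a≢0 refl = 0≢1 (sym (proj₁ (anisotropic 1# 0# (trans (cong₂ _+_ (zeroˡ _) (trans (cong (g *_) 0²) (zeroʳ g))) (+-identityʳ 0#)))))

      g≢0 : g ≢ 0#
      g≢0 refl = 0≢1 (sym (proj₂ (anisotropic 0# 1# (trans (cong₂ _+_ (trans (cong (a *_) 0²) (zeroʳ a)) (zeroˡ _)) (+-identityʳ 0#)))))

      ∬ : (Carrier → Carrier → Carrier) → Carrier
      ∬ f = F.∑ elems (λ ξ → F.∑ elems (f ξ))

      ∬-cong : ∀ {f h} → (∀ ξ c → f ξ c ≡ h ξ c) → ∬ f ≡ ∬ h
      ∬-cong e = F.∑-cong elems λ ξ → F.∑-cong elems (e ξ)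

      ∬-+ : ∀ f h → ∬ (λ ξ c → f ξ c + h ξ c) ≡ ∬ f + ∬ h
      ∬-+ f h = trans (F.∑-cong elems (λ ξ → F.∑-∙ elems (f ξ) (h ξ))) (F.∑-∙ elems _ _)

      ∬-* : ∀ k f → ∬ (λ ξ c → k * f ξ c) ≡ k * ∬ f
      ∬-* k f = trans (F.∑-cong elems (λ ξ → F-∑-*ˡ k elems (f ξ))) (F-∑-*ˡ k elems _)

      Sξ Sc Sξc : Carrier
      Sξ  = ∬ (λ ξ c → ξ * ξ * inv (X ξ c))
      Sc  = ∬ (λ ξ c → c * c * inv (X ξ c))
      Sξc = ∬ (λ ξ c → ξ * c * inv (X ξ c))

      inv-0 : inv 0# ≡ 0#
      inv-0 with 0# ≟ 0#
      ... | yes _ = refl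
      ... | no ne = ⊥-elim (ne refl)

      inv-* : ∀ {k} x → k ≢ 0# → inv (k * x) * k ≡ inv x
      inv-* {k} x k≢0 with x ≟ 0#
      ... | yes refl = trans (cong (λ z → inv z * k) (zeroʳ k)) (trans (cong (_* k) inv-0) (zeroˡ k))
      ... | no x≢0 = *-cancelˡ x≢0 (trans
              (trans (solve 3 (λ x i k → x :* (i :* k) := k :* x :* i) refl x (inv (k * x)) k)
                     (inv-inverseʳ (*-≢0 k≢0 x≢0)))
              (sym (proj₂ (inverse x x≢0))))

      neg² : ∀ x → - x * - x ≡ x * x
      neg² x = solve 1 (λ x → :- x :* :- x := x :* x) refl x

      Sξc≡0 : Sξc ≡ 0#
      Sξc≡0 = x+x≡0⇒x≡0 (trans (cong (Sξc +_) Sξc≡-) (-‿inverseʳ Sξc))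
        where
        neg-neg : ∀ x → - - x ≡ x
        neg-neg x = solve 1 (λ x → :- :- x := x) refl x
        Sξc≡- : Sξc ≡ - Sξc
        Sξc≡- = begin
          Sξc
            ≡⟨ sym (Reindex.F-reindex -_ -_ neg-neg neg-neg (λ ξ → F.∑ elems (λ c → ξ * c * inv (X ξ c)))) ⟩
          ∬ (λ ξ c → - ξ * c * inv (X (- ξ) c))
            ≡⟨ ∬-cong (λ ξ c → trans (cong (λ z → - ξ * c * inv (a * z + g * (c * c))) (neg² ξ))
                 (solve 4 (λ o ξ c i → :- ξ :* c :* i := :- (ξ :* c :* i)) refl 1# ξ c (inv (X ξ c)))) ⟩
          ∬ (λ ξ c → - (ξ * c * inv (X ξ c)))
            ≡⟨ ∬-cong (λ ξ c → trans (cong -_ (sym (*-identityˡ _))) (solve 2 (λ o t → :- (o :* t) := (:- o) :* t) refl 1# _)) ⟩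
          ∬ (λ ξ c → - 1# * (ξ * c * inv (X ξ c)))
            ≡⟨ ∬-* (- 1#) _ ⟩
          - 1# * Sξc
            ≡⟨ trans (solve 2 (λ o t → (:- o) :* t := :- (o :* t)) refl 1# Sξc) (cong -_ (*-identityˡ _)) ⟩
          - Sξc ∎

      -- The substitution (ξ , c) ↦ (-g c , a ξ) multiplies X by a g. It permutes the pairs and
      -- exchanges the roles of ξ² and c² up to constants.
      similitude : a * Sξ ≡ g * Sc
      similitude = begin
        a * Sξ
          ≡⟨ cong (a *_) (begin
            Sξ
              ≡⟨ sym (Reindex.F-reindex (- g *_) (inv (- g) *_) (cancel1 _ -g≢0) (cancel2 _ -g≢0) _) ⟩
            F.∑ elems (λ c → F.∑ elems (λ ξ → (- g * c) * (- g * c) * inv (X (- g * c) ξ)))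
              ≡⟨ F.∑-cong elems (λ c → sym (Reindex.F-reindex (a *_) (inv a *_) (cancel1 _ a≢0) (cancel2 _ a≢0)
                   (λ ξ → (- g * c) * (- g * c) * inv (X (- g * c) ξ)))) ⟩
            F.∑ elems (λ c → F.∑ elems (λ ξ → (- g * c) * (- g * c) * inv (X (- g * c) (a * ξ))))
              ≡⟨ F.∑-swap elems elems _ ⟩
            ∬ (λ ξ c → (- g * c) * (- g * c) * inv (X (- g * c) (a * ξ))) ∎) ⟩
        a * ∬ (λ ξ c → (- g * c) * (- g * c) * inv (X (- g * c) (a * ξ)))
          ≡⟨ sym (∬-* a _) ⟩
        ∬ (λ ξ c → a * ((- g * c) * (- g * c) * inv (X (- g * c) (a * ξ))))
          ≡⟨ ∬-cong (λ ξ c → begin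
               a * ((- g * c) * (- g * c) * inv (X (- g * c) (a * ξ)))
                 ≡⟨ cong (λ z → a * ((- g * c) * (- g * c) * inv z))
                      (solve 4 (λ a g ξ c → a :* ((:- g :* c) :* (:- g :* c)) :+ g :* ((a :* ξ) :* (a :* ξ))
                        := (a :* g) :* (a :* (ξ :* ξ) :+ g :* (c :* c))) refl a g ξ c) ⟩
               a * ((- g * c) * (- g * c) * inv ((a * g) * X ξ c))
                 ≡⟨ solve 4 (λ a g c i → a :* ((:- g :* c) :* (:- g :* c) :* i) := g :* (c :* c :* (i :* (a :* g))))
                      refl a g c (inv ((a * g) * X ξ c)) ⟩
               g * (c * c * (inv ((a * g) * X ξ c) * (a * g)))
                 ≡⟨ cong (λ z → g * (c * c * z)) (inv-* (X ξ c) (*-≢0 a≢0 g≢0)) ⟩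
               g * (c * c * inv (X ξ c)) ∎) ⟩
        ∬ (λ ξ c → g * (c * c * inv (X ξ c)))
          ≡⟨ ∬-* g _ ⟩
        g * Sc ∎
        where
        -g≢0 : - g ≢ 0#
        -g≢0 e = g≢0 (trans (solve 1 (λ x → x := :- :- x) refl g) (trans (cong -_ e) -0≡0))
        cancel1 : ∀ k → k ≢ 0# → ∀ x → k * (inv k * x) ≡ x
        cancel1 k k≢0 x = trans (sym (*-assoc _ _ _)) (trans (cong (_* x) (inv-inverseʳ k≢0)) (*-identityˡ x))
        cancel2 : ∀ k → k ≢ 0# → ∀ x → inv k * (k * x) ≡ x
        cancel2 k k≢0 x = trans (sym (*-assoc _ _ _)) (trans (cong (_* x) (trans (*-comm _ _) (inv-inverseʳ k≢0))) (*-identityˡ x))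

      origin : Carrier → Carrier → Carrier
      origin ξ c = F.select _≟_ 0# ξ (F.select _≟_ 0# c 1#)

      ∬origin : ∬ origin ≡ 1#
      ∬origin = trans (F.∑-cong elems inner) (F.∑-select _≟_ elems-unique (∈-elems 0#) (λ _ → 1#))
        where
        inner : ∀ ξ → F.∑ elems (origin ξ) ≡ F.select _≟_ 0# ξ 1#
        inner ξ with 0# ≟ ξ
        ... | yes _ = F.∑-select _≟_ elems-unique (∈-elems 0#) (λ _ → 1#)
        ... | no _  = F.∑-ε elems

      -- The first two terms add up X/X, which is 1 at each nonzero pair, and the final 1 stands for
      -- the origin. So q² ones are summed in characteristic p, giving 0.
      total : a * Sξ + g * Sc + 1# ≡ 0#
      total = begin
        a * Sξ + g * Sc + 1#
          ≡⟨ cong₂ (λ s t → s + t) (cong₂ _+_ (sym (∬-* a _)) (sym (∬-* g _))) (sym ∬origin) ⟩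
        ∬ (λ ξ c → a * (ξ * ξ * inv (X ξ c))) + ∬ (λ ξ c → g * (c * c * inv (X ξ c))) + ∬ origin
          ≡⟨ trans (cong (_+ ∬ origin) (sym (∬-+ _ _))) (sym (∬-+ _ _)) ⟩
        ∬ (λ ξ c → a * (ξ * ξ * inv (X ξ c)) + g * (c * c * inv (X ξ c)) + origin ξ c)
          ≡⟨ ∬-cong pointwise ⟩
        ∬ (λ _ _ → 1#)
          ≡⟨ trans (F.∑-cong elems (λ _ → F-∑-1)) (F.∑-ε elems) ⟩
        0# ∎
        where
        collect : ∀ ξ c → a * (ξ * ξ * inv (X ξ c)) + g * (c * c * inv (X ξ c)) ≡ X ξ c * inv (X ξ c)
        collect ξ c = solve 5 (λ a g x y i → a :* (x :* i) :+ g :* (y :* i) := (a :* x :+ g :* y) :* i)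
          refl a g (ξ * ξ) (c * c) (inv (X ξ c))
        X00 : X 0# 0# ≡ 0#
        X00 = trans (cong₂ _+_ (trans (cong (a *_) 0²) (zeroʳ a)) (trans (cong (g *_) 0²) (zeroʳ g))) (+-identityʳ 0#)
        pointwise : ∀ ξ c → a * (ξ * ξ * inv (X ξ c)) + g * (c * c * inv (X ξ c)) + origin ξ c ≡ 1#
        pointwise ξ c with 0# ≟ ξ
        ... | no 0≢ξ = trans (+-identityʳ _) (trans (collect ξ c)
                         (inv-inverseʳ (λ e → 0≢ξ (sym (proj₁ (anisotropic ξ c e))))))
        ... | yes refl with 0# ≟ c
        ...   | no 0≢c = trans (+-identityʳ _) (trans (collect 0# c)
                         (inv-inverseʳ (λ e → 0≢c (sym (proj₂ (anisotropic 0# c e))))))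
        ...   | yes refl = trans (cong (_+ 1#) (trans (collect 0# 0#)
                         (trans (cong (λ z → z * inv z) X00) (zeroˡ _)))) (+-identityˡ 1#)

      Sc≢0 : Sc ≢ 0#
      Sc≢0 Sc≡0 = 0≢1 (sym (trans (sym (trans (cong (λ z → z + z + 1#) (trans (cong (g *_) Sc≡0) (zeroʳ g)))
          (trans (cong (_+ 1#) (+-identityʳ 0#)) (+-identityˡ 1#))))
        (trans (cong (λ z → z + g * Sc + 1#) (sym similitude)) total)))

    Y : (k₁₁ k₁₃ k₃₃ : Carrier) → Carrier → Carrier → Carrier
    Y k₁₁ k₁₃ k₃₃ ξ c = k₁₁ * (ξ * ξ) + (k₁₃ + k₁₃) * (ξ * c) + k₃₃ * (c * c)

    private
      ∬Y/X : ∀ k₁₁ k₁₃ k₃₃ → ∬ (λ ξ c → Y k₁₁ k₁₃ k₃₃ ξ c * inv (X ξ c)) ≡ k₁₁ * Sξ + k₃₃ * Sc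
      ∬Y/X k₁₁ k₁₃ k₃₃ = begin
        ∬ (λ ξ c → Y k₁₁ k₁₃ k₃₃ ξ c * inv (X ξ c))
          ≡⟨ ∬-cong (λ ξ c → solve 7 (λ k l m x y z i → (k :* x :+ l :* y :+ m :* z) :* i
               := k :* (x :* i) :+ l :* (y :* i) :+ m :* (z :* i)) refl k₁₁ (k₁₃ + k₁₃) k₃₃ (ξ * ξ) (ξ * c) (c * c) (inv (X ξ c))) ⟩
        ∬ (λ ξ c → k₁₁ * (ξ * ξ * inv (X ξ c)) + (k₁₃ + k₁₃) * (ξ * c * inv (X ξ c)) + k₃₃ * (c * c * inv (X ξ c)))
          ≡⟨ trans (∬-+ _ _) (cong₂ _+_ (trans (∬-+ _ _) (cong₂ _+_ (∬-* k₁₁ _) (∬-* (k₁₃ + k₁₃) _))) (∬-* k₃₃ _)) ⟩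
        k₁₁ * Sξ + (k₁₃ + k₁₃) * Sξc + k₃₃ * Sc
          ≡⟨ cong (λ z → k₁₁ * Sξ + z + k₃₃ * Sc) (trans (cong ((k₁₃ + k₁₃) *_) Sξc≡0) (zeroʳ _)) ⟩
        k₁₁ * Sξ + 0# + k₃₃ * Sc
          ≡⟨ cong (_+ k₃₃ * Sc) (+-identityʳ _) ⟩
        k₁₁ * Sξ + k₃₃ * Sc ∎

      -- The hypothesis concerns weights in ℕ, the conclusion weights in the field. Writing w as a
      -- combination of indicators of single pairs (s , t) reduces the second to images of counts
      -- under `nat`.
      transfer : ∀ (Y Y′ : Carrier → Carrier → Carrier) →
        ((w : Carrier → Carrier → ℕ) → N.∑ elems (λ ξ → N.∑ elems (λ c → w (Y ξ c) (X ξ c)))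
                                     ≡ N.∑ elems (λ ξ → N.∑ elems (λ c → w (Y′ ξ c) (X ξ c)))) →
        ∀ (w : Carrier → Carrier → Carrier) → ∬ (λ ξ c → w (Y ξ c) (X ξ c)) ≡ ∬ (λ ξ c → w (Y′ ξ c) (X ξ c))
      transfer Y Y′ same w = trans (expand Y) (trans
        (∬-cong λ s t → cong (_* w s t) (cong nat (same (λ u v → N.select _≟_ u s (N.select _≟_ v t 1)))))
        (sym (expand Y′)))
        where
        pick : ∀ u v → w u v ≡ ∬ (λ s t → nat (N.select _≟_ u s (N.select _≟_ v t 1)) * w s t)
        pick u v = sym (trans (F.∑-cong elems inner) (F.∑-select _≟_ elems-unique (∈-elems u) (λ s → w s v)))
          where
          inner : ∀ s → F.∑ elems (λ t → nat (N.select _≟_ u s (N.select _≟_ v t 1)) * w s t) ≡ F.select _≟_ u s (w s v)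
          inner s with u ≟ s
          ... | no _ = trans (F.∑-cong elems (λ t → zeroˡ (w s t))) (F.∑-ε elems)
          ... | yes _ = trans (F.∑-cong elems inner′) (F.∑-select _≟_ elems-unique (∈-elems v) (w s))
            where
            inner′ : ∀ t → nat (N.select _≟_ v t 1) * w s t ≡ F.select _≟_ v t (w s t)
            inner′ t with v ≟ t
            ... | no _ = zeroˡ _
            ... | yes _ = trans (cong (_* w s t) (+-identityʳ 1#)) (*-identityˡ _)
        expand : ∀ Y → ∬ (λ ξ c → w (Y ξ c) (X ξ c)) ≡
                 ∬ (λ s t → nat (N.∑ elems (λ ξ → N.∑ elems (λ c → N.select _≟_ (Y ξ c) s (N.select _≟_ (X ξ c) t 1)))) * w s t)
        expand Y = begin
          ∬ (λ ξ c → w (Y ξ c) (X ξ c))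
            ≡⟨ ∬-cong (λ ξ c → pick (Y ξ c) (X ξ c)) ⟩
          ∬ (λ ξ c → ∬ (λ s t → nat (I ξ c s t) * w s t))
            ≡⟨ F.∑-cong elems (λ ξ → F.∑-swap elems elems _) ⟩
          F.∑ elems (λ ξ → F.∑ elems (λ s → F.∑ elems (λ c → F.∑ elems (λ t → nat (I ξ c s t) * w s t))))
            ≡⟨ F.∑-swap elems elems _ ⟩
          F.∑ elems (λ s → F.∑ elems (λ ξ → F.∑ elems (λ c → F.∑ elems (λ t → nat (I ξ c s t) * w s t))))
            ≡⟨ F.∑-cong elems (λ s → trans (F.∑-cong elems (λ ξ → F.∑-swap elems elems _)) (F.∑-swap elems elems _)) ⟩
          ∬ (λ s t → F.∑ elems (λ ξ → F.∑ elems (λ c → nat (I ξ c s t) * w s t)))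
            ≡⟨ ∬-cong (λ s t → begin
                 F.∑ elems (λ ξ → F.∑ elems (λ c → nat (I ξ c s t) * w s t))
                   ≡⟨ ∬-cong (λ ξ c → *-comm _ _) ⟩
                 F.∑ elems (λ ξ → F.∑ elems (λ c → w s t * nat (I ξ c s t)))
                   ≡⟨ ∬-* (w s t) _ ⟩
                 w s t * ∬ (λ ξ c → nat (I ξ c s t))
                   ≡⟨ *-comm _ _ ⟩
                 ∬ (λ ξ c → nat (I ξ c s t)) * w s t
                   ≡⟨ cong (_* w s t) (sym (trans (nat-∑ elems _) (F.∑-cong elems (λ ξ → nat-∑ elems _)))) ⟩
                 nat (N.∑ elems (λ ξ → N.∑ elems (λ c → I ξ c s t))) * w s t ∎) ⟩
          ∬ (λ s t → nat (N.∑ elems (λ ξ → N.∑ elems (λ c → I ξ c s t))) * w s t) ∎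
          where
          I : Carrier → Carrier → Carrier → Carrier → ℕ
          I ξ c s t = N.select _≟_ (Y ξ c) s (N.select _≟_ (X ξ c) t 1)

    -- The weight y/x turns the distribution into k₁₁ `Sξ` + k₃₃ `Sc`. The mixed coefficients, which
    -- may differ, are killed by the antisymmetry under ξ ↦ -ξ; the common k₁₁ cancels and `Sc` is
    -- nonzero.
    conic-determines : ∀ {k₁₁ k₁₃ k₃₃ k₁₃′ k₃₃′} →
      ((w : Carrier → Carrier → ℕ) → N.∑ elems (λ ξ → N.∑ elems (λ c → w (Y k₁₁ k₁₃ k₃₃ ξ c) (X ξ c)))
                                   ≡ N.∑ elems (λ ξ → N.∑ elems (λ c → w (Y k₁₁ k₁₃′ k₃₃′ ξ c) (X ξ c)))) →
      k₃₃ ≡ k₃₃′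
    conic-determines {k₁₁} {k₁₃} {k₃₃} {k₁₃′} {k₃₃′} same = *-cancelˡ Sc≢0 (trans (*-comm _ _) (trans
      (+-cancel (trans (sym (∬Y/X k₁₁ k₁₃ k₃₃)) (trans (transfer _ _ same (λ y x → y * inv x)) (∬Y/X k₁₁ k₁₃′ k₃₃′))))
      (*-comm _ _)))
      where
      +-cancel : ∀ {x y z} → x + y ≡ x + z → y ≡ z
      +-cancel {x} {y} {z} e = trans (solve 2 (λ x y → y := :- x :+ (x :+ y)) refl x y)
        (trans (cong (- x +_) e) (solve 2 (λ x z → :- x :+ (x :+ z) := z) refl x z))

-- Gaussian elimination on distributions, and functionals on polynomials.

module Elimination (𝔽 : FiniteField) (odd : FiniteField.size 𝔽 ℕ.% 2 ≡ 1) (4<size : 4 < FiniteField.size 𝔽) where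
  open FieldTheory 𝔽
  open FieldCounting 𝔽 odd
  open Distributions 𝔽 odd
  open F-solver
  open ≡-Reasoning

  -- Index ranges are infinite so that passing to a Schur complement is a mere shift; the number of
  -- variables is carried by the vectors at which forms are evaluated.
  Matrix Vector : Set
  Matrix = ℕ → ℕ → Carrier
  Vector = ℕ → Carrier

  schur : Matrix → Matrix
  schur M j l = M (suc j) (suc l) + - (M 0 (suc j) * M 0 (suc l) * inv (M 0 0))

  schurᵥ : Matrix → Vector → Vector
  schurᵥ M h j = h (suc j) + - (M 0 (suc j) * h 0 * inv (M 0 0))

  pivot : ℕ → Matrix → Carrier
  pivot zero    M = M 0 0
  pivot (suc i) M = pivot i (schur M)

  entry : ℕ → Matrix → Vector → Carrier
  entry zero    M h = h 0
  entry (suc i) M h = entry i (schur M) (schurᵥ M h)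

  -- For symmetric M with nonzero pivots this is hᵀMₙ⁻¹h′, where Mₙ is the leading n by n block,
  -- expanded along its LDLᵀ factorisation. In this form the last pivot enters through the last
  -- summand alone.
  correction : ℕ → Matrix → Vector → Vector → Carrier
  correction zero    M h h′ = 0#
  correction (suc n) M h h′ = correction n M h h′ + entry n M h * entry n M h′ * inv (pivot n M)

  -- The definition splits off the last summand, as peeling needs; elimination removes the first
  -- variable and needs the sum split at the front.
  correction-front : ∀ n M h h′ → correction (suc n) M h h′ ≡
    h 0 * h′ 0 * inv (M 0 0) + correction n (schur M) (schurᵥ M h) (schurᵥ M h′)
  correction-front zero    M h h′ = +-comm _ _
  correction-front (suc n) M h h′ = trans (cong (_+ entry (suc n) M h * entry (suc n) M h′ * inv (pivot (suc n) M)) (correction-front n M h h′)) (+-assoc _ _ _)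

  dot : ∀ {n} → Vector → Vec Carrier n → Carrier
  dot h []       = 0#
  dot h (x ∷ xs) = x * h 0 + dot (h ∘ suc) xs

  quad : ∀ {n} → Matrix → Vec Carrier n → Carrier
  quad M []       = 0#
  quad M (x ∷ xs) = M 0 0 * (x * x) + (x * dot (M 0 ∘ suc) xs + x * dot (M 0 ∘ suc) xs)
                  + quad (λ j l → M (suc j) (suc l)) xs

  dot-linear : ∀ {n} h u k (xs : Vec Carrier n) → dot (λ j → h j + - (u j * k)) xs ≡ dot h xs + - (dot u xs * k)
  dot-linear h u k []       = solve 1 (λ k → con (ℤ.+ 0) := con (ℤ.+ 0) :+ :- (con (ℤ.+ 0) :* k)) refl k
    where import Data.Integer as ℤ
  dot-linear h u k (x ∷ xs) = trans (cong (x * (h 0 + - (u 0 * k)) +_) (dot-linear (h ∘ suc) (u ∘ suc) k xs))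
    (solve 6 (λ x a b k d e → x :* (a :+ :- (b :* k)) :+ (d :+ :- (e :* k)) := (x :* a :+ d) :+ :- ((x :* b :+ e) :* k))
       refl x (h 0) (u 0) k (dot (h ∘ suc) xs) (dot (u ∘ suc) xs))

  dot-cong : ∀ {n} {h h′} → (∀ j → h j ≡ h′ j) → (xs : Vec Carrier n) → dot h xs ≡ dot h′ xs
  dot-cong e []       = refl
  dot-cong e (x ∷ xs) = cong₂ _+_ (cong (x *_) (e 0)) (dot-cong (e ∘ suc) xs)

  quad-rank-one : ∀ {n} M u i (xs : Vec Carrier n) →
    quad (λ j l → M j l + - (u j * u l * i)) xs ≡ quad M xs + - (dot u xs * dot u xs * i)
  quad-rank-one M u i []       = solve 1 (λ i → con (ℤ.+ 0) := con (ℤ.+ 0) :+ :- (con (ℤ.+ 0) :* con (ℤ.+ 0) :* i)) refl i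
    where import Data.Integer as ℤ
  quad-rank-one M u i (x ∷ xs) = trans
    (cong₂ (λ d q → (M 0 0 + - (u 0 * u 0 * i)) * (x * x) + (x * d + x * d) + q)
      (trans (dot-cong (λ l → cong (λ z → M 0 (suc l) + - z)
                (solve 3 (λ a b c → a :* b :* c := b :* (a :* c)) refl (u 0) (u (suc l)) i)) xs)
             (dot-linear (M 0 ∘ suc) (u ∘ suc) (u 0 * i) xs))
      (quad-rank-one (λ j l → M (suc j) (suc l)) (u ∘ suc) i xs))
    (solve 7 (λ m u i x d e q → (m :+ :- (u :* u :* i)) :* (x :* x)
        :+ (x :* (d :+ :- (e :* (u :* i))) :+ x :* (d :+ :- (e :* (u :* i)))) :+ (q :+ :- (e :* e :* i))
        := (m :* (x :* x) :+ (x :* d :+ x :* d) :+ q) :+ :- ((x :* u :+ e) :* (x :* u :+ e) :* i))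
      refl (M 0 0) (u 0) i x (dot (M 0 ∘ suc) xs) (dot (u ∘ suc) xs) (quad (λ j l → M (suc j) (suc l)) xs))

  form : ∀ {n} → Matrix → Vector → Carrier → Vec Carrier n → Carrier
  form M h κ xs = quad M xs + (dot h xs + dot h xs) + κ

  complete-square : ∀ {n} M h κ x (xs : Vec Carrier n) → M 0 0 ≢ 0# →
    let y = x + (dot (M 0 ∘ suc) xs + h 0) * inv (M 0 0) in
    form M h κ (x ∷ xs) ≡
    M 0 0 * (y * y) + form (schur M) (schurᵥ M h) (κ + - (h 0 * h 0 * inv (M 0 0))) xs
  complete-square M h κ x xs m≢0 = sym (trans
    (cong₂ (λ q d → m * (y * y) + (q + (d + d) + (κ + - (h 0 * h 0 * i))))
      (quad-rank-one (λ j l → M (suc j) (suc l)) (M 0 ∘ suc) i xs)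
      (trans (dot-cong (λ j → cong (λ z → h (suc j) + - z) (*-assoc _ _ _)) xs)
             (dot-linear (h ∘ suc) (M 0 ∘ suc) (h 0 * i) xs)))
    (begin
      m * (y * y) + (q + - (e * e * i) + ((d + - (e * (h 0 * i))) + (d + - (e * (h 0 * i)))) + (κ + - (h 0 * h 0 * i)))
        ≡⟨ solve 8 (λ m i x e h q d κ →
             m :* ((x :+ (e :+ h) :* i) :* (x :+ (e :+ h) :* i))
             :+ (q :+ :- (e :* e :* i) :+ ((d :+ :- (e :* (h :* i))) :+ (d :+ :- (e :* (h :* i)))) :+ (κ :+ :- (h :* h :* i)))
             := (m :* (x :* x) :+ (m :* i) :* (x :* e :+ x :* e :+ (x :* h :+ x :* h)) :+ q :+ (d :+ d) :+ κ)
                :+ (m :* i :+ :- con (ℤ.+ 1)) :* ((e :+ h) :* (e :+ h) :* i))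
           refl m i x e (h 0) q d κ ⟩
      (m * (x * x) + m * i * (x * e + x * e + (x * h 0 + x * h 0)) + q + (d + d) + κ)
        + (m * i + - (1# + 0#)) * ((e + h 0) * (e + h 0) * i)
        ≡⟨ cong₂ (λ s t → (m * (x * x) + s * (x * e + x * e + (x * h 0 + x * h 0)) + q + (d + d) + κ) + t * ((e + h 0) * (e + h 0) * i))
             mi (trans (cong₂ (λ s t → s + - t) mi (+-identityʳ 1#)) (-‿inverseʳ 1#)) ⟩
      (m * (x * x) + 1# * (x * e + x * e + (x * h 0 + x * h 0)) + q + (d + d) + κ) + 0# * ((e + h 0) * (e + h 0) * i)
        ≡⟨ cong₂ (λ s t → (m * (x * x) + s + q + (d + d) + κ) + t) (*-identityˡ _) (zeroˡ _) ⟩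
      (m * (x * x) + (x * e + x * e + (x * h 0 + x * h 0)) + q + (d + d) + κ) + 0#
        ≡⟨ +-identityʳ _ ⟩
      m * (x * x) + (x * e + x * e + (x * h 0 + x * h 0)) + q + (d + d) + κ
        ≡⟨ solve 6 (λ a b c q d κ → a :+ (b :+ b :+ (c :+ c)) :+ q :+ (d :+ d) :+ κ
             := (a :+ (b :+ b) :+ q) :+ ((c :+ d) :+ (c :+ d)) :+ κ) refl (m * (x * x)) (x * e) (x * h 0) q d κ ⟩
      form M h κ (x ∷ xs) ∎))
    where
    import Data.Integer as ℤ
    m = M 0 0
    i = inv m
    mi = inv-inverseʳ m≢0
    e = dot (M 0 ∘ suc) xs
    d = dot (h ∘ suc) xs
    q = quad (λ j l → M (suc j) (suc l)) xs
    y = x + (e + h 0) * i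

  vecs : ∀ n → List (Vec Carrier n)
  vecs zero    = [] ∷ []
  vecs (suc n) = List.cartesianProductWith _∷_ elems (vecs n)

  ∑-vecs-suc : ∀ n (f : Vec Carrier (suc n) → ℕ) →
    N.∑ (vecs (suc n)) f ≡ N.∑ elems (λ x → N.∑ (vecs n) (λ xs → f (x ∷ xs)))
  ∑-vecs-suc n f = N.∑-product _∷_ elems (vecs n) f

  -- Completing the square translates the first variable by an amount depending on the linear part,
  -- which differs for h and h′. A sum over the field ignores the translation, so `cancel-square`
  -- applies with the remaining variables and the parameter τ as index set. Only the matrix M has to
  -- be common to both sides.
  eliminate : ∀ {T Z : Set} n M (τs : List T) {h h′ : T → Vector} {κ κ′ : T → Carrier} {z z′ : T → Z} →
    (∀ i → i < n → pivot i M ≢ 0#) →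
    ((w : Carrier → Z → ℕ) → N.∑ (vecs n) (λ xs → N.∑ τs (λ τ → w (form M (h τ) (κ τ) xs) (z τ)))
                           ≡ N.∑ (vecs n) (λ xs → N.∑ τs (λ τ → w (form M (h′ τ) (κ′ τ) xs) (z′ τ)))) →
    SameDistribution τs (λ τ → κ τ + - correction n M (h τ) (h τ)) (λ τ → κ′ τ + - correction n M (h′ τ) (h′ τ)) z z′
  eliminate zero M τs {h} {h′} {κ} {κ′} {z} {z′} piv same w = trans
    (N.∑-cong τs (λ τ → cong (λ s → w s (z τ)) (fix (κ τ)))) (trans
    (trans (sym (ℕₚ.+-identityʳ _)) (trans (same w) (ℕₚ.+-identityʳ _)))
    (N.∑-cong τs (λ τ → cong (λ s → w s (z′ τ)) (sym (fix (κ′ τ))))))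
    where
    fix : ∀ k → k + - 0# ≡ 0# + (0# + 0#) + k
    fix k = solve 1 (λ k → k :+ :- con (ℤ.+ 0) := con (ℤ.+ 0) :+ (con (ℤ.+ 0) :+ con (ℤ.+ 0)) :+ k) refl k
      where import Data.Integer as ℤ
  eliminate {T} {Z} (suc n) M τs {h} {h′} {κ} {κ′} {z} {z′} piv same w = trans
    (N.∑-cong τs (λ τ → cong (λ s → w s (z τ)) (fix (h τ) (κ τ)))) (trans
    (eliminate n (schur M) τs {h = λ τ → schurᵥ M (h τ)} {h′ = λ τ → schurᵥ M (h′ τ)}
      {κ = λ τ → κ τ + - (h τ 0 * h τ 0 * inv (M 0 0))} {κ′ = λ τ → κ′ τ + - (h′ τ 0 * h′ τ 0 * inv (M 0 0))}
      {z} {z′} (λ i i<n → piv (suc i) (s≤s i<n)) (λ w →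
      trans (sym (∑-pairs _)) (trans (cancel-square (piv 0 (s≤s z≤n)) pairs {f = rest h κ} {f′ = rest h′ κ′}
        {z = z ∘ proj₂} {z′ = z′ ∘ proj₂} (λ w →
        trans (sym (step h κ z w)) (trans (same w) (step h′ κ′ z′ w))) w) (∑-pairs _))) w)
    (N.∑-cong τs (λ τ → cong (λ s → w s (z′ τ)) (sym (fix (h′ τ) (κ′ τ))))))
    where
    fix : ∀ h k → k + - correction (suc n) M h h ≡
          k + - (h 0 * h 0 * inv (M 0 0)) + - correction n (schur M) (schurᵥ M h) (schurᵥ M h)
    fix h k = trans (cong (λ t → k + - t) (correction-front n M h h))
      (solve 3 (λ k a b → k :+ :- (a :+ b) := k :+ :- a :+ :- b) refl k _ _)
    rest : (T → Vector) → (T → Carrier) → Vec Carrier n × T → Carrier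
    rest h κ p = form (schur M) (schurᵥ M (h (proj₂ p))) (κ (proj₂ p) + - (h (proj₂ p) 0 * h (proj₂ p) 0 * inv (M 0 0))) (proj₁ p)
    pairs : List (Vec Carrier n × T)
    pairs = List.cartesianProductWith _,_ (vecs n) τs
    ∑-pairs : ∀ (f : Vec Carrier n × T → ℕ) → N.∑ pairs f ≡ N.∑ (vecs n) (λ xs → N.∑ τs (λ τ → f (xs , τ)))
    ∑-pairs f = N.∑-product _,_ (vecs n) τs f
    step : ∀ (h : T → Vector) (κ : T → Carrier) (z : T → Z) (w : Carrier → Z → ℕ) →
      N.∑ (vecs (suc n)) (λ xs → N.∑ τs (λ τ → w (form M (h τ) (κ τ) xs) (z τ))) ≡
      N.∑ elems (λ x → N.∑ pairs (λ p → w (M 0 0 * (x * x) + form (schur M) (schurᵥ M (h (proj₂ p)))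
        (κ (proj₂ p) + - (h (proj₂ p) 0 * h (proj₂ p) 0 * inv (M 0 0))) (proj₁ p)) (z (proj₂ p))))
    step h κ z w = begin
      N.∑ (vecs (suc n)) (λ xs → N.∑ τs (λ τ → w (form M (h τ) (κ τ) xs) (z τ)))
        ≡⟨ ∑-vecs-suc n _ ⟩
      N.∑ elems (λ x → N.∑ (vecs n) (λ xs → N.∑ τs (λ τ → w (form M (h τ) (κ τ) (x ∷ xs)) (z τ))))
        ≡⟨ N.∑-cong elems (λ x → sym (∑-pairs _)) ⟩
      N.∑ elems (λ x → N.∑ pairs (λ p → w (form M (h (proj₂ p)) (κ (proj₂ p)) (x ∷ proj₁ p)) (z (proj₂ p))))
        ≡⟨ N.∑-swap elems pairs _ ⟩
      N.∑ pairs (λ p → N.∑ elems (λ x → w (form M (h (proj₂ p)) (κ (proj₂ p)) (x ∷ proj₁ p)) (z (proj₂ p))))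
        ≡⟨ N.∑-cong pairs (λ { (xs , τ) → trans
             (N.∑-cong elems (λ x → cong (λ s → w s (z τ)) (complete-square M (h τ) (κ τ) x xs (piv 0 (s≤s z≤n)))))
             (Translate.N-reindex _ (λ y → w (M 0 0 * (y * y) + form (schur M) (schurᵥ M (h τ))
               (κ τ + - (h τ 0 * h τ 0 * inv (M 0 0))) xs) (z τ))) }) ⟩
      N.∑ pairs (λ p → N.∑ elems (λ x → w (M 0 0 * (x * x) + form (schur M) (schurᵥ M (h (proj₂ p)))
        (κ (proj₂ p) + - (h (proj₂ p) 0 * h (proj₂ p) 0 * inv (M 0 0))) (proj₁ p)) (z (proj₂ p))))
        ≡⟨ N.∑-swap pairs elems _ ⟩
      N.∑ elems (λ x → N.∑ pairs (λ p → w (M 0 0 * (x * x) + form (schur M) (schurᵥ M (h (proj₂ p)))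
        (κ (proj₂ p) + - (h (proj₂ p) 0 * h (proj₂ p) 0 * inv (M 0 0))) (proj₁ p)) (z (proj₂ p)))) ∎

  -- An arbitrary F_q-linear functional on polynomials, stored by its values on the powers of t.
  -- Each of these coordinates can be moved independently.
  Functional : Set
  Functional = ℕ → Carrier

  ev : Functional → Poly → Carrier
  ev χ []      = 0#
  ev χ (c ∷ p) = c * χ 0 + ev (χ ∘ suc) p

  ev-0 : ∀ χ p → p ≈ₚ 0ₚ → ev χ p ≡ 0#
  ev-0 χ []      e = refl
  ev-0 χ (c ∷ p) e = trans (cong₂ _+_ (trans (cong (_* χ 0) (e 0)) (zeroˡ _)) (ev-0 (χ ∘ suc) p (e ∘ suc)))
    (+-identityʳ 0#)

  ev-cong : ∀ χ p r → p ≈ₚ r → ev χ p ≡ ev χ r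
  ev-cong χ []      r       e = sym (ev-0 χ r (λ i → sym (e i)))
  ev-cong χ (c ∷ p) []      e = ev-0 χ (c ∷ p) e
  ev-cong χ (c ∷ p) (d ∷ r) e = cong₂ _+_ (cong (_* χ 0) (e 0)) (ev-cong (χ ∘ suc) p r (e ∘ suc))

  ev-+ : ∀ χ p r → ev χ (p +ₚ r) ≡ ev χ p + ev χ r
  ev-+ χ []      r       = sym (+-identityˡ _)
  ev-+ χ (c ∷ p) []      = sym (+-identityʳ _)
  ev-+ χ (c ∷ p) (d ∷ r) = trans (cong ((c + d) * χ 0 +_) (ev-+ (χ ∘ suc) p r))
    (solve 5 (λ c d l a b → (c :+ d) :* l :+ (a :+ b) := (c :* l :+ a) :+ (d :* l :+ b)) refl c d (χ 0) _ _)

  ev-scale : ∀ χ k p → ev χ (List.map (k *_) p) ≡ k * ev χ p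
  ev-scale χ k []      = sym (zeroʳ k)
  ev-scale χ k (c ∷ p) = trans (cong (k * c * χ 0 +_) (ev-scale (χ ∘ suc) k p))
    (solve 4 (λ k c l a → k :* c :* l :+ k :* a := k :* (c :* l :+ a)) refl k c (χ 0) _)

  ev-neg : ∀ χ p → ev χ (-ₚ p) ≡ - ev χ p
  ev-neg χ []      = sym -0≡0
  ev-neg χ (c ∷ p) = trans (cong (- c * χ 0 +_) (ev-neg (χ ∘ suc) p))
    (solve 3 (λ c l a → (:- c) :* l :+ :- a := :- (c :* l :+ a)) refl c (χ 0) _)

  basis : ℕ → Functional
  basis zero    zero    = 1#
  basis zero    (suc _) = 0#
  basis (suc w) zero    = 0#
  basis (suc w) (suc n) = basis w n

  _+[_]_ : Functional → ℕ → Carrier → Functional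
  (χ +[ w ] y) n = χ n + y * basis w n

  ev-line : ∀ χ μ y p → ev (λ n → χ n + y * μ n) p ≡ ev χ p + y * ev μ p
  ev-line χ μ y []      = sym (trans (+-identityˡ _) (zeroʳ y))
  ev-line χ μ y (c ∷ p) = trans (cong (c * (χ 0 + y * μ 0) +_) (ev-line (χ ∘ suc) (μ ∘ suc) y p))
    (solve 6 (λ c l y m a b → c :* (l :+ y :* m) :+ (a :+ y :* b) := (c :* l :+ a) :+ y :* (c :* m :+ b))
      refl c (χ 0) y (μ 0) _ _)

  ev-basis : ∀ w p → ev (basis w) p ≡ coeff p w
  ev-basis w       []      = refl
  ev-basis zero    (c ∷ p) = trans (cong₂ _+_ (*-identityʳ c) (zeros p)) (+-identityʳ c)
    where
    zeros : ∀ p → ev (λ _ → 0#) p ≡ 0#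
    zeros []      = refl
    zeros (c ∷ p) = trans (cong₂ _+_ (zeroʳ c) (zeros p)) (+-identityʳ 0#)
  ev-basis (suc w) (c ∷ p) = trans (cong₂ _+_ (zeroʳ c) (ev-basis w p)) (+-identityˡ _)

  ev-shift : ∀ χ w y p → ev (χ +[ w ] y) p ≡ ev χ p + y * coeff p w
  ev-shift χ w y p = trans (ev-line χ (basis w) y p) (cong (λ z → ev χ p + y * z) (ev-basis w p))

  zero-or-coeff : ∀ p → p ≈ₚ 0ₚ ⊎ ∃ λ i → coeff p i ≢ 0#
  zero-or-coeff [] = inj₁ (λ _ → refl)
  zero-or-coeff (c ∷ p) with c ≟ 0# | zero-or-coeff p
  ... | no c≢0  | _              = inj₂ (0 , c≢0)
  ... | yes _   | inj₂ (i , i≢0) = inj₂ (suc i , i≢0)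
  ... | yes c≡0 | inj₁ p≈0       = inj₁ λ { zero → c≡0 ; (suc i) → p≈0 i }

  root : ∀ {a b c} → b ≢ 0# → a + c * b ≡ 0# → c ≡ - a * inv b
  root {a} {b} {c} b≢0 e = *-cancelˡ b≢0 (trans (solve 3 (λ a b c → b :* c := :- a :+ (a :+ c :* b)) refl a b c)
    (trans (cong (- a +_) e) (trans (+-identityʳ _) (trans (sym (*-identityʳ _))
      (trans (cong (- a *_) (sym (inv-inverseʳ b≢0))) (solve 3 (λ a b i → a :* (b :* i) := b :* (a :* i)) refl (- a) b (inv b)))))))

  -- Finitely many hyperplanes, fewer than q, do not cover the space of functionals.
  separate : ∀ us → length us < size → All (λ u → ¬ (u ≈ₚ 0ₚ)) us → ∃ λ χ → All (λ u → ev χ u ≢ 0#) us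
  separate []       len []        = (λ _ → 0#) , []
  separate (u ∷ us) len (u≉0 ∷ nz) with separate us (ℕₚ.<-trans (ℕₚ.n<1+n _) len) nz | zero-or-coeff u
  ... | χ , ok | inj₁ u≈0 = ⊥-elim (u≉0 u≈0)
  ... | χ , ok | inj₂ (i , ui≢0) with ev χ u ≟ 0#
  ...   | no evu≢0 = χ , evu≢0 ∷ ok
  ...   | yes evu≡0 = χ +[ i ] y , new ∷ All.tabulate (λ {v} v∈ e → old v v∈ e)
    where
    bad : Poly → Carrier
    bad v = - ev χ v * inv (coeff v i)
    -- Along the line in direction `basis i` each polynomial evaluates to an affine function of y.
    -- Those with nonzero slope have the single root `bad v`, which y avoids; the others keep their
    -- value.
    y = proj₁ (avoid (List.map bad (u ∷ us)) (subst (_< size) (sym (length-map bad (u ∷ us))) len))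
    y∉ = proj₂ (avoid (List.map bad (u ∷ us)) (subst (_< size) (sym (length-map bad (u ∷ us))) len))
    new : ev (χ +[ i ] y) u ≢ 0#
    new e = y∉ (here (root ui≢0 (trans (sym (ev-shift χ i y u)) e)))
    old : ∀ v → v ∈ us → ev (χ +[ i ] y) v ≢ 0#
    old v v∈ e with coeff v i ≟ 0#
    ... | no vi≢0  = y∉ (there (subst (_∈ List.map bad us) (sym (root vi≢0 (trans (sym (ev-shift χ i y v)) e))) (∈-map⁺ bad v∈)))
    ... | yes vi≡0 = All.lookup ok v∈ (trans (sym (trans (cong (λ z → ev χ v + y * z) vi≡0)
                       (trans (cong (ev χ v +_) (zeroʳ y)) (+-identityʳ _)))) (trans (sym (ev-shift χ i y v)) e))

  quadratic-roots : ∀ {α β γ x y z} → x ≢ y → x ≢ z → y ≢ z →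
    (∀ t → t ≡ x ⊎ t ≡ y ⊎ t ≡ z → α * (t * t) + β * t + γ ≡ 0#) → α ≡ 0# × β ≡ 0# × γ ≡ 0#
  quadratic-roots {α} {β} {γ} {x} {y} {z} x≢y x≢z y≢z r = α≡0 , β≡0 , γ≡0
    where
    diff≢0 : ∀ {a b} → a ≢ b → a + - b ≢ 0#
    diff≢0 {a} {b} ne e = ne (trans (solve 2 (λ a b → a := (a :+ :- b) :+ b) refl a b) (trans (cong (_+ b) e) (+-identityˡ b)))
    slope : ∀ {s t} → s ≢ t → α * (s * s) + β * s + γ ≡ 0# → α * (t * t) + β * t + γ ≡ 0# → α * (s + t) + β ≡ 0#
    slope {s} {t} ne e e′ = *-cancelˡ (diff≢0 ne) (trans
      (solve 5 (λ α β γ s t → (s :+ :- t) :* (α :* (s :+ t) :+ β)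
        := (α :* (s :* s) :+ β :* s :+ γ) :+ :- (α :* (t :* t) :+ β :* t :+ γ)) refl α β γ s t)
      (trans (cong₂ (λ a b → a + - b) e e′) (trans (-‿inverseʳ 0#) (sym (zeroʳ _)))))
    xy = slope x≢y (r x (inj₁ refl)) (r y (inj₂ (inj₁ refl)))
    xz = slope x≢z (r x (inj₁ refl)) (r z (inj₂ (inj₂ refl)))
    α≡0 : α ≡ 0#
    α≡0 = *-cancelˡ (diff≢0 y≢z) (trans
      (solve 5 (λ α β x y z → (y :+ :- z) :* α := (α :* (x :+ y) :+ β) :+ :- (α :* (x :+ z) :+ β)) refl α β x y z)
      (trans (cong₂ (λ a b → a + - b) xy xz) (trans (-‿inverseʳ 0#) (sym (zeroʳ _)))))
    β≡0 : β ≡ 0#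
    β≡0 = trans (sym (trans (cong (λ a → a * (x + y) + β) α≡0) (trans (cong (_+ β) (zeroˡ _)) (+-identityˡ β)))) xy
    γ≡0 : γ ≡ 0#
    γ≡0 = trans (sym (trans (cong₂ (λ a b → a * (x * x) + b * x + γ) α≡0 β≡0)
      (trans (cong (_+ γ) (trans (cong₂ _+_ (zeroˡ _) (zeroˡ _)) (+-identityʳ 0#))) (+-identityˡ γ)))) (r x (inj₁ refl))

  -- A + yU = κ/(p + ya) for three values of y clears to a quadratic polynomial in y.
  peel-line : ∀ {A U κ p a} y₀ → a ≢ 0# →
    (∀ y → y ≢ y₀ → p + y * a ≢ 0# → A + y * U ≡ κ * inv (p + y * a)) → A ≡ 0# × κ ≡ 0#
  peel-line {A} {U} {κ} {p} {a} y₀ a≢0 eq = A≡0 , κ≡0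
    where
    y₁ = - p * inv a
    -- Three distinct points outside `y₀` and the pole `y₁` are needed; the last is chosen off four
    -- elements, which is where q ≥ 5 enters.
    pick : ∀ xs → length xs ≤ 4 → ∃ λ x → x ∉ xs
    pick xs len = avoid xs (ℕₚ.≤-<-trans len 4<size)
    px = pick (y₀ ∷ y₁ ∷ []) (s≤s (s≤s z≤n))
    x = proj₁ px
    py = pick (y₀ ∷ y₁ ∷ x ∷ []) (s≤s (s≤s (s≤s z≤n)))
    y = proj₁ py
    pz = pick (y₀ ∷ y₁ ∷ x ∷ y ∷ []) (s≤s (s≤s (s≤s (s≤s z≤n))))
    z = proj₁ pz
    vanish : ∀ t → t ≢ y₀ → t ≢ y₁ → U * a * (t * t) + (A * a + U * p) * t + (A * p + - κ) ≡ 0#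
    vanish t t≢y₀ t≢y₁ = begin
      U * a * (t * t) + (A * a + U * p) * t + (A * p + - κ)
        ≡⟨ solve 6 (λ A U κ p a t → U :* a :* (t :* t) :+ (A :* a :+ U :* p) :* t :+ (A :* p :+ :- κ)
             := (A :+ t :* U) :* (p :+ t :* a) :+ :- κ) refl A U κ p a t ⟩
      (A + t * U) * (p + t * a) + - κ
        ≡⟨ cong (λ s → s * (p + t * a) + - κ) (eq t t≢y₀ nz) ⟩
      κ * inv (p + t * a) * (p + t * a) + - κ
        ≡⟨ cong (_+ - κ) (trans (solve 3 (λ k i q → k :* i :* q := k :* (q :* i)) refl κ (inv (p + t * a)) (p + t * a))
             (trans (cong (κ *_) (inv-inverseʳ nz)) (*-identityʳ κ))) ⟩
      κ + - κ
        ≡⟨ -‿inverseʳ κ ⟩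
      0# ∎
      where
      nz : p + t * a ≢ 0#
      nz e = t≢y₁ (root a≢0 e)
    all : ∀ t → t ≡ x ⊎ t ≡ y ⊎ t ≡ z → U * a * (t * t) + (A * a + U * p) * t + (A * p + - κ) ≡ 0#
    all t (inj₁ refl)        = vanish x (λ e → proj₂ px (here e)) (λ e → proj₂ px (there (here e)))
    all t (inj₂ (inj₁ refl)) = vanish y (λ e → proj₂ py (here e)) (λ e → proj₂ py (there (here e)))
    all t (inj₂ (inj₂ refl)) = vanish z (λ e → proj₂ pz (here e)) (λ e → proj₂ pz (there (here e)))
    roots = quadratic-roots (λ e → proj₂ py (there (there (here (sym e)))))
      (λ e → proj₂ pz (there (there (here (sym e))))) (λ e → proj₂ pz (there (there (there (here (sym e)))))) all
    U≡0 : U ≡ 0#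
    U≡0 = *-cancelˡ a≢0 (trans (*-comm a U) (trans (proj₁ roots) (sym (zeroʳ a))))
    A≡0 : A ≡ 0#
    A≡0 = *-cancelˡ a≢0 (trans (*-comm a A) (trans (trans (sym (trans (cong (A * a +_)
      (trans (cong (_* p) U≡0) (zeroˡ p))) (+-identityʳ _))) (proj₁ (proj₂ roots))) (sym (zeroʳ a))))
    κ≡0 : κ ≡ 0#
    κ≡0 = trans (solve 2 (λ k s → k := s :+ :- (s :+ :- k)) refl κ (A * p)) (trans (cong (λ s → A * p + - s) (proj₂ (proj₂ roots)))
      (trans (cong (λ s → s * p + - 0#) A≡0) (trans (cong (_+ - 0#) (zeroˡ p)) (-‿inverseʳ 0#))))

  -- The effect of moving one coordinate of χ: within the leading block of size i + 1 only the
  -- corner changes, by Δ. Elimination preserves this situation, so earlier pivots and the entries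
  -- up to i stay fixed while pivot i grows by exactly Δ.
  record Agree (i : ℕ) (Δ : Carrier) (M M′ : Matrix) : Set where
    field
      below : ∀ j l → j ≤ i → l ≤ i → j < i ⊎ l < i → M′ j l ≡ M j l
      corner : M′ i i ≡ M i i + Δ

  schur-agree : ∀ {i Δ M M′} → Agree (suc i) Δ M M′ → Agree i Δ (schur M) (schur M′)
  schur-agree {i} {Δ} {M} {M′} ag = record { below = below′ ; corner = top′ }
    where
    open Agree ag
    m : ∀ j → j ≤ suc i → M′ 0 j ≡ M 0 j
    m j j≤ = below 0 j z≤n j≤ (inj₁ (s≤s z≤n))
    below′ : ∀ j l → j ≤ i → l ≤ i → j < i ⊎ l < i → schur M′ j l ≡ schur M j l
    below′ j l j≤ l≤ lt = cong₂ (λ s t → s + - t) (below (suc j) (suc l) (s≤s j≤) (s≤s l≤) (Data.Sum.map s≤s s≤s lt))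
      (cong₂ _*_ (cong₂ _*_ (m (suc j) (s≤s j≤)) (m (suc l) (s≤s l≤))) (cong inv (m 0 z≤n)))
      where import Data.Sum
    top′ : schur M′ i i ≡ schur M i i + Δ
    top′ = trans (cong₂ (λ s t → s + - t) corner
      (cong₂ _*_ (cong₂ _*_ (m (suc i) ℕₚ.≤-refl) (m (suc i) ℕₚ.≤-refl)) (cong inv (m 0 z≤n))))
      (solve 3 (λ a d b → a :+ d :+ :- b := a :+ :- b :+ d) refl _ Δ _)

  schurᵥ-agree : ∀ {i Δ M M′} {h h′ : Vector} → Agree (suc i) Δ M M′ → (∀ j → j ≤ suc i → h′ j ≡ h j) →
                 ∀ j → j ≤ i → schurᵥ M′ h′ j ≡ schurᵥ M h j
  schurᵥ-agree ag e j j≤ = cong₂ (λ s t → s + - t) (e (suc j) (s≤s j≤))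
    (cong₂ _*_ (cong₂ _*_ (below 0 (suc j) z≤n (s≤s j≤) (inj₁ (s≤s z≤n))) (e 0 z≤n)) (cong inv (below 0 0 z≤n z≤n (inj₁ (s≤s z≤n)))))
    where open Agree ag

  pivot-agree : ∀ {i Δ M M′} → Agree i Δ M M′ → ∀ s → s < i → pivot s M′ ≡ pivot s M
  pivot-agree {suc i} ag zero    _         = Agree.below ag 0 0 z≤n z≤n (inj₁ (s≤s z≤n))
  pivot-agree {suc i} ag (suc s) (s≤s s<i) = pivot-agree (schur-agree ag) s s<i

  pivot-top : ∀ i {Δ M M′} → Agree i Δ M M′ → pivot i M′ ≡ pivot i M + Δ
  pivot-top zero    ag = Agree.corner ag
  pivot-top (suc i) ag = pivot-top i (schur-agree ag)

  entry-agree : ∀ {i Δ M M′} {h h′ : Vector} → Agree i Δ M M′ → (∀ j → j ≤ i → h′ j ≡ h j) →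
                ∀ s → s ≤ i → entry s M′ h′ ≡ entry s M h
  entry-agree ag e zero _ = e 0 z≤n
  entry-agree {suc i} {M = M} {M′} {h} {h′} ag e (suc s) (s≤s s≤i) = entry-agree (schur-agree ag) (schurᵥ-agree {h = h} {h′} ag e) s s≤i

  correction-agree : ∀ {i Δ M M′} {h h′ k k′ : Vector} → Agree i Δ M M′ →
    (∀ j → j ≤ i → h′ j ≡ h j) → (∀ j → j ≤ i → k′ j ≡ k j) →
    ∀ s → s ≤ i → correction s M′ h′ k′ ≡ correction s M h k
  correction-agree ag e e′ zero    _   = refl
  correction-agree {h = h} {h′} {k} {k′} ag e e′ (suc s) s<i = cong₂ _+_ (correction-agree {h = h} {h′} {k} {k′} ag e e′ s (ℕₚ.<⇒≤ s<i))
    (cong₂ _*_ (cong₂ _*_ (entry-agree {h = h} {h′} ag e s (ℕₚ.<⇒≤ s<i)) (entry-agree {h = k} {k′} ag e′ s (ℕₚ.<⇒≤ s<i)))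
      (cong inv (pivot-agree ag s s<i)))

-- Peeling correction terms off identities that are rational in χ.

module Peeling (𝔽 : FiniteField) (odd : FiniteField.size 𝔽 ℕ.% 2 ≡ 1) (4<size : 4 < FiniteField.size 𝔽) where
  open FieldTheory 𝔽
  open FieldCounting 𝔽 odd
  open Elimination 𝔽 odd 4<size
  open F-solver
  open ≡-Reasoning

  infixl 6 _-ₚ_
  _-ₚ_ : Poly → Poly → Poly
  p -ₚ r = p +ₚ (-ₚ r)

  ev-- : ∀ χ p r → ev χ (p -ₚ r) ≡ ev χ p + - ev χ r
  ev-- χ p r = trans (ev-+ χ p (-ₚ r)) (cong (ev χ p +_) (ev-neg χ r))

  x-y≡0⇒x≡y : ∀ {x y} → x + - y ≡ 0# → x ≡ y
  x-y≡0⇒x≡y {x} {y} e = trans (solve 2 (λ x y → x := (x :+ :- y) :+ y) refl x y) (trans (cong (_+ y) e) (+-identityˡ y))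

  x≡y⇒x-y≡0 : ∀ {x y} → x ≡ y → x + - y ≡ 0#
  x≡y⇒x-y≡0 refl = -‿inverseʳ _

  x+y≡0⇒x≡-y : ∀ {x y} → x + y ≡ 0# → x ≡ - y
  x+y≡0⇒x≡-y {x} {y} e = trans (solve 2 (λ x y → x := (x :+ y) :+ :- y) refl x y) (trans (cong (_+ - y) e) (+-identityˡ _))

  coeff-- : ∀ p r i → coeff (p -ₚ r) i ≡ coeff p i + - coeff r i
  coeff-- p r i = trans (coeff-+ p (-ₚ r) i) (cong (coeff p i +_) (coeff-neg r i))

  p-r≈0⇒p≈r : ∀ p r → p -ₚ r ≈ₚ 0ₚ → p ≈ₚ r
  p-r≈0⇒p≈r p r e i = x-y≡0⇒x≡y (trans (sym (coeff-- p r i)) (e i))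

  p+r≈0⇒p≈-r : ∀ p r → p +ₚ r ≈ₚ 0ₚ → p ≈ₚ -ₚ r
  p+r≈0⇒p≈-r p r e i = trans (x+y≡0⇒x≡-y (trans (sym (coeff-+ p r i)) (e i))) (sym (coeff-neg r i))

  ev≡0⇒≈0 : ∀ p → (∀ χ → ev χ p ≡ 0#) → p ≈ₚ 0ₚ
  ev≡0⇒≈0 p e i = trans (sym (ev-basis i p)) (e (basis i))

  ≈0? : ∀ p → p ≈ₚ 0ₚ ⊎ ¬ (p ≈ₚ 0ₚ)
  ≈0? p with zero-or-coeff p
  ... | inj₁ e        = inj₁ e
  ... | inj₂ (i , ne) = inj₂ (λ e → ne (e i))

  2<size : 2 < size
  2<size = ℕₚ.≤-trans (s≤s (s≤s (s≤s z≤n))) 4<size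

  3<size : 3 < size
  3<size = ℕₚ.≤-trans (s≤s (s≤s (s≤s (s≤s z≤n)))) 4<size

  -- The hypothesis reads χ(p - r) χ(p + r) = 0 for all χ. Were both polynomials nonzero, a single χ
  -- would avoid both kernels.
  ev²-determines : ∀ p r → (∀ χ → ev χ p * ev χ p ≡ ev χ r * ev χ r) → p ≈ₚ r ⊎ p ≈ₚ -ₚ r
  ev²-determines p r e with ≈0? (p -ₚ r) | ≈0? (p +ₚ r)
  ... | inj₁ z | _      = inj₁ (p-r≈0⇒p≈r p r z)
  ... | inj₂ _ | inj₁ z = inj₂ (p+r≈0⇒p≈-r p r z)
  ... | inj₂ n | inj₂ n′ with separate (p -ₚ r ∷ p +ₚ r ∷ []) 2<size (n ∷ n′ ∷ [])
  ...   | χ , (x ∷ y ∷ []) = ⊥-elim (*-≢0 x y (trans (cong₂ _*_ (ev-- χ p r) (ev-+ χ p r)) (trans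
            (solve 2 (λ x y → (x :+ :- y) :* (x :+ y) := x :* x :+ :- (y :* y)) refl (ev χ p) (ev χ r))
            (trans (cong (_+ - (ev χ r * ev χ r)) (e χ)) (-‿inverseʳ _)))))

  -- The eliminated entry is h k minus the pairing of column k of M with h. Two rows that agree
  -- before position k thus have entries differing only by their k-th coordinates.
  entry-correction : ∀ k M h → entry k M h ≡ h k + - correction k M (λ j → M j k) h
  entry-correction zero    M h = sym (trans (cong (h 0 +_) -0≡0) (+-identityʳ _))
  entry-correction (suc k) M h = trans (entry-correction k (schur M) (schurᵥ M h)) (trans
    (solve 3 (λ x y z → x :+ :- y :+ :- z := x :+ :- (y :+ z)) refl (h (suc k)) _ _)
    (cong (λ t → h (suc k) + - t) (sym (correction-front k M (λ j → M j (suc k)) h))))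

  entry-local : ∀ s M {h h′ : Vector} → (∀ j → j ≤ s → h′ j ≡ h j) → entry s M h′ ≡ entry s M h
  entry-local zero    M e = e 0 z≤n
  entry-local (suc s) M e = entry-local s (schur M) (λ j j≤ → cong₂ (λ x y → x + - (M 0 (suc j) * y * inv (M 0 0)))
    (e (suc j) (s≤s j≤)) (e 0 z≤n))

  correction-local : ∀ n M k {h h′ : Vector} → (∀ j → j < n → h′ j ≡ h j) → correction n M k h′ ≡ correction n M k h
  correction-local zero    M k e = refl
  correction-local (suc n) M k {h} {h′} e = cong₂ (λ x y → x + entry n M k * y * inv (pivot n M))
    (correction-local n M k (λ j j<n → e j (ℕₚ.m<n⇒m<1+n j<n))) (entry-local n M {h} {h′} (λ j j≤n → e j (s≤s j≤n)))

  evᵛ : Functional → (ℕ → Poly) → Vector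
  evᵛ χ h j = ev χ (h j)

  -- The hypotheses express triangularity: among the Gram entries of the first i + 1 vectors, the
  -- power t^(w i) occurs in the corner (i , i) and nowhere else. Moving χ in this coordinate
  -- therefore moves pivot i and none before it.
  module Peel (n : ℕ) (w : ℕ → ℕ) (G : ℕ → ℕ → Poly)
    (off : ∀ i → i < n → ∀ j l → j ≤ i → l ≤ i → j < i ⊎ l < i → coeff (G j l) (w i) ≡ 0#)
    (diag : ∀ i → i < n → coeff (G i i) (w i) ≢ 0#) where

    Mat : Functional → Matrix
    Mat χ j l = ev χ (G j l)

    NonSingular : ℕ → Functional → Set
    NonSingular i χ = ∀ s → s < i → pivot s (Mat χ) ≢ 0#

    -- The condition under which the entries of a row up to i do not notice the move of coordinate w
    -- i.
    Graded : (ℕ → Poly) → Set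
    Graded h = ∀ i → i < n → ∀ j → j ≤ i → coeff (h j) (w i) ≡ 0#

    private
      unmoved : ∀ χ i y p → coeff p (w i) ≡ 0# → ev (χ +[ w i ] y) p ≡ ev χ p
      unmoved χ i y p e = trans (ev-shift χ (w i) y p) (trans (cong (λ z → ev χ p + y * z) e)
        (trans (cong (ev χ p +_) (zeroʳ y)) (+-identityʳ _)))

      agree : ∀ {i} χ y → i < n → Agree i (y * coeff (G i i) (w i)) (Mat χ) (Mat (χ +[ w i ] y))
      agree {i} χ y i<n = record
        { below  = λ j l j≤ l≤ lt → unmoved χ i y (G j l) (off i i<n j l j≤ l≤ lt)
        ; corner = ev-shift χ (w i) y (G i i) }

    graded-agree : ∀ {h i} χ y → i < n → Graded h → ∀ j → j ≤ i → evᵛ (χ +[ w i ] y) h j ≡ evᵛ χ h j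
    graded-agree {h} {i} χ y i<n gr j j≤ = unmoved χ i y (h j) (gr i i<n j j≤)

    correction-inv : ∀ {b h} → Graded b → Graded h → ∀ i χ y → i < n →
      correction i (Mat (χ +[ w i ] y)) (evᵛ (χ +[ w i ] y) b) (evᵛ (χ +[ w i ] y) h) ≡
      correction i (Mat χ) (evᵛ χ b) (evᵛ χ h)
    correction-inv {b} {h} grb grh i χ y i<n =
      correction-agree {h = evᵛ χ b} {evᵛ (χ +[ w i ] y) b} {evᵛ χ h} {evᵛ (χ +[ w i ] y) h}
        (agree χ y i<n) (graded-agree {b} χ y i<n grb) (graded-agree {h} χ y i<n grh) i ℕₚ.≤-refl

    entry-inv : ∀ {h} → Graded h → ∀ i χ y → i < n →
      entry i (Mat (χ +[ w i ] y)) (evᵛ (χ +[ w i ] y) h) ≡ entry i (Mat χ) (evᵛ χ h)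
    entry-inv {h} gr i χ y i<n = entry-agree {h = evᵛ χ h} {evᵛ (χ +[ w i ] y) h}
      (agree χ y i<n) (graded-agree {h} χ y i<n gr) i ℕₚ.≤-refl

    -- Here `Φ i` collects the correction terms whose outer pivots lie below i. If χ(u) equals
    -- `Φ (suc i)`, moving coordinate w i changes the left side linearly and the right side only
    -- through pivot i; `peel-line` then yields `κ i` = 0 and the identity with `Φ i`. The condition
    -- `C` may exclude one point on each line, which is what `y₀` is for.
    module Descent (C : Functional → Set)
      (line : ∀ χ v → C χ → ∃ λ y₀ → ∀ y → y ≢ y₀ → C (χ +[ v ] y))
      (u : Poly) (Φ κ : ℕ → Functional → Carrier)
      (Φ-zero : ∀ χ → Φ 0 χ ≡ 0#)
      (Φ-suc : ∀ i χ → Φ (suc i) χ ≡ Φ i χ + κ i χ * inv (pivot i (Mat χ)))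
      (Φ-inv : ∀ i χ y → i < n → Φ i (χ +[ w i ] y) ≡ Φ i χ)
      (κ-inv : ∀ i χ y → i < n → κ i (χ +[ w i ] y) ≡ κ i χ)
      (start : ∀ χ → C χ → NonSingular n χ → ev χ u ≡ Φ n χ) where

      Holds : ℕ → Set
      Holds i = ∀ χ → C χ → NonSingular i χ → ev χ u ≡ Φ i χ

      step : ∀ i → i < n → Holds (suc i) → ∀ χ → C χ → NonSingular i χ → ev χ u + - Φ i χ ≡ 0# × κ i χ ≡ 0#
      step i i<n holds χ c ns = peel-line (proj₁ (line χ (w i) c)) (diag i i<n) eq
        where
        a = coeff (G i i) (w i)
        p = pivot i (Mat χ)
        eq : ∀ y → y ≢ proj₁ (line χ (w i) c) → p + y * a ≢ 0# →
             ev χ u + - Φ i χ + y * coeff u (w i) ≡ κ i χ * inv (p + y * a)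
        eq y y≢ nz = begin
          ev χ u + - Φ i χ + y * coeff u (w i)
            ≡⟨ solve 3 (λ a b c → a :+ :- b :+ c := (a :+ c) :+ :- b) refl (ev χ u) (Φ i χ) _ ⟩
          (ev χ u + y * coeff u (w i)) + - Φ i χ
            ≡⟨ cong (_+ - Φ i χ) (trans (sym (ev-shift χ (w i) y u)) (holds μ (proj₂ (line χ (w i) c) y y≢) ns′)) ⟩
          Φ (suc i) μ + - Φ i χ
            ≡⟨ cong (_+ - Φ i χ) (trans (Φ-suc i μ) (cong₂ _+_ (Φ-inv i χ y i<n)
                 (cong₂ _*_ (κ-inv i χ y i<n) (cong inv piv)))) ⟩
          (Φ i χ + κ i χ * inv (p + y * a)) + - Φ i χ
            ≡⟨ solve 2 (λ a b → (a :+ b) :+ :- a := b) refl (Φ i χ) _ ⟩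
          κ i χ * inv (p + y * a) ∎
          where
          μ = χ +[ w i ] y
          ag = agree χ y i<n
          piv : pivot i (Mat μ) ≡ p + y * a
          piv = pivot-top i ag
          ns′ : NonSingular (suc i) μ
          ns′ s (s≤s s≤i) e with ℕₚ.m≤n⇒m<n∨m≡n s≤i
          ... | inj₁ s<i  = ns s s<i (trans (sym (pivot-agree ag s s<i)) e)
          ... | inj₂ refl = nz (trans (sym piv) e)

      all : ∀ k i → k ℕ.+ i ≡ n → Holds i
      all zero    i refl = start
      all (suc k) i e χ c ns = x-y≡0⇒x≡y (proj₁ (step i (ℕₚ.m+n≤o⇒n≤o k (ℕₚ.≤-reflexive (trans (ℕₚ.+-suc k i) e)))
        (all k (suc i) (trans (ℕₚ.+-suc k i) e)) χ c ns))

      ev≡0 : ∀ χ → C χ → ev χ u ≡ 0#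
      ev≡0 χ c = trans (all n 0 (ℕₚ.+-identityʳ n) χ c (λ s ())) (Φ-zero χ)

      κ≡0 : ∀ i → i < n → ∀ χ → C χ → NonSingular i χ → κ i χ ≡ 0#
      κ≡0 i i<n χ c ns = proj₂ (step i i<n (all (n ℕ.∸ suc i) (suc i) (ℕₚ.m∸n+n≡m i<n)) χ c ns)

    -- The difference of the two corrections has the numerators entry² - entry′². Descent thus gives
    -- more than g ≈ g′: every eliminated entry is determined up to sign.
    module Squares {h h′ : ℕ → Poly} {g g′ : Poly} (gr : Graded h) (gr′ : Graded h′)
      (same : ∀ χ → NonSingular n χ →
        ev χ g + - correction n (Mat χ) (evᵛ χ h) (evᵛ χ h) ≡
        ev χ g′ + - correction n (Mat χ) (evᵛ χ h′) (evᵛ χ h′)) where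

      private
        Φ κ : ℕ → Functional → Carrier
        Φ i χ = correction i (Mat χ) (evᵛ χ h) (evᵛ χ h) + - correction i (Mat χ) (evᵛ χ h′) (evᵛ χ h′)
        κ i χ = entry i (Mat χ) (evᵛ χ h) * entry i (Mat χ) (evᵛ χ h)
               + - (entry i (Mat χ) (evᵛ χ h′) * entry i (Mat χ) (evᵛ χ h′))
        module D = Descent (λ _ → ⊤) (λ _ _ _ → 0# , λ _ _ → tt) (g -ₚ g′) Φ κ
          (λ _ → -‿inverseʳ 0#)
          (λ i χ → solve 5 (λ t t′ e e′ p → (t :+ e :* p) :+ :- (t′ :+ e′ :* p) := (t :+ :- t′) :+ (e :+ :- e′) :* p)
            refl (correction i (Mat χ) (evᵛ χ h) (evᵛ χ h)) (correction i (Mat χ) (evᵛ χ h′) (evᵛ χ h′))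
            (entry i (Mat χ) (evᵛ χ h) * entry i (Mat χ) (evᵛ χ h)) (entry i (Mat χ) (evᵛ χ h′) * entry i (Mat χ) (evᵛ χ h′))
            (inv (pivot i (Mat χ))))
          (λ i χ y i<n → cong₂ (λ s t → s + - t) (correction-inv {h} {h} gr gr i χ y i<n) (correction-inv {h′} {h′} gr′ gr′ i χ y i<n))
          (λ i χ y i<n → cong₂ (λ s t → s * s + - (t * t)) (entry-inv {h} gr i χ y i<n) (entry-inv {h′} gr′ i χ y i<n))
          (λ χ _ ns → trans (ev-- χ g g′) (begin
            ev χ g + - ev χ g′
              ≡⟨ solve 4 (λ g g′ t t′ → g :+ :- g′ := (g :+ :- t) :+ :- (g′ :+ :- t′) :+ (t :+ :- t′)) refl (ev χ g) (ev χ g′)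
                   (correction n (Mat χ) (evᵛ χ h) (evᵛ χ h)) (correction n (Mat χ) (evᵛ χ h′) (evᵛ χ h′)) ⟩
            (ev χ g + - correction n (Mat χ) (evᵛ χ h) (evᵛ χ h)) +
              - (ev χ g′ + - correction n (Mat χ) (evᵛ χ h′) (evᵛ χ h′)) + Φ n χ
              ≡⟨ cong (_+ Φ n χ) (x≡y⇒x-y≡0 (same χ ns)) ⟩
            0# + Φ n χ
              ≡⟨ +-identityˡ _ ⟩
            Φ n χ ∎))

      g≈g′ : g ≈ₚ g′
      g≈g′ = p-r≈0⇒p≈r g g′ (ev≡0⇒≈0 (g -ₚ g′) (λ χ → D.ev≡0 χ tt))

      entries² : ∀ i → i < n → ∀ χ → NonSingular i χ →
        entry i (Mat χ) (evᵛ χ h) * entry i (Mat χ) (evᵛ χ h) ≡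
        entry i (Mat χ) (evᵛ χ h′) * entry i (Mat χ) (evᵛ χ h′)
      entries² i i<n χ ns = x-y≡0⇒x≡y (D.κ≡0 i i<n χ tt ns)

    -- Descent under the proviso χ(φ) ≠ 0, which fails at most once on each line on which it holds
    -- somewhere. The numerators are now twice the products of the entries of b and h.
    module Products {b h : ℕ → Poly} (φ u : Poly) (grb : Graded b) (grh : Graded h)
      (same : ∀ χ → ev χ φ ≢ 0# → NonSingular n χ →
        ev χ u ≡ correction n (Mat χ) (evᵛ χ b) (evᵛ χ h) + correction n (Mat χ) (evᵛ χ b) (evᵛ χ h)) where

      private
        Φ κ : ℕ → Functional → Carrier
        Φ i χ = correction i (Mat χ) (evᵛ χ b) (evᵛ χ h) + correction i (Mat χ) (evᵛ χ b) (evᵛ χ h)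
        κ i χ = entry i (Mat χ) (evᵛ χ b) * entry i (Mat χ) (evᵛ χ h)
               + entry i (Mat χ) (evᵛ χ b) * entry i (Mat χ) (evᵛ χ h)
        line : ∀ χ v → ev χ φ ≢ 0# → ∃ λ y₀ → ∀ y → y ≢ y₀ → ev (χ +[ v ] y) φ ≢ 0#
        line χ v nz with coeff φ v ≟ 0#
        ... | no c≢0  = - ev χ φ * inv (coeff φ v) , λ y y≢ e → y≢ (root c≢0 (trans (sym (ev-shift χ v y φ)) e))
        ... | yes c≡0 = 0# , λ y _ e → nz (trans (sym (trans (ev-shift χ v y φ) (trans (cong (λ z → ev χ φ + y * z) c≡0)
                          (trans (cong (ev χ φ +_) (zeroʳ y)) (+-identityʳ _))))) e)
        module D = Descent (λ χ → ev χ φ ≢ 0#) line u Φ κ (λ _ → +-identityʳ 0#)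
          (λ i χ → solve 3 (λ t e p → (t :+ e :* p) :+ (t :+ e :* p) := (t :+ t) :+ (e :+ e) :* p) refl
            (correction i (Mat χ) (evᵛ χ b) (evᵛ χ h)) (entry i (Mat χ) (evᵛ χ b) * entry i (Mat χ) (evᵛ χ h))
            (inv (pivot i (Mat χ))))
          (λ i χ y i<n → cong (λ s → s + s) (correction-inv {b} {h} grb grh i χ y i<n))
          (λ i χ y i<n → cong₂ (λ s t → s * t + s * t) (entry-inv {b} grb i χ y i<n) (entry-inv {h} grh i χ y i<n))
          same

      u≡0 : ∀ χ → ev χ φ ≢ 0# → ev χ u ≡ 0#
      u≡0 = D.ev≡0

      product≡0 : 0 < n → ∀ χ → ev χ φ ≢ 0# → ev χ (b 0) * ev χ (h 0) ≡ 0#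
      product≡0 0<n χ nz = x+x≡0⇒x≡0 (D.κ≡0 0 0<n χ nz (λ s ()))

  -- If two rows h , h′ agree before position k and have entries of equal square there, then h k = ± h′ k,
  -- and the sign - can only occur when the products b s * h s making up the correction vanish.
  module SignRigidity (k : ℕ) (0<k : 0 < k) (w : ℕ → ℕ) (G : ℕ → ℕ → Poly)
    (off : ∀ i → i < k → ∀ j l → j ≤ i → l ≤ i → j < i ⊎ l < i → coeff (G j l) (w i) ≡ 0#)
    (diag : ∀ i → i < k → coeff (G i i) (w i) ≢ 0#) where
    open Peel k w G off diag

    rigid : ∀ {h h′ : ℕ → Poly} → Graded h → Graded (λ j → G j k) →
      (∀ j → j < k → h′ j ≈ₚ h j) →
      (∀ χ → NonSingular k χ → entry k (Mat χ) (evᵛ χ h) * entry k (Mat χ) (evᵛ χ h)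
                               ≡ entry k (Mat χ) (evᵛ χ h′) * entry k (Mat χ) (evᵛ χ h′)) →
      h k ≈ₚ h′ k ⊎ (h k ≈ₚ -ₚ h′ k × (G 0 k ≈ₚ 0ₚ ⊎ h 0 ≈ₚ 0ₚ))
    rigid {h} {h′} grh grb h≈ squares with ≈0? (h k -ₚ h′ k)
    ... | inj₁ φ≈0 = inj₁ (p-r≈0⇒p≈r (h k) (h′ k) φ≈0)
    ... | inj₂ φ≉0 = inj₂ (p+r≈0⇒p≈-r (h k) (h′ k) u≈0 , product)
      where
      φ u : Poly
      φ = h k -ₚ h′ k
      u = h k +ₚ h′ k
      -- Both entries have the form x - t and x′ - t with a common correction t. Equality of their
      -- squares reads (x - x′)(x + x′ - 2t) = 0, and φ keeps the first factor away from 0.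
      same : ∀ χ → ev χ φ ≢ 0# → NonSingular k χ →
        ev χ u ≡ correction k (Mat χ) (evᵛ χ (λ j → G j k)) (evᵛ χ h) + correction k (Mat χ) (evᵛ χ (λ j → G j k)) (evᵛ χ h)
      same χ nz ns = trans (ev-+ χ (h k) (h′ k)) (x-y≡0⇒x≡y (*-cancelˡ nz (trans (cong₂ _*_ (ev-- χ (h k) (h′ k)) refl) (begin
        (x + - x′) * (x + x′ + - (t + t))
          ≡⟨ solve 3 (λ x x′ t → (x :+ :- x′) :* (x :+ x′ :+ :- (t :+ t))
               := (x :+ :- t) :* (x :+ :- t) :+ :- ((x′ :+ :- t) :* (x′ :+ :- t))) refl x x′ t ⟩
        (x + - t) * (x + - t) + - ((x′ + - t) * (x′ + - t))
          ≡⟨ cong₂ (λ a b → a * a + - (b * b)) (sym (entry-correction k (Mat χ) (evᵛ χ h)))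
               (trans (cong (λ z → x′ + - z) (sym (correction-local k (Mat χ) _ {evᵛ χ h} {evᵛ χ h′}
                 (λ j j<k → ev-cong χ (h′ j) (h j) (h≈ j j<k))))) (sym (entry-correction k (Mat χ) (evᵛ χ h′)))) ⟩
        entry k (Mat χ) (evᵛ χ h) * entry k (Mat χ) (evᵛ χ h) + - (entry k (Mat χ) (evᵛ χ h′) * entry k (Mat χ) (evᵛ χ h′))
          ≡⟨ x≡y⇒x-y≡0 (squares χ ns) ⟩
        0#
          ≡⟨ sym (zeroʳ _) ⟩
        ev χ φ * 0# ∎))))
        where
        x = ev χ (h k)
        x′ = ev χ (h′ k)
        t = correction k (Mat χ) (evᵛ χ (λ j → G j k)) (evᵛ χ h)
      module Q = Products {λ j → G j k} {h} φ u grb grh same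
      u≈0 : u ≈ₚ 0ₚ
      u≈0 with ≈0? u
      ... | inj₁ e = e
      ... | inj₂ n with separate (φ ∷ u ∷ []) 2<size (φ≉0 ∷ n ∷ [])
      ...   | χ , (x ∷ y ∷ []) = ⊥-elim (y (Q.u≡0 χ x))
      product : G 0 k ≈ₚ 0ₚ ⊎ h 0 ≈ₚ 0ₚ
      product with ≈0? (G 0 k) | ≈0? (h 0)
      ... | inj₁ e | _      = inj₁ e
      ... | inj₂ _ | inj₁ e = inj₂ e
      ... | inj₂ n | inj₂ n′ with separate (φ ∷ G 0 k ∷ h 0 ∷ []) 3<size (φ≉0 ∷ n ∷ n′ ∷ [])
      ...   | χ , (x ∷ y ∷ z ∷ []) = ⊥-elim (*-≢0 y z (Q.product≡0 0<k χ x))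

-- Representation numbers of polynomial forms.

module Forms (𝔽 : FiniteField) where
  open FieldTheory 𝔽

  Triple : Set
  Triple = Vec₃ Poly

  Gram : Set
  Gram = Mat₃ Poly

  B : Gram → Triple → Triple → Poly
  B G u v = Σ₃ _+ₚ_ (λ i → Σ₃ _+ₚ_ (λ j → G i j *ₚ (u i *ₚ v j)))

  Represents : (Triple → Poly) → Poly → ℕ → Set
  Represents q κ n = Σ (List Triple) λ xs → (length xs ≡ n) ×
    AllPairs (λ u v → ¬ (u ≈ᵥ v)) xs ×
    (∀ v → (q v ≈ₚ κ → Any (v ≈ᵥ_) xs) × (Any (v ≈ᵥ_) xs → q v ≈ₚ κ))

  RespectsRep : (q q′ : Triple → Poly) → Set
  RespectsRep q q′ = ∀ κ n → Represents q κ n → Represents q′ κ n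

  ≈ᵥ-sym : ∀ {u v : Triple} → u ≈ᵥ v → v ≈ᵥ u
  ≈ᵥ-sym e i n = sym (e i n)

  ≈ᵥ-trans : ∀ {u v w : Triple} → u ≈ᵥ v → v ≈ᵥ w → u ≈ᵥ w
  ≈ᵥ-trans e f i n = trans (e i n) (f i n)

  private
    remove : ∀ {P : Triple → Set} {ys} → Any P ys → List Triple
    remove {ys = y ∷ ys} (here _)  = ys
    remove {ys = y ∷ ys} (there p) = y ∷ remove p

    length-remove : ∀ {P : Triple → Set} {ys} (p : Any P ys) → length ys ≡ suc (length (remove p))
    length-remove (here _)  = refl
    length-remove (there p) = cong suc (length-remove p)

    in-remove : ∀ (x z : Triple) {ys} (p : Any (x ≈ᵥ_) ys) → ¬ (x ≈ᵥ z) → Any (z ≈ᵥ_) ys → Any (z ≈ᵥ_) (remove p)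
    in-remove x z {y ∷ _} (here e) ne (here e′) = ⊥-elim (ne (≈ᵥ-trans {x} {y} {z} e (≈ᵥ-sym {z} {y} e′)))
    in-remove x z (here e)  ne (there q)  = q
    in-remove x z (there p) ne (here e′)  = here e′
    in-remove x z (there p) ne (there q)  = there (in-remove x z p ne q)

    distinct⊆⇒length≤ : ∀ xs ys → AllPairs (λ u v → ¬ (u ≈ᵥ v)) xs → (∀ v → v ∈ xs → Any (v ≈ᵥ_) ys) → length xs ≤ length ys
    distinct⊆⇒length≤ []       ys _          sub = z≤n
    distinct⊆⇒length≤ (x ∷ xs) ys (px ∷ dis) sub = subst (suc (length xs) ≤_) (sym (length-remove p))
      (s≤s (distinct⊆⇒length≤ xs (remove p) dis (λ v v∈ → in-remove x v p (All.lookup px v∈) (sub v (there v∈)))))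
      where p = sub x (here refl)

  represents-≤ : ∀ {q κ n n′} → Represents q κ n → Represents q κ n′ → n ≤ n′
  represents-≤ {q} {κ} (xs , refl , dis , mem) (ys , refl , _ , mem′) = distinct⊆⇒length≤ xs ys dis
    (λ v v∈ → proj₁ (mem′ v) (proj₂ (mem v) (Any.map (λ { refl i n → refl }) v∈)))

  -- A vector with value κ makes the representation number positive, so the list for the other form
  -- cannot be empty.
  transfer-value : ∀ {q q′ κ n} → RespectsRep q q′ → Represents q κ n → ∀ v → q v ≈ₚ κ → ∃ λ v′ → q′ v′ ≈ₚ κ
  transfer-value {q} {q′} {κ} {n} to rep v e with to κ n rep
  ... | (y ∷ ys) , _ , _ , mem′ = y , proj₂ (mem′ y) (here (λ _ _ → refl))
  ... | [] , len′ , _ , _ = ⊥-elim (nonempty (proj₁ (proj₂ (proj₂ (proj₂ rep)) v) e) (trans (proj₁ (proj₂ rep)) (sym len′)))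
    where
    nonempty : ∀ {xs} → Any (v ≈ᵥ_) xs → length xs ≢ 0
    nonempty (here _)  ()
    nonempty (there _) ()

  transport-rep : ∀ {q q′ : Triple → Poly} (φ ψ : Triple → Triple) →
    (∀ {u v} → u ≈ᵥ v → φ u ≈ᵥ φ v) → (∀ {u v} → u ≈ᵥ v → ψ u ≈ᵥ ψ v) →
    (∀ v → φ (ψ v) ≈ᵥ v) → (∀ v → ψ (φ v) ≈ᵥ v) → (∀ {u v} → u ≈ᵥ v → q′ u ≈ₚ q′ v) → (∀ v → q′ (φ v) ≈ₚ q v) →
    RespectsRep q q′
  transport-rep {q} {q′} φ ψ φ-cong ψ-cong φψ ψφ q′-cong q′φ κ n (xs , len , dis , mem) =
    map φ xs , trans (length-map φ xs) len
    , AllPairs.map⁺ (AllPairs.map (λ {u} {v} ne e → ne (≈ᵥ-trans {u} {ψ (φ u)} {v} (≈ᵥ-sym {ψ (φ u)} {u} (ψφ u))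
        (≈ᵥ-trans {ψ (φ u)} {ψ (φ v)} {v} (ψ-cong {φ u} {φ v} e) (ψφ v)))) dis)
    , λ v → (λ e → Any.map⁺ (Any.map (λ {y} e′ → ≈ᵥ-trans {v} {φ (ψ v)} {φ y} (≈ᵥ-sym {φ (ψ v)} {v} (φψ v)) (φ-cong {ψ v} {y} e′))
                (proj₁ (mem (ψ v)) (λ i → trans (sym (q′φ (ψ v) i)) (trans (q′-cong {φ (ψ v)} {v} (φψ v) i) (e i))))))
          , (λ a i → trans (q′-cong {v} {φ (ψ v)} (≈ᵥ-sym {φ (ψ v)} {v} (φψ v)) i) (trans (q′φ (ψ v) i) (proj₂ (mem (ψ v))
                (Any.map (λ {y} e′ → ≈ᵥ-trans {ψ v} {ψ (φ y)} {y} (ψ-cong {v} {φ y} e′) (ψφ y)) (Any.map⁻ a)) i)))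

  module BoxSums {C : Set} (codes : List C) (unique : Unique codes) (decode : C → Triple)
    (W : ℕ) (injective : ∀ {c c′} → decode c ≈ᵥ decode c′ → c ≡ c′)
    where

    -- The codes describe, up to `≈ᵥ`, precisely the vectors whose value has degree at most W. One
    -- finite list covering both forms is what makes counts over all of A³ comparable.
    Covers : (Triple → Poly) → Set
    Covers q = (∀ {u v} → u ≈ᵥ v → q u ≈ₚ q v)
             × (∀ v → (∀ n → W < n → coeff (q v) n ≡ 0#) → ∃ λ c → c ∈ codes × v ≈ᵥ decode c)
             × (∀ c → c ∈ codes → ∀ n → W < n → coeff (q (decode c)) n ≡ 0#)

    -- Coefficient lists denote polynomials only up to trailing zeros. Cutting after a fixed number
    -- of coefficients gives a canonical representative with decidable propositional equality, as
    -- the comparison of multisets requires.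
    key : ∀ N → Poly → Vec Carrier N
    key zero    p = []
    key (suc N) p = coeff p 0 ∷ key N (List.drop 1 p)

    Key : Set
    Key = Vec Carrier (suc W)

    coeff-drop : ∀ p n → coeff (List.drop 1 p) n ≡ coeff p (suc n)
    coeff-drop []      n = refl
    coeff-drop (_ ∷ p) n = refl

    coeff-key : ∀ N p n → n < N → coeff (Vec.toList (key N p)) n ≡ coeff p n
    coeff-key (suc N) p zero    _         = refl
    coeff-key (suc N) p (suc n) (s≤s n<N) = trans (coeff-key N (List.drop 1 p) n n<N) (coeff-drop p n)

    coeff-toList : ∀ {N} (κ : Vec Carrier N) n → N ≤ n → coeff (Vec.toList κ) n ≡ 0#
    coeff-toList []      n       _         = refl
    coeff-toList (x ∷ κ) (suc n) (s≤s N≤n) = coeff-toList κ n N≤n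

    key-cong : ∀ N {p r} → (∀ n → n < N → coeff p n ≡ coeff r n) → key N p ≡ key N r
    key-cong zero    e = refl
    key-cong (suc N) {p} {r} e = cong₂ _∷_ (e 0 (s≤s z≤n)) (key-cong N (λ n n<N →
      trans (coeff-drop p n) (trans (e (suc n) (s≤s n<N)) (sym (coeff-drop r n)))))

    key-toList : ∀ {N} (κ : Vec Carrier N) → key N (Vec.toList κ) ≡ κ
    key-toList []      = refl
    key-toList (x ∷ κ) = cong (x ∷_) (key-toList κ)

    key-faithful : ∀ p → (∀ n → W < n → coeff p n ≡ 0#) → ∀ (κ : Key) →
                   (key (suc W) p ≡ κ → p ≈ₚ Vec.toList κ)
    key-faithful p deg κ refl n with n ℕₚ.<? suc W
    ... | yes n< = sym (coeff-key (suc W) p n n<)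
    ... | no n≮  = trans (deg n (ℕₚ.≮⇒≥ n≮)) (sym (coeff-toList (key (suc W) p) n (ℕₚ.≮⇒≥ n≮)))

    _≟ᵏ_ : DecidableEquality Key
    _≟ᵏ_ = Vec.≡-dec _≟_

    module _ (q : Triple → Poly) (covers : Covers q) where
      private
        q-cong = proj₁ covers
        keyOf : C → Key
        keyOf c = key (suc W) (q (decode c))

      box-represents : ∀ κ → Represents q (Vec.toList κ) (length (filter (λ c → κ ≟ᵏ keyOf c) codes))
      box-represents κ = map decode hits , length-map decode hits
        , AllPairs.map⁺ (AllPairs.map (λ ne e → ne (injective e)) (Unique.filter⁺ (λ c → κ ≟ᵏ keyOf c) unique))
        , λ v → to v , from v
        where
        hits = filter (λ c → κ ≟ᵏ keyOf c) codes
        to : ∀ v → q v ≈ₚ Vec.toList κ → Any (v ≈ᵥ_) (map decode hits)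
        to v e with proj₁ (proj₂ covers) v (λ n W<n → trans (e n) (coeff-toList κ n W<n))
        ... | c , c∈ , v≈ = Any.map⁺ (lose (∈-filter⁺ (λ c → κ ≟ᵏ keyOf c) c∈
                (sym (trans (key-cong (suc W) {q (decode c)} {Vec.toList κ}
                  (λ n _ → trans (sym (q-cong v≈ n)) (e n))) (key-toList κ)))) v≈)
        from : ∀ v → Any (v ≈ᵥ_) (map decode hits) → q v ≈ₚ Vec.toList κ
        from v a with find (Any.map⁻ a)
        ... | c , c∈ , v≈ with ∈-filter⁻ (λ c → κ ≟ᵏ keyOf c) {xs = codes} c∈
        ...   | c∈codes , κ≡ = λ n → trans (q-cong v≈ n) (key-faithful (q (decode c)) (proj₂ (proj₂ covers) c c∈codes) κ (sym κ≡) n)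

      multiplicity-box : ∀ κ → multiplicity _≟ᵏ_ κ (map keyOf codes) ≡ length (filter (λ c → κ ≟ᵏ keyOf c) codes)
      multiplicity-box κ = go codes
        where
        go : ∀ cs → multiplicity _≟ᵏ_ κ (map keyOf cs) ≡ length (filter (λ c → κ ≟ᵏ keyOf c) cs)
        go []       = refl
        go (c ∷ cs) with κ ≟ᵏ keyOf c
        ... | yes _ = cong suc (go cs)
        ... | no _  = go cs

    -- In each list of values the multiplicity of κ is its representation number. The two numbers
    -- bound each other, so the lists are permutations of one another.
    box-sums : ∀ {q q′} → Covers q → Covers q′ → RespectsRep q q′ → RespectsRep q′ q → (w : Key → ℕ) →
      let module N = Summation ℕₚ.+-0-isCommutativeMonoid in
      N.∑ codes (λ c → w (key (suc W) (q (decode c)))) ≡ N.∑ codes (λ c → w (key (suc W) (q′ (decode c))))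
    box-sums {q} {q′} cov cov′ to from w = trans (sym (N.∑-map _ codes w)) (trans
      (N.∑-↭ w (multiplicities⇒↭ _≟ᵏ_ (map (λ c → key (suc W) (q (decode c))) codes) (map (λ c → key (suc W) (q′ (decode c))) codes) λ κ → trans (multiplicity-box q cov κ) (trans
        (ℕₚ.≤-antisym (represents-≤ {q′} {Vec.toList κ} (to (Vec.toList κ) _ (box-represents q cov κ)) (box-represents q′ cov′ κ))
                      (represents-≤ {q} {Vec.toList κ} (from (Vec.toList κ) _ (box-represents q′ cov′ κ)) (box-represents q cov κ)))
        (sym (multiplicity-box q′ cov′ κ)))))
      (N.∑-map _ codes w))
      where module N = Summation ℕₚ.+-0-isCommutativeMonoid

-- Arithmetic of the minima.

double-≤ : ∀ {a b} → a ℕ.+ a ≤ b ℕ.+ b → a ≤ b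
double-≤ {a} {b} le with a ℕₚ.≤? b
... | yes a≤b = a≤b
... | no a≰b  = ⊥-elim (ℕₚ.<⇒≱ (ℕₚ.+-mono-< (ℕₚ.≰⇒> a≰b) (ℕₚ.≰⇒> a≰b)) le)

double-< : ∀ {a b} → a ℕ.+ a < b ℕ.+ b → a < b
double-< {a} {b} lt with a ℕₚ.<? b
... | yes a<b = a<b
... | no a≮b  = ⊥-elim (ℕₚ.<⇒≱ lt (ℕₚ.+-mono-≤ (ℕₚ.≮⇒≥ a≮b) (ℕₚ.≮⇒≥ a≮b)))

double-≡ : ∀ {a b} → a ℕ.+ a ≡ b ℕ.+ b → a ≡ b
double-≡ e = ℕₚ.≤-antisym (double-≤ (ℕₚ.≤-reflexive e)) (double-≤ (ℕₚ.≤-reflexive (sym e)))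

odd≢even : ∀ a b → suc (a ℕ.+ a) ≢ b ℕ.+ b
odd≢even a b e = ℕₚ.<⇒≱ (double-< {a} {b} (ℕₚ.≤-reflexive e)) (ℕₚ.≤-pred (double-< {b} {suc a}
  (subst (suc (b ℕ.+ b) ≤_) (cong suc (sym (ℕₚ.+-suc a a))) (s≤s (ℕₚ.≤-reflexive (sym e))))))

-- The minima after clearing denominators. The gaps are the odd numbers 2k - 1 and 2m - 1, hence m₃
-- = m₁ + 2ℓ with ℓ = k + m - 1. There are k monomials tⁱv₁ of weight below m₂, and t^ℓ v₁ has the
-- weight m₃.
record Weights : Set where
  field
    m₁ m₂ m₃ k m ℓ : ℕ
    m₂≡ : suc m₂ ≡ m₁ ℕ.+ (k ℕ.+ k)
    m₃≡ : suc m₃ ≡ m₂ ℕ.+ (m ℕ.+ m)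
    ℓ≡  : suc ℓ ≡ k ℕ.+ m
    0<k : 0 < k
    0<m : 0 < m

  open +-*-Solver

  m₃≡′ : m₃ ≡ m₁ ℕ.+ (ℓ ℕ.+ ℓ)
  m₃≡′ = ℕₚ.suc-injective (ℕₚ.suc-injective (trans (cong suc m₃≡) (trans
    (cong (ℕ._+ (m ℕ.+ m)) m₂≡) (trans
    (solve 3 (λ a k m → a :+ (k :+ k) :+ (m :+ m) := a :+ ((k :+ m) :+ (k :+ m))) refl m₁ k m) (trans
    (cong (λ t → m₁ ℕ.+ (t ℕ.+ t)) (sym ℓ≡))
    (solve 2 (λ a l → a :+ ((con 1 :+ l) :+ (con 1 :+ l)) := con 2 :+ (a :+ (l :+ l))) refl m₁ ℓ))))))

  m₁<m₂ : m₁ < m₂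
  m₁<m₂ = ℕₚ.≤-pred (subst (suc (suc m₁) ≤_) (sym m₂≡) (subst (_≤ m₁ ℕ.+ (k ℕ.+ k)) (ℕₚ.+-comm m₁ 2)
    (ℕₚ.+-monoʳ-≤ m₁ (ℕₚ.+-mono-≤ 0<k 0<k))))

  m₂<m₃ : m₂ < m₃
  m₂<m₃ = ℕₚ.≤-pred (subst (suc (suc m₂) ≤_) (sym m₃≡) (subst (_≤ m₂ ℕ.+ (m ℕ.+ m)) (ℕₚ.+-comm m₂ 2)
    (ℕₚ.+-monoʳ-≤ m₂ (ℕₚ.+-mono-≤ 0<m 0<m))))

  parity₁₂ : ∀ i j → m₁ ℕ.+ (i ℕ.+ i) ≢ m₂ ℕ.+ (j ℕ.+ j)
  parity₁₂ i j e = odd≢even i (k ℕ.+ j) (ℕₚ.+-cancelˡ-≡ m₁ _ _ (trans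
    (ℕₚ.+-suc m₁ (i ℕ.+ i)) (trans (cong suc e) (trans (cong (ℕ._+ (j ℕ.+ j)) m₂≡)
    (solve 3 (λ a k j → a :+ (k :+ k) :+ (j :+ j) := a :+ ((k :+ j) :+ (k :+ j))) refl m₁ k j)))))

  m₃-shift : ∀ l → m₃ ℕ.+ (l ℕ.+ l) ≡ m₁ ℕ.+ ((ℓ ℕ.+ l) ℕ.+ (ℓ ℕ.+ l))
  m₃-shift l = trans (cong (ℕ._+ (l ℕ.+ l)) m₃≡′)
    (solve 3 (λ a p l → a :+ (p :+ p) :+ (l :+ l) := a :+ ((p :+ l) :+ (p :+ l))) refl m₁ ℓ l)

  μ : Fin 3 → ℕ
  μ zero             = m₁
  μ (suc zero)       = m₂
  μ (suc (suc zero)) = m₃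

pattern 0F = zero
pattern 1F = suc zero
pattern 2F = suc (suc zero)

-- Degrees of the values of a reduced anisotropic form.

module Degrees (𝔽 : FiniteField) where
  open FieldTheory 𝔽
  open Forms 𝔽

  ⊛-zero : ∀ f g n → (∀ i j → i ℕ.+ j ≡ n → f i * g j ≡ 0#) → (f ⊛ g) n ≡ 0#
  ⊛-zero f g zero    h = h 0 0 refl
  ⊛-zero f g (suc n) h = trans (cong₂ _+_ (h 0 (suc n) refl) (⊛-zero (f ∘ suc) g n (λ i j e → h (suc i) j (cong suc e))))
    (+-identityʳ 0#)

  ⊛-single : ∀ f g i j → (∀ i′ j′ → i′ ℕ.+ j′ ≡ i ℕ.+ j → i′ ≢ i → f i′ * g j′ ≡ 0#) → (f ⊛ g) (i ℕ.+ j) ≡ f i * g j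
  ⊛-single f g zero    zero    h = refl
  ⊛-single f g zero    (suc j) h = trans (cong (f 0 * g (suc j) +_) (⊛-zero (f ∘ suc) g j
    (λ i′ j′ e → h (suc i′) j′ (cong suc e) (λ ())))) (+-identityʳ _)
  ⊛-single f g (suc i) j       h = trans (cong₂ _+_ (h 0 _ refl (λ ())) (⊛-single (f ∘ suc) g i j
    (λ i′ j′ e ne → h (suc i′) j′ (cong suc e) (λ e′ → ne (ℕₚ.suc-injective e′))))) (+-identityˡ _)

  coeff-*-zero : ∀ p r n → (∀ i j → i ℕ.+ j ≡ n → coeff p i * coeff r j ≡ 0#) → coeff (p *ₚ r) n ≡ 0#
  coeff-*-zero p r n h = trans (coeff-* p r n) (⊛-zero _ _ n h)

  coeff₃-zero : ∀ s p r n → (∀ a i j → a ℕ.+ (i ℕ.+ j) ≡ n → coeff s a ≡ 0# ⊎ coeff p i ≡ 0# ⊎ coeff r j ≡ 0#) →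
                coeff (s *ₚ (p *ₚ r)) n ≡ 0#
  coeff₃-zero s p r n h = coeff-*-zero s (p *ₚ r) n term
    where
    term : ∀ a t → a ℕ.+ t ≡ n → coeff s a * coeff (p *ₚ r) t ≡ 0#
    term a t e with coeff s a ≟ 0#
    ... | yes z = trans (cong (_* _) z) (zeroˡ _)
    ... | no nz = trans (cong (coeff s a *_) (coeff-*-zero p r t inner)) (zeroʳ _)
      where
      inner : ∀ i j → i ℕ.+ j ≡ t → coeff p i * coeff r j ≡ 0#
      inner i j refl with h a i j e
      ... | inj₁ z        = ⊥-elim (nz z)
      ... | inj₂ (inj₁ z) = trans (cong (_* coeff r j) z) (zeroˡ _)
      ... | inj₂ (inj₂ z) = trans (cong (coeff p i *_) z) (zeroʳ _)

  coeff₃-lead : ∀ s p a l → (∀ a′ → a < a′ → coeff s a′ ≡ 0#) → (∀ l′ → l < l′ → coeff p l′ ≡ 0#) →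
                coeff (s *ₚ (p *ₚ p)) (a ℕ.+ (l ℕ.+ l)) ≡ coeff s a * (coeff p l * coeff p l)
  coeff₃-lead s p a l hs hp = trans (coeff-* s (p *ₚ p) _) (trans (⊛-single (coeff s) (coeff (p *ₚ p)) a (l ℕ.+ l) outer)
    (cong (coeff s a *_) (trans (coeff-* p p _) (⊛-single (coeff p) (coeff p) l l inner))))
    where
    inner : ∀ i j → i ℕ.+ j ≡ l ℕ.+ l → i ≢ l → coeff p i * coeff p j ≡ 0#
    inner i j e i≢l with l ℕₚ.<? i | l ℕₚ.<? j
    ... | yes l<i | _       = trans (cong (_* coeff p j) (hp i l<i)) (zeroˡ _)
    ... | no _    | yes l<j = trans (cong (coeff p i *_) (hp j l<j)) (zeroʳ _)
    ... | no l≮i  | no l≮j  = ⊥-elim (ℕₚ.<⇒≢ (ℕₚ.+-mono-<-≤ (ℕₚ.≤∧≢⇒< (ℕₚ.≮⇒≥ l≮i) i≢l) (ℕₚ.≮⇒≥ l≮j)) e)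
    outer : ∀ a′ t → a′ ℕ.+ t ≡ a ℕ.+ (l ℕ.+ l) → a′ ≢ a → coeff s a′ * coeff (p *ₚ p) t ≡ 0#
    outer a′ t e a′≢a with a ℕₚ.<? a′
    ... | yes a<a′ = trans (cong (_* _) (hs a′ a<a′)) (zeroˡ _)
    ... | no a≮a′  = trans (cong (coeff s a′ *_) (coeff-*-zero p p t λ i j e′ → case i j e′)) (zeroʳ _)
      where
      l+l<t : l ℕ.+ l < t
      l+l<t = ℕₚ.≰⇒> λ t≤ → ℕₚ.<⇒≢ (ℕₚ.+-mono-<-≤ (ℕₚ.≤∧≢⇒< (ℕₚ.≮⇒≥ a≮a′) a′≢a) t≤) e
      case : ∀ i j → i ℕ.+ j ≡ t → coeff p i * coeff p j ≡ 0#
      case i j e′ with l ℕₚ.<? i | l ℕₚ.<? j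
      ... | yes l<i | _       = trans (cong (_* coeff p j) (hp i l<i)) (zeroˡ _)
      ... | no _    | yes l<j = trans (cong (coeff p i *_) (hp j l<j)) (zeroʳ _)
      ... | no l≮i  | no l≮j  = ⊥-elim (ℕₚ.<⇒≱ l+l<t (subst (_≤ l ℕ.+ l) e′ (ℕₚ.+-mono-≤ (ℕₚ.≮⇒≥ l≮i) (ℕₚ.≮⇒≥ l≮j))))

  coeff-Σ₃ : ∀ f n → coeff (Σ₃ _+ₚ_ f) n ≡ Σ₃ _+_ (λ i → coeff (f i) n)
  coeff-Σ₃ f n = trans (coeff-+ (f 0F) _ n) (cong (coeff (f 0F) n +_) (coeff-+ (f 1F) (f 2F) n))

  Σ₃-cong : ∀ {f g : Fin 3 → Carrier} → (∀ i → f i ≡ g i) → Σ₃ _+_ f ≡ Σ₃ _+_ g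
  Σ₃-cong e = cong₂ _+_ (e 0F) (cong₂ _+_ (e 1F) (e 2F))

  Σ₃-zero : ∀ {f : Fin 3 → Carrier} → (∀ i → f i ≡ 0#) → Σ₃ _+_ f ≡ 0#
  Σ₃-zero e = trans (Σ₃-cong e) (trans (+-identityˡ _) (+-identityˡ _))

  coeff-B : ∀ G u v n → coeff (B G u v) n ≡ Σ₃ _+_ (λ i → Σ₃ _+_ (λ j → coeff (G i j *ₚ (u i *ₚ v j)) n))
  coeff-B G u v n = trans (coeff-Σ₃ (λ i → Σ₃ _+ₚ_ (λ j → G i j *ₚ (u i *ₚ v j))) n) (Σ₃-cong λ i → coeff-Σ₃ (λ j → G i j *ₚ (u i *ₚ v j)) n)

  B-cong : ∀ G {u u′ v v′} → u ≈ᵥ u′ → v ≈ᵥ v′ → B G u v ≈ₚ B G u′ v′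
  B-cong G {u} {u′} {v} {v′} e f n = trans (coeff-B G u v n) (trans (Σ₃-cong λ i → Σ₃-cong λ j →
    *ₚ-cong {G i j} {G i j} {u i *ₚ v j} {u′ i *ₚ v′ j} (λ _ → refl) (*ₚ-cong {u i} {u′ i} {v j} {v′ j} (e i) (f j)) n)
    (sym (coeff-B G u′ v′ n)))

  module _ (wts : Weights) where
    open Weights wts

    -- The Gram matrix of a reduced basis of an anisotropic form whose minima are m₁ < m₂ < m₃.
    record Shape (G : Gram) : Set where
      field
        symmetric : ∀ i j → G i j ≈ₚ G j i
        degree    : ∀ i n → μ i < n → coeff (G i i) n ≡ 0#
        lead≢0    : ∀ i → coeff (G i i) (μ i) ≢ 0#
        degree₀₁  : ∀ n → m₁ ≤ n → coeff (G 0F 1F) n ≡ 0#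
        degree₀₂  : ∀ n → m₁ ≤ n → coeff (G 0F 2F) n ≡ 0#
        degree₁₂  : ∀ n → m₂ ≤ n → coeff (G 1F 2F) n ≡ 0#
        anisotropic : ∀ ξ c → coeff (G 0F 0F) m₁ * (ξ * ξ) + coeff (G 2F 2F) m₃ * (c * c) ≡ 0# → ξ ≡ 0# × c ≡ 0#

      lead : Fin 3 → Carrier
      lead i = coeff (G i i) (μ i)

      -- The bound by the smaller of μ i and μ j is relaxed to one by their mean. This version is
      -- symmetric in i and j and adds up along the products in B.
      off-diagonal : ∀ i j n → i ≢ j → μ i ℕ.+ μ j ≤ n ℕ.+ n → coeff (G i j) n ≡ 0#
      off-diagonal 0F 0F n ne le = ⊥-elim (ne refl)
      off-diagonal 1F 1F n ne le = ⊥-elim (ne refl)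
      off-diagonal 2F 2F n ne le = ⊥-elim (ne refl)
      off-diagonal 0F 1F n ne le = degree₀₁ n (double-≤ (ℕₚ.≤-trans (ℕₚ.+-monoʳ-≤ m₁ (ℕₚ.<⇒≤ m₁<m₂)) le))
      off-diagonal 0F 2F n ne le = degree₀₂ n (double-≤ (ℕₚ.≤-trans (ℕₚ.+-monoʳ-≤ m₁ (ℕₚ.<⇒≤ (ℕₚ.<-trans m₁<m₂ m₂<m₃))) le))
      off-diagonal 1F 2F n ne le = degree₁₂ n (double-≤ (ℕₚ.≤-trans (ℕₚ.+-monoʳ-≤ m₂ (ℕₚ.<⇒≤ m₂<m₃)) le))
      off-diagonal 1F 0F n ne le = trans (symmetric 1F 0F n)
        (degree₀₁ n (double-≤ (ℕₚ.≤-trans (ℕₚ.+-monoˡ-≤ m₁ (ℕₚ.<⇒≤ m₁<m₂)) le)))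
      off-diagonal 2F 0F n ne le = trans (symmetric 2F 0F n)
        (degree₀₂ n (double-≤ (ℕₚ.≤-trans (ℕₚ.+-monoˡ-≤ m₁ (ℕₚ.<⇒≤ (ℕₚ.<-trans m₁<m₂ m₂<m₃))) le)))
      off-diagonal 2F 1F n ne le = trans (symmetric 2F 1F n)
        (degree₁₂ n (double-≤ (ℕₚ.≤-trans (ℕₚ.+-monoˡ-≤ m₂ (ℕₚ.<⇒≤ m₂<m₃)) le)))

      entry-degree : ∀ i j n → μ i ℕ.+ μ j < n ℕ.+ n → coeff (G i j) n ≡ 0#
      entry-degree 0F 0F n lt = degree 0F n (double-< lt)
      entry-degree 1F 1F n lt = degree 1F n (double-< lt)
      entry-degree 2F 2F n lt = degree 2F n (double-< lt)
      entry-degree 0F 1F n lt = off-diagonal 0F 1F n (λ ()) (ℕₚ.<⇒≤ lt)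
      entry-degree 0F 2F n lt = off-diagonal 0F 2F n (λ ()) (ℕₚ.<⇒≤ lt)
      entry-degree 1F 0F n lt = off-diagonal 1F 0F n (λ ()) (ℕₚ.<⇒≤ lt)
      entry-degree 1F 2F n lt = off-diagonal 1F 2F n (λ ()) (ℕₚ.<⇒≤ lt)
      entry-degree 2F 0F n lt = off-diagonal 2F 0F n (λ ()) (ℕₚ.<⇒≤ lt)
      entry-degree 2F 1F n lt = off-diagonal 2F 1F n (λ ()) (ℕₚ.<⇒≤ lt)

    -- v has weight at most W: each coefficient of v contributes degree at most W to the form.
    Bounded : ℕ → Triple → Set
    Bounded W v = ∀ i l → W < μ i ℕ.+ (l ℕ.+ l) → coeff (v i) l ≡ 0#

    private
      doubled-sum : ∀ a i j x y → a ℕ.+ (i ℕ.+ j) ℕ.+ (a ℕ.+ (i ℕ.+ j)) ℕ.+ (x ℕ.+ y) ≡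
                    a ℕ.+ a ℕ.+ ((x ℕ.+ (i ℕ.+ i)) ℕ.+ (y ℕ.+ (j ℕ.+ j)))
      doubled-sum = solve 5 (λ a i j x y → a :+ (i :+ j) :+ (a :+ (i :+ j)) :+ (x :+ y)
        := a :+ a :+ ((x :+ (i :+ i)) :+ (y :+ (j :+ j)))) refl
        where open +-*-Solver

      term-bound : ∀ x y i j {W W′} a → x ℕ.+ (i ℕ.+ i) ≤ W → y ℕ.+ (j ℕ.+ j) ≤ W′ →
        ∀ {n} → a ℕ.+ (i ℕ.+ j) ≡ n → n ℕ.+ n ℕ.+ (x ℕ.+ y) ≤ a ℕ.+ a ℕ.+ (W ℕ.+ W′)
      term-bound x y i j {W} {W′} a le le′ refl = subst (_≤ a ℕ.+ a ℕ.+ (W ℕ.+ W′)) (sym (doubled-sum a i j x y))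
        (ℕₚ.+-monoʳ-≤ (a ℕ.+ a) (ℕₚ.+-mono-≤ le le′))

    module _ {G : Gram} (shape : Shape G) where
      open Shape shape

      term-zero : ∀ {u v W W′} i j n → Bounded W u → Bounded W′ v → W ℕ.+ W′ < n ℕ.+ n →
                  coeff (G i j *ₚ (u i *ₚ v j)) n ≡ 0#
      term-zero {u} {v} {W} {W′} i j n bu bv lt = coeff₃-zero (G i j) (u i) (v j) n λ a l l′ e → case a l l′ e
        where
        case : ∀ a l l′ → a ℕ.+ (l ℕ.+ l′) ≡ n → coeff (G i j) a ≡ 0# ⊎ coeff (u i) l ≡ 0# ⊎ coeff (v j) l′ ≡ 0#
        case a l l′ e with W ℕₚ.<? μ i ℕ.+ (l ℕ.+ l) | W′ ℕₚ.<? μ j ℕ.+ (l′ ℕ.+ l′)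
        ... | yes p | _     = inj₂ (inj₁ (bu i l p))
        ... | no _  | yes p = inj₂ (inj₂ (bv j l′ p))
        ... | no p  | no p′ = inj₁ (entry-degree i j a (ℕₚ.+-cancelˡ-< (W ℕ.+ W′) _ _ (subst (W ℕ.+ W′ ℕ.+ (μ i ℕ.+ μ j) <_) (ℕₚ.+-comm (a ℕ.+ a) _)
                (ℕₚ.<-≤-trans (ℕₚ.+-monoˡ-< (μ i ℕ.+ μ j) lt) (term-bound (μ i) (μ j) l l′ a (ℕₚ.≮⇒≥ p) (ℕₚ.≮⇒≥ p′) e)))))

      term-zero-off : ∀ {u v W W′} i j n → i ≢ j → Bounded W u → Bounded W′ v → W ℕ.+ W′ ≤ n ℕ.+ n →
                  coeff (G i j *ₚ (u i *ₚ v j)) n ≡ 0#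
      term-zero-off {u} {v} {W} {W′} i j n ne bu bv lt = coeff₃-zero (G i j) (u i) (v j) n λ a l l′ e → case a l l′ e
        where
        case : ∀ a l l′ → a ℕ.+ (l ℕ.+ l′) ≡ n → coeff (G i j) a ≡ 0# ⊎ coeff (u i) l ≡ 0# ⊎ coeff (v j) l′ ≡ 0#
        case a l l′ e with W ℕₚ.<? μ i ℕ.+ (l ℕ.+ l) | W′ ℕₚ.<? μ j ℕ.+ (l′ ℕ.+ l′)
        ... | yes p | _     = inj₂ (inj₁ (bu i l p))
        ... | no _  | yes p = inj₂ (inj₂ (bv j l′ p))
        ... | no p  | no p′ = inj₁ (off-diagonal i j a ne (ℕₚ.+-cancelˡ-≤ (W ℕ.+ W′) _ _ (subst (W ℕ.+ W′ ℕ.+ (μ i ℕ.+ μ j) ≤_) (ℕₚ.+-comm (a ℕ.+ a) _)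
                (ℕₚ.≤-trans (ℕₚ.+-monoˡ-≤ (μ i ℕ.+ μ j) lt) (term-bound (μ i) (μ j) l l′ a (ℕₚ.≮⇒≥ p) (ℕₚ.≮⇒≥ p′) e)))))

      B-zero : ∀ {u v W W′} n → Bounded W u → Bounded W′ v → W ℕ.+ W′ < n ℕ.+ n → coeff (B G u v) n ≡ 0#
      B-zero {u} {v} n bu bv lt = trans (coeff-B G u v n) (Σ₃-zero λ i → Σ₃-zero λ j → term-zero {u} {v} i j n bu bv lt)

      diagonal : Triple → ℕ → Fin 3 → Carrier
      diagonal v n i = coeff (G i i *ₚ (v i *ₚ v i)) n

      -- For a vector of weight at most W the off-diagonal products have degree strictly below W, so
      -- the coefficient at W comes from the diagonal alone.
      B-top : ∀ {v W} → Bounded W v → coeff (B G v v) W ≡ Σ₃ _+_ (diagonal v W)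
      B-top {v} {W} b = trans (coeff-B G v v W) (cong₂ _+_ (row₀) (cong₂ _+_ row₁ row₂))
        where
        off : ∀ i j → i ≢ j → coeff (G i j *ₚ (v i *ₚ v j)) W ≡ 0#
        off i j ne = term-zero-off {v} {v} i j W ne b b ℕₚ.≤-refl
        row₀ = trans (cong₂ _+_ refl (trans (cong₂ _+_ (off 0F 1F (λ ())) (off 0F 2F (λ ()))) (+-identityʳ 0#))) (+-identityʳ (diagonal v W 0F))
        row₁ = trans (cong₂ _+_ (off 1F 0F (λ ())) (trans (cong₂ _+_ refl (off 1F 2F (λ ()))) (+-identityʳ (diagonal v W 1F)))) (+-identityˡ _)
        row₂ = trans (cong₂ _+_ (off 2F 0F (λ ())) (trans (cong₂ _+_ (off 2F 1F (λ ())) refl) (+-identityˡ (diagonal v W 2F)))) (+-identityˡ _)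

      diagonal-lead : ∀ {v W} i l → Bounded W v → W ≡ μ i ℕ.+ (l ℕ.+ l) →
                      diagonal v W i ≡ lead i * (coeff (v i) l * coeff (v i) l)
      diagonal-lead {v} i l b refl = coeff₃-lead (G i i) (v i) (μ i) l (degree i)
        (λ l′ l<l′ → b i l′ (ℕₚ.+-monoʳ-< (μ i) (ℕₚ.+-mono-< l<l′ l<l′)))

      -- A contribution in degree W forces G i i to contribute its leading coefficient and both
      -- factors v i a coefficient of extreme weight, that is W = μ i + 2l.
      diagonal-none : ∀ {v W} i → Bounded W v → (∀ l → W ≢ μ i ℕ.+ (l ℕ.+ l)) → diagonal v W i ≡ 0#
      diagonal-none {v} {W} i b none = coeff₃-zero (G i i) (v i) (v i) W λ a l l′ e → case a l l′ e
        where
        case : ∀ a l l′ → a ℕ.+ (l ℕ.+ l′) ≡ W → coeff (G i i) a ≡ 0# ⊎ coeff (v i) l ≡ 0# ⊎ coeff (v i) l′ ≡ 0#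
        case a l l′ e with W ℕₚ.<? μ i ℕ.+ (l ℕ.+ l) | W ℕₚ.<? μ i ℕ.+ (l′ ℕ.+ l′) | μ i ℕₚ.<? a
        ... | yes p | _     | _     = inj₂ (inj₁ (b i l p))
        ... | no _  | yes p | _     = inj₂ (inj₂ (b i l′ p))
        ... | no _  | no _  | yes p = inj₁ (degree i a p)
        ... | no p  | no p′ | no p″ = ⊥-elim (ℕₚ.<-irrefl refl (ℕₚ.<-≤-trans
                (subst (_< a ℕ.+ a ℕ.+ (W ℕ.+ W)) (trans (sym (doubled-sum a l l′ (μ i) (μ i))) (cong (λ t → t ℕ.+ t ℕ.+ (μ i ℕ.+ μ i)) e))
                  (ℕₚ.+-monoʳ-< (a ℕ.+ a) (ℕₚ.+-mono-<-≤ (ℕₚ.≤∧≢⇒< (ℕₚ.≮⇒≥ p) (λ eq → none l (sym eq))) (ℕₚ.≮⇒≥ p′))))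
                (subst (_≤ W ℕ.+ W ℕ.+ (μ i ℕ.+ μ i)) (ℕₚ.+-comm (W ℕ.+ W) (a ℕ.+ a))
                  (ℕₚ.+-monoʳ-≤ (W ℕ.+ W) (ℕₚ.+-mono-≤ (ℕₚ.≮⇒≥ p″) (ℕₚ.≮⇒≥ p″))))))

      private
        only : ∀ {v W} → Bounded W v → coeff (B G v v) W ≡ 0# → Σ₃ _+_ (diagonal v W) ≡ 0#
        only {v} b e = trans (sym (B-top {v} b)) e

        square-zero : ∀ {a x} → a ≢ 0# → a * (x * x) ≡ 0# → x ≡ 0#
        square-zero {a} {x} a≢0 e with x ≟ 0#
        ... | yes x≡0 = x≡0
        ... | no x≢0  = ⊥-elim (*-≢0 a≢0 (*-≢0 x≢0 x≢0) e)

        sum₁ : ∀ {x y z} → x ≡ 0# → z ≡ 0# → x + (y + z) ≡ y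
        sum₁ refl refl = trans (+-identityˡ _) (+-identityʳ _)

        sum₀ : ∀ {x y z} → y ≡ 0# → z ≡ 0# → x + (y + z) ≡ x
        sum₀ refl refl = trans (cong (_ +_) (+-identityʳ 0#)) (+-identityʳ _)

        sum₀₂ : ∀ {x y z} → y ≡ 0# → x + (y + z) ≡ x + z
        sum₀₂ refl = cong (_ +_) (+-identityˡ _)

      -- The two squares of equal parity cannot cancel by anisotropy, and the third has the other parity.
      top-vanishes : ∀ {v W} → Bounded W v → coeff (B G v v) W ≡ 0# → ∀ i l → W ≡ μ i ℕ.+ (l ℕ.+ l) → coeff (v i) l ≡ 0#
      top-vanishes {v} {W} b e 1F l eq = square-zero (lead≢0 1F) (trans (sym (diagonal-lead {v} 1F l b eq)) (trans
        (sym (sum₁ (diagonal-none {v} 0F b (λ i e′ → parity₁₂ i l (trans (sym e′) eq)))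
                   (diagonal-none {v} 2F b (λ i e′ → parity₁₂ (ℓ ℕ.+ i) l (trans (sym (m₃-shift i)) (trans (sym e′) eq))))))
        (only {v} b e)))
      top-vanishes {v} {W} b e 0F l eq with ℓ ℕₚ.≤? l
      ... | no ℓ≰l = square-zero (lead≢0 0F) (trans (sym (diagonal-lead {v} 0F l b eq)) (trans
              (sym (sum₀ (diagonal-none {v} 1F b (λ j e′ → parity₁₂ l j (trans (sym eq) e′)))
                         (diagonal-none {v} 2F b (λ j e′ → ℓ≰l (subst (ℓ ≤_)
                            (sym (double-≡ (ℕₚ.+-cancelˡ-≡ m₁ _ _ (trans (sym eq) (trans e′ (m₃-shift j)))))) (ℕₚ.m≤m+n ℓ j))))))
              (only {v} b e)))
      ... | yes ℓ≤l = proj₁ (anisotropic _ _ (trans (sym (cong₂ _+_ (diagonal-lead {v} 0F l b eq)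
              (diagonal-lead {v} 2F (l ℕ.∸ ℓ) b (trans eq (trans (cong (λ t → m₁ ℕ.+ (t ℕ.+ t)) (sym (ℕₚ.m+[n∸m]≡n ℓ≤l))) (sym (m₃-shift (l ℕ.∸ ℓ))))))))
              (trans (sym (sum₀₂ (diagonal-none {v} 1F b (λ j e′ → parity₁₂ l j (trans (sym eq) e′))))) (only {v} b e))))
      top-vanishes {v} {W} b e 2F l eq = proj₂ (anisotropic _ _ (trans (sym (cong₂ _+_ (diagonal-lead {v} 0F (ℓ ℕ.+ l) b (trans eq (m₃-shift l)))
              (diagonal-lead {v} 2F l b eq)))
              (trans (sym (sum₀₂ (diagonal-none {v} 1F b (λ j e′ → parity₁₂ (ℓ ℕ.+ l) j (trans (sym (m₃-shift l)) (trans (sym eq) e′)))))) (only {v} b e))))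

      bounded-descend : ∀ {v} N W → Bounded (N ℕ.+ W) v → (∀ n → W < n → coeff (B G v v) n ≡ 0#) → Bounded W v
      bounded-descend         zero    W b z = b
      bounded-descend {v} (suc N) W b z = bounded-descend {v} N W b′ z
        where
        b′ : Bounded (N ℕ.+ W) v
        b′ i l lt with ℕₚ.m≤n⇒m<n∨m≡n lt
        ... | inj₁ lt′ = b i l lt′
        ... | inj₂ eq  = top-vanishes {v} b (z (suc (N ℕ.+ W)) (s≤s (ℕₚ.m≤n+m W N))) i l eq

      -- List lengths provide some weight bound, and `top-vanishes` lowers it one step at a time
      -- down to W. The set of vectors with values of degree at most W is thereby the linear space
      -- `Bounded W`, which depends on the minima only.
      degree⇒bounded : ∀ v W → (∀ n → W < n → coeff (B G v v) n ≡ 0#) → Bounded W v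
      degree⇒bounded v W z = bounded-descend {v} N W big z
        where
        N = Σ₃ ℕ._+_ (λ i → μ i ℕ.+ (length (v i) ℕ.+ length (v i)))
        coeff-beyond : ∀ p l → length p ≤ l → coeff p l ≡ 0#
        coeff-beyond []      l       _        = refl
        coeff-beyond (_ ∷ p) (suc l) (s≤s le) = coeff-beyond p l le
        part : ∀ i → μ i ℕ.+ (length (v i) ℕ.+ length (v i)) ≤ N
        part 0F = ℕₚ.m≤m+n _ _
        part 1F = ℕₚ.≤-trans (ℕₚ.m≤m+n _ _) (ℕₚ.m≤n+m _ (μ 0F ℕ.+ (length (v 0F) ℕ.+ length (v 0F))))
        part 2F = ℕₚ.≤-trans (ℕₚ.m≤n+m _ (μ 1F ℕ.+ (length (v 1F) ℕ.+ length (v 1F)))) (ℕₚ.m≤n+m _ (μ 0F ℕ.+ (length (v 0F) ℕ.+ length (v 0F))))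
        big : Bounded (N ℕ.+ W) v
        big i l lt with length (v i) ℕₚ.≤? l
        ... | yes le = coeff-beyond (v i) l le
        ... | no nle = ⊥-elim (ℕₚ.<⇒≱ lt (ℕₚ.≤-trans (ℕₚ.+-monoʳ-≤ (μ i) (ℕₚ.+-mono-≤ (ℕₚ.<⇒≤ (ℕₚ.≰⇒> nle)) (ℕₚ.<⇒≤ (ℕₚ.≰⇒> nle))))
                    (ℕₚ.≤-trans (part i) (ℕₚ.m≤m+n N W))))

-- The monomials in the first two basis vectors, ordered by weight.

-- The monomials tⁱv₁ (inj₁ i) and tʲv₂ (inj₂ j) in the order of their weights a + 2i and b + 2j,
-- where b = a + 2k - 1.
alternate : ℕ → ℕ ⊎ ℕ
alternate zero          = inj₂ 0
alternate (suc zero)    = inj₁ 0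
alternate (suc (suc r)) = Sum.map suc suc (alternate r)

-- The first k places belong to v₁ alone, since the weights a, a + 2, ... stay below b until then;
-- from b on the two sequences of opposite parity interlace.
slot : ℕ → ℕ → ℕ ⊎ ℕ
slot zero    r       = alternate r
slot (suc k) zero    = inj₁ 0
slot (suc k) (suc r) = Sum.map₁ suc (slot k r)

weight : ℕ → ℕ → ℕ ⊎ ℕ → ℕ
weight a b (inj₁ i) = a ℕ.+ (i ℕ.+ i)
weight a b (inj₂ j) = b ℕ.+ (j ℕ.+ j)

slotWeight : ℕ → ℕ → ℕ → ℕ → ℕ
slotWeight zero    a b r       = b ℕ.+ r
slotWeight (suc k) a b zero    = a
slotWeight (suc k) a b (suc r) = slotWeight k (2 ℕ.+ a) b r

private
  +-2 : ∀ a i → a ℕ.+ (suc i ℕ.+ suc i) ≡ 2 ℕ.+ (a ℕ.+ (i ℕ.+ i))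
  +-2 a i = trans (cong (a ℕ.+_) (cong suc (ℕₚ.+-suc i i))) (trans (ℕₚ.+-suc a _) (cong suc (ℕₚ.+-suc a _)))

weight-alternate : ∀ {a b} → suc b ≡ a ℕ.+ 0 → ∀ r → weight a b (alternate r) ≡ b ℕ.+ r
weight-alternate e zero          = refl
weight-alternate {a} {b} e (suc zero) = trans (sym e) (sym (trans (ℕₚ.+-suc b 0) (cong suc (ℕₚ.+-identityʳ b))))
weight-alternate {a} {b} e (suc (suc r)) = trans (shift (alternate r)) (trans (cong (2 ℕ.+_) (weight-alternate e r))
  (sym (trans (ℕₚ.+-suc b (suc r)) (cong suc (ℕₚ.+-suc b r)))))
  where
  shift : ∀ s → weight a b (Sum.map suc suc s) ≡ 2 ℕ.+ weight a b s
  shift (inj₁ i) = +-2 a i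
  shift (inj₂ j) = +-2 b j

next-start : ∀ {a b} k → suc b ≡ a ℕ.+ (suc k ℕ.+ suc k) → suc b ≡ 2 ℕ.+ a ℕ.+ (k ℕ.+ k)
next-start {a} k e = trans e (+-2 a k)

weight-slot : ∀ k {a b} → suc b ≡ a ℕ.+ (k ℕ.+ k) → ∀ r → weight a b (slot k r) ≡ slotWeight k a b r
weight-slot zero    e r       = weight-alternate e r
weight-slot (suc k) {a} e zero    = ℕₚ.+-identityʳ a
weight-slot (suc k) {a} {b} e (suc r) = trans (shift (slot k r)) (weight-slot k (next-start k e) r)
  where
  shift : ∀ s → weight a b (Sum.map₁ suc s) ≡ weight (2 ℕ.+ a) b s
  shift (inj₁ i) = +-2 a i
  shift (inj₂ j) = refl

slotWeight-step : ∀ k {a b} → suc b ≡ a ℕ.+ (k ℕ.+ k) → ∀ r → slotWeight k a b r < slotWeight k a b (suc r)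
slotWeight-step zero    {a} {b} e r       = ℕₚ.+-monoʳ-< b (ℕₚ.n<1+n r)
slotWeight-step (suc zero) {a} {b} e zero = ℕₚ.≤-reflexive (ℕₚ.suc-injective (trans (sym (ℕₚ.+-comm a 2))
  (trans (sym e) (cong suc (sym (ℕₚ.+-identityʳ b))))))
slotWeight-step (suc (suc k)) {a} e zero  = ℕₚ.m<n⇒m<1+n (ℕₚ.n<1+n a)
slotWeight-step (suc k) e (suc r)         = slotWeight-step k (next-start k e) r

slotWeight-mono : ∀ k {a b} → suc b ≡ a ℕ.+ (k ℕ.+ k) → ∀ {r s} → r < s → slotWeight k a b r < slotWeight k a b s
slotWeight-mono k e {r} {suc s} (s≤s r≤s) with ℕₚ.m≤n⇒m<n∨m≡n r≤s
... | inj₁ r<s  = ℕₚ.<-trans (slotWeight-mono k e r<s) (slotWeight-step k e s)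
... | inj₂ refl = slotWeight-step k e r

twice : ℕ → ℕ
twice zero    = zero
twice (suc i) = suc (suc (twice i))

position₁ : ℕ → ℕ → ℕ
position₁ zero    i       = suc (twice i)
position₁ (suc k) zero    = zero
position₁ (suc k) (suc i) = suc (position₁ k i)

alternate₁ : ∀ i → alternate (suc (twice i)) ≡ inj₁ i
alternate₁ zero    = refl
alternate₁ (suc i) = cong (Sum.map suc suc) (alternate₁ i)

alternate₂ : ∀ j → alternate (twice j) ≡ inj₂ j
alternate₂ zero    = refl
alternate₂ (suc j) = cong (Sum.map suc suc) (alternate₂ j)

slot-position₁ : ∀ k i → slot k (position₁ k i) ≡ inj₁ i
slot-position₁ zero    i       = alternate₁ i
slot-position₁ (suc k) zero    = refl
slot-position₁ (suc k) (suc i) = cong (Sum.map₁ suc) (slot-position₁ k i)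

slot-position₂ : ∀ k j → slot k (k ℕ.+ twice j) ≡ inj₂ j
slot-position₂ zero    j = alternate₂ j
slot-position₂ (suc k) j = cong (Sum.map₁ suc) (slot-position₂ k j)

slot-initial : ∀ k r → r < k → slot k r ≡ inj₁ r
slot-initial (suc k) zero    _         = refl
slot-initial (suc k) (suc r) (s≤s r<k) = cong (Sum.map₁ suc) (slot-initial k r r<k)

-- Bilinearity, unit vectors and coordinates.

module Bilinear (𝔽 : FiniteField) where
  open FieldTheory 𝔽
  open Forms 𝔽
  open Degrees 𝔽

  infixl 6 _+ᵥ_
  _+ᵥ_ : Triple → Triple → Triple
  (u +ᵥ v) i = u i +ₚ v i

  infixl 7 _∙_
  _∙_ : Carrier → Triple → Triple
  (c ∙ u) i = map (c *_) (u i)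

  scale-* : ∀ c p r → map (c *_) p *ₚ r ≈ₚ map (c *_) (p *ₚ r)
  scale-* c p r n = trans (coeff-* (map (c *_) p) r n) (trans (⊛-cong (coeff-scale c p) (λ _ → refl) n)
    (trans (⊛-scaleˡ c (coeff p) (coeff r) n) (trans (cong (c *_) (sym (coeff-* p r n))) (sym (coeff-scale c (p *ₚ r) n)))))

  Σ₃-+ : ∀ f g → Σ₃ _+_ (λ i → f i + g i) ≡ Σ₃ _+_ f + Σ₃ _+_ g
  Σ₃-+ f g = solve 6 (λ a b c x y z → (a :+ x) :+ ((b :+ y) :+ (c :+ z)) := (a :+ (b :+ c)) :+ (x :+ (y :+ z)))
    refl (f 0F) (f 1F) (f 2F) (g 0F) (g 1F) (g 2F)
    where open F-solver

  Σ₃-* : ∀ c f → Σ₃ _+_ (λ i → c * f i) ≡ c * Σ₃ _+_ f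
  Σ₃-* c f = solve 4 (λ c x y z → c :* x :+ (c :* y :+ c :* z) := c :* (x :+ (y :+ z))) refl c (f 0F) (f 1F) (f 2F)
    where open F-solver

  Σ₃-swap : ∀ (f : Fin 3 → Fin 3 → Carrier) → Σ₃ _+_ (λ i → Σ₃ _+_ (f i)) ≡ Σ₃ _+_ (λ j → Σ₃ _+_ (λ i → f i j))
  Σ₃-swap f = solve 9 (λ a b c d e g h i j → (a :+ (b :+ c)) :+ ((d :+ (e :+ g)) :+ (h :+ (i :+ j)))
      := (a :+ (d :+ h)) :+ ((b :+ (e :+ i)) :+ (c :+ (g :+ j)))) refl
      (f 0F 0F) (f 0F 1F) (f 0F 2F) (f 1F 0F) (f 1F 1F) (f 1F 2F) (f 2F 0F) (f 2F 1F) (f 2F 2F)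
    where open F-solver

  B-+ˡ : ∀ G u u′ v → B G (u +ᵥ u′) v ≈ₚ B G u v +ₚ B G u′ v
  B-+ˡ G u u′ v n = trans (coeff-B G (u +ᵥ u′) v n) (trans (Σ₃-cong λ i → trans (Σ₃-cong λ j →
      trans (solve 4 (λ g a b c → g :* ((a :+ b) :* c) := g :* (a :* c) :+ g :* (b :* c)) (λ _ → refl) (G i j) (u i) (u′ i) (v j) n)
            (coeff-+ (G i j *ₚ (u i *ₚ v j)) (G i j *ₚ (u′ i *ₚ v j)) n)) (Σ₃-+ (t u i) (t u′ i)))
    (trans (Σ₃-+ (λ i → Σ₃ _+_ (t u i)) (λ i → Σ₃ _+_ (t u′ i))) (trans (cong₂ _+_ (sym (coeff-B G u v n)) (sym (coeff-B G u′ v n)))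
      (sym (coeff-+ (B G u v) (B G u′ v) n)))))
    where
    open P-solver
    t : Triple → Fin 3 → Fin 3 → Carrier
    t u i j = coeff (G i j *ₚ (u i *ₚ v j)) n

  B-∙ˡ : ∀ G c u v → B G (c ∙ u) v ≈ₚ map (c *_) (B G u v)
  B-∙ˡ G c u v n = trans (coeff-B G (c ∙ u) v n) (trans (Σ₃-cong λ i → trans (Σ₃-cong λ j → term i j) (Σ₃-* c (λ j → coeff (G i j *ₚ (u i *ₚ v j)) n)))
    (trans (Σ₃-* c (λ i → Σ₃ _+_ (λ j → coeff (G i j *ₚ (u i *ₚ v j)) n))) (trans (cong (c *_) (sym (coeff-B G u v n))) (sym (coeff-scale c (B G u v) n)))))
    where
    term : ∀ i j → coeff (G i j *ₚ (map (c *_) (u i) *ₚ v j)) n ≡ c * coeff (G i j *ₚ (u i *ₚ v j)) n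
    term i j = trans (*ₚ-cong {G i j} {G i j} {map (c *_) (u i) *ₚ v j} {map (c *_) (u i *ₚ v j)} (λ _ → refl) (scale-* c (u i) (v j)) n)
      (trans (P.*-comm (G i j) (map (c *_) (u i *ₚ v j)) n) (trans (scale-* c (u i *ₚ v j) (G i j) n)
      (trans (coeff-scale c ((u i *ₚ v j) *ₚ G i j) n) (cong (c *_) (P.*-comm (u i *ₚ v j) (G i j) n)))))

  ΣΣ-cong : ∀ (f g : Fin 3 → Fin 3 → Carrier) → (∀ i j → f i j ≡ g i j) →
            Σ₃ _+_ (λ i → Σ₃ _+_ (f i)) ≡ Σ₃ _+_ (λ i → Σ₃ _+_ (g i))
  ΣΣ-cong f g e = Σ₃-cong {λ i → Σ₃ _+_ (f i)} {λ i → Σ₃ _+_ (g i)} (λ i → Σ₃-cong {f i} {g i} (e i))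

  B-sym : ∀ {G} → (∀ i j → G i j ≈ₚ G j i) → ∀ u v → B G u v ≈ₚ B G v u
  B-sym {G} s u v n = trans (coeff-B G u v n) (trans
    (ΣΣ-cong (λ i j → coeff (G i j *ₚ (u i *ₚ v j)) n) (λ i j → coeff (G j i *ₚ (v j *ₚ u i)) n)
      (λ i j → *ₚ-cong {G i j} {G j i} {u i *ₚ v j} {v j *ₚ u i} (s i j) (P.*-comm (u i) (v j)) n))
    (trans (Σ₃-swap (λ i j → coeff (G j i *ₚ (v j *ₚ u i)) n)) (sym (coeff-B G v u n))))

  -- Gram entries that meet an empty coordinate may differ. This serves to compare two forms known
  -- to agree only on the plane of the first two basis vectors.
  B-congᴳ : ∀ {G G′} u v → (∀ i j → G i j ≈ₚ G′ i j ⊎ u i ≡ [] ⊎ v j ≡ []) → B G u v ≈ₚ B G′ u v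
  B-congᴳ {G} {G′} u v h n = trans (coeff-B G u v n) (trans
    (ΣΣ-cong (λ i j → coeff (G i j *ₚ (u i *ₚ v j)) n) (λ i j → coeff (G′ i j *ₚ (u i *ₚ v j)) n) (λ i j → term i j (h i j)))
    (sym (coeff-B G′ u v n)))
    where
    empty : ∀ s p r → p ≡ [] ⊎ r ≡ [] → coeff (s *ₚ (p *ₚ r)) n ≡ 0#
    empty s p r (inj₁ refl) = coeff₃-zero s [] r n (λ _ _ _ _ → inj₂ (inj₁ refl))
    empty s p r (inj₂ refl) = coeff₃-zero s p [] n (λ _ _ _ _ → inj₂ (inj₂ refl))
    term : ∀ i j → G i j ≈ₚ G′ i j ⊎ u i ≡ [] ⊎ v j ≡ [] → coeff (G i j *ₚ (u i *ₚ v j)) n ≡ coeff (G′ i j *ₚ (u i *ₚ v j)) n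
    term i j (inj₁ e) = *ₚ-cong {G i j} {G′ i j} {u i *ₚ v j} {u i *ₚ v j} e (λ _ → refl) n
    term i j (inj₂ e) = trans (empty (G i j) (u i) (v j) e) (sym (empty (G′ i j) (u i) (v j) e))

  mono : ℕ → Poly
  mono zero    = 1ₚ
  mono (suc i) = 0# ∷ mono i

  coeff-mono-≡ : ∀ i → coeff (mono i) i ≡ 1#
  coeff-mono-≡ zero    = refl
  coeff-mono-≡ (suc i) = coeff-mono-≡ i

  coeff-mono-≢ : ∀ i l → i ≢ l → coeff (mono i) l ≡ 0#
  coeff-mono-≢ zero    zero    ne = ⊥-elim (ne refl)
  coeff-mono-≢ zero    (suc l) ne = refl
  coeff-mono-≢ (suc i) zero    ne = refl
  coeff-mono-≢ (suc i) (suc l) ne = coeff-mono-≢ i l (λ e → ne (cong suc e))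

  unit : Fin 3 → Poly → Triple
  unit 0F p 0F = p
  unit 1F p 1F = p
  unit 2F p 2F = p
  unit _  p _  = []

  unit-off : ∀ i p j → i ≢ j → unit i p j ≡ []
  unit-off 0F p 0F ne = ⊥-elim (ne refl)
  unit-off 0F p 1F ne = refl
  unit-off 0F p 2F ne = refl
  unit-off 1F p 0F ne = refl
  unit-off 1F p 1F ne = ⊥-elim (ne refl)
  unit-off 1F p 2F ne = refl
  unit-off 2F p 0F ne = refl
  unit-off 2F p 1F ne = refl
  unit-off 2F p 2F ne = ⊥-elim (ne refl)

  unit-on : ∀ i p → unit i p i ≡ p
  unit-on 0F p = refl
  unit-on 1F p = refl
  unit-on 2F p = refl

  coeff-B-unit : ∀ G i p j r n → coeff (B G (unit i p) (unit j r)) n ≡ coeff (G i j *ₚ (p *ₚ r)) n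
  coeff-B-unit G i p j r n = trans (coeff-B G (unit i p) (unit j r) n) (trans
    (pick i (λ i′ → Σ₃ _+_ (λ j′ → t i′ j′)) (λ i′ ne → Σ₃-zero λ j′ → offˡ i′ j′ ne))
    (trans (pick j (t i) (λ j′ ne → offʳ i j′ ne)) (cong₂ (λ x y → coeff (G i j *ₚ (x *ₚ y)) n) (unit-on i p) (unit-on j r))))
    where
    t : Fin 3 → Fin 3 → Carrier
    t i′ j′ = coeff (G i′ j′ *ₚ (unit i p i′ *ₚ unit j r j′)) n
    offˡ : ∀ i′ j′ → i ≢ i′ → t i′ j′ ≡ 0#
    offˡ i′ j′ ne rewrite unit-off i p i′ ne = coeff₃-zero (G i′ j′) [] (unit j r j′) n (λ _ _ _ _ → inj₂ (inj₁ refl))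
    offʳ : ∀ i′ j′ → j ≢ j′ → t i′ j′ ≡ 0#
    offʳ i′ j′ ne rewrite unit-off j r j′ ne = coeff₃-zero (G i′ j′) (unit i p i′) [] n (λ _ _ _ _ → inj₂ (inj₂ refl))
    pick : ∀ i (f : Fin 3 → Carrier) → (∀ i′ → i ≢ i′ → f i′ ≡ 0#) → Σ₃ _+_ f ≡ f i
    pick 0F f z = trans (cong₂ (λ x y → f 0F + (x + y)) (z 1F (λ ())) (z 2F (λ ()))) (trans (cong (f 0F +_) (+-identityʳ 0#)) (+-identityʳ _))
    pick 1F f z = trans (cong₂ (λ x y → x + (f 1F + y)) (z 0F (λ ())) (z 2F (λ ()))) (trans (+-identityˡ _) (+-identityʳ _))
    pick 2F f z = trans (cong₂ (λ x y → x + (y + f 2F)) (z 0F (λ ())) (z 1F (λ ()))) (trans (+-identityˡ _) (+-identityˡ _))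

  B-unit-1 : ∀ G i j → B G (unit i 1ₚ) (unit j 1ₚ) ≈ₚ G i j
  B-unit-1 G i j n = trans (coeff-B-unit G i 1ₚ j 1ₚ n) (trans
    (*ₚ-cong {G i j} {G i j} {1ₚ *ₚ 1ₚ} {1ₚ} (λ _ → refl) (P.*-identityˡ 1ₚ) n) (P.*-identityʳ (G i j) n))

  slotVector : ℕ ⊎ ℕ → Triple
  slotVector (inj₁ i) = unit 0F (mono i)
  slotVector (inj₂ j) = unit 1F (mono j)

  coordinate : ℕ ⊎ ℕ → Triple → Carrier
  coordinate (inj₁ i) v = coeff (v 0F) i
  coordinate (inj₂ j) v = coeff (v 1F) j

  coordinate-+ : ∀ s u v → coordinate s (u +ᵥ v) ≡ coordinate s u + coordinate s v
  coordinate-+ (inj₁ i) u v = coeff-+ (u 0F) (v 0F) i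
  coordinate-+ (inj₂ j) u v = coeff-+ (u 1F) (v 1F) j

  coordinate-∙ : ∀ s c u → coordinate s (c ∙ u) ≡ c * coordinate s u
  coordinate-∙ (inj₁ i) c u = coeff-scale c (u 0F) i
  coordinate-∙ (inj₂ j) c u = coeff-scale c (u 1F) j

  coordinate-cong : ∀ s {u v} → u ≈ᵥ v → coordinate s u ≡ coordinate s v
  coordinate-cong (inj₁ i) e = e 0F i
  coordinate-cong (inj₂ j) e = e 1F j

  coordinate-≡ : ∀ s → coordinate s (slotVector s) ≡ 1#
  coordinate-≡ (inj₁ i) = coeff-mono-≡ i
  coordinate-≡ (inj₂ j) = coeff-mono-≡ j

  coordinate-≢ : ∀ s s′ → s ≢ s′ → coordinate s (slotVector s′) ≡ 0#
  coordinate-≢ (inj₁ i) (inj₁ i′) ne = coeff-mono-≢ i′ i (λ e → ne (cong inj₁ (sym e)))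
  coordinate-≢ (inj₁ i) (inj₂ _)  ne = refl
  coordinate-≢ (inj₂ j) (inj₁ _)  ne = refl
  coordinate-≢ (inj₂ j) (inj₂ j′) ne = coeff-mono-≢ j′ j (λ e → ne (cong inj₂ (sym e)))

  slotVector-third : ∀ s → slotVector s 2F ≡ []
  slotVector-third (inj₁ _) = refl
  slotVector-third (inj₂ _) = refl

  combination : ∀ {n} → (ℕ → Triple) → Vec Carrier n → Triple
  combination β []       _ = []
  combination β (x ∷ xs)   = x ∙ β 0 +ᵥ combination (β ∘ suc) xs

-- Finite boxes of vectors of bounded weight.

module Boxes (𝔽 : FiniteField) (odd : FiniteField.size 𝔽 ℕ.% 2 ≡ 1) (4<size : 4 < FiniteField.size 𝔽) (wts : Weights) where
  open FieldTheory 𝔽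
  open FieldCounting 𝔽 odd
  open Elimination 𝔽 odd 4<size
  open Forms 𝔽
  open Degrees 𝔽
  open Bilinear 𝔽
  open Weights wts

  β : ℕ → Triple
  β r = slotVector (slot k r)

  w : ℕ → ℕ
  w r = weight m₁ m₂ (slot k r)

  w-mono : ∀ {r s} → r < s → w r < w s
  w-mono {r} {s} lt = subst₂′ (sym (weight-slot k m₂≡ r)) (sym (weight-slot k m₂≡ s)) (slotWeight-mono k m₂≡ lt)
    where
    subst₂′ : ∀ {a b c d : ℕ} → a ≡ b → c ≡ d → a < c → b < d
    subst₂′ refl refl p = p

  w-mono-≤ : ∀ {r s} → r ≤ s → w r ≤ w s
  w-mono-≤ le with ℕₚ.m≤n⇒m<n∨m≡n le
  ... | inj₁ lt   = ℕₚ.<⇒≤ (w-mono lt)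
  ... | inj₂ refl = ℕₚ.≤-refl

  w-cancel-< : ∀ {r s} → w r < w s → r < s
  w-cancel-< {r} {s} lt with r ℕₚ.<? s
  ... | yes p = p
  ... | no np = ⊥-elim (ℕₚ.<⇒≱ lt (w-mono-≤ (ℕₚ.≮⇒≥ np)))

  slot-injective : ∀ {r s} → slot k r ≡ slot k s → r ≡ s
  slot-injective {r} {s} e = ℕₚ.≤-antisym (ℕₚ.≮⇒≥ (λ lt → ℕₚ.<⇒≢ (w-mono lt) (cong (weight m₁ m₂) (sym e))))
                                          (ℕₚ.≮⇒≥ (λ lt → ℕₚ.<⇒≢ (w-mono lt) (cong (weight m₁ m₂) e)))

  at : ∀ {n} → Vec Carrier n → ℕ → Carrier
  at []       r       = 0#
  at (x ∷ xs) zero    = x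
  at (x ∷ xs) (suc r) = at xs r

  at-≥ : ∀ {n} (xs : Vec Carrier n) r → n ≤ r → at xs r ≡ 0#
  at-≥ []       r       _        = refl
  at-≥ (x ∷ xs) (suc r) (s≤s le) = at-≥ xs r le

  at-ext : ∀ {n} (xs ys : Vec Carrier n) → (∀ r → r < n → at xs r ≡ at ys r) → xs ≡ ys
  at-ext []       []       e = refl
  at-ext (x ∷ xs) (y ∷ ys) e = cong₂ _∷_ (e 0 (s≤s z≤n)) (at-ext xs ys (λ r r<n → e (suc r) (s≤s r<n)))

  generate : ∀ n → (ℕ → Carrier) → Vec Carrier n
  generate zero    f = []
  generate (suc n) f = f 0 ∷ generate n (f ∘ suc)

  at-generate : ∀ n f r → r < n → at (generate n f) r ≡ f r
  at-generate (suc n) f zero    _         = refl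
  at-generate (suc n) f (suc r) (s≤s r<n) = at-generate n (f ∘ suc) r r<n

  dot-δ : ∀ {n} h (xs : Vec Carrier n) r → h r ≡ 1# → (∀ s → s ≢ r → h s ≡ 0#) → dot h xs ≡ at xs r
  dot-δ h []       r       one zero′ = refl
  dot-δ h (x ∷ xs) zero    one zero′ = trans (cong₂ _+_ (trans (cong (x *_) one) (*-identityʳ x))
    (all-zero xs (h ∘ suc) (λ s → zero′ (suc s) (λ ())))) (+-identityʳ x)
    where
    all-zero : ∀ {n} (xs : Vec Carrier n) h → (∀ s → h s ≡ 0#) → dot h xs ≡ 0#
    all-zero []       h z = refl
    all-zero (x ∷ xs) h z = trans (cong₂ _+_ (trans (cong (x *_) (z 0)) (zeroʳ x)) (all-zero xs (h ∘ suc) (z ∘ suc))) (+-identityʳ 0#)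
  dot-δ h (x ∷ xs) (suc r) one zero′ = trans (cong₂ _+_ (trans (cong (x *_) (zero′ 0 (λ ()))) (zeroʳ x))
    (dot-δ (h ∘ suc) xs r one (λ s ne → zero′ (suc s) (λ e → ne (ℕₚ.suc-injective e))))) (+-identityˡ _)

  coordinate-combination : ∀ s {n} γ (xs : Vec Carrier n) → coordinate s (combination γ xs) ≡ dot (λ r → coordinate s (γ r)) xs
  coordinate-combination (inj₁ i) γ [] = refl
  coordinate-combination (inj₂ j) γ [] = refl
  coordinate-combination s γ (x ∷ xs) = trans (coordinate-+ s (x ∙ γ 0) _) (cong₂ _+_ (coordinate-∙ s x (γ 0))
    (coordinate-combination s (γ ∘ suc) xs))

  third-combination : ∀ {n} γ (xs : Vec Carrier n) l → (∀ r → γ r 2F ≡ []) → coeff (combination γ xs 2F) l ≡ 0#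
  third-combination γ []       l z = refl
  third-combination γ (x ∷ xs) l z = trans (coeff-+ (map (x *_) (γ 0 2F)) _ l) (trans (cong₂ _+_
    (trans (coeff-scale x (γ 0 2F) l) (trans (cong (λ p → x * coeff p l) (z 0)) (zeroʳ x)))
    (third-combination (γ ∘ suc) xs l (z ∘ suc))) (+-identityʳ 0#))

  e₃ : Triple
  e₃ = unit 2F 1ₚ

  tail-vector : ℕ → Carrier × Carrier → Triple
  tail-vector n (ξ , c) = ξ ∙ β n +ᵥ c ∙ e₃

  -- The n lower slots are the variables to be eliminated; the pair (ξ , c), the coordinates at slot
  -- n and at v₃, is kept to the end.
  decode : ∀ n → Vec Carrier n × (Carrier × Carrier) → Triple
  decode n (xs , τ) = combination β xs +ᵥ tail-vector n τ

  δ# : ℕ → ℕ → Carrier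
  δ# r n with r ℕₚ.≟ n
  ... | yes _ = 1#
  ... | no _  = 0#

  coordinate-β : ∀ r n → coordinate (slot k r) (β n) ≡ δ# r n
  coordinate-β r n with r ℕₚ.≟ n
  ... | yes refl = coordinate-≡ (slot k r)
  ... | no r≢n   = coordinate-≢ (slot k r) (slot k n) (λ e → r≢n (slot-injective e))

  coordinate-decode : ∀ n xs ξ c r → coordinate (slot k r) (decode n (xs , (ξ , c))) ≡ at xs r + ξ * δ# r n
  coordinate-decode n xs ξ c r = trans (coordinate-+ s (combination β xs) _) (cong₂ _+_
    (trans (coordinate-combination s β xs) (dot-δ _ xs r (coordinate-≡ s) (λ s′ ne → coordinate-≢ s (slot k s′) (λ e → ne (sym (slot-injective e))))))
    (trans (coordinate-+ s (ξ ∙ β n) (c ∙ e₃)) (trans (cong₂ _+_ (trans (coordinate-∙ s ξ (β n)) (cong (ξ *_) (coordinate-β r n)))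
      (trans (coordinate-∙ s c e₃) (trans (cong (c *_) (e₃-zero s)) (zeroʳ c)))) (+-identityʳ _))))
    where
    s = slot k r
    e₃-zero : ∀ s → coordinate s e₃ ≡ 0#
    e₃-zero (inj₁ _) = refl
    e₃-zero (inj₂ _) = refl

  third-decode : ∀ n xs ξ c l → coeff (decode n (xs , (ξ , c)) 2F) l ≡ c * coeff 1ₚ l
  third-decode n xs ξ c l = trans (coeff-+ (combination β xs 2F) _ l) (trans (cong₂ _+_
    (third-combination β xs l (λ r → slotVector-third (slot k r)))
    (trans (coeff-+ (map (ξ *_) (β n 2F)) (map (c *_) 1ₚ) l) (cong₂ _+_
      (trans (coeff-scale ξ (β n 2F) l) (trans (cong (λ p → ξ * coeff p l) (slotVector-third (slot k n))) (zeroʳ ξ)))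
      (coeff-scale c 1ₚ l)))) (trans (+-identityˡ _) (+-identityˡ _)))

  δ#-refl : ∀ n → δ# n n ≡ 1#
  δ#-refl n with n ℕₚ.≟ n
  ... | yes _ = refl
  ... | no ne = ⊥-elim (ne refl)

  δ#-≢ : ∀ {r n} → r ≢ n → δ# r n ≡ 0#
  δ#-≢ {r} {n} ne with r ℕₚ.≟ n
  ... | yes e = ⊥-elim (ne e)
  ... | no _  = refl

  below-decode : ∀ n xs ξ c r → r < n → coordinate (slot k r) (decode n (xs , (ξ , c))) ≡ at xs r
  below-decode n xs ξ c r lt = trans (coordinate-decode n xs ξ c r) (trans (cong (λ d → at xs r + ξ * d) (δ#-≢ (ℕₚ.<⇒≢ lt)))
    (trans (cong (at xs r +_) (zeroʳ ξ)) (+-identityʳ _)))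

  at-decode : ∀ n xs ξ c → coordinate (slot k n) (decode n (xs , (ξ , c))) ≡ ξ
  at-decode n xs ξ c = trans (coordinate-decode n xs ξ c n) (trans (cong₂ (λ x d → x + ξ * d) (at-≥ xs n ℕₚ.≤-refl) (δ#-refl n))
    (trans (+-identityˡ _) (*-identityʳ ξ)))

  above-decode : ∀ n xs ξ c r → n < r → coordinate (slot k r) (decode n (xs , (ξ , c))) ≡ 0#
  above-decode n xs ξ c r lt = trans (coordinate-decode n xs ξ c r) (trans (cong₂ (λ x d → x + ξ * d) (at-≥ xs r (ℕₚ.<⇒≤ lt))
    (δ#-≢ (λ e → ℕₚ.<⇒≢ lt (sym e)))) (trans (+-identityˡ _) (zeroʳ ξ)))

  decode-injective : ∀ n {c c′} → decode n c ≈ᵥ decode n c′ → c ≡ c′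
  decode-injective n {xs , (ξ , c)} {xs′ , (ξ′ , c′)} e = cong₂ _,_
    (at-ext xs xs′ (λ r lt → trans (sym (below-decode n xs ξ c r lt)) (trans (coordinate-cong (slot k r) {decode n (xs , (ξ , c))} {decode n (xs′ , (ξ′ , c′))} e)
      (below-decode n xs′ ξ′ c′ r lt))))
    (cong₂ _,_ (trans (sym (at-decode n xs ξ c)) (trans (coordinate-cong (slot k n) {decode n (xs , (ξ , c))} {decode n (xs′ , (ξ′ , c′))} e) (at-decode n xs′ ξ′ c′)))
      (trans (sym (*-identityʳ c)) (trans (sym (third-decode n xs ξ c 0)) (trans (e 2F 0) (trans (third-decode n xs′ ξ′ c′ 0) (*-identityʳ c′))))))

  position : (s : ℕ ⊎ ℕ) → ∃ λ r → slot k r ≡ s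
  position (inj₁ i) = position₁ k i , slot-position₁ k i
  position (inj₂ j) = k ℕ.+ twice j , slot-position₂ k j

  bounded-coordinate : ∀ {W v} s → Bounded wts W v → W < weight m₁ m₂ s → coordinate s v ≡ 0#
  bounded-coordinate (inj₁ i) b lt = b 0F i lt
  bounded-coordinate (inj₂ j) b lt = b 1F j lt

  bounded⇒decode : ∀ n v → Bounded wts (w n) v → (∀ l → 0 < l → coeff (v 2F) l ≡ 0#) →
    v ≈ᵥ decode n (generate n (λ r → coordinate (slot k r) v) , (coordinate (slot k n) v , coeff (v 2F) 0))
  bounded⇒decode n v b third = eq
    where
    xs = generate n (λ r → coordinate (slot k r) v)
    ξ = coordinate (slot k n) v
    c = coeff (v 2F) 0
    d = decode n (xs , (ξ , c))
    by-slot : ∀ r → coordinate (slot k r) v ≡ coordinate (slot k r) d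
    by-slot r with ℕₚ.<-cmp r n
    ... | tri< lt _ _ = sym (trans (below-decode n xs ξ c r lt) (at-generate n _ r lt))

    ... | tri≈ _ refl _ = sym (at-decode n xs ξ c)
    ... | tri> _ _ gt = trans (bounded-coordinate {w n} {v} (slot k r) b (w-mono gt)) (sym (above-decode n xs ξ c r gt))
    by : ∀ s → coordinate s v ≡ coordinate s d
    by s = subst (λ s → coordinate s v ≡ coordinate s d) (proj₂ (position s)) (by-slot (proj₁ (position s)))
    eq : v ≈ᵥ d
    eq 0F i = by (inj₁ i)
    eq 1F j = by (inj₂ j)
    eq 2F zero    = sym (trans (third-decode n xs ξ c 0) (*-identityʳ c))
    eq 2F (suc l) = trans (third (suc l) (s≤s z≤n)) (sym (trans (third-decode n xs ξ c (suc l)) (zeroʳ c)))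

  decode-bounded : ∀ n xs ξ c → (w n < m₃ → c ≡ 0#) → w n ≤ m₃ → Bounded wts (w n) (decode n (xs , (ξ , c)))
  decode-bounded n xs ξ c c0 le 2F zero lt = trans (third-decode n xs ξ c 0) (trans (*-identityʳ c) (c0 (subst (w n <_) (ℕₚ.+-identityʳ m₃) lt)))
  decode-bounded n xs ξ c c0 le 2F (suc l) lt = trans (third-decode n xs ξ c (suc l)) (zeroʳ c)
  decode-bounded n xs ξ c c0 le 0F i lt = subst (λ s → w n < weight m₁ m₂ s → coordinate s (decode n (xs , (ξ , c))) ≡ 0#) (proj₂ (position (inj₁ i)))
    (λ lt → above-decode n xs ξ c (proj₁ (position (inj₁ i))) (w-cancel-< lt)) lt
  decode-bounded n xs ξ c c0 le 1F j lt = subst (λ s → w n < weight m₁ m₂ s → coordinate s (decode n (xs , (ξ , c))) ≡ 0#) (proj₂ (position (inj₂ j)))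
    (λ lt → above-decode n xs ξ c (proj₁ (position (inj₂ j))) (w-cancel-< lt)) lt

  ∈-vecs : ∀ n (xs : Vec Carrier n) → xs ∈ vecs n
  ∈-vecs zero    []       = here refl
  ∈-vecs (suc n) (x ∷ xs) = ∈-cartesianProductWith⁺ _∷_ (∈-elems x) (∈-vecs n xs)

  vecs-unique : ∀ n → Unique (vecs n)
  vecs-unique zero    = [] ∷ []
  vecs-unique (suc n) = Unique.cartesianProductWith⁺ _∷_ (λ { refl → refl , refl }) elems-unique (vecs-unique n)

  -- The list `cs` holds the admissible constant coefficients at v₃: only 0 as long as the level
  -- lies below m₃, the whole field at level m₃. One enumeration thereby serves for both levels.
  module BoxLevel (n : ℕ) (w≤m₃ : w n ≤ m₃) (cs : List Carrier) (cs-unique : Unique cs)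
    (cs-sound : ∀ c → c ∈ cs → w n < m₃ → c ≡ 0#) (cs-complete : ∀ c → (w n < m₃ → c ≡ 0#) → c ∈ cs) where

    tails : List (Carrier × Carrier)
    tails = cartesianProductWith _,_ elems cs

    codes : List (Vec Carrier n × (Carrier × Carrier))
    codes = cartesianProductWith _,_ (vecs n) tails

    codes-unique : Unique codes
    codes-unique = Unique.cartesianProductWith⁺ _,_ (λ { refl → refl , refl }) (vecs-unique n)
      (Unique.cartesianProductWith⁺ _,_ (λ { refl → refl , refl }) elems-unique cs-unique)

    open BoxSums codes codes-unique (decode n) (w n) (λ {c} {c′} → decode-injective n {c} {c′})

    in-cs : ∀ xs ξ c → (xs , (ξ , c)) ∈ codes → c ∈ cs
    in-cs xs ξ c p with ∈-cartesianProductWith⁻ _,_ (vecs n) tails p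
    ... | _ , _ , _ , q , refl with ∈-cartesianProductWith⁻ _,_ elems cs q
    ...   | _ , _ , _ , c∈ , refl = c∈

    covers : ∀ {G} → Shape wts G → Covers (λ v → B G v v)
    covers {G} sh = (λ {u} {v} e → B-cong G {u} {v} {u} {v} e e) , cover , bound
      where
      cover : ∀ v → (∀ N → w n < N → coeff (B G v v) N ≡ 0#) → ∃ λ c → c ∈ codes × v ≈ᵥ decode n c
      cover v z = (generate n (λ r → coordinate (slot k r) v) , (coordinate (slot k n) v , coeff (v 2F) 0))
        , ∈-cartesianProductWith⁺ _,_ (∈-vecs n _) (∈-cartesianProductWith⁺ _,_ (∈-elems _)
            (cs-complete _ (λ lt → b 2F 0 (subst (w n <_) (sym (ℕₚ.+-identityʳ m₃)) lt))))
        , bounded⇒decode n v b (λ { (suc l) _ → b 2F (suc l) (ℕₚ.≤-<-trans w≤m₃ (ℕₚ.m<m+n m₃ (s≤s z≤n))) })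
        where b = degree⇒bounded wts sh v (w n) z
      bound : ∀ c → c ∈ codes → ∀ N → w n < N → coeff (B G (decode n c) (decode n c)) N ≡ 0#
      bound (xs , (ξ , c)) p N lt = B-zero wts sh {decode n (xs , (ξ , c))} {decode n (xs , (ξ , c))} N b b (ℕₚ.+-mono-< lt lt)
        where b = decode-bounded n xs ξ c (cs-sound c (in-cs xs ξ c p)) w≤m₃

    -- The weight sees χ of the value together with the coefficient in the highest degree w n. Both
    -- are functions of the truncated value, so `box-sums` applies.
    level-sums : ∀ {G G′} → Shape wts G → Shape wts G′ →
      RespectsRep (λ v → B G v v) (λ v → B G′ v v) → RespectsRep (λ v → B G′ v v) (λ v → B G v v) →
      ∀ χ (f : Carrier → Carrier → ℕ) →
      N.∑ (vecs n) (λ xs → N.∑ tails (λ τ → f (ev χ (B G (decode n (xs , τ)) (decode n (xs , τ))))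
                                              (coeff (B G (decode n (xs , τ)) (decode n (xs , τ))) (w n)))) ≡
      N.∑ (vecs n) (λ xs → N.∑ tails (λ τ → f (ev χ (B G′ (decode n (xs , τ)) (decode n (xs , τ))))
                                              (coeff (B G′ (decode n (xs , τ)) (decode n (xs , τ))) (w n))))
    level-sums {G} {G′} sh sh′ to from χ f = trans (sym (expand sh)) (trans
      (box-sums {λ v → B G v v} {λ v → B G′ v v} (covers sh) (covers sh′) to from
        (λ κ → f (ev χ (Vec.toList κ)) (coeff (Vec.toList κ) (w n)))) (expand sh′))
      where
      expand : ∀ {G} → Shape wts G → N.∑ codes (λ c → f (ev χ (Vec.toList (key (suc (w n)) (B G (decode n c) (decode n c)))))
                                               (coeff (Vec.toList (key (suc (w n)) (B G (decode n c) (decode n c)))) (w n)))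
        ≡ N.∑ (vecs n) (λ xs → N.∑ tails (λ τ → f (ev χ (B G (decode n (xs , τ)) (decode n (xs , τ))))
                                              (coeff (B G (decode n (xs , τ)) (decode n (xs , τ))) (w n))))
      expand {G} sh = trans (N.∑-cong-∈ codes (λ {c} c∈ → cong₂ f
          (sym (ev-cong χ (B G (decode n c) (decode n c)) (Vec.toList (key (suc (w n)) (B G (decode n c) (decode n c)))) (faithful c c∈))) (sym (faithful c c∈ (w n)))))
        (N.∑-product _,_ (vecs n) tails _)
        where
        faithful : ∀ c → c ∈ codes → B G (decode n c) (decode n c) ≈ₚ Vec.toList (key (suc (w n)) (B G (decode n c) (decode n c)))
        faithful c c∈ = key-faithful (B G (decode n c) (decode n c)) (proj₂ (proj₂ (covers sh)) c c∈) _ refl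

    level-value : ∀ {G G′} → Shape wts G → RespectsRep (λ v → B G v v) (λ v → B G′ v v) →
      ∀ v → (∀ N → w n < N → coeff (B G v v) N ≡ 0#) → ∃ λ v′ → B G′ v′ v′ ≈ₚ B G v v
    level-value {G} {G′} sh to v z = proj₁ found , λ i → trans (proj₂ found i) (sym (faithful i))
      where
      κ : Key
      κ = key (suc (w n)) (B G v v)
      faithful : B G v v ≈ₚ Vec.toList κ
      faithful = key-faithful (B G v v) z κ refl
      found : ∃ λ v′ → B G′ v′ v′ ≈ₚ Vec.toList κ
      found = transfer-value {λ v → B G v v} {λ v → B G′ v v} {Vec.toList κ} to (box-represents (λ v → B G v v) (covers sh) κ) v faithful

-- Comparison of two reduced forms, entry by entry.

module Core (𝔽 : FiniteField) (odd : FiniteField.size 𝔽 ℕ.% 2 ≡ 1) (4<size : 4 < FiniteField.size 𝔽) (wts : Weights) where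
  open FieldTheory 𝔽
  open FieldCounting 𝔽 odd
  open Distributions 𝔽 odd
  open Elimination 𝔽 odd 4<size
  open Peeling 𝔽 odd 4<size
  open Forms 𝔽
  open Degrees 𝔽
  open Bilinear 𝔽
  open Boxes 𝔽 odd 4<size wts
  open Weights wts
  open ≡-Reasoning

  dot-local : ∀ {n} {h h′ : Vector} (xs : Vec Carrier n) → (∀ j → j < n → h j ≡ h′ j) → dot h xs ≡ dot h′ xs
  dot-local []       e = refl
  dot-local (x ∷ xs) e = cong₂ _+_ (cong (x *_) (e 0 (s≤s z≤n))) (dot-local xs (λ j lt → e (suc j) (s≤s lt)))

  quad-local : ∀ {n} {M M′ : Matrix} (xs : Vec Carrier n) → (∀ j l → j < n → l < n → M j l ≡ M′ j l) → quad M xs ≡ quad M′ xs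
  quad-local []       e = refl
  quad-local {M = M} {M′} (x ∷ xs) e = cong₂ _+_
    (cong₂ (λ a d → a * (x * x) + (x * d + x * d)) (e 0 0 (s≤s z≤n) (s≤s z≤n))
      (dot-local {h = M 0 ∘ suc} {M′ 0 ∘ suc} xs (λ j lt → e 0 (suc j) (s≤s z≤n) (s≤s lt))))
    (quad-local xs (λ j l lt lt′ → e (suc j) (suc l) (s≤s lt) (s≤s lt′)))

  entry-linear : ∀ s M (h h′ : Vector) x y → entry s M (λ j → x * h j + y * h′ j) ≡ x * entry s M h + y * entry s M h′
  entry-linear zero    M h h′ x y = refl
  entry-linear (suc s) M h h′ x y = trans
    (entry-local s (schur M) {λ j → x * schurᵥ M h j + y * schurᵥ M h′ j} {schurᵥ M (λ j → x * h j + y * h′ j)} (λ j _ →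
      solve 8 (λ x y a b m c d i → (x :* a :+ y :* b) :+ :- (m :* (x :* c :+ y :* d) :* i)
        := x :* (a :+ :- (m :* c :* i)) :+ y :* (b :+ :- (m :* d :* i))) refl
        x y (h (suc j)) (h′ (suc j)) (M 0 (suc j)) (h 0) (h′ 0) (inv (M 0 0))))
    (entry-linear s (schur M) (schurᵥ M h) (schurᵥ M h′) x y)
    where open F-solver

  correction-linear : ∀ n M (h h′ : Vector) x y → let f = λ j → x * h j + y * h′ j in
    correction n M f f ≡ correction n M h h * (x * x) + (correction n M h h′ + correction n M h h′) * (x * y) + correction n M h′ h′ * (y * y)
  correction-linear zero    M h h′ x y = solve 3 (λ a b c → con (ℤ.+ 0) := con (ℤ.+ 0) :* a :+ (con (ℤ.+ 0) :+ con (ℤ.+ 0)) :* b :+ con (ℤ.+ 0) :* c)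
      refl (x * x) (x * y) (y * y)
    where open F-solver
          import Data.Integer as ℤ
  correction-linear (suc n) M h h′ x y = trans
    (cong₂ (λ s t → s + t * t * inv (pivot n M)) (correction-linear n M h h′ x y) (entry-linear n M h h′ x y))
    (solve 8 (λ p q r e f i x y → (p :* (x :* x) :+ (q :+ q) :* (x :* y) :+ r :* (y :* y)) :+ (x :* e :+ y :* f) :* (x :* e :+ y :* f) :* i
       := (p :+ e :* e :* i) :* (x :* x) :+ ((q :+ e :* f :* i) :+ (q :+ e :* f :* i)) :* (x :* y) :+ (r :+ f :* f :* i) :* (y :* y)) refl
      (correction n M h h) (correction n M h h′) (correction n M h′ h′) (entry n M h) (entry n M h′) (inv (pivot n M)) x y)
    where open F-solver

  module Functionals {G : Gram} (G-sym : ∀ i j → G i j ≈ₚ G j i) (χ : Functional) where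
    ⟪_,_⟫ : Triple → Triple → Carrier
    ⟪ u , v ⟫ = ev χ (B G u v)

    ⟪⟫-sym : ∀ u v → ⟪ u , v ⟫ ≡ ⟪ v , u ⟫
    ⟪⟫-sym u v = ev-cong χ (B G u v) (B G v u) (B-sym {G} G-sym u v)

    ⟪⟫-+ˡ : ∀ u u′ v → ⟪ u +ᵥ u′ , v ⟫ ≡ ⟪ u , v ⟫ + ⟪ u′ , v ⟫
    ⟪⟫-+ˡ u u′ v = trans (ev-cong χ (B G (u +ᵥ u′) v) (B G u v +ₚ B G u′ v) (B-+ˡ G u u′ v)) (ev-+ χ (B G u v) (B G u′ v))

    ⟪⟫-∙ˡ : ∀ c u v → ⟪ c ∙ u , v ⟫ ≡ c * ⟪ u , v ⟫
    ⟪⟫-∙ˡ c u v = trans (ev-cong χ (B G (c ∙ u) v) (map (c *_) (B G u v)) (B-∙ˡ G c u v)) (ev-scale χ c (B G u v))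

    ⟪⟫-+ʳ : ∀ u v v′ → ⟪ u , v +ᵥ v′ ⟫ ≡ ⟪ u , v ⟫ + ⟪ u , v′ ⟫
    ⟪⟫-+ʳ u v v′ = trans (⟪⟫-sym u (v +ᵥ v′)) (trans (⟪⟫-+ˡ v v′ u) (cong₂ _+_ (⟪⟫-sym v u) (⟪⟫-sym v′ u)))

    ⟪⟫-∙ʳ : ∀ c u v → ⟪ u , c ∙ v ⟫ ≡ c * ⟪ u , v ⟫
    ⟪⟫-∙ʳ c u v = trans (⟪⟫-sym u (c ∙ v)) (trans (⟪⟫-∙ˡ c v u) (cong (c *_) (⟪⟫-sym v u)))

    ⟪⟫-square : ∀ c u v → ⟪ c ∙ u +ᵥ v , c ∙ u +ᵥ v ⟫ ≡ ⟪ u , u ⟫ * (c * c) + (c * ⟪ v , u ⟫ + c * ⟪ v , u ⟫) + ⟪ v , v ⟫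
    ⟪⟫-square c u v = begin
      ⟪ c ∙ u +ᵥ v , c ∙ u +ᵥ v ⟫
        ≡⟨ trans (⟪⟫-+ˡ (c ∙ u) v (c ∙ u +ᵥ v)) (cong₂ _+_ (trans (⟪⟫-∙ˡ c u (c ∙ u +ᵥ v)) (cong (c *_) (⟪⟫-+ʳ u (c ∙ u) v))) (⟪⟫-+ʳ v (c ∙ u) v)) ⟩
      c * (⟪ u , c ∙ u ⟫ + ⟪ u , v ⟫) + (⟪ v , c ∙ u ⟫ + ⟪ v , v ⟫)
        ≡⟨ cong₂ (λ s t → c * s + (t + ⟪ v , v ⟫)) (cong₂ _+_ (⟪⟫-∙ʳ c u u) (⟪⟫-sym u v)) (⟪⟫-∙ʳ c v u) ⟩
      c * (c * ⟪ u , u ⟫ + ⟪ v , u ⟫) + (c * ⟪ v , u ⟫ + ⟪ v , v ⟫)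
        ≡⟨ solve 4 (λ c a b d → c :* (c :* a :+ b) :+ (c :* b :+ d) := a :* (c :* c) :+ (c :* b :+ c :* b) :+ d) refl c ⟪ u , u ⟫ ⟪ v , u ⟫ ⟪ v , v ⟫ ⟩
      ⟪ u , u ⟫ * (c * c) + (c * ⟪ v , u ⟫ + c * ⟪ v , u ⟫) + ⟪ v , v ⟫ ∎
      where open F-solver

    ⟪⟫-zeroˡ : ∀ v → ⟪ (λ _ → []) , v ⟫ ≡ 0#
    ⟪⟫-zeroˡ v = ev-0 χ (B G (λ _ → []) v) (λ n → trans (coeff-B G (λ _ → []) v n)
      (Σ₃-zero {λ i → Σ₃ _+_ (λ j → coeff (G i j *ₚ ([] *ₚ v j)) n)}
        (λ i → Σ₃-zero {λ j → coeff (G i j *ₚ ([] *ₚ v j)) n} λ j → coeff₃-zero (G i j) [] (v j) n (λ _ _ _ _ → inj₂ (inj₁ refl)))))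

    combination-⟪⟫ : ∀ {n} γ (xs : Vec Carrier n) v → ⟪ combination γ xs , v ⟫ ≡ dot (λ j → ⟪ γ j , v ⟫) xs
    combination-⟪⟫ γ []       v = ⟪⟫-zeroˡ v
    combination-⟪⟫ γ (x ∷ xs) v = trans (⟪⟫-+ˡ (x ∙ γ 0) (combination (γ ∘ suc) xs) v)
      (cong₂ _+_ (⟪⟫-∙ˡ x (γ 0) v) (combination-⟪⟫ (γ ∘ suc) xs v))

    combination-quad : ∀ {n} γ (xs : Vec Carrier n) → ⟪ combination γ xs , combination γ xs ⟫ ≡ quad (λ j l → ⟪ γ j , γ l ⟫) xs
    combination-quad γ []       = ⟪⟫-zeroˡ (λ _ → [])
    combination-quad γ (x ∷ xs) = trans (⟪⟫-square x (γ 0) (combination (γ ∘ suc) xs)) (cong₂ _+_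
      (cong (λ d → ⟪ γ 0 , γ 0 ⟫ * (x * x) + (x * d + x * d))
        (trans (combination-⟪⟫ (γ ∘ suc) xs (γ 0)) (dot-cong (λ j → ⟪⟫-sym (γ (suc j)) (γ 0)) xs)))
      (combination-quad (γ ∘ suc) xs))

    combination-form : ∀ {n} γ (xs : Vec Carrier n) v →
      ⟪ combination γ xs +ᵥ v , combination γ xs +ᵥ v ⟫ ≡ form (λ j l → ⟪ γ j , γ l ⟫) (λ j → ⟪ γ j , v ⟫) ⟪ v , v ⟫ xs
    combination-form γ xs v = begin
      ⟪ c +ᵥ v , c +ᵥ v ⟫
        ≡⟨ trans (⟪⟫-+ˡ c v (c +ᵥ v)) (cong₂ _+_ (⟪⟫-+ʳ c c v) (trans (⟪⟫-+ʳ v c v) (cong (_+ ⟪ v , v ⟫) (⟪⟫-sym v c)))) ⟩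
      (⟪ c , c ⟫ + ⟪ c , v ⟫) + (⟪ c , v ⟫ + ⟪ v , v ⟫)
        ≡⟨ solve 3 (λ a b d → (a :+ b) :+ (b :+ d) := a :+ (b :+ b) :+ d) refl ⟪ c , c ⟫ ⟪ c , v ⟫ ⟪ v , v ⟫ ⟩
      ⟪ c , c ⟫ + (⟪ c , v ⟫ + ⟪ c , v ⟫) + ⟪ v , v ⟫
        ≡⟨ cong₂ (λ q d → q + (d + d) + ⟪ v , v ⟫) (combination-quad γ xs) (combination-⟪⟫ γ xs v) ⟩
      form (λ j l → ⟪ γ j , γ l ⟫) (λ j → ⟪ γ j , v ⟫) ⟪ v , v ⟫ xs ∎
      where
      open F-solver
      c = combination γ xs

    tail-form : ∀ n ξ c → let τ = tail-vector n (ξ , c) in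
      ⟪ τ , τ ⟫ ≡ ⟪ β n , β n ⟫ * (ξ * ξ) + (⟪ β n , e₃ ⟫ + ⟪ β n , e₃ ⟫) * (ξ * c) + ⟪ e₃ , e₃ ⟫ * (c * c)
    tail-form n ξ c = trans (⟪⟫-square ξ (β n) (c ∙ e₃)) (trans
      (cong₂ (λ s t → ⟪ β n , β n ⟫ * (ξ * ξ) + (ξ * s + ξ * s) + t)
        (trans (⟪⟫-∙ˡ c e₃ (β n)) (cong (c *_) (⟪⟫-sym e₃ (β n)))) (trans (⟪⟫-∙ˡ c e₃ (c ∙ e₃)) (cong (c *_) (⟪⟫-∙ʳ c e₃ e₃))))
      (solve 5 (λ p q r x c → p :* (x :* x) :+ (x :* (c :* q) :+ x :* (c :* q)) :+ c :* (c :* r)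
        := p :* (x :* x) :+ (q :+ q) :* (x :* c) :+ r :* (c :* c)) refl ⟪ β n , β n ⟫ ⟪ β n , e₃ ⟫ ⟪ e₃ , e₃ ⟫ ξ c))
      where open F-solver

    tail-row : ∀ n ξ c j → ⟪ β j , tail-vector n (ξ , c) ⟫ ≡ ξ * ⟪ β j , β n ⟫ + c * ⟪ β j , e₃ ⟫
    tail-row n ξ c j = trans (⟪⟫-+ʳ (β j) (ξ ∙ β n) (c ∙ e₃)) (cong₂ _+_ (⟪⟫-∙ʳ ξ (β j) (β n)) (⟪⟫-∙ʳ c (β j) e₃))

    -- The Schur complement of the pairing against the span of the first n slots. The matrix M is a
    -- parameter because both forms are reduced with the same one, their Gram matrices on these
    -- slots being equal.
    residue : ℕ → Matrix → (u v : Triple) → Carrier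
    residue n M u v = ⟪ u , v ⟫ + - correction n M (λ j → ⟪ β j , u ⟫) (λ j → ⟪ β j , v ⟫)

    tail-residue : ∀ n M ξ c → let τ = tail-vector n (ξ , c) in
      residue n M τ τ ≡ residue n M (β n) (β n) * (ξ * ξ) + (residue n M (β n) e₃ + residue n M (β n) e₃) * (ξ * c) + residue n M e₃ e₃ * (c * c)
    tail-residue n M ξ c = trans (cong₂ (λ s t → s + - t) (tail-form n ξ c) (trans
        (trans (correction-local n M (λ j → ⟪ β j , τ ⟫) {λ j → ξ * ⟪ β j , β n ⟫ + c * ⟪ β j , e₃ ⟫} (λ j _ → tail-row n ξ c j))
          (correction-localˡ {n} {λ j → ξ * ⟪ β j , β n ⟫ + c * ⟪ β j , e₃ ⟫} {λ j → ⟪ β j , τ ⟫} {λ j → ξ * ⟪ β j , β n ⟫ + c * ⟪ β j , e₃ ⟫} (λ j → tail-row n ξ c j)))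
        (correction-linear n M (λ j → ⟪ β j , β n ⟫) (λ j → ⟪ β j , e₃ ⟫) ξ c)))
      (solve 9 (λ a b d p q r x y z → (a :* x :+ (b :+ b) :* y :+ d :* z) :+ :- (p :* x :+ (q :+ q) :* y :+ r :* z)
        := (a :+ :- p) :* x :+ ((b :+ :- q) :+ (b :+ :- q)) :* y :+ (d :+ :- r) :* z) refl
        ⟪ β n , β n ⟫ ⟪ β n , e₃ ⟫ ⟪ e₃ , e₃ ⟫ (correction n M (λ j → ⟪ β j , β n ⟫) (λ j → ⟪ β j , β n ⟫))
        (correction n M (λ j → ⟪ β j , β n ⟫) (λ j → ⟪ β j , e₃ ⟫)) (correction n M (λ j → ⟪ β j , e₃ ⟫) (λ j → ⟪ β j , e₃ ⟫))
        (ξ * ξ) (ξ * c) (c * c))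
      where
      open F-solver
      τ = tail-vector n (ξ , c)
      correction-localˡ : ∀ {n h h′ k} → (∀ j → h′ j ≡ h j) → correction n M h′ k ≡ correction n M h k
      correction-localˡ {zero}  e = refl
      correction-localˡ {suc n} {h} {h′} {k} e = cong₂ (λ x y → x + y * entry n M k * inv (pivot n M)) (correction-localˡ {n} {h} {h′} {k} e)
        (entry-local n M {h} {h′} (λ j _ → e j))

  slotVector-bounded : ∀ s → Bounded wts (weight m₁ m₂ s) (slotVector s)
  slotVector-bounded (inj₁ i) 0F l lt = coeff-mono-≢ i l (λ { refl → ℕₚ.<-irrefl refl lt })
  slotVector-bounded (inj₁ i) 1F l lt = refl
  slotVector-bounded (inj₁ i) 2F l lt = refl
  slotVector-bounded (inj₂ j) 0F l lt = refl
  slotVector-bounded (inj₂ j) 1F l lt = coeff-mono-≢ j l (λ { refl → ℕₚ.<-irrefl refl lt })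
  slotVector-bounded (inj₂ j) 2F l lt = refl

  gramOfSlots : Gram → ℕ → ℕ → Poly
  gramOfSlots G j l = B G (β j) (β l)

  module _ {G : Gram} (sh : Shape wts G) where
    open Shape sh

    -- A pairing of weights w j and w l has degree at most their mean, which lies below w i as soon
    -- as one index is smaller than i.
    slots-off : ∀ n i → i < n → ∀ j l → j ≤ i → l ≤ i → j < i ⊎ l < i → coeff (gramOfSlots G j l) (w i) ≡ 0#
    slots-off n i _ j l j≤ l≤ lt = B-zero wts sh {β j} {β l} (w i) (slotVector-bounded (slot k j)) (slotVector-bounded (slot k l)) (sum lt)
      where
      sum : j < i ⊎ l < i → w j ℕ.+ w l < w i ℕ.+ w i
      sum (inj₁ lt) = ℕₚ.+-mono-<-≤ (w-mono lt) (w-mono-≤ l≤)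
      sum (inj₂ lt) = ℕₚ.+-mono-≤-< (w-mono-≤ j≤) (w-mono lt)

    slots-diagonal : ∀ n i → i < n → coeff (gramOfSlots G i i) (w i) ≢ 0#
    slots-diagonal n i _ = go (slot k i)
      where
      lead-mono : ∀ h j → coeff (B G (unit h (mono j)) (unit h (mono j))) (μ h ℕ.+ (j ℕ.+ j)) ≡ lead h * (1# * 1#)
      lead-mono h j = trans (coeff-B-unit G h (mono j) h (mono j) _) (trans
        (coeff₃-lead (G h h) (mono j) (μ h) j (degree h) (λ l lt → coeff-mono-≢ j l (ℕₚ.<⇒≢ lt)))
        (cong (λ x → lead h * (x * x)) (coeff-mono-≡ j)))
      1*1≢0 : ∀ {x} → x ≢ 0# → x * (1# * 1#) ≢ 0#
      1*1≢0 {x} ne e = ne (trans (sym (trans (cong (x *_) (*-identityˡ 1#)) (*-identityʳ x))) e)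
      go : ∀ s → coeff (B G (slotVector s) (slotVector s)) (weight m₁ m₂ s) ≢ 0#
      go (inj₁ j) e = 1*1≢0 (lead≢0 0F) (trans (sym (lead-mono 0F j)) e)
      go (inj₂ j) e = 1*1≢0 (lead≢0 1F) (trans (sym (lead-mono 1F j)) e)

    row-degree : ∀ {h h′ b} i N → (∀ n → b ≤ n → coeff (G h h′) n ≡ 0#) → b ℕ.+ (i ℕ.+ i) ≤ N →
                 coeff (B G (unit h (mono i)) (unit h′ 1ₚ)) N ≡ 0#
    row-degree {h} {h′} {b} i N deg le = trans (coeff-B-unit G h (mono i) h′ 1ₚ N) (coeff₃-zero (G h h′) (mono i) 1ₚ N case)
      where
      case : ∀ a l l′ → a ℕ.+ (l ℕ.+ l′) ≡ N → coeff (G h h′) a ≡ 0# ⊎ coeff (mono i) l ≡ 0# ⊎ coeff 1ₚ l′ ≡ 0#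
      case a l (suc l′) e = inj₂ (inj₂ refl)
      case a l zero e with i ℕₚ.≟ l
      ... | no ne = inj₂ (inj₁ (coeff-mono-≢ i l ne))
      ... | yes refl = inj₁ (deg a (ℕₚ.+-cancelʳ-≤ i b a (ℕₚ.≤-trans (ℕₚ.+-monoʳ-≤ b (ℕₚ.m≤m+n i i))
              (ℕₚ.≤-trans le (ℕₚ.≤-reflexive (sym (trans (cong (a ℕ.+_) (sym (ℕₚ.+-identityʳ i))) e)))))))

    -- Reducedness bounds the degree of B(tᵖvⱼ , v₃) strictly by μⱼ + p, hence by the weight μⱼ +
    -- 2p, however large the weight of v₃ is. The mean of the weights would not be good enough here.
    third-row-degree : ∀ n i → i < n → ∀ j → j ≤ i → coeff (B G (β j) e₃) (w i) ≡ 0#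
    third-row-degree n i _ j j≤ = go (slot k j) (w-mono-≤ j≤)
      where
      go : ∀ s → weight m₁ m₂ s ≤ w i → coeff (B G (slotVector s) e₃) (w i) ≡ 0#
      go (inj₁ p) le = row-degree {0F} {2F} p (w i) degree₀₂ le
      go (inj₂ p) le = row-degree {1F} {2F} p (w i) degree₁₂ le

  slot-k : slot k k ≡ inj₂ 0
  slot-k = subst (λ r → slot k r ≡ inj₂ 0) (ℕₚ.+-identityʳ k) (slot-position₂ k 0)

  slot-0 : slot k 0 ≡ inj₁ 0
  slot-0 = slot-initial k 0 0<k

  β-k : β k ≡ unit 1F 1ₚ
  β-k = cong slotVector slot-k

  β-0 : β 0 ≡ unit 0F 1ₚ
  β-0 = cong slotVector slot-0

  w-k : w k ≡ m₂
  w-k = trans (cong (weight m₁ m₂) slot-k) (ℕₚ.+-identityʳ m₂)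

  second-row-degree : ∀ {G} → Shape wts G → ∀ i → i < k → ∀ j → j ≤ i → coeff (gramOfSlots G j k) (w i) ≡ 0#
  second-row-degree {G} sh i i<k j j≤ = subst (λ v → coeff (B G (β j) v) (w i) ≡ 0#) (sym β-k)
    (subst (λ s → coeff (B G (slotVector s) (unit 1F 1ₚ)) (w i) ≡ 0#) (sym (slot-initial k j (ℕₚ.≤-<-trans j≤ i<k)))
      (row-degree sh {0F} {1F} j (w i) (Shape.degree₀₁ sh)
        (subst (_≤ w i) (cong (weight m₁ m₂) (slot-initial k j (ℕₚ.≤-<-trans j≤ i<k))) (w-mono-≤ j≤))))

  module _ {G G′ : Gram} (sh : Shape wts G) (sh′ : Shape wts G′)
    (to : RespectsRep (λ v → B G v v) (λ v → B G′ v v)) (from : RespectsRep (λ v → B G′ v v) (λ v → B G v v)) where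
    private
      module Sh = Shape sh
      module Sh′ = Shape sh′

    -- The forms share the Gram matrix of the lower slots (`base`) and the top coefficient on the
    -- box (`top`). Eliminating the lower slots leaves two quadratic forms in (ξ , c) with the same
    -- joint distribution with `top`.
    module Eliminated (n : ℕ) (w≤m₃ : w n ≤ m₃) (cs : List Carrier) (cs-unique : Unique cs)
      (cs-sound : ∀ c → c ∈ cs → w n < m₃ → c ≡ 0#) (cs-complete : ∀ c → (w n < m₃ → c ≡ 0#) → c ∈ cs)
      (base : ∀ j l → j < n → l < n → gramOfSlots G′ j l ≈ₚ gramOfSlots G j l)
      (top : Carrier → Carrier → Carrier)
      (top-G  : ∀ xs ξ c → c ∈ cs → coeff (B G (decode n (xs , (ξ , c))) (decode n (xs , (ξ , c)))) (w n) ≡ top ξ c)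
      (top-G′ : ∀ xs ξ c → c ∈ cs → coeff (B G′ (decode n (xs , (ξ , c))) (decode n (xs , (ξ , c)))) (w n) ≡ top ξ c)
      (χ : Functional) where

      open BoxLevel n w≤m₃ cs cs-unique cs-sound cs-complete
      module Fn = Functionals {G} Sh.symmetric χ
      module Fn′ = Functionals {G′} Sh′.symmetric χ

      M : Matrix
      M j l = ev χ (gramOfSlots G j l)

      private
        quadratic : (p q r : Carrier) → Carrier → Carrier → Carrier
        quadratic p q r ξ c = p * (ξ * ξ) + (q + q) * (ξ * c) + r * (c * c)

        topτ : Carrier × Carrier → Carrier
        topτ (ξ , c) = top ξ c

        in-cs′ : ∀ {ξ c} → (ξ , c) ∈ tails → c ∈ cs
        in-cs′ p with ∈-cartesianProductWith⁻ _,_ elems cs p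
        ... | _ , _ , _ , c∈ , refl = c∈

      residues : (∀ i → i < n → pivot i M ≢ 0#) → (f : Carrier → Carrier → ℕ) →
        N.∑ elems (λ ξ → N.∑ cs (λ c → f (quadratic (Fn.residue n M (β n) (β n)) (Fn.residue n M (β n) e₃) (Fn.residue n M e₃ e₃) ξ c) (top ξ c))) ≡
        N.∑ elems (λ ξ → N.∑ cs (λ c → f (quadratic (Fn′.residue n M (β n) (β n)) (Fn′.residue n M (β n) e₃) (Fn′.residue n M e₃ e₃) ξ c) (top ξ c)))
      residues piv f = begin
        N.∑ elems (λ ξ → N.∑ cs (λ c → f (quadratic _ _ _ ξ c) (top ξ c)))
          ≡⟨ sym (N.∑-product _,_ elems cs _) ⟩
        N.∑ tails (λ τ → f (quadratic (Fn.residue n M (β n) (β n)) (Fn.residue n M (β n) e₃) (Fn.residue n M e₃ e₃) (proj₁ τ) (proj₂ τ)) (topτ τ))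
          ≡⟨ N.∑-cong tails (λ { (ξ , c) → cong (λ s → f s (top ξ c)) (sym (Fn.tail-residue n M ξ c)) }) ⟩
        N.∑ tails (λ τ → f (Fn.residue n M (tail-vector n τ) (tail-vector n τ)) (topτ τ))
          ≡⟨ eliminate n M tails {h = λ τ j → Fn.⟪ β j , tail-vector n τ ⟫} {h′ = λ τ j → Fn′.⟪ β j , tail-vector n τ ⟫}
               {κ = λ τ → Fn.⟪ tail-vector n τ , tail-vector n τ ⟫} {κ′ = λ τ → Fn′.⟪ tail-vector n τ , tail-vector n τ ⟫}
               {z = topτ} {z′ = topτ} piv (λ f → trans (sym (values f)) (trans (level-sums sh sh′ to from χ f) (values′ f))) f ⟩
        N.∑ tails (λ τ → f (Fn′.residue n M (tail-vector n τ) (tail-vector n τ)) (topτ τ))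
          ≡⟨ N.∑-cong tails (λ { (ξ , c) → cong (λ s → f s (top ξ c)) (Fn′.tail-residue n M ξ c) }) ⟩
        N.∑ tails (λ τ → f (quadratic (Fn′.residue n M (β n) (β n)) (Fn′.residue n M (β n) e₃) (Fn′.residue n M e₃ e₃) (proj₁ τ) (proj₂ τ)) (topτ τ))
          ≡⟨ N.∑-product _,_ elems cs _ ⟩
        N.∑ elems (λ ξ → N.∑ cs (λ c → f (quadratic _ _ _ ξ c) (top ξ c))) ∎
        where
        values : ∀ f → N.∑ (vecs n) (λ xs → N.∑ tails (λ τ → f (ev χ (B G (decode n (xs , τ)) (decode n (xs , τ))))
                                              (coeff (B G (decode n (xs , τ)) (decode n (xs , τ))) (w n))))
          ≡ N.∑ (vecs n) (λ xs → N.∑ tails (λ τ → f (form M (λ j → Fn.⟪ β j , tail-vector n τ ⟫) Fn.⟪ tail-vector n τ , tail-vector n τ ⟫ xs) (topτ τ)))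
        values f = N.∑-cong (vecs n) λ xs → N.∑-cong-∈ tails λ { {ξ , c} τ∈ → cong₂ f
          (Fn.combination-form β xs (tail-vector n (ξ , c))) (top-G xs ξ c (in-cs′ τ∈)) }
        values′ : ∀ f → N.∑ (vecs n) (λ xs → N.∑ tails (λ τ → f (ev χ (B G′ (decode n (xs , τ)) (decode n (xs , τ))))
                                              (coeff (B G′ (decode n (xs , τ)) (decode n (xs , τ))) (w n))))
          ≡ N.∑ (vecs n) (λ xs → N.∑ tails (λ τ → f (form M (λ j → Fn′.⟪ β j , tail-vector n τ ⟫) Fn′.⟪ tail-vector n τ , tail-vector n τ ⟫ xs) (topτ τ)))
        values′ f = N.∑-cong (vecs n) λ xs → N.∑-cong-∈ tails λ { {ξ , c} τ∈ → cong₂ f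
          (trans (Fn′.combination-form β xs (tail-vector n (ξ , c))) (cong (λ q → q + (dot (λ j → Fn′.⟪ β j , tail-vector n (ξ , c) ⟫) xs
              + dot (λ j → Fn′.⟪ β j , tail-vector n (ξ , c) ⟫) xs) + Fn′.⟪ tail-vector n (ξ , c) , tail-vector n (ξ , c) ⟫)
            (quad-local xs (λ j l j< l< → ev-cong χ (gramOfSlots G′ j l) (gramOfSlots G j l) (base j l j< l<)))))
          (top-G′ xs ξ c (in-cs′ τ∈)) }

    private
      N-∑-≥ : ∀ {A : Set} {x : A} xs (f : A → ℕ) → x ∈ xs → f x ≤ N.∑ xs f
      N-∑-≥ (x ∷ xs) f (here refl) = ℕₚ.m≤m+n _ _
      N-∑-≥ (y ∷ xs) f (there x∈)  = ℕₚ.≤-trans (N-∑-≥ xs f x∈) (ℕₚ.m≤n+m _ (f y))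

    -- At level k the lower slots are the tⁱv₁ with i < k, whose Gram matrix is known from a, and
    -- the top slot is v₂. Since m₂ < m₃, only c = 0 occurs and the top coefficient is d₀ξ².
    module SecondMinimum (a≈ : G 0F 0F ≈ₚ G′ 0F 0F) (lead₁ : Sh.lead 1F ≡ Sh′.lead 1F) where
      private
        base : ∀ j l → j < k → l < k → gramOfSlots G′ j l ≈ₚ gramOfSlots G j l
        base j l j< l< n = subst (λ u → coeff (B G′ (β j) u) n ≡ coeff (B G (β j) u) n) (sym (cong slotVector (slot-initial k l l<)))
          (subst (λ u → coeff (B G′ u (unit 0F (mono l))) n ≡ coeff (B G u (unit 0F (mono l))) n) (sym (cong slotVector (slot-initial k j j<)))
            (trans (coeff-B-unit G′ 0F (mono j) 0F (mono l) n) (trans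
              (*ₚ-cong {G′ 0F 0F} {G 0F 0F} {mono j *ₚ mono l} {mono j *ₚ mono l} (λ i → sym (a≈ i)) (λ _ → refl) n)
              (sym (coeff-B-unit G 0F (mono j) 0F (mono l) n)))))

        wk<m₃ : w k < m₃
        wk<m₃ = subst (_< m₃) (sym w-k) m₂<m₃

        top-value : ∀ {G} (sh : Shape wts G) xs ξ c → c ∈ (0# ∷ []) →
          coeff (B G (decode k (xs , (ξ , c))) (decode k (xs , (ξ , c)))) (w k) ≡ Shape.lead sh 1F * (ξ * ξ)
        top-value sh xs ξ c (here refl) = trans (B-top wts sh {v} b) (trans
          (cong₂ (λ x y → x + (diagonal wts sh v (w k) 1F + y))
            (diagonal-none wts sh {v} 0F b (λ i e → parity₁₂ i 0 (trans (sym e) (trans w-k (sym (ℕₚ.+-identityʳ m₂))))))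
            (diagonal-none wts sh {v} 2F b (λ i e → parity₁₂ (ℓ ℕ.+ i) 0 (trans (sym (m₃-shift i)) (trans (sym e) (trans w-k (sym (ℕₚ.+-identityʳ m₂))))))))
          (trans (+-identityˡ _) (trans (+-identityʳ _) (trans
            (diagonal-lead wts sh {v} 1F 0 b (trans w-k (sym (ℕₚ.+-identityʳ m₂))))
            (cong (λ x → Shape.lead sh 1F * (x * x)) (subst (λ s → coordinate s v ≡ ξ) slot-k (at-decode k xs ξ 0#)))))))
          where
          v = decode k (xs , (ξ , 0#))
          b = decode-bounded k xs ξ 0# (λ _ → refl) (ℕₚ.<⇒≤ wk<m₃)

        only-zero : ∀ c → c ∈ (0# ∷ []) → w k < m₃ → c ≡ 0#
        only-zero _ (here refl) _ = refl

        module E = Eliminated k (ℕₚ.<⇒≤ wk<m₃) (0# ∷ []) ([] ∷ []) only-zero (λ c h → here (h wk<m₃))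
          base (λ ξ c → Sh.lead 1F * (ξ * ξ)) (top-value sh) (λ xs ξ c c∈ → trans (top-value sh′ xs ξ c c∈) (cong (_* (ξ * ξ)) (sym lead₁)))

        -- The label d₀ξ² = d₀ forces ξ² = 1, where the value is the residue itself. Tested with the
        -- indicator of (p , d₀), the first form counts at least one, while a different residue p′
        -- would leave nothing to count.
        residue≡ : ∀ χ → (∀ i → i < k → pivot i (E.M χ) ≢ 0#) →
          E.Fn.residue χ k (E.M χ) (β k) (β k) ≡ E.Fn′.residue χ k (E.M χ) (β k) (β k)
        residue≡ χ piv with E.Fn.residue χ k (E.M χ) (β k) (β k) ≟ E.Fn′.residue χ k (E.M χ) (β k) (β k)
        ... | yes e = e
        ... | no ne = ⊥-elim (ℕₚ.<⇒≱ {0} {1} (s≤s z≤n) (subst₂′ hit (trans (E.residues χ piv f) miss)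
                (N-∑-≥ elems (λ ξ → N.∑ (0# ∷ []) (λ c → f (p * (ξ * ξ) + (q + q) * (ξ * c) + r * (c * c)) (Sh.lead 1F * (ξ * ξ)))) (∈-elems 1#))))
          where
          subst₂′ : ∀ {a b c d : ℕ} → a ≡ b → c ≡ d → a ≤ c → b ≤ d
          subst₂′ refl refl x = x
          p = E.Fn.residue χ k (E.M χ) (β k) (β k)
          q = E.Fn.residue χ k (E.M χ) (β k) e₃
          r = E.Fn.residue χ k (E.M χ) e₃ e₃
          p′ = E.Fn′.residue χ k (E.M χ) (β k) (β k)
          q′ = E.Fn′.residue χ k (E.M χ) (β k) e₃
          r′ = E.Fn′.residue χ k (E.M χ) e₃ e₃
          f : Carrier → Carrier → ℕ
          f s t = N.select _≟_ t (Sh.lead 1F) (N.select _≟_ s p 1)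
          simplify : ∀ p q r ξ → p * (ξ * ξ) + (q + q) * (ξ * 0#) + r * (0# * 0#) ≡ p * (ξ * ξ)
          simplify p q r ξ = trans (cong₂ (λ x y → p * (ξ * ξ) + x + y) (trans (cong ((q + q) *_) (zeroʳ ξ)) (zeroʳ _))
            (trans (cong (r *_) (zeroˡ 0#)) (zeroʳ r))) (trans (+-identityʳ _) (+-identityʳ _))
          x1 : ∀ x → x * (1# * 1#) ≡ x
          x1 x = trans (cong (x *_) (*-identityˡ 1#)) (*-identityʳ x)
          hit : N.∑ (0# ∷ []) (λ c → f (p * (1# * 1#) + (q + q) * (1# * c) + r * (c * c)) (Sh.lead 1F * (1# * 1#))) ≡ 1
          hit = trans (ℕₚ.+-identityʳ _) (trans (cong₂ f (trans (simplify p q r 1#) (x1 p)) (x1 (Sh.lead 1F)))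
            (trans (N.select-≡ _≟_ (Sh.lead 1F) _) (N.select-≡ _≟_ p 1)))
          miss : N.∑ elems (λ ξ → N.∑ (0# ∷ []) (λ c → f (p′ * (ξ * ξ) + (q′ + q′) * (ξ * c) + r′ * (c * c)) (Sh.lead 1F * (ξ * ξ)))) ≡ 0
          miss = trans (N.∑-cong elems (λ ξ → trans (ℕₚ.+-identityʳ _) (trans (cong (λ s → f s (Sh.lead 1F * (ξ * ξ))) (simplify p′ q′ r′ ξ)) (zero′ ξ)))) (N.∑-ε elems)
            where
            zero′ : ∀ ξ → f (p′ * (ξ * ξ)) (Sh.lead 1F * (ξ * ξ)) ≡ 0
            zero′ ξ with (Sh.lead 1F * (ξ * ξ)) ≟ Sh.lead 1F
            ... | no _  = refl
            ... | yes e = N.select-≢ _≟_ 1 (λ e′ → ne (sym (trans (sym (trans (cong (p′ *_) ξ²≡1) (*-identityʳ p′))) e′)))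
              where
              ξ²≡1 : ξ * ξ ≡ 1#
              ξ²≡1 = *-cancelˡ (Sh.lead≢0 1F) (trans e (sym (*-identityʳ _)))

        module Pl = Peel k w (gramOfSlots G) (slots-off sh k) (slots-diagonal sh k)
        module Sq = Pl.Squares {λ j → gramOfSlots G j k} {λ j → gramOfSlots G′ j k} {gramOfSlots G k k} {gramOfSlots G′ k k}
          (second-row-degree sh) (second-row-degree sh′) residue≡

        second-entry : ∀ G → gramOfSlots G k k ≈ₚ G 1F 1F
        second-entry G n = trans (cong (λ u → coeff (B G u u) n) β-k) (B-unit-1 G 1F 1F n)

        first-entry : ∀ G → gramOfSlots G 0 k ≈ₚ G 0F 1F
        first-entry G n = trans (cong₂ (λ u v → coeff (B G u v) n) β-0 β-k) (B-unit-1 G 0F 1F n)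

      d≈ : G 1F 1F ≈ₚ G′ 1F 1F
      d≈ n = trans (sym (second-entry G n)) (trans (Sq.g≈g′ n) (second-entry G′ n))

      -- Entry 0 precedes every elimination step and is χ(b) itself, so its square is known for all
      -- χ.
      b≈± : G 0F 1F ≈ₚ G′ 0F 1F ⊎ G 0F 1F ≈ₚ -ₚ G′ 0F 1F
      b≈± = ev²-determines (G 0F 1F) (G′ 0F 1F) (λ χ → trans (cong (λ x → x * x) (sym (ev-cong χ (gramOfSlots G 0 k) (G 0F 1F) (first-entry G))))
        (trans (Sq.entries² 0 0<k χ (λ _ ())) (cong (λ x → x * x) (ev-cong χ (gramOfSlots G′ 0 k) (G′ 0F 1F) (first-entry G′)))))

    -- At level m₃ the lower slots are all monomials in v₁ and v₂ of smaller weight. The top slot is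
    -- t^ℓ v₁, which shares the weight m₃ with v₃; the top coefficient is therefore the anisotropic
    -- form a₀ξ² + g₀c².
    module ThirdMinimum (a≈ : G 0F 0F ≈ₚ G′ 0F 0F) (b≈ : G 0F 1F ≈ₚ G′ 0F 1F) (d≈ : G 1F 1F ≈ₚ G′ 1F 1F)
                        (lead₂ : Sh.lead 2F ≡ Sh′.lead 2F) where
      private
        n : ℕ
        n = position₁ k ℓ

        slot-n : slot k n ≡ inj₁ ℓ
        slot-n = slot-position₁ k ℓ

        w-n : w n ≡ m₃
        w-n = trans (cong (weight m₁ m₂) slot-n) (sym m₃≡′)

        k<n : k < n
        k<n = w-cancel-< (subst (_< w n) (sym w-k) (subst (m₂ <_) (sym w-n) m₂<m₃))

        base : ∀ j l → gramOfSlots G′ j l ≈ₚ gramOfSlots G j l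
        base j l = B-congᴳ {G′} {G} (β j) (β l) agree
          where
          agree : ∀ i i′ → G′ i i′ ≈ₚ G i i′ ⊎ β j i ≡ [] ⊎ β l i′ ≡ []
          agree 0F 0F = inj₁ (λ n → sym (a≈ n))
          agree 0F 1F = inj₁ (λ n → sym (b≈ n))
          agree 1F 0F = inj₁ (λ n → trans (Sh′.symmetric 1F 0F n) (trans (sym (b≈ n)) (Sh.symmetric 0F 1F n)))
          agree 1F 1F = inj₁ (λ n → sym (d≈ n))
          agree 2F _  = inj₂ (inj₁ (slotVector-third (slot k j)))
          agree 0F 2F = inj₂ (inj₂ (slotVector-third (slot k l)))
          agree 1F 2F = inj₂ (inj₂ (slotVector-third (slot k l)))

        open Conic {Sh.lead 0F} {Sh.lead 2F} Sh.anisotropic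

        top-value : ∀ {G} (sh : Shape wts G) xs ξ c → c ∈ elems →
          coeff (B G (decode n (xs , (ξ , c))) (decode n (xs , (ξ , c)))) (w n) ≡ Shape.lead sh 0F * (ξ * ξ) + Shape.lead sh 2F * (c * c)
        top-value sh xs ξ c _ = trans (B-top wts sh {v} b) (trans
          (cong (λ x → diagonal wts sh v (w n) 0F + (x + diagonal wts sh v (w n) 2F))
            (diagonal-none wts sh {v} 1F b (λ j e → parity₁₂ ℓ j (trans (sym m₃≡′) (trans (sym w-n) e)))))
          (cong₂ _+_
            (trans (diagonal-lead wts sh {v} 0F ℓ b (trans w-n m₃≡′))
              (cong (λ x → Shape.lead sh 0F * (x * x)) (subst (λ s → coordinate s v ≡ ξ) slot-n (at-decode n xs ξ c))))
            (trans (+-identityˡ _) (trans (diagonal-lead wts sh {v} 2F 0 b (trans w-n (sym (ℕₚ.+-identityʳ m₃))))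
              (cong (λ x → Shape.lead sh 2F * (x * x)) (trans (third-decode n xs ξ c 0) (*-identityʳ c)))))))
          where
          v = decode n (xs , (ξ , c))
          b = decode-bounded n xs ξ c (λ lt → ⊥-elim (ℕₚ.<⇒≢ lt w-n)) (ℕₚ.≤-reflexive w-n)

        lead₀ : Sh.lead 0F ≡ Sh′.lead 0F
        lead₀ = a≈ m₁

        module E = Eliminated n (ℕₚ.≤-reflexive w-n) elems elems-unique (λ c _ lt → ⊥-elim (ℕₚ.<⇒≢ lt w-n)) (λ c _ → ∈-elems c)
          (λ j l _ _ → base j l) X (top-value sh)
          (λ xs ξ c c∈ → trans (top-value sh′ xs ξ c c∈) (cong₂ (λ x y → x * (ξ * ξ) + y * (c * c)) (sym lead₀) (sym lead₂)))

        residue≡ : ∀ χ → (∀ i → i < n → pivot i (E.M χ) ≢ 0#) →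
          E.Fn.residue χ n (E.M χ) e₃ e₃ ≡ E.Fn′.residue χ n (E.M χ) e₃ e₃
        residue≡ χ piv = conic-determines {E.Fn.residue χ n (E.M χ) (β n) (β n)} {E.Fn.residue χ n (E.M χ) (β n) e₃}
          {E.Fn.residue χ n (E.M χ) e₃ e₃} {E.Fn′.residue χ n (E.M χ) (β n) e₃} {E.Fn′.residue χ n (E.M χ) e₃ e₃}
          (λ f → trans (E.residues χ piv f) (N.∑-cong elems λ ξ → N.∑-cong elems λ c →
            cong (λ p → f (p * (ξ * ξ) + (E.Fn′.residue χ n (E.M χ) (β n) e₃ + E.Fn′.residue χ n (E.M χ) (β n) e₃) * (ξ * c)
              + E.Fn′.residue χ n (E.M χ) e₃ e₃ * (c * c)) (X ξ c)) same-ξ))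
          where
          ev-base : ∀ j l → ev χ (gramOfSlots G′ j l) ≡ ev χ (gramOfSlots G j l)
          ev-base j l = ev-cong χ (gramOfSlots G′ j l) (gramOfSlots G j l) (base j l)
          correction-both : ∀ s → correction s (E.M χ) (λ j → ev χ (gramOfSlots G′ j n)) (λ j → ev χ (gramOfSlots G′ j n))
                                ≡ correction s (E.M χ) (λ j → ev χ (gramOfSlots G j n)) (λ j → ev χ (gramOfSlots G j n))
          correction-both zero    = refl
          correction-both (suc s) = cong₂ (λ x y → x + y * y * inv (pivot s (E.M χ))) (correction-both s)
            (entry-local s (E.M χ) {λ j → ev χ (gramOfSlots G j n)} {λ j → ev χ (gramOfSlots G′ j n)} (λ j _ → ev-base j n))
          -- The vector `β n` lies in the plane of the first two basis vectors, where the forms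
          -- agree already. This supplies the common coefficient of ξ² for `conic-determines`.
          same-ξ : E.Fn′.residue χ n (E.M χ) (β n) (β n) ≡ E.Fn.residue χ n (E.M χ) (β n) (β n)
          same-ξ = cong₂ (λ x y → x + - y) (ev-base n n) (correction-both n)

        module Pl = Peel n w (gramOfSlots G) (slots-off sh n) (slots-diagonal sh n)
        module Sq = Pl.Squares {λ j → B G (β j) e₃} {λ j → B G′ (β j) e₃} {B G e₃ e₃} {B G′ e₃ e₃}
          (third-row-degree sh n) (third-row-degree sh′ n) residue≡

        e-entry : ∀ G → B G (β 0) e₃ ≈ₚ G 0F 2F
        e-entry G n = trans (cong (λ u → coeff (B G u e₃) n) β-0) (B-unit-1 G 0F 2F n)

        f-entry : ∀ G → B G (β k) e₃ ≈ₚ G 1F 2F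
        f-entry G n = trans (cong (λ u → coeff (B G u e₃) n) β-k) (B-unit-1 G 1F 2F n)

        b-entry : ∀ G → gramOfSlots G 0 k ≈ₚ G 0F 1F
        b-entry G n = trans (cong₂ (λ u v → coeff (B G u v) n) β-0 β-k) (B-unit-1 G 0F 1F n)

      g≈ : G 2F 2F ≈ₚ G′ 2F 2F
      g≈ n = trans (sym (B-unit-1 G 2F 2F n)) (trans (Sq.g≈g′ n) (B-unit-1 G′ 2F 2F n))

      e≈± : G 0F 2F ≈ₚ G′ 0F 2F ⊎ G 0F 2F ≈ₚ -ₚ G′ 0F 2F
      e≈± = ev²-determines (G 0F 2F) (G′ 0F 2F) (λ χ → trans (cong (λ x → x * x) (sym (ev-cong χ (B G (β 0) e₃) (G 0F 2F) (e-entry G))))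
        (trans (Sq.entries² 0 (ℕₚ.<-trans 0<k k<n) χ (λ _ ())) (cong (λ x → x * x) (ev-cong χ (B G′ (β 0) e₃) (G′ 0F 2F) (e-entry G′)))))

      -- Slot k is v₂, so entry k of the third column is χ(f) minus a correction that involves only
      -- a, b and e. As these agree for both forms, the two values of f are compared through the
      -- same correction, the situation of `SignRigidity`.
      f≈± : G 0F 2F ≈ₚ G′ 0F 2F → G 1F 2F ≈ₚ G′ 1F 2F ⊎ (G 1F 2F ≈ₚ -ₚ G′ 1F 2F × (G 0F 1F ≈ₚ 0ₚ ⊎ G 0F 2F ≈ₚ 0ₚ))
      f≈± e≈ = finish (SignRigidity.rigid k 0<k w (gramOfSlots G) (slots-off sh k) (slots-diagonal sh k)
        {λ j → B G (β j) e₃} {λ j → B G′ (β j) e₃} (λ i lt → third-row-degree sh k i lt) (second-row-degree sh) rows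
        (λ χ ns → Sq.entries² k k<n χ ns))
        where
        rows : ∀ j → j < k → B G′ (β j) e₃ ≈ₚ B G (β j) e₃
        rows j j<k n = subst (λ s → coeff (B G′ (slotVector s) e₃) n ≡ coeff (B G (slotVector s) e₃) n) (sym (slot-initial k j j<k))
          (trans (coeff-B-unit G′ 0F (mono j) 2F 1ₚ n) (trans
            (*ₚ-cong {G′ 0F 2F} {G 0F 2F} {mono j *ₚ 1ₚ} {mono j *ₚ 1ₚ} (λ i → sym (e≈ i)) (λ _ → refl) n)
            (sym (coeff-B-unit G 0F (mono j) 2F 1ₚ n))))
        finish : B G (β k) e₃ ≈ₚ B G′ (β k) e₃ ⊎ (B G (β k) e₃ ≈ₚ -ₚ B G′ (β k) e₃ × (gramOfSlots G 0 k ≈ₚ 0ₚ ⊎ B G (β 0) e₃ ≈ₚ 0ₚ)) →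
                 G 1F 2F ≈ₚ G′ 1F 2F ⊎ (G 1F 2F ≈ₚ -ₚ G′ 1F 2F × (G 0F 1F ≈ₚ 0ₚ ⊎ G 0F 2F ≈ₚ 0ₚ))
        finish (inj₁ e) = inj₁ (λ n → trans (sym (f-entry G n)) (trans (e n) (f-entry G′ n)))
        finish (inj₂ (e , z)) = inj₂ ((λ n → trans (sym (f-entry G n)) (trans (e n) (trans (coeff-neg (B G′ (β k) e₃) n)
            (trans (cong -_ (f-entry G′ n)) (sym (coeff-neg (G′ 1F 2F) n)))))) , zeros z)
          where
          zeros : gramOfSlots G 0 k ≈ₚ 0ₚ ⊎ B G (β 0) e₃ ≈ₚ 0ₚ → G 0F 1F ≈ₚ 0ₚ ⊎ G 0F 2F ≈ₚ 0ₚ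
          zeros (inj₁ z) = inj₁ (λ n → trans (sym (b-entry G n)) (z n))
          zeros (inj₂ z) = inj₂ (λ n → trans (sym (e-entry G n)) (z n))

-- Fractions, common denominators and changes of basis.

module Reduction (𝔽 : FiniteField) where
  open FieldTheory 𝔽
  open Forms 𝔽
  open Degrees 𝔽
  open Bilinear 𝔽

  HasDegree : Poly → ℕ → Set
  HasDegree p n = coeff p n ≢ 0# × (∀ i → n < i → coeff p i ≡ 0#)

  degₚ-just : ∀ p {n} → degₚ p ≡ just n → HasDegree p n
  degₚ-nothing : ∀ p → degₚ p ≡ nothing → p ≈ₚ 0ₚ

  degₚ-just (c ∷ p) e with degₚ p in eq
  degₚ-just (c ∷ p) refl | just k = proj₁ rec , λ { (suc i) (s≤s lt) → proj₂ rec i lt }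
    where rec = degₚ-just p eq
  ... | nothing with c ≟ 0#
  degₚ-just (c ∷ p) refl | nothing | no c≢0 = c≢0 , λ { (suc i) _ → degₚ-nothing p eq i }

  degₚ-nothing []      e i = refl
  degₚ-nothing (c ∷ p) e with degₚ p in eq
  ... | nothing with c ≟ 0#
  ...   | yes c≡0 = λ { zero → c≡0 ; (suc i) → degₚ-nothing p eq i }

  HasDegree-≉0 : ∀ {p n} → HasDegree p n → ¬ (p ≈ₚ 0ₚ)
  HasDegree-≉0 {n = n} (ne , _) e = ne (e n)

  ≉0⇒HasDegree : ∀ p → ¬ (p ≈ₚ 0ₚ) → ∃ (HasDegree p)
  ≉0⇒HasDegree p ne with degₚ p in eq
  ... | just n  = n , degₚ-just p eq
  ... | nothing = ⊥-elim (ne (degₚ-nothing p eq))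

  HasDegree-cong : ∀ {p r n} → p ≈ₚ r → HasDegree p n → HasDegree r n
  HasDegree-cong e (ne , z) = (λ e′ → ne (trans (e _) e′)) , λ i lt → trans (sym (e i)) (z i lt)

  HasDegree-unique : ∀ {p m n} → HasDegree p m → HasDegree p n → m ≡ n
  HasDegree-unique {p} {m} {n} (ne , z) (ne′ , z′) =
    ℕₚ.≤-antisym (ℕₚ.≮⇒≥ (λ lt → ne (z′ m lt))) (ℕₚ.≮⇒≥ (λ lt → ne′ (z n lt)))

  HasDegree-* : ∀ {p r m n} → HasDegree p m → HasDegree r n → HasDegree (p *ₚ r) (m ℕ.+ n)
  HasDegree-* {p} {r} {m} {n} (ne , z) (ne′ , z′) =
    (λ e → *-≢0 ne ne′ (trans (sym (trans (coeff-* p r _) (⊛-single (coeff p) (coeff r) m n lower))) e))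
    , λ N lt → coeff-*-zero p r N (upper N lt)
    where
    kill : ∀ i j → (m < i) ⊎ (n < j) → coeff p i * coeff r j ≡ 0#
    kill i j (inj₁ lt) = trans (cong (_* coeff r j) (z i lt)) (zeroˡ _)
    kill i j (inj₂ lt) = trans (cong (coeff p i *_) (z′ j lt)) (zeroʳ _)
    lower : ∀ i j → i ℕ.+ j ≡ m ℕ.+ n → i ≢ m → coeff p i * coeff r j ≡ 0#
    lower i j e i≢m with m ℕₚ.<? i
    ... | yes lt = kill i j (inj₁ lt)
    ... | no nlt = kill i j (inj₂ (ℕₚ.≰⇒> λ le → ℕₚ.<⇒≢ (ℕₚ.+-mono-<-≤ (ℕₚ.≤∧≢⇒< (ℕₚ.≮⇒≥ nlt) i≢m) le) e))
    upper : ∀ N → m ℕ.+ n < N → ∀ i j → i ℕ.+ j ≡ N → coeff p i * coeff r j ≡ 0#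
    upper N lt i j refl with m ℕₚ.<? i
    ... | yes lt′ = kill i j (inj₁ lt′)
    ... | no nlt  = kill i j (inj₂ (ℕₚ.≰⇒> λ le → ℕₚ.<⇒≱ lt (ℕₚ.+-mono-≤ (ℕₚ.≮⇒≥ nlt) le)))

  *ₚ-≉0 : ∀ {p r} → ¬ (p ≈ₚ 0ₚ) → ¬ (r ≈ₚ 0ₚ) → ¬ (p *ₚ r ≈ₚ 0ₚ)
  *ₚ-≉0 {p} {r} np nr with ≉0⇒HasDegree p np | ≉0⇒HasDegree r nr
  ... | m , hp | n , hr = HasDegree-≉0 {p *ₚ r} (HasDegree-* {p} {r} hp hr)

  decide-≈0 : ∀ p → p ≈ₚ 0ₚ ⊎ ¬ (p ≈ₚ 0ₚ)
  decide-≈0 p with degₚ p in eq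
  ... | just n  = inj₂ (HasDegree-≉0 {p} (degₚ-just p eq))
  ... | nothing = inj₁ (degₚ-nothing p eq)

  *ₚ-cancelˡ : ∀ p x y → ¬ (p ≈ₚ 0ₚ) → p *ₚ x ≈ₚ p *ₚ y → x ≈ₚ y
  *ₚ-cancelˡ p x y np e with decide-≈0 (x +ₚ (-ₚ y))
  ... | inj₁ z = λ n → trans (solve 2 (λ x y → x := (x :+ :- y) :+ y) (λ _ → refl) x y n)
                   (trans (coeff-+ (x +ₚ (-ₚ y)) y n) (trans (cong (_+ coeff y n) (z n)) (+-identityˡ _)))
    where open P-solver
  ... | inj₂ nz = ⊥-elim (*ₚ-≉0 {p} {x +ₚ (-ₚ y)} np nz λ n → trans
          (solve 3 (λ p x y → p :* (x :+ :- y) := p :* x :+ :- (p :* y)) (λ _ → refl) p x y n)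
          (trans (coeff-+ (p *ₚ x) (-ₚ (p *ₚ y)) n) (trans (cong₂ _+_ (e n) (coeff-neg (p *ₚ y) n)) (-‿inverseʳ _))))
    where open P-solver

  IsFraction : Frac → Poly → Poly → Set
  IsFraction x p D = ValidK x × num x *ₚ D ≈ₚ p *ₚ den x

  IsFraction-+ : ∀ {x y p r} D → IsFraction x p D → IsFraction y r D → IsFraction (x +ₖ y) (p +ₚ r) D
  IsFraction-+ {x} {y} {p} {r} D (vx , ex) (vy , ey) = *ₚ-≉0 {den x} {den y} vx vy , λ n → begin
    coeff ((num x *ₚ den y +ₚ num y *ₚ den x) *ₚ D) n
      ≡⟨ solve 5 (λ a b c d D → (a :* d :+ c :* b) :* D := (a :* D) :* d :+ (c :* D) :* b) (λ _ → refl) (num x) (den x) (num y) (den y) D n ⟩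
    coeff ((num x *ₚ D) *ₚ den y +ₚ (num y *ₚ D) *ₚ den x) n
      ≡⟨ +ₚ-cong {(num x *ₚ D) *ₚ den y} {(p *ₚ den x) *ₚ den y} {(num y *ₚ D) *ₚ den x} {(r *ₚ den y) *ₚ den x}
           (*ₚ-cong {num x *ₚ D} {p *ₚ den x} {den y} {den y} ex (λ _ → refl)) (*ₚ-cong {num y *ₚ D} {r *ₚ den y} {den x} {den x} ey (λ _ → refl)) n ⟩
    coeff ((p *ₚ den x) *ₚ den y +ₚ (r *ₚ den y) *ₚ den x) n
      ≡⟨ solve 4 (λ p r b d → (p :* b) :* d :+ (r :* d) :* b := (p :+ r) :* (b :* d)) (λ _ → refl) p r (den x) (den y) n ⟩
    coeff ((p +ₚ r) *ₚ (den x *ₚ den y)) n ∎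
    where open P-solver
          open ≡-Reasoning

  1ₚ≉0 : ¬ (1ₚ ≈ₚ 0ₚ)
  1ₚ≉0 e = 0≢1 (sym (e 0))

  IsFraction-*ι : ∀ {x p} D s → IsFraction x p D → IsFraction (x *ₖ ιₖ s) (p *ₚ s) D
  IsFraction-*ι {x} {p} D s (vx , ex) = *ₚ-≉0 {den x} {1ₚ} vx 1ₚ≉0 , λ n → begin
    coeff ((num x *ₚ s) *ₚ D) n
      ≡⟨ solve 3 (λ a s D → (a :* s) :* D := (a :* D) :* s) (λ _ → refl) (num x) s D n ⟩
    coeff ((num x *ₚ D) *ₚ s) n
      ≡⟨ *ₚ-cong {num x *ₚ D} {p *ₚ den x} {s} {s} ex (λ _ → refl) n ⟩
    coeff ((p *ₚ den x) *ₚ s) n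
      ≡⟨ solve 3 (λ p s d → (p :* d) :* s := (p :* s) :* d) (λ _ → refl) p s (den x) n ⟩
    coeff ((p *ₚ s) *ₚ den x) n
      ≡⟨ *ₚ-cong {p *ₚ s} {p *ₚ s} {den x} {den x *ₚ 1ₚ} (λ _ → refl) (λ i → sym (P.*-identityʳ (den x) i)) n ⟩
    coeff ((p *ₚ s) *ₚ (den x *ₚ 1ₚ)) n ∎
    where open P-solver
          open ≡-Reasoning

  IsFraction-≈ : ∀ {x y p r} D → ¬ (D ≈ₚ 0ₚ) → IsFraction x p D → IsFraction y r D → (x ≈ₖ y → p ≈ₚ r) × (p ≈ₚ r → x ≈ₖ y)
  IsFraction-≈ {x} {y} {p} {r} D D≉0 (vx , ex) (vy , ey) = to , from
    where
    open P-solver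
    open ≡-Reasoning
    X Y : Poly
    X = den x
    Y = den y
    to : x ≈ₖ y → p ≈ₚ r
    to e = *ₚ-cancelˡ (X *ₚ Y) p r (*ₚ-≉0 {X} {Y} vx vy) λ n → begin
      coeff ((X *ₚ Y) *ₚ p) n           ≡⟨ solve 3 (λ X Y p → (X :* Y) :* p := (p :* X) :* Y) (λ _ → refl) X Y p n ⟩
      coeff ((p *ₚ X) *ₚ Y) n           ≡⟨ *ₚ-cong {p *ₚ X} {num x *ₚ D} {Y} {Y} (λ i → sym (ex i)) (λ _ → refl) n ⟩
      coeff ((num x *ₚ D) *ₚ Y) n       ≡⟨ solve 3 (λ a D Y → (a :* D) :* Y := (a :* Y) :* D) (λ _ → refl) (num x) D Y n ⟩
      coeff ((num x *ₚ Y) *ₚ D) n       ≡⟨ *ₚ-cong {num x *ₚ Y} {num y *ₚ X} {D} {D} e (λ _ → refl) n ⟩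
      coeff ((num y *ₚ X) *ₚ D) n       ≡⟨ solve 3 (λ a X D → (a :* X) :* D := (a :* D) :* X) (λ _ → refl) (num y) X D n ⟩
      coeff ((num y *ₚ D) *ₚ X) n       ≡⟨ *ₚ-cong {num y *ₚ D} {r *ₚ Y} {X} {X} ey (λ _ → refl) n ⟩
      coeff ((r *ₚ Y) *ₚ X) n           ≡⟨ solve 3 (λ r X Y → (r :* Y) :* X := (X :* Y) :* r) (λ _ → refl) r X Y n ⟩
      coeff ((X *ₚ Y) *ₚ r) n           ∎
    from : p ≈ₚ r → x ≈ₖ y
    from e = *ₚ-cancelˡ D (num x *ₚ Y) (num y *ₚ X) D≉0 λ n → begin
      coeff (D *ₚ (num x *ₚ Y)) n       ≡⟨ solve 3 (λ D a Y → D :* (a :* Y) := (a :* D) :* Y) (λ _ → refl) D (num x) Y n ⟩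
      coeff ((num x *ₚ D) *ₚ Y) n       ≡⟨ *ₚ-cong {num x *ₚ D} {p *ₚ X} {Y} {Y} ex (λ _ → refl) n ⟩
      coeff ((p *ₚ X) *ₚ Y) n           ≡⟨ *ₚ-cong {p *ₚ X} {r *ₚ X} {Y} {Y} (*ₚ-cong {p} {r} {X} {X} e (λ _ → refl)) (λ _ → refl) n ⟩
      coeff ((r *ₚ X) *ₚ Y) n           ≡⟨ solve 3 (λ r X Y → (r :* X) :* Y := (r :* Y) :* X) (λ _ → refl) r X Y n ⟩
      coeff ((r *ₚ Y) *ₚ X) n           ≡⟨ *ₚ-cong {r *ₚ Y} {num y *ₚ D} {X} {X} (λ i → sym (ey i)) (λ _ → refl) n ⟩
      coeff ((num y *ₚ D) *ₚ X) n       ≡⟨ solve 3 (λ a X D → (a :* D) :* X := D :* (a :* X)) (λ _ → refl) (num y) X D n ⟩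
      coeff (D *ₚ (num y *ₚ X)) n       ∎

  IsFraction-Σ₃ : ∀ {f : Fin 3 → Frac} {g : Fin 3 → Poly} D → (∀ i → IsFraction (f i) (g i) D) → IsFraction (Σ₃ _+ₖ_ f) (Σ₃ _+ₚ_ g) D
  IsFraction-Σ₃ {f} {g} D h = IsFraction-+ {f 0F} {f 1F +ₖ f 2F} {g 0F} {g 1F +ₚ g 2F} D (h 0F)
    (IsFraction-+ {f 1F} {f 2F} {g 1F} {g 2F} D (h 1F) (h 2F))

  -- The polynomial form D·Q. As D is a parameter, two lattices can be given the same one, and then
  -- their values compare as polynomials.
  record Integral (L : TernaryLattice) (D : Poly) : Set where
    field
      D≉0      : ¬ (D ≈ₚ 0ₚ)
      n        : Gram
      n-gram   : ∀ i j → IsFraction (gram L i j) (n i j) D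

    n-sym : ∀ i j → n i j ≈ₚ n j i
    n-sym i j = proj₁ (IsFraction-≈ {gram L i j} {gram L j i} {n i j} {n j i} D D≉0 (n-gram i j) (n-gram j i)) (gramSym L i j)

    halfB-fraction : ∀ x y → IsFraction (halfB L x y) (B n x y) D
    halfB-fraction x y = IsFraction-Σ₃ {λ i → Σ₃ _+ₖ_ (λ j → gram L i j *ₖ ιₖ (x i *ₚ y j))} {λ i → Σ₃ _+ₚ_ (λ j → n i j *ₚ (x i *ₚ y j))} D
      (λ i → IsFraction-Σ₃ {λ j → gram L i j *ₖ ιₖ (x i *ₚ y j)} {λ j → n i j *ₚ (x i *ₚ y j)} D
        (λ j → IsFraction-*ι {gram L i j} {n i j} D (x i *ₚ y j) (n-gram i j)))

    Q-≈ : ∀ κ v → (Q L v ≈ₖ (κ / D) → B n v v ≈ₚ κ) × (B n v v ≈ₚ κ → Q L v ≈ₖ (κ / D))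
    Q-≈ κ v = IsFraction-≈ {Q L v} {κ / D} {B n v v} {κ} D D≉0 (halfB-fraction v v) (D≉0 , λ _ → refl)

    number⇒represents : ∀ κ N → RepNumber L (κ / D) N → Represents (λ v → B n v v) κ N
    number⇒represents κ N (xs , len , dis , mem) = xs , len , dis , λ v →
      (λ e → proj₁ (mem v) (proj₂ (Q-≈ κ v) e)) , (λ a → proj₁ (Q-≈ κ v) (proj₂ (mem v) a))

    represents⇒number : ∀ κ N → Represents (λ v → B n v v) κ N → RepNumber L (κ / D) N
    represents⇒number κ N (xs , len , dis , mem) = xs , len , dis , λ v →
      (λ e → proj₁ (mem v) (proj₁ (Q-≈ κ v) e)) , (λ a → proj₂ (Q-≈ κ v) (proj₂ (mem v) a))

  private
    product₃ : (Fin 3 → Poly) → Poly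
    product₃ f = f 0F *ₚ (f 1F *ₚ f 2F)

    cofactor : (Fin 3 → Poly) → Fin 3 → Poly
    cofactor f 0F = f 1F *ₚ f 2F
    cofactor f 1F = f 0F *ₚ f 2F
    cofactor f 2F = f 0F *ₚ f 1F

    cofactor-* : ∀ f i → product₃ f ≈ₚ cofactor f i *ₚ f i
    cofactor-* f 0F = solve 3 (λ a b c → a :* (b :* c) := (b :* c) :* a) (λ _ → refl) (f 0F) (f 1F) (f 2F) where open P-solver
    cofactor-* f 1F = solve 3 (λ a b c → a :* (b :* c) := (a :* c) :* b) (λ _ → refl) (f 0F) (f 1F) (f 2F) where open P-solver
    cofactor-* f 2F = solve 3 (λ a b c → a :* (b :* c) := (a :* b) :* c) (λ _ → refl) (f 0F) (f 1F) (f 2F) where open P-solver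

    product₃-≉0 : ∀ {f} → (∀ i → ¬ (f i ≈ₚ 0ₚ)) → ¬ (product₃ f ≈ₚ 0ₚ)
    product₃-≉0 {f} h = *ₚ-≉0 {f 0F} {f 1F *ₚ f 2F} (h 0F) (*ₚ-≉0 {f 1F} {f 2F} (h 1F) (h 2F))

  module CommonDenominator (L : TernaryLattice) where
    rows : Fin 3 → Poly
    rows i = product₃ (λ j → den (gram L i j))

    denominator : Poly
    denominator = product₃ rows

    denominator≉0 : ¬ (denominator ≈ₚ 0ₚ)
    denominator≉0 = product₃-≉0 {rows} (λ i → product₃-≉0 {λ j → den (gram L i j)} (gramValid L i))

    numerators : Gram
    numerators i j = num (gram L i j) *ₚ (cofactor rows i *ₚ cofactor (λ j → den (gram L i j)) j)

    -- The factor E makes a shared D possible: each of the two lattices takes the denominator of the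
    -- other for E.
    integral : ∀ E → ¬ (E ≈ₚ 0ₚ) → ∀ D → D ≈ₚ denominator *ₚ E → Integral L D
    integral E E≉0 D D≈ = record
      { D≉0 = λ z → *ₚ-≉0 {denominator} {E} denominator≉0 E≉0 (λ n → trans (sym (D≈ n)) (z n))
      ; n = λ i j → numerators i j *ₚ E
      ; n-gram = λ i j → gramValid L i j , λ n → begin
          coeff (num (gram L i j) *ₚ D) n
            ≡⟨ *ₚ-cong {num (gram L i j)} {num (gram L i j)} {D} {denominator *ₚ E} (λ _ → refl) D≈ n ⟩
          coeff (num (gram L i j) *ₚ (denominator *ₚ E)) n
            ≡⟨ *ₚ-cong {num (gram L i j)} {num (gram L i j)} {denominator *ₚ E} {(cofactor rows i *ₚ (c i j *ₚ d i j)) *ₚ E} (λ _ → refl)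
                 (*ₚ-cong {denominator} {cofactor rows i *ₚ (c i j *ₚ d i j)} {E} {E} (λ m → trans (cofactor-* rows i m)
                   (*ₚ-cong {cofactor rows i} {cofactor rows i} {rows i} {c i j *ₚ d i j} (λ _ → refl) (cofactor-* (d i) j) m)) (λ _ → refl)) n ⟩
          coeff (num (gram L i j) *ₚ ((cofactor rows i *ₚ (c i j *ₚ d i j)) *ₚ E)) n
            ≡⟨ solve 5 (λ a r c d E → a :* ((r :* (c :* d)) :* E) := ((a :* (r :* c)) :* E) :* d) (λ _ → refl)
                 (num (gram L i j)) (cofactor rows i) (c i j) (d i j) E n ⟩
          coeff ((numerators i j *ₚ E) *ₚ d i j) n ∎ }
      where
      open P-solver
      open ≡-Reasoning
      d : Fin 3 → Fin 3 → Poly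
      d i j = den (gram L i j)
      c : Fin 3 → Fin 3 → Poly
      c i j = cofactor (d i) j

  ·ᵥ-cong : ∀ (U : Mat₃ Poly) {u v} → u ≈ᵥ v → U ·ᵥ u ≈ᵥ U ·ᵥ v
  ·ᵥ-cong U {u} {v} e i n = trans (coeff-Σ₃ (λ k → U i k *ₚ u k) n) (trans
    (Σ₃-cong {λ k → coeff (U i k *ₚ u k) n} {λ k → coeff (U i k *ₚ v k) n}
      (λ k → *ₚ-cong {U i k} {U i k} {u k} {v k} (λ _ → refl) (e k) n))
    (sym (coeff-Σ₃ (λ k → U i k *ₚ v k) n)))

  ·ᵥ-congˡ : ∀ {U V : Mat₃ Poly} → U ≈ₘ V → ∀ v → U ·ᵥ v ≈ᵥ V ·ᵥ v
  ·ᵥ-congˡ {U} {V} e v i n = trans (coeff-Σ₃ (λ k → U i k *ₚ v k) n) (trans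
    (Σ₃-cong {λ k → coeff (U i k *ₚ v k) n} {λ k → coeff (V i k *ₚ v k) n}
      (λ k → *ₚ-cong {U i k} {V i k} {v k} {v k} (e i k) (λ _ → refl) n))
    (sym (coeff-Σ₃ (λ k → V i k *ₚ v k) n)))

  ·ₘ-·ᵥ : ∀ U V v → (U ·ₘ V) ·ᵥ v ≈ᵥ U ·ᵥ (V ·ᵥ v)
  ·ₘ-·ᵥ U V v i n = trans (coeff-Σ₃ (λ l → (U ·ₘ V) i l *ₚ v l) n) (trans
    (Σ₃-cong {λ l → coeff ((U ·ₘ V) i l *ₚ v l) n} {λ l → Σ₃ _+_ (λ k → f k l)} expand) (trans (Σ₃-swap (λ l k → f k l)) (sym (trans
    (coeff-Σ₃ (λ k → U i k *ₚ (V ·ᵥ v) k) n)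
    (Σ₃-cong {λ k → coeff (U i k *ₚ (V ·ᵥ v) k) n} {λ k → Σ₃ _+_ (f k)} collect)))))
    where
    open P-solver
    f : Fin 3 → Fin 3 → Carrier
    f k l = coeff (U i k *ₚ (V k l *ₚ v l)) n
    expand : ∀ l → coeff ((U ·ₘ V) i l *ₚ v l) n ≡ Σ₃ _+_ (λ k → f k l)
    expand l = trans (solve 7 (λ a b c x y z w → (a :* x :+ (b :* y :+ c :* z)) :* w := a :* (x :* w) :+ (b :* (y :* w) :+ c :* (z :* w)))
        (λ _ → refl) (U i 0F) (U i 1F) (U i 2F) (V 0F l) (V 1F l) (V 2F l) (v l) n) (coeff-Σ₃ (λ k → U i k *ₚ (V k l *ₚ v l)) n)
    collect : ∀ k → coeff (U i k *ₚ (V ·ᵥ v) k) n ≡ Σ₃ _+_ (f k)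
    collect k = trans (solve 4 (λ a x y z → a :* (x :+ (y :+ z)) := a :* x :+ (a :* y :+ a :* z)) (λ _ → refl)
        (U i k) (V k 0F *ₚ v 0F) (V k 1F *ₚ v 1F) (V k 2F *ₚ v 2F) n) (coeff-Σ₃ (λ l → U i k *ₚ (V k l *ₚ v l)) n)

  Iₘ-·ᵥ : ∀ v → Iₘ ·ᵥ v ≈ᵥ v
  Iₘ-·ᵥ v i n = trans (coeff-Σ₃ (λ k → Iₘ i k *ₚ v k) n) (go i)
    where
    one : ∀ p → coeff (1ₚ *ₚ p) n ≡ coeff p n
    one p = P.*-identityˡ p n
    go : ∀ i → Σ₃ _+_ (λ k → coeff (Iₘ i k *ₚ v k) n) ≡ coeff (v i) n
    go 0F = trans (cong (_+ (0# + 0#)) (one (v 0F))) (trans (cong (coeff (v 0F) n +_) (+-identityʳ 0#)) (+-identityʳ _))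
    go 1F = trans (+-identityˡ _) (trans (+-identityʳ _) (one (v 1F)))
    go 2F = trans (+-identityˡ _) (trans (+-identityˡ _) (one (v 2F)))

  inverse-·ᵥ : ∀ {U V} → U ·ₘ V ≈ₘ Iₘ → ∀ v → U ·ᵥ (V ·ᵥ v) ≈ᵥ v
  inverse-·ᵥ {U} {V} e v i n = trans (sym (·ₘ-·ᵥ U V v i n)) (trans (·ᵥ-congˡ {U ·ₘ V} {Iₘ} e v i n) (Iₘ-·ᵥ v i n))

  infixl 7 _⋆_
  _⋆_ : Poly → Triple → Triple
  (p ⋆ u) i = p *ₚ u i

  B-⋆ˡ : ∀ G p u v → B G (p ⋆ u) v ≈ₚ p *ₚ B G u v
  B-⋆ˡ G p u v n = trans (coeff-B G (p ⋆ u) v n) (trans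
    (ΣΣ-cong (λ i j → coeff (G i j *ₚ ((p *ₚ u i) *ₚ v j)) n) (λ i j → coeff (p *ₚ t i j) n)
      (λ i j → solve 4 (λ g p a b → g :* ((p :* a) :* b) := p :* (g :* (a :* b))) (λ _ → refl) (G i j) p (u i) (v j) n))
    (sym (trans (pull (λ i → Σ₃ _+ₚ_ (t i))) (Σ₃-cong {λ i → coeff (p *ₚ Σ₃ _+ₚ_ (t i)) n} {λ i → Σ₃ _+_ (λ j → coeff (p *ₚ t i j) n)} (λ i → pull (t i))))))
    where
    open P-solver
    t : Fin 3 → Fin 3 → Poly
    t i j = G i j *ₚ (u i *ₚ v j)
    pull : ∀ f → coeff (p *ₚ Σ₃ _+ₚ_ f) n ≡ Σ₃ _+_ (λ i → coeff (p *ₚ f i) n)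
    pull f = trans (solve 4 (λ p a b c → p :* (a :+ (b :+ c)) := p :* a :+ (p :* b :+ p :* c)) (λ _ → refl) p (f 0F) (f 1F) (f 2F) n)
      (coeff-Σ₃ (λ i → p *ₚ f i) n)

  gramIn : Gram → Mat₃ Poly → Gram
  gramIn G U i j = B G (col U i) (col U j)

  B-gramIn : ∀ {G} → (∀ i j → G i j ≈ₚ G j i) → ∀ U x y → B G (U ·ᵥ x) (U ·ᵥ y) ≈ₚ B (gramIn G U) x y
  B-gramIn {G} s U x y n = begin
    coeff (B G (U ·ᵥ x) (U ·ᵥ y)) n
      ≡⟨ linear x (U ·ᵥ y) n ⟩
    coeff (Σ₃ _+ₚ_ (λ i → x i *ₚ B G (col U i) (U ·ᵥ y))) n
      ≡⟨ coeff-Σ₃ (λ i → x i *ₚ B G (col U i) (U ·ᵥ y)) n ⟩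
    Σ₃ _+_ (λ i → coeff (x i *ₚ B G (col U i) (U ·ᵥ y)) n)
      ≡⟨ Σ₃-cong {λ i → coeff (x i *ₚ B G (col U i) (U ·ᵥ y)) n} {λ i → coeff (Σ₃ _+ₚ_ (λ j → gramIn G U i j *ₚ (x i *ₚ y j))) n} row ⟩
    Σ₃ _+_ (λ i → coeff (Σ₃ _+ₚ_ (λ j → gramIn G U i j *ₚ (x i *ₚ y j))) n)
      ≡⟨ sym (coeff-Σ₃ (λ i → Σ₃ _+ₚ_ (λ j → gramIn G U i j *ₚ (x i *ₚ y j))) n) ⟩
    coeff (B (gramIn G U) x y) n ∎
    where
    open ≡-Reasoning
    open P-solver
    c : Fin 3 → Triple
    c = col U
    linear : ∀ x v → B G (U ·ᵥ x) v ≈ₚ Σ₃ _+ₚ_ (λ i → x i *ₚ B G (col U i) v)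
    linear x v m = trans (B-cong G {U ·ᵥ x} {x 0F ⋆ c 0F +ᵥ (x 1F ⋆ c 1F +ᵥ x 2F ⋆ c 2F)} {v} {v}
        (λ i l → solve 6 (λ a b d x y z → a :* x :+ (b :* y :+ d :* z) := x :* a :+ (y :* b :+ z :* d)) (λ _ → refl)
          (U i 0F) (U i 1F) (U i 2F) (x 0F) (x 1F) (x 2F) l) (λ _ _ → refl) m) (trans
      (B-+ˡ G (x 0F ⋆ c 0F) (x 1F ⋆ c 1F +ᵥ x 2F ⋆ c 2F) v m) (+ₚ-cong {B G (x 0F ⋆ c 0F) v} {x 0F *ₚ B G (c 0F) v}
        {B G (x 1F ⋆ c 1F +ᵥ x 2F ⋆ c 2F) v} {x 1F *ₚ B G (c 1F) v +ₚ x 2F *ₚ B G (c 2F) v} (B-⋆ˡ G (x 0F) (c 0F) v)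
        (λ l → trans (B-+ˡ G (x 1F ⋆ c 1F) (x 2F ⋆ c 2F) v l) (+ₚ-cong {B G (x 1F ⋆ c 1F) v} {x 1F *ₚ B G (c 1F) v}
          {B G (x 2F ⋆ c 2F) v} {x 2F *ₚ B G (c 2F) v} (B-⋆ˡ G (x 1F) (c 1F) v) (B-⋆ˡ G (x 2F) (c 2F) v) l)) m))
    row : ∀ i → coeff (x i *ₚ B G (c i) (U ·ᵥ y)) n ≡ coeff (Σ₃ _+ₚ_ (λ j → gramIn G U i j *ₚ (x i *ₚ y j))) n
    row i = trans (*ₚ-cong {x i} {x i} {B G (c i) (U ·ᵥ y)} {Σ₃ _+ₚ_ (λ j → y j *ₚ B G (c j) (c i))} (λ _ → refl)
        (λ l → trans (B-sym {G} s (c i) (U ·ᵥ y) l) (linear y (c i) l)) n) (trans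
      (solve 7 (λ x a b d p q r → x :* (a :* p :+ (b :* q :+ d :* r)) := p :* (x :* a) :+ (q :* (x :* b) :+ r :* (x :* d))) (λ _ → refl)
        (x i) (y 0F) (y 1F) (y 2F) (B G (c 0F) (c i)) (B G (c 1F) (c i)) (B G (c 2F) (c i)) n)
      (trans (coeff-Σ₃ (λ j → B G (c j) (c i) *ₚ (x i *ₚ y j)) n) (trans
        (Σ₃-cong {λ j → coeff (B G (c j) (c i) *ₚ (x i *ₚ y j)) n} {λ j → coeff (gramIn G U i j *ₚ (x i *ₚ y j)) n}
          (λ j → *ₚ-cong {B G (c j) (c i)} {B G (c i) (c j)} {x i *ₚ y j} {x i *ₚ y j} (B-sym {G} s (c j) (c i)) (λ _ → refl) n))
        (sym (coeff-Σ₃ (λ j → gramIn G U i j *ₚ (x i *ₚ y j)) n)))))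

  rescale : Mat₃ Poly → (Fin 3 → Carrier) → Mat₃ Poly
  rescale U s i j = map (s j *_) (U i j)

  rescale-invertible : ∀ {U} s → (∀ i → s i ≢ 0#) → Invertible U → Invertible (rescale U s)
  rescale-invertible {U} s s≢0 (V , UV , VU) = (λ i j → map (inv (s i) *_) (V i j)) , left , right
    where
    entry : ∀ x y p r → map (x *_) p *ₚ map (y *_) r ≈ₚ map ((x * y) *_) (p *ₚ r)
    entry x y p r n = trans (coeff-* (map (x *_) p) (map (y *_) r) n) (trans (⊛-cong (coeff-scale x p) (coeff-scale y r) n)
      (trans (⊛-scaleˡ x (coeff p) (λ m → y * coeff r m) n) (trans (cong (x *_) (trans (⊛-comm (coeff p) (λ m → y * coeff r m) n)
        (trans (⊛-scaleˡ y (coeff r) (coeff p) n) (cong (y *_) (⊛-comm (coeff r) (coeff p) n)))))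
      (trans (sym (*-assoc x y _)) (trans (cong ((x * y) *_) (sym (coeff-* p r n))) (sym (coeff-scale (x * y) (p *ₚ r) n)))))))
    left : rescale U s ·ₘ (λ i j → map (inv (s i) *_) (V i j)) ≈ₘ Iₘ
    left i j n = trans (coeff-Σ₃ (λ k → map (s k *_) (U i k) *ₚ map (inv (s k) *_) (V k j)) n) (trans
      (Σ₃-cong {λ k → coeff (map (s k *_) (U i k) *ₚ map (inv (s k) *_) (V k j)) n} {λ k → coeff (U i k *ₚ V k j) n}
        (λ k → trans (entry (s k) (inv (s k)) (U i k) (V k j) n) (trans (coeff-scale _ (U i k *ₚ V k j) n)
          (trans (cong (_* coeff (U i k *ₚ V k j) n) (inv-inverseʳ (s≢0 k))) (*-identityˡ _)))))
      (trans (sym (coeff-Σ₃ (λ k → U i k *ₚ V k j) n)) (UV i j n)))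
    right : (λ i j → map (inv (s i) *_) (V i j)) ·ₘ rescale U s ≈ₘ Iₘ
    right i j n = trans (coeff-Σ₃ (λ k → map (inv (s i) *_) (V i k) *ₚ map (s j *_) (U k j)) n) (trans
      (Σ₃-cong {λ k → coeff (map (inv (s i) *_) (V i k) *ₚ map (s j *_) (U k j)) n} {λ k → inv (s i) * s j * coeff (V i k *ₚ U k j) n}
        (λ k → trans (entry (inv (s i)) (s j) (V i k) (U k j) n) (coeff-scale _ (V i k *ₚ U k j) n)))
      (trans (Σ₃-* (inv (s i) * s j) (λ k → coeff (V i k *ₚ U k j) n)) (trans
        (cong (inv (s i) * s j *_) (trans (sym (coeff-Σ₃ (λ k → V i k *ₚ U k j) n)) (VU i j n)))
        (identity i j))))
      where
      diag : ∀ i → inv (s i) * s i * coeff 1ₚ n ≡ coeff 1ₚ n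
      diag i = trans (cong (_* coeff 1ₚ n) (trans (*-comm _ _) (inv-inverseʳ (s≢0 i)))) (*-identityˡ _)
      identity : ∀ i j → inv (s i) * s j * coeff (Iₘ i j) n ≡ coeff (Iₘ i j) n
      identity 0F 0F = diag 0F
      identity 1F 1F = diag 1F
      identity 2F 2F = diag 2F
      identity 0F 1F = zeroʳ _
      identity 0F 2F = zeroʳ _
      identity 1F 0F = zeroʳ _
      identity 1F 2F = zeroʳ _
      identity 2F 0F = zeroʳ _
      identity 2F 1F = zeroʳ _

  gramIn-rescale : ∀ {G} → (∀ i j → G i j ≈ₚ G j i) → ∀ U s i j → gramIn G (rescale U s) i j ≈ₚ map ((s i * s j) *_) (gramIn G U i j)
  gramIn-rescale {G} sy U s i j n = trans (B-∙ˡ G (s i) (col U i) (s j ∙ col U j) n) (trans (coeff-scale (s i) (B G (col U i) (s j ∙ col U j)) n)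
    (trans (cong (s i *_) (trans (B-sym {G} sy (col U i) (s j ∙ col U j) n) (trans (B-∙ˡ G (s j) (col U j) (col U i) n)
      (trans (coeff-scale (s j) (B G (col U j) (col U i)) n) (cong (s j *_) (B-sym {G} sy (col U j) (col U i) n))))))
    (trans (sym (*-assoc _ _ _)) (sym (coeff-scale (s i * s j) (gramIn G U i j) n)))))

-- Power series in 1/t and the completion at infinity.

module LaurentSeries (𝔽 : FiniteField) (odd : FiniteField.size 𝔽 ℕ.% 2 ≡ 1) where
  open FieldTheory 𝔽
  open FieldCounting 𝔽 odd using (x+x≡0⇒x≡0)
  open Forms 𝔽
  open Degrees 𝔽
  open Bilinear 𝔽
  open Reduction 𝔽

  -- The series defined by R 0 = s and R (n + 1) = φ n R, where φ n only looks at R 0, …, R n.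
  module Recursion (s : Carrier) (φ : ℕ → Series → Carrier)
    (local : ∀ n {R R′} → (∀ i → i ≤ n → R i ≡ R′ i) → φ n R ≡ φ n R′) where

    approximation : ℕ → Series
    approximation zero    _ = s
    approximation (suc n) i with i ℕₚ.≤? n
    ... | yes _ = approximation n i
    ... | no _  = φ n (approximation n)

    solution : Series
    solution n = approximation n n

    stable : ∀ n i → i ≤ n → approximation (suc n) i ≡ approximation n i
    stable n i le with i ℕₚ.≤? n
    ... | yes _ = refl
    ... | no ne = ⊥-elim (ne le)

    solution-approximation : ∀ n i → i ≤ n → approximation n i ≡ solution i
    solution-approximation n i le with ℕₚ.m≤n⇒m<n∨m≡n le
    ... | inj₂ refl = refl
    solution-approximation (suc n) i le | inj₁ (s≤s i≤n) = trans (stable n i i≤n) (solution-approximation n i i≤n)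

    solution-suc : ∀ n → solution (suc n) ≡ φ n solution
    solution-suc n with suc n ℕₚ.≤? n
    ... | yes le = ⊥-elim (ℕₚ.1+n≰n le)
    ... | no _   = local n (solution-approximation n)

  ⊛-local : ∀ {f f′ g g′} n → (∀ i → i ≤ n → f i ≡ f′ i) → (∀ i → i ≤ n → g i ≡ g′ i) → (f ⊛ g) n ≡ (f′ ⊛ g′) n
  ⊛-local zero    e e′ = cong₂ _*_ (e 0 z≤n) (e′ 0 z≤n)
  ⊛-local {f} {f′} {g} {g′} (suc n) e e′ = cong₂ _+_ (cong₂ _*_ (e 0 z≤n) (e′ (suc n) ℕₚ.≤-refl))
    (⊛-local {f ∘ suc} {f′ ∘ suc} {g} {g′} n (λ i le → e (suc i) (s≤s le)) (λ i le → e′ i (ℕₚ.m≤n⇒m≤1+n le)))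

  series-inverse : ∀ f → f 0 ≢ 0# → ∃ λ I → f ⊛ I ≗ 1ˢ
  series-inverse f f0≢0 = solution , λ { zero → inv-inverseʳ f0≢0 ; (suc n) → step n }
    where
    open Recursion (inv (f 0)) (λ n R → inv (f 0) * - ((f ∘ suc) ⊛ R) n)
      (λ n {R} {R′} e → cong (λ x → inv (f 0) * - x) (⊛-local {f ∘ suc} {f ∘ suc} {R} {R′} n (λ _ _ → refl) e))
    step : ∀ n → f 0 * solution (suc n) + ((f ∘ suc) ⊛ solution) n ≡ 0#
    step n = trans (cong (_+ c) (trans (cong (f 0 *_) (solution-suc n)) (trans (sym (*-assoc _ _ _))
      (trans (cong (_* - c) (inv-inverseʳ f0≢0)) (*-identityˡ _))))) (-‿inverseˡ c)
      where c = ((f ∘ suc) ⊛ solution) n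

  -- Each further coefficient of the root solves a linear equation with slope 2σ, which is nonzero
  -- in odd characteristic.
  series-sqrt : ∀ f σ → σ ≢ 0# → f 0 ≡ σ * σ → ∃ λ S → S ⊛ S ≗ f
  series-sqrt f σ σ≢0 f0 = S , λ { zero → sym f0 ; (suc zero) → first ; (suc (suc n)) → step n }
    where
    2σ≢0 : σ + σ ≢ 0#
    2σ≢0 e = σ≢0 (x+x≡0⇒x≡0 e)
    i = inv (σ + σ)
    -- Here R is the root without its constant coefficient σ, so `(R ⊛ R) n` is the part of the
    -- coefficient n + 2 of the square that does not involve the unknown.
    open Recursion (i * f 1) (λ n R → i * (f (suc (suc n)) + - (R ⊛ R) n))
      (λ n {R} {R′} e → cong (λ x → i * (f (suc (suc n)) + - x)) (⊛-local {R} {R′} {R} {R′} n e e))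
    S : Series
    S zero    = σ
    S (suc n) = solution n
    half-twice : ∀ x → σ * (i * x) + (i * x) * σ ≡ x
    half-twice x = trans (solve 3 (λ s i x → s :* (i :* x) :+ (i :* x) :* s := (s :+ s) :* i :* x) refl σ i x)
      (trans (cong (_* x) (inv-inverseʳ 2σ≢0)) (*-identityˡ x))
      where open F-solver
    first : σ * (i * f 1) + (i * f 1) * σ ≡ f 1
    first = half-twice (f 1)
    step : ∀ n → σ * solution (suc n) + (solution ⊛ S) (suc n) ≡ f (suc (suc n))
    step n = trans (cong (σ * solution (suc n) +_) (⊛-unfoldʳ solution S n)) (trans
      (cong (λ x → σ * x + (c + x * σ)) (solution-suc n)) (trans
      (solve 3 (λ a c b → a :+ (c :+ b) := c :+ (a :+ b)) refl (σ * (i * (f (suc (suc n)) + - c))) c _)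
      (trans (cong (c +_) (half-twice _)) (solve 2 (λ c x → c :+ (x :+ :- c) := x) refl c (f (suc (suc n)))))))
      where
      open F-solver
      c = (solution ⊛ solution) n

  -- Multiplication by the a-th power of 1/t, used to bring expansions with different top exponents
  -- to a common scale.
  sh : ℕ → Series → Series
  sh zero    f n       = f n
  sh (suc a) f zero    = 0#
  sh (suc a) f (suc n) = sh a f n

  sh-cong : ∀ a {f g} → f ≗ g → sh a f ≗ sh a g
  sh-cong zero    e n       = e n
  sh-cong (suc a) e zero    = refl
  sh-cong (suc a) e (suc n) = sh-cong a e n

  sh-⊛ : ∀ a f g → sh a f ⊛ g ≗ sh a (f ⊛ g)
  sh-⊛ zero    f g n       = ⊛-cong {sh 0 f} {f} {g} {g} (λ _ → refl) (λ _ → refl) n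
  sh-⊛ (suc a) f g zero    = zeroˡ _
  sh-⊛ (suc a) f g (suc n) = trans (cong₂ _+_ (zeroˡ _) (sh-⊛ a f g n)) (+-identityˡ _)

  sh-sh : ∀ a b f → sh a (sh b f) ≗ sh (a ℕ.+ b) f
  sh-sh zero    b f n       = refl
  sh-sh (suc a) b f zero    = refl
  sh-sh (suc a) b f (suc n) = sh-sh a b f n

  sh-above : ∀ a f n → sh a f (a ℕ.+ n) ≡ f n
  sh-above zero    f n = refl
  sh-above (suc a) f n = sh-above a f n

  sh-below : ∀ a f n → n < a → sh a f n ≡ 0#
  sh-below (suc a) f zero    _        = refl
  sh-below (suc a) f (suc n) (s≤s lt) = sh-below a f n lt

  -- p / tᴺ as a power series in 1/t
  rev : ℕ → Poly → Series
  rev N       p zero    = coeff p N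
  rev zero    p (suc n) = 0#
  rev (suc N) p (suc n) = rev N p n

  Within : ℕ → Poly → Set
  Within N p = ∀ i → N < i → coeff p i ≡ 0#

  rev-cong : ∀ N {p r} → p ≈ₚ r → rev N p ≗ rev N r
  rev-cong N       e zero    = e N
  rev-cong zero    e (suc n) = refl
  rev-cong (suc N) e (suc n) = rev-cong N e n

  rev-+ : ∀ N p r → rev N (p +ₚ r) ≗ rev N p ⊕ rev N r
  rev-+ N       p r zero    = coeff-+ p r N
  rev-+ zero    p r (suc n) = sym (+-identityʳ 0#)
  rev-+ (suc N) p r (suc n) = rev-+ N p r n

  rev-neg : ∀ N p → rev N (-ₚ p) ≗ ⊝ rev N p
  rev-neg N       p zero    = coeff-neg p N
  rev-neg zero    p (suc n) = sym -0≡0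
  rev-neg (suc N) p (suc n) = rev-neg N p n

  rev-scale : ∀ N c p n → rev N (map (c *_) p) n ≡ c * rev N p n
  rev-scale N       c p zero    = coeff-scale c p N
  rev-scale zero    c p (suc n) = sym (zeroʳ c)
  rev-scale (suc N) c p (suc n) = rev-scale N c p n

  rev-[] : ∀ N → rev N [] ≗ 0ˢ
  rev-[] N       zero    = refl
  rev-[] zero    (suc n) = refl
  rev-[] (suc N) (suc n) = rev-[] N n

  rev-0∷ : ∀ N p → rev (suc N) (0# ∷ p) ≗ rev N p
  rev-0∷ N       p zero          = refl
  rev-0∷ zero    p (suc zero)    = refl
  rev-0∷ zero    p (suc (suc n)) = refl
  rev-0∷ (suc N) p (suc n)       = rev-0∷ N p n

  rev-const : ∀ N c g n → (rev N (c ∷ []) ⊛ g) n ≡ c * sh N g n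
  rev-const zero    c g zero    = refl
  rev-const zero    c g (suc n) = trans (cong (c * g (suc n) +_) (⊛-zeroˡ g n)) (+-identityʳ _)
  rev-const (suc N) c g zero    = trans (zeroˡ _) (sym (zeroʳ c))
  rev-const (suc N) c g (suc n) = trans (cong₂ _+_ (zeroˡ _) (rev-const N c g n)) (+-identityˡ _)

  rev-raise : ∀ a N p → Within N p → rev (a ℕ.+ N) p ≗ sh a (rev N p)
  rev-raise zero    N p wi n       = refl
  rev-raise (suc a) N p wi zero    = wi (suc a ℕ.+ N) (s≤s (ℕₚ.m≤n+m N a))
  rev-raise (suc a) N p wi (suc n) = rev-raise a N p wi n

  rev-* : ∀ N M p r → Within N p → Within M r → rev N p ⊛ rev M r ≗ rev (N ℕ.+ M) (p *ₚ r)
  rev-* N M [] r wp wr n = trans (⊛-cong {rev N []} {0ˢ} {rev M r} {rev M r} (rev-[] N) (λ _ → refl) n)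
    (trans (⊛-zeroˡ (rev M r) n) (sym (rev-[] (N ℕ.+ M) n)))
  rev-* zero M (c ∷ p) r wp wr n = trans (⊛-cong {rev 0 (c ∷ p)} {rev 0 (c ∷ [])} {rev M r} {rev M r} (λ { zero → refl ; (suc _) → refl }) (λ _ → refl) n)
    (trans (rev-const 0 c (rev M r) n) (trans (sym (rev-scale M c r n)) (rev-cong M {map (c *_) r} {(c ∷ p) *ₚ r}
      (λ m → sym (trans (coeff-+ (map (c *_) r) (0# ∷ (p *ₚ r)) m) (trans (cong (coeff (map (c *_) r) m +_) (vanish m)) (+-identityʳ _)))) n)))
    where
    p≈0 : p ≈ₚ 0ₚ
    p≈0 i = wp (suc i) (s≤s z≤n)
    vanish : ∀ m → coeff (0# ∷ (p *ₚ r)) m ≡ 0#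
    vanish zero    = refl
    vanish (suc m) = *ₚ-cong {p} {[]} {r} {r} p≈0 (λ _ → refl) m
  rev-* (suc N) M (c ∷ p) r wp wr n = begin
    (rev (suc N) (c ∷ p) ⊛ rev M r) n
      ≡⟨ ⊛-cong {rev (suc N) (c ∷ p)} {rev (suc N) (c ∷ []) ⊕ rev N p} {rev M r} {rev M r} (λ m → trans
           (rev-cong (suc N) {c ∷ p} {(c ∷ []) +ₚ (0# ∷ p)} (λ { zero → sym (+-identityʳ c) ; (suc _) → refl }) m)
           (trans (rev-+ (suc N) (c ∷ []) (0# ∷ p) m) (cong (rev (suc N) (c ∷ []) m +_) (rev-0∷ N p m)))) (λ _ → refl) n ⟩
    ((rev (suc N) (c ∷ []) ⊕ rev N p) ⊛ rev M r) n
      ≡⟨ trans (⊛-distribʳ (rev M r) (rev (suc N) (c ∷ [])) (rev N p) n) (cong₂ _+_ (rev-const (suc N) c (rev M r) n)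
           (rev-* N M p r (λ i lt → wp (suc i) (s≤s lt)) wr n)) ⟩
    c * sh (suc N) (rev M r) n + rev (N ℕ.+ M) (p *ₚ r) n
      ≡⟨ cong₂ _+_ (trans (cong (c *_) (sym (rev-raise (suc N) M r wr n))) (sym (rev-scale (suc N ℕ.+ M) c r n))) (sym (rev-0∷ (N ℕ.+ M) (p *ₚ r) n)) ⟩
    rev (suc N ℕ.+ M) (map (c *_) r) n + rev (suc N ℕ.+ M) (0# ∷ (p *ₚ r)) n
      ≡⟨ sym (rev-+ (suc N ℕ.+ M) (map (c *_) r) (0# ∷ (p *ₚ r)) n) ⟩
    rev (suc N ℕ.+ M) ((c ∷ p) *ₚ r) n ∎
    where open ≡-Reasoning

  rev-injective : ∀ N p → Within N p → rev N p ≗ 0ˢ → p ≈ₚ 0ₚ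
  rev-injective N p wi z i with N ℕₚ.<? i
  ... | yes lt = wi i lt
  ... | no nlt = trans (sym (read N i (ℕₚ.≮⇒≥ nlt))) (z (N ℕ.∸ i))
    where
    read : ∀ N i → i ≤ N → rev N p (N ℕ.∸ i) ≡ coeff p i
    read N       i le with ℕₚ.m≤n⇒m<n∨m≡n le
    read N       .N le | inj₂ refl = cong (rev N p) (ℕₚ.n∸n≡0 N)
    read (suc N) i  le | inj₁ (s≤s i≤N) = trans (cong (rev (suc N) p) (ℕₚ.+-∸-assoc 1 i≤N)) (read N i i≤N)

  Within-* : ∀ {N M p r} → Within N p → Within M r → Within (N ℕ.+ M) (p *ₚ r)
  Within-* {N} {M} {p} {r} wp wr n lt = coeff-*-zero p r n λ i j e → case i j e
    where
    case : ∀ i j → i ℕ.+ j ≡ n → coeff p i * coeff r j ≡ 0#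
    case i j e with N ℕₚ.<? i
    ... | yes lt′ = trans (cong (_* coeff r j) (wp i lt′)) (zeroˡ _)
    ... | no nlt  = trans (cong (coeff p i *_) (wr j (ℕₚ.≰⇒> λ le → ℕₚ.<⇒≱ lt (subst (_≤ N ℕ.+ M) e (ℕₚ.+-mono-≤ (ℕₚ.≮⇒≥ nlt) le))))) (zeroʳ _)

  sumTo-⊛ : ∀ f g n → sumTo (λ i → f i * g (n ℕ.∸ i)) n ≡ (f ⊛ g) n
  sumTo-⊛ f g zero    = refl
  sumTo-⊛ f g (suc n) = trans (cong₂ _+_ (trans (sumTo-cong n (λ i le → cong (λ m → f i * g m) (ℕₚ.+-∸-assoc 1 le))) (sumTo-⊛ f (g ∘ suc) n))
      (cong (λ m → f (suc n) * g m) (ℕₚ.n∸n≡0 n))) (sym (⊛-unfoldʳ f g n))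
    where
    sumTo-cong : ∀ {h h′} n → (∀ i → i ≤ n → h i ≡ h′ i) → sumTo h n ≡ sumTo h′ n
    sumTo-cong zero    e = e 0 z≤n
    sumTo-cong (suc n) e = cong₂ _+_ (sumTo-cong n (λ i le → e i (ℕₚ.m≤n⇒m≤1+n le))) (e (suc n) ℕₚ.≤-refl)

  -- x = tᵀ c(1/t), presented with top exponent T
  Expands : Laurent → ℤ → Series → Set
  Expands x T c = top x ≡ T × co x ≗ c

  coeff∞-+ : ∀ x j n → top x ℤ.- j ≡ ℤ.+ n → coeff∞ x j ≡ co x n
  coeff∞-+ x j n e with top x ℤ.- j | e
  ... | .(ℤ.+ n) | refl = refl

  T-[T-k] : ∀ T k → T ℤ.- (T ℤ.- k) ≡ k
  T-[T-k] T k = trans (cong (λ z → T ℤ.+ z) (ℤₚ.neg-distrib-+ T (ℤ.- k))) (trans (sym (ℤₚ.+-assoc T (ℤ.- T) _))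
    (trans (cong₂ ℤ._+_ (ℤₚ.+-inverseʳ T) (ℤₚ.neg-involutive k)) (ℤₚ.+-identityˡ k)))

  coeff∞-at : ∀ x {T} k → top x ≡ T → coeff∞ x (T ℤ.- ℤ.+ k) ≡ co x k
  coeff∞-at x k refl = coeff∞-+ x (top x ℤ.- ℤ.+ k) k (T-[T-k] (top x) (ℤ.+ k))

  Expands-+ : ∀ {x y T c d} → Expands x T c → Expands y T d → Expands (x +∞ y) T (c ⊕ d)
  Expands-+ {x} {y} {T} (refl , ec) (et , ed) = m≡ , λ k → cong₂ _+_
      (trans (coeff∞-at x k (sym m≡)) (ec k)) (trans (coeff∞-at y k (trans et (sym m≡))) (ed k))
    where
    m≡ : top x ℤ.⊔ top y ≡ top x
    m≡ = trans (cong (top x ℤ.⊔_) et) (ℤₚ.⊔-idem (top x))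

  Expands-* : ∀ {x y T S c d} → Expands x T c → Expands y S d → Expands (x *∞ y) (T ℤ.+ S) (c ⊛ d)
  Expands-* {x} {y} (ex , ec) (ey , ed) = cong₂ ℤ._+_ ex ey , λ k → trans (sumTo-⊛ (co x) (co y) k) (⊛-cong ec ed k)

  Expands-Σ₃ : ∀ {f : Fin 3 → Laurent} {T} {g : Fin 3 → Series} → (∀ i → Expands (f i) T (g i)) → Expands (Σ₃ _+∞_ f) T (Σ₃ _⊕_ g)
  Expands-Σ₃ {f} {T} {g} h = Expands-+ {f 0F} {f 1F +∞ f 2F} {T} {g 0F} {g 1F ⊕ g 2F} (h 0F) (Expands-+ {f 1F} {f 2F} {T} {g 1F} {g 2F} (h 1F) (h 2F))

  coeff∞-0 : ∀ j → coeff∞ 0∞ j ≡ 0#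
  coeff∞-0 j with ℤ.+ 0 ℤ.- j
  ... | ℤ.+ n    = refl
  ... | -[1+ n ] = refl

  Expands-0 : ∀ {x T} → Expands x T 0ˢ → x ≈∞ 0∞
  Expands-0 {x} (_ , z) j with top x ℤ.- j in e
  ... | ℤ.+ n    = trans (z n) (sym (coeff∞-0 j))
  ... | -[1+ n ] = sym (coeff∞-0 j)

  ≈∞0⇒0 : ∀ {x T c} → Expands x T c → x ≈∞ 0∞ → c ≗ 0ˢ
  ≈∞0⇒0 {x} {T} (et , ec) z k = trans (sym (ec k)) (trans (sym (coeff∞-at x k et)) (trans (z (T ℤ.- ℤ.+ k)) (coeff∞-0 (T ℤ.- ℤ.+ k))))

  -- A Laurent series may be presented with a larger top exponent if as many zeros are put in front.
  -- Denominator times image and numerator come with different presentations of this kind.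
  Expands-≈ : ∀ {x y T c} a → Expands x (T ℤ.+ ℤ.+ a) (sh a c) → Expands y T c → x ≈∞ y
  Expands-≈ {x} {y} {T} {c} a (tx , cx) (ty , cy) j with top y ℤ.- j in ey
  ... | ℤ.+ n = trans (coeff∞-+ x j (a ℕ.+ n) (trans shift (trans (cong (ℤ._+ ℤ.+ a) (trans (cong (ℤ._- j) (sym ty)) ey))
                  (cong (λ z → ℤ.+ z) (ℕₚ.+-comm n a))))) (trans (cx (a ℕ.+ n)) (trans (sh-above a c n) (sym (cy n))))
    where
    shift : top x ℤ.- j ≡ (T ℤ.- j) ℤ.+ ℤ.+ a
    shift = trans (cong (ℤ._- j) tx) (trans (ℤₚ.+-assoc T (ℤ.+ a) (ℤ.- j)) (trans (cong (λ z → T ℤ.+ z) (ℤₚ.+-comm (ℤ.+ a) (ℤ.- j)))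
      (sym (ℤₚ.+-assoc T (ℤ.- j) (ℤ.+ a)))))
  ... | -[1+ m ] with top x ℤ.- j in ex
  ...   | -[1+ n ] = refl
  ...   | ℤ.+ n    = trans (cx n) (sh-below a c n (ℤₚ.drop‿+<+ (subst (ℤ._< ℤ.+ a) (trans (sym eq) ex)
                       (subst (-[1+ m ] ℤ.+ ℤ.+ a ℤ.<_) (ℤₚ.+-identityˡ (ℤ.+ a)) (ℤₚ.+-monoˡ-< (ℤ.+ a) ℤ.-<+)))))
    where
    eq : top x ℤ.- j ≡ -[1+ m ] ℤ.+ ℤ.+ a
    eq = trans (cong (ℤ._- j) tx) (trans (ℤₚ.+-assoc T (ℤ.+ a) (ℤ.- j)) (trans (cong (λ z → T ℤ.+ z) (ℤₚ.+-comm (ℤ.+ a) (ℤ.- j)))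
      (trans (sym (ℤₚ.+-assoc T (ℤ.- j) (ℤ.+ a))) (cong (ℤ._+ ℤ.+ a) (trans (cong (ℤ._- j) (sym ty)) ey)))))

  ι∞-expands : ∀ p → Expands (ι∞ₚ p) (ℤ.+ length p) (rev (length p) p)
  ι∞-expands p = refl , go (length p)
    where
    go : ∀ N k → (if k ℕ.≤ᵇ N then coeff p (N ℕ.∸ k) else 0#) ≡ rev N p k
    go N       zero          = refl
    go zero    (suc k)       = refl
    go (suc N) (suc zero)    = go N zero
    go (suc N) (suc (suc k)) = go N (suc k)

  Within-length : ∀ p N → length p ≤ N → Within N p
  Within-length []      N       _        i       _        = refl
  Within-length (c ∷ p) (suc N) (s≤s le) (suc i) (s≤s lt) = Within-length p N le i lt

-- Isotropic vectors over the completion.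

module Isotropy (𝔽 : FiniteField) (odd : FiniteField.size 𝔽 ℕ.% 2 ≡ 1) where
  open FieldTheory 𝔽
  open Forms 𝔽
  open Degrees 𝔽
  open Bilinear 𝔽
  open Reduction 𝔽
  open LaurentSeries 𝔽 odd

  Within-Σ₃ : ∀ {N} f → (∀ i → Within N (f i)) → Within N (Σ₃ _+ₚ_ f)
  Within-Σ₃ f w n lt = trans (coeff-Σ₃ f n) (Σ₃-zero (λ i → w i n lt))

  rev-Σ₃ : ∀ N f → rev N (Σ₃ _+ₚ_ f) ≗ Σ₃ _⊕_ (λ i → rev N (f i))
  rev-Σ₃ N f n = trans (rev-+ N (f 0F) (f 1F +ₚ f 2F) n) (cong (rev N (f 0F) n +_) (rev-+ N (f 1F) (f 2F) n))

  Seriesᵥ : Set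
  Seriesᵥ = Fin 3 → Series

  form : (Fin 3 → Fin 3 → Series) → Seriesᵥ → Seriesᵥ → Series
  form g x y = Σ₃ _⊕_ (λ i → Σ₃ _⊕_ (λ j → g i j ⊛ (x i ⊛ y j)))

  combine : Series → Seriesᵥ → Series → Seriesᵥ → Seriesᵥ
  combine p x r y i = p ⊛ x i ⊕ r ⊛ y i

  Σ₃-⊛ : ∀ p f → Σ₃ _⊕_ (λ i → p ⊛ f i) ≗ p ⊛ Σ₃ _⊕_ f
  Σ₃-⊛ p f = solve 4 (λ p a b c → p :* a :+ (p :* b :+ p :* c) := p :* (a :+ (b :+ c))) (λ _ → refl) p (f 0F) (f 1F) (f 2F)
    where open S-solver

  Σ₃-combine : ∀ {h : Seriesᵥ} p f r g → (∀ i → h i ≗ p ⊛ f i ⊕ r ⊛ g i) → Σ₃ _⊕_ h ≗ p ⊛ Σ₃ _⊕_ f ⊕ r ⊛ Σ₃ _⊕_ g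
  Σ₃-combine {h} p f r g e n = trans (Σ₃-cong {λ i → h i n} {λ i → (p ⊛ f i) n + (r ⊛ g i) n} (λ i → e i n)) (trans
    (Σ₃-+ (λ i → (p ⊛ f i) n) (λ i → (r ⊛ g i) n)) (cong₂ _+_ (Σ₃-⊛ p f n) (Σ₃-⊛ r g n)))

  form-combine : ∀ g p x r y z → form g (combine p x r y) z ≗ p ⊛ form g x z ⊕ r ⊛ form g y z
  form-combine g p x r y z = Σ₃-combine {λ i → Σ₃ _⊕_ (λ j → g i j ⊛ (combine p x r y i ⊛ z j))} p
    (λ i → Σ₃ _⊕_ (λ j → g i j ⊛ (x i ⊛ z j))) r (λ i → Σ₃ _⊕_ (λ j → g i j ⊛ (y i ⊛ z j)))
    λ i → Σ₃-combine {λ j → g i j ⊛ (combine p x r y i ⊛ z j)} p (λ j → g i j ⊛ (x i ⊛ z j)) r (λ j → g i j ⊛ (y i ⊛ z j))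
      λ j → solve 6 (λ g p x r y z → g :* ((p :* x :+ r :* y) :* z) := p :* (g :* (x :* z)) :+ r :* (g :* (y :* z))) (λ _ → refl)
        (g i j) p (x i) r (y i) (z j)
    where open S-solver

  form-sym : ∀ {g} → (∀ i j → g i j ≗ g j i) → ∀ x y → form g x y ≗ form g y x
  form-sym {g} s x y n = trans (Σ₃-cong {λ i → Σ₃ _+_ (λ j → (g i j ⊛ (x i ⊛ y j)) n)} {λ i → Σ₃ _+_ (λ j → (g j i ⊛ (y j ⊛ x i)) n)}
      (λ i → Σ₃-cong {λ j → (g i j ⊛ (x i ⊛ y j)) n} {λ j → (g j i ⊛ (y j ⊛ x i)) n}
        (λ j → ⊛-cong {g i j} {g j i} {x i ⊛ y j} {y j ⊛ x i} (s i j) (⊛-comm (x i) (y j)) n)))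
    (Σ₃-swap (λ i j → (g j i ⊛ (y j ⊛ x i)) n))

  -- The quadratic formula on the plane of x and y. With a, b, c the values `form g x x`,
  -- `form g x y`, `form g y y`, the vector (s - b)x + a y has the value a(s² - (b² - a c)).
  isotropic-vector : ∀ {g} → (∀ i j → g i j ≗ g j i) → ∀ x y s →
    s ⊛ s ≗ form g x y ⊛ form g x y ⊕ (⊝ (form g x x ⊛ form g y y)) →
    let z = combine (s ⊕ (⊝ form g x y)) x (form g x x) y in form g z z ≗ 0ˢ
  isotropic-vector {g} sy x y s e n = begin
    form g z z n
      ≡⟨ form-combine g p x a y z n ⟩
    (p ⊛ form g x z ⊕ a ⊛ form g y z) n
      ≡⟨ cong₂ _+_ (⊛-cong {p} {p} {form g x z} {p ⊛ a ⊕ a ⊛ b} (λ _ → refl) (λ m → trans (form-sym {g} sy x z m) (trans (form-combine g p x a y x m)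
           (cong ((p ⊛ a) m +_) (⊛-cong {a} {a} {form g y x} {b} (λ _ → refl) (form-sym {g} sy y x) m)))) n)
         (⊛-cong {a} {a} {form g y z} {p ⊛ b ⊕ a ⊛ c} (λ _ → refl) (λ m → trans (form-sym {g} sy y z m) (form-combine g p x a y y m)) n) ⟩
    (p ⊛ (p ⊛ a ⊕ a ⊛ b) ⊕ a ⊛ (p ⊛ b ⊕ a ⊛ c)) n
      ≡⟨ solve 4 (λ s a b c → (s :+ :- b) :* ((s :+ :- b) :* a :+ a :* b) :+ a :* ((s :+ :- b) :* b :+ a :* c)
           := a :* (s :* s) :+ :- (a :* (b :* b :+ :- (a :* c)))) (λ _ → refl) s a b c n ⟩
    (a ⊛ (s ⊛ s)) n + - (a ⊛ (b ⊛ b ⊕ (⊝ (a ⊛ c)))) n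
      ≡⟨ cong (_+ - (a ⊛ (b ⊛ b ⊕ (⊝ (a ⊛ c)))) n) (⊛-cong {a} {a} {s ⊛ s} {b ⊛ b ⊕ (⊝ (a ⊛ c))} (λ _ → refl) e n) ⟩
    (a ⊛ (b ⊛ b ⊕ (⊝ (a ⊛ c)))) n + - (a ⊛ (b ⊛ b ⊕ (⊝ (a ⊛ c)))) n
      ≡⟨ -‿inverseʳ _ ⟩
    0# ∎
    where
    open ≡-Reasoning
    open S-solver
    a b c p : Series
    a = form g x x
    b = form g x y
    c = form g y y
    p = s ⊕ (⊝ b)
    z = combine p x a y

  bound : (Fin 3 → ℕ) → ℕ
  bound = Σ₃ ℕ._+_

  ≤-bound : ∀ f i → f i ≤ bound f
  ≤-bound f 0F = ℕₚ.m≤m+n _ _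
  ≤-bound f 1F = ℕₚ.≤-trans (ℕₚ.m≤m+n _ _) (ℕₚ.m≤n+m _ (f 0F))
  ≤-bound f 2F = ℕₚ.≤-trans (ℕₚ.m≤n+m _ (f 1F)) (ℕₚ.m≤n+m _ (f 0F))

  module _ {L : TernaryLattice} {D : Poly} (int : Integral L D) where
    open Integral int

    discriminant : Triple → Triple → Poly
    discriminant u w = B n u w *ₚ B n u w +ₚ (-ₚ (B n u u *ₚ B n w w))

    -- The functional v certifies that the isotropic vector in the K∞-span of u and w is nonzero.
    isotropic : ∀ (u w v : Triple) h σ → Σ₃ _+ₚ_ (λ k → v k *ₚ u k) ≈ₚ 0ₚ → ¬ (Σ₃ _+ₚ_ (λ k → v k *ₚ w k) ≈ₚ 0ₚ) →
      ¬ (B n u u ≈ₚ 0ₚ) → Within (h ℕ.+ h) (discriminant u w) → coeff (discriminant u w) (h ℕ.+ h) ≡ σ * σ → σ ≢ 0# →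
      IsotropicOverK∞ L
    isotropic u w v h σ vu≈0 vw≉0 A≉0 wΔ lead σ≢0 = x , x≉0 , m , image , sum≈0
      where
      Δ = discriminant u w
      deg-D : ∃ (HasDegree D)
      deg-D = ≉0⇒HasDegree D D≉0
      δ : ℕ
      δ = proj₁ deg-D
      sizes : Fin 3 → Fin 3 → ℕ
      sizes i j = length (num (gram L i j)) ℕ.+ length (n i j)
      sizeᵥ : Fin 3 → ℕ
      sizeᵥ i = length (u i) ℕ.+ (length (w i) ℕ.+ length (v i))
      -- One exponent dominates all degrees involved, so that vectors and Gram entries expand at the
      -- same scale and the bookkeeping of exponents stays uniform.
      e₀ e : ℕ
      e₀ = bound sizeᵥ ℕ.+ bound (λ i → bound (sizes i))
      e = h ℕ.+ (δ ℕ.+ e₀)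

      e₀≤e : e₀ ≤ e
      e₀≤e = ℕₚ.≤-trans (ℕₚ.m≤n+m e₀ δ) (ℕₚ.m≤n+m _ h)

      sizeᵥ≤e : ∀ i → sizeᵥ i ≤ e
      sizeᵥ≤e i = ℕₚ.≤-trans (≤-bound sizeᵥ i) (ℕₚ.≤-trans (ℕₚ.m≤m+n _ _) e₀≤e)
      sizes≤e₀ : ∀ i j → sizes i j ≤ e₀
      sizes≤e₀ i j = ℕₚ.≤-trans (≤-bound (sizes i) j) (ℕₚ.≤-trans (≤-bound (λ i → bound (sizes i)) i) (ℕₚ.m≤n+m _ (bound sizeᵥ)))

      within-u : ∀ i → Within e (u i)
      within-u i = Within-length (u i) e (ℕₚ.≤-trans (ℕₚ.m≤m+n _ _) (sizeᵥ≤e i))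
      within-w : ∀ i → Within e (w i)
      within-w i = Within-length (w i) e (ℕₚ.≤-trans (ℕₚ.≤-trans (ℕₚ.m≤m+n _ _) (ℕₚ.m≤n+m _ (length (u i)))) (sizeᵥ≤e i))
      within-v : ∀ i → Within e (v i)
      within-v i = Within-length (v i) e (ℕₚ.≤-trans (ℕₚ.≤-trans (ℕₚ.m≤n+m _ (length (w i))) (ℕₚ.m≤n+m _ (length (u i)))) (sizeᵥ≤e i))
      within-n : ∀ i j → Within e (n i j)
      within-n i j = Within-length (n i j) e (ℕₚ.≤-trans (ℕₚ.≤-trans (ℕₚ.m≤n+m _ (length (num (gram L i j)))) (sizes≤e₀ i j)) e₀≤e)
      num-δ≤e : ∀ i j → length (num (gram L i j)) ℕ.+ δ ≤ e
      num-δ≤e i j = ℕₚ.≤-trans (ℕₚ.≤-reflexive (ℕₚ.+-comm _ δ)) (ℕₚ.≤-trans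
        (ℕₚ.+-monoʳ-≤ δ (ℕₚ.≤-trans (ℕₚ.m≤m+n _ _) (sizes≤e₀ i j))) (ℕₚ.m≤n+m _ h))

      N̂ : Fin 3 → Fin 3 → Series
      N̂ i j = rev e (n i j)
      û ŵ v̂ : Seriesᵥ
      û i = rev e (u i)
      ŵ i = rev e (w i)
      v̂ i = rev e (v i)

      e₃ : ℕ
      e₃ = e ℕ.+ (e ℕ.+ e)

      within-B : ∀ y z → (∀ i → Within e (y i)) → (∀ i → Within e (z i)) → Within e₃ (B n y z)
      within-B y z wy wz = Within-Σ₃ (λ i → Σ₃ _+ₚ_ (λ j → n i j *ₚ (y i *ₚ z j))) λ i → Within-Σ₃ (λ j → n i j *ₚ (y i *ₚ z j))
        λ j → Within-* {e} {e ℕ.+ e} {n i j} {y i *ₚ z j} (within-n i j) (Within-* {e} {e} {y i} {z j} (wy i) (wz j))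

      rev-B : ∀ y z → (∀ i → Within e (y i)) → (∀ i → Within e (z i)) → rev e₃ (B n y z) ≗ form N̂ (λ i → rev e (y i)) (λ i → rev e (z i))
      rev-B y z wy wz k = trans (rev-Σ₃ e₃ (λ i → Σ₃ _+ₚ_ (t i)) k) (Σ₃-cong {λ i → rev e₃ (Σ₃ _+ₚ_ (t i)) k} λ i →
        trans (rev-Σ₃ e₃ (t i) k) (Σ₃-cong {λ j → rev e₃ (t i j) k} λ j → sym (trans
          (⊛-cong {N̂ i j} {N̂ i j} {rev e (y i) ⊛ rev e (z j)} {rev (e ℕ.+ e) (y i *ₚ z j)} (λ _ → refl) (rev-* e e (y i) (z j) (wy i) (wz j)) k)
          (rev-* e (e ℕ.+ e) (n i j) (y i *ₚ z j) (within-n i j) (Within-* {e} {e} {y i} {z j} (wy i) (wz j)) k))))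
        where
        t : Fin 3 → Fin 3 → Poly
        t i j = n i j *ₚ (y i *ₚ z j)

      root : ∃ λ s → s ⊛ s ≗ rev (h ℕ.+ h) Δ
      root = series-sqrt (rev (h ℕ.+ h) Δ) σ σ≢0 lead
      r : ℕ
      r = e₃ ℕ.∸ h
      -- The root of the discriminant is found at scale h, its true degree; the shift by r moves it
      -- to the scale e₃ of the values of B.
      s : Series
      s = sh r (proj₁ root)
      h≤e₃ : h ≤ e₃
      h≤e₃ = ℕₚ.≤-trans (ℕₚ.m≤m+n h _) (ℕₚ.m≤m+n e _)
      r+h : (r ℕ.+ r) ℕ.+ (h ℕ.+ h) ≡ e₃ ℕ.+ e₃
      r+h = trans (ℕ-solve r h) (cong₂ ℕ._+_ (ℕₚ.m∸n+n≡m h≤e₃) (ℕₚ.m∸n+n≡m h≤e₃))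
        where
        open +-*-Solver
        ℕ-solve : ∀ r h → (r ℕ.+ r) ℕ.+ (h ℕ.+ h) ≡ (r ℕ.+ h) ℕ.+ (r ℕ.+ h)
        ℕ-solve = solve 2 (λ r h → (r :+ r) :+ (h :+ h) := (r :+ h) :+ (r :+ h)) refl

      s² : s ⊛ s ≗ rev (e₃ ℕ.+ e₃) Δ
      s² k = begin
        (sh r q ⊛ sh r q) k             ≡⟨ sh-⊛ r q (sh r q) k ⟩
        sh r (q ⊛ sh r q) k             ≡⟨ sh-cong r (λ l → trans (⊛-comm q (sh r q) l) (sh-⊛ r q q l)) k ⟩
        sh r (sh r (q ⊛ q)) k           ≡⟨ sh-sh r r (q ⊛ q) k ⟩
        sh (r ℕ.+ r) (q ⊛ q) k          ≡⟨ sh-cong (r ℕ.+ r) (proj₂ root) k ⟩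
        sh (r ℕ.+ r) (rev (h ℕ.+ h) Δ) k ≡⟨ sym (rev-raise (r ℕ.+ r) (h ℕ.+ h) Δ wΔ k) ⟩
        rev ((r ℕ.+ r) ℕ.+ (h ℕ.+ h)) Δ k ≡⟨ cong (λ N → rev N Δ k) r+h ⟩
        rev (e₃ ℕ.+ e₃) Δ k             ∎
        where open ≡-Reasoning
              q = proj₁ root

      product : ∀ y z y′ z′ → (∀ i → Within e (y i)) → (∀ i → Within e (z i)) → (∀ i → Within e (y′ i)) → (∀ i → Within e (z′ i)) →
        rev (e₃ ℕ.+ e₃) (B n y z *ₚ B n y′ z′) ≗ form N̂ (λ i → rev e (y i)) (λ i → rev e (z i)) ⊛ form N̂ (λ i → rev e (y′ i)) (λ i → rev e (z′ i))
      product y z y′ z′ wy wz wy′ wz′ k = trans (sym (rev-* e₃ e₃ (B n y z) (B n y′ z′) (within-B y z wy wz) (within-B y′ z′ wy′ wz′) k))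
        (⊛-cong (rev-B y z wy wz) (rev-B y′ z′ wy′ wz′) k)

      s-form : s ⊛ s ≗ form N̂ û ŵ ⊛ form N̂ û ŵ ⊕ (⊝ (form N̂ û û ⊛ form N̂ ŵ ŵ))
      s-form k = trans (s² k) (trans (rev-+ (e₃ ℕ.+ e₃) (B n u w *ₚ B n u w) (-ₚ (B n u u *ₚ B n w w)) k) (cong₂ _+_
        (product u w u w within-u within-w within-u within-w k)
        (trans (rev-neg (e₃ ℕ.+ e₃) (B n u u *ₚ B n w w) k) (cong -_ (product u u w w within-u within-u within-w within-w k)))))

      A : Series
      A = form N̂ û û
      p : Series
      p = s ⊕ (⊝ form N̂ û ŵ)
      x̂ : Seriesᵥ
      x̂ = combine p û A ŵ
      N̂-sym : ∀ i j → N̂ i j ≗ N̂ j i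
      N̂-sym i j = rev-cong e {n i j} {n j i} (n-sym i j)

      x̂-isotropic : form N̂ x̂ x̂ ≗ 0ˢ
      x̂-isotropic = isotropic-vector {N̂} N̂-sym û ŵ s s-form

      x : Fin 3 → Laurent
      x i = laurent (ℤ.+ 0) (x̂ i)

      pairing : ∀ y → (∀ i → Within e (y i)) → Σ₃ _⊕_ (λ k → v̂ k ⊛ rev e (y k)) ≗ rev (e ℕ.+ e) (Σ₃ _+ₚ_ (λ k → v k *ₚ y k))
      pairing y wy l = sym (trans (rev-Σ₃ (e ℕ.+ e) (λ k → v k *ₚ y k) l) (Σ₃-cong {λ k → rev (e ℕ.+ e) (v k *ₚ y k) l}
        (λ k → sym (rev-* e e (v k) (y k) (within-v k) (wy k) l))))

      -- Pairing x with v annihilates the part along u and leaves A times the pairing of v with w, a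
      -- product of nonzero factors.
      x≉0 : ¬ (∀ i → x i ≈∞ 0∞)
      x≉0 z = *ₚ-≉0 {B n u u} {Σ₃ _+ₚ_ (λ k → v k *ₚ w k)} A≉0 vw≉0
        (rev-injective (e₃ ℕ.+ (e ℕ.+ e)) (B n u u *ₚ vw) (Within-* {e₃} {e ℕ.+ e} {B n u u} {vw} within-A within-vw) λ k → begin
          rev (e₃ ℕ.+ (e ℕ.+ e)) (B n u u *ₚ vw) k
            ≡⟨ sym (rev-* e₃ (e ℕ.+ e) (B n u u) vw within-A within-vw k) ⟩
          (rev e₃ (B n u u) ⊛ rev (e ℕ.+ e) vw) k
            ≡⟨ ⊛-cong {rev e₃ (B n u u)} {A} {rev (e ℕ.+ e) vw} {vŵ} (rev-B u u within-u within-u) (λ l → sym (pairing w within-w l)) k ⟩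
          (A ⊛ vŵ) k
            ≡⟨ sym (+-identityˡ _) ⟩
          0# + (A ⊛ vŵ) k
            ≡⟨ cong (_+ (A ⊛ vŵ) k) (sym (trans (⊛-comm p vû k) (trans (⊛-cong {vû} {0ˢ} {p} {p} vû≗0 (λ _ → refl) k) (⊛-zeroˡ p k)))) ⟩
          (p ⊛ vû) k + (A ⊛ vŵ) k
            ≡⟨ sym (Σ₃-combine {λ i → v̂ i ⊛ x̂ i} p (λ i → v̂ i ⊛ û i) A (λ i → v̂ i ⊛ ŵ i)
                 (λ i → solve 5 (λ v p u a w → v :* (p :* u :+ a :* w) := p :* (v :* u) :+ a :* (v :* w)) (λ _ → refl) (v̂ i) p (û i) A (ŵ i)) k) ⟩
          Σ₃ _+_ (λ i → (v̂ i ⊛ x̂ i) k)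
            ≡⟨ Σ₃-zero (λ i → trans (⊛-comm (v̂ i) (x̂ i) k) (trans
                 (⊛-cong {x̂ i} {0ˢ} {v̂ i} {v̂ i} (≈∞0⇒0 {x i} {ℤ.+ 0} (refl , λ _ → refl) (z i)) (λ _ → refl) k) (⊛-zeroˡ (v̂ i) k))) ⟩
          0# ∎)
        where
        open ≡-Reasoning
        open S-solver
        vw : Poly
        vw = Σ₃ _+ₚ_ (λ k → v k *ₚ w k)
        vû vŵ : Series
        vû = Σ₃ _⊕_ (λ k → v̂ k ⊛ û k)
        vŵ = Σ₃ _⊕_ (λ k → v̂ k ⊛ ŵ k)
        within-A = within-B u u within-u within-u
        within-vw : Within (e ℕ.+ e) vw
        within-vw = Within-Σ₃ (λ k → v k *ₚ w k) (λ k → Within-* {e} {e} {v k} {w k} (within-v k) (within-w k))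
        vû≗0 : vû ≗ 0ˢ
        vû≗0 l = trans (pairing u within-u l) (trans (rev-cong (e ℕ.+ e) {Σ₃ _+ₚ_ (λ k → v k *ₚ u k)} {[]} vu≈0 l) (rev-[] (e ℕ.+ e) l))

      D-inverse : ∃ λ I → rev δ D ⊛ I ≗ 1ˢ
      D-inverse = series-inverse (rev δ D) (proj₁ (proj₂ deg-D))
      I : Series
      I = proj₁ D-inverse

      -- The quotient of `n i j` by D, expanded as a series in 1/t; the top exponent e - δ accounts
      -- for the scales of the two.
      m : Mat₃ Laurent
      m i j = laurent (ℤ.+ e ℤ.- ℤ.+ δ) (N̂ i j ⊛ I)

      image : ∀ i j → IsImage∞ (gram L i j) (m i j)
      image i j = Expands-≈ {ι∞ₚ d *∞ m i j} {ι∞ₚ c} {ℤ.+ lc} {rev lc c} a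
        (trans (proj₁ product-expands) top≡ , λ k → trans (proj₂ product-expands k) (series k)) (ι∞-expands c)
        where
        open ≡-Reasoning
        open S-solver
        c d : Poly
        c = num (gram L i j)
        d = den (gram L i j)
        lc ld a : ℕ
        lc = length c
        ld = length d
        a = (ld ℕ.+ e) ℕ.∸ (lc ℕ.+ δ)
        a+ : a ℕ.+ (lc ℕ.+ δ) ≡ ld ℕ.+ e
        a+ = ℕₚ.m∸n+n≡m (ℕₚ.≤-trans (num-δ≤e i j) (ℕₚ.m≤n+m e ld))
        product-expands : Expands (ι∞ₚ d *∞ m i j) (ℤ.+ ld ℤ.+ (ℤ.+ e ℤ.- ℤ.+ δ)) (rev ld d ⊛ (N̂ i j ⊛ I))
        product-expands = Expands-* {ι∞ₚ d} {m i j} {ℤ.+ ld} {ℤ.+ e ℤ.- ℤ.+ δ} {rev ld d} {N̂ i j ⊛ I} (ι∞-expands d) (refl , λ _ → refl)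
        top≡ : ℤ.+ ld ℤ.+ (ℤ.+ e ℤ.- ℤ.+ δ) ≡ ℤ.+ lc ℤ.+ ℤ.+ a
        top≡ = trans (sym (ℤₚ.+-assoc (ℤ.+ ld) (ℤ.+ e) (ℤ.- ℤ.+ δ))) (trans (cong (λ t → ℤ.+ t ℤ.- ℤ.+ δ) (trans (sym a+) (trans (sym (ℕₚ.+-assoc a lc δ))
          (cong (ℕ._+ δ) (ℕₚ.+-comm a lc))))) (trans (ℤₚ.+-assoc (ℤ.+ (lc ℕ.+ a)) (ℤ.+ δ) (ℤ.- ℤ.+ δ))
          (trans (cong (λ t → ℤ.+ (lc ℕ.+ a) ℤ.+ t) (ℤₚ.+-inverseʳ (ℤ.+ δ))) (ℤₚ.+-identityʳ _))))
        within-c : Within lc c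
        within-c = Within-length c lc ℕₚ.≤-refl
        cross : rev ld d ⊛ N̂ i j ≗ sh a (rev lc c ⊛ rev δ D)
        cross k = begin
          (rev ld d ⊛ N̂ i j) k            ≡⟨ rev-* ld e d (n i j) (Within-length d ld ℕₚ.≤-refl) (within-n i j) k ⟩
          rev (ld ℕ.+ e) (d *ₚ n i j) k   ≡⟨ rev-cong (ld ℕ.+ e) {d *ₚ n i j} {c *ₚ D}
                                               (λ l → trans (P.*-comm d (n i j) l) (sym (proj₂ (n-gram i j) l))) k ⟩
          rev (ld ℕ.+ e) (c *ₚ D) k       ≡⟨ cong (λ N → rev N (c *ₚ D) k) (sym a+) ⟩
          rev (a ℕ.+ (lc ℕ.+ δ)) (c *ₚ D) k ≡⟨ rev-raise a (lc ℕ.+ δ) (c *ₚ D) (Within-* {lc} {δ} {c} {D} within-c (proj₂ (proj₂ deg-D))) k ⟩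
          sh a (rev (lc ℕ.+ δ) (c *ₚ D)) k ≡⟨ sh-cong a (λ l → sym (rev-* lc δ c D within-c (proj₂ (proj₂ deg-D)) l)) k ⟩
          sh a (rev lc c ⊛ rev δ D) k     ∎
        series : rev ld d ⊛ (N̂ i j ⊛ I) ≗ sh a (rev lc c)
        series k = begin
          (rev ld d ⊛ (N̂ i j ⊛ I)) k            ≡⟨ sym (⊛-assoc (rev ld d) (N̂ i j) I k) ⟩
          ((rev ld d ⊛ N̂ i j) ⊛ I) k            ≡⟨ ⊛-cong {rev ld d ⊛ N̂ i j} {sh a (rev lc c ⊛ rev δ D)} {I} {I} cross (λ _ → refl) k ⟩
          (sh a (rev lc c ⊛ rev δ D) ⊛ I) k      ≡⟨ sh-⊛ a (rev lc c ⊛ rev δ D) I k ⟩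
          sh a ((rev lc c ⊛ rev δ D) ⊛ I) k      ≡⟨ sh-cong a (λ l → trans (⊛-assoc (rev lc c) (rev δ D) I l) (trans
                                                     (⊛-cong {rev lc c} {rev lc c} {rev δ D ⊛ I} {1ˢ} (λ _ → refl) (proj₂ D-inverse) l) (S.*-identityʳ (rev lc c) l))) k ⟩
          sh a (rev lc c) k                      ∎

      sum≈0 : Σ₃ _+∞_ (λ i → Σ₃ _+∞_ (λ j → m i j *∞ (x i *∞ x j))) ≈∞ 0∞
      sum≈0 = Expands-0 {Σ₃ _+∞_ (λ i → Σ₃ _+∞_ (λ j → m i j *∞ (x i *∞ x j)))} {T} (proj₁ expansion , λ k → trans (proj₂ expansion k) (zero-series k))
        where
        open S-solver
        T : ℤ
        T = (ℤ.+ e ℤ.- ℤ.+ δ) ℤ.+ (ℤ.+ 0 ℤ.+ ℤ.+ 0)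
        t : Fin 3 → Fin 3 → Series
        t i j = (N̂ i j ⊛ I) ⊛ (x̂ i ⊛ x̂ j)
        expansion : Expands (Σ₃ _+∞_ (λ i → Σ₃ _+∞_ (λ j → m i j *∞ (x i *∞ x j)))) T (Σ₃ _⊕_ (λ i → Σ₃ _⊕_ (t i)))
        expansion = Expands-Σ₃ {λ i → Σ₃ _+∞_ (λ j → m i j *∞ (x i *∞ x j))} {T} {λ i → Σ₃ _⊕_ (t i)} λ i →
          Expands-Σ₃ {λ j → m i j *∞ (x i *∞ x j)} {T} {t i} λ j →
            Expands-* {m i j} {x i *∞ x j} {ℤ.+ e ℤ.- ℤ.+ δ} {ℤ.+ 0 ℤ.+ ℤ.+ 0} {N̂ i j ⊛ I} {x̂ i ⊛ x̂ j} (refl , λ _ → refl)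
              (Expands-* {x i} {x j} {ℤ.+ 0} {ℤ.+ 0} {x̂ i} {x̂ j} (refl , λ _ → refl) (refl , λ _ → refl))
        zero-series : Σ₃ _⊕_ (λ i → Σ₃ _⊕_ (t i)) ≗ 0ˢ
        zero-series k = trans (Σ₃-cong {λ i → Σ₃ _+_ (λ j → t i j k)} {λ i → (I ⊛ row i) k} (λ i → trans
            (Σ₃-cong {λ j → t i j k} {λ j → (I ⊛ (N̂ i j ⊛ (x̂ i ⊛ x̂ j))) k} (λ j →
              solve 3 (λ n i z → (n :* i) :* z := i :* (n :* z)) (λ _ → refl) (N̂ i j) I (x̂ i ⊛ x̂ j) k))
            (Σ₃-⊛ I (λ j → N̂ i j ⊛ (x̂ i ⊛ x̂ j)) k)))
          (trans (Σ₃-⊛ I row k) (trans (⊛-comm I (form N̂ x̂ x̂) k) (trans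
            (⊛-cong {form N̂ x̂ x̂} {0ˢ} {I} {I} x̂-isotropic (λ _ → refl) k) (⊛-zeroˡ I k))))
          where
          row : Fin 3 → Series
          row i = Σ₃ _⊕_ (λ j → N̂ i j ⊛ (x̂ i ⊛ x̂ j))

-- What definiteness says about leading coefficients and parities.

module Definiteness (𝔽 : FiniteField) (odd : FiniteField.size 𝔽 ℕ.% 2 ≡ 1) where
  open FieldTheory 𝔽
  open FieldCounting 𝔽 odd
  open Forms 𝔽
  open Degrees 𝔽
  open Bilinear 𝔽
  open Reduction 𝔽
  open LaurentSeries 𝔽 odd
  open Isotropy 𝔽 odd

  record ReducedGram (G : Gram) (μ : Fin 3 → ℕ) : Set where
    field
      symmetric : ∀ i j → G i j ≈ₚ G j i
      diagonal-degree : ∀ i → HasDegree (G i i) (μ i)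
      upper     : ∀ i j n → i Fin.< j → μ i ≤ n → coeff (G i j) n ≡ 0#

    lead : Fin 3 → Carrier
    lead i = coeff (G i i) (μ i)

  module _ {L : TernaryLattice} {D : Poly} (definite : Definite L) (int : Integral L D)
    {U V : Mat₃ Poly} (VU : V ·ₘ U ≈ₘ Iₘ) where
    open Integral int

    private
      G : Gram
      G = gramIn n U

    -- Since B(x , y) stays below the mean degree h, the discriminant has degree 2h and leading
    -- coefficient -a_p c_q. If this is a nonzero square, the plane becomes isotropic over K∞. The
    -- last row of V, the third coordinate in the basis U, vanishes on x but not on y and certifies
    -- nonzeroness.
    no-square : ∀ (x y : Triple) p q h σ → x 2F ≈ₚ 0ₚ → ¬ (y 2F ≈ₚ 0ₚ) → HasDegree (B G x x) p → Within q (B G y y) →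
      (∀ n → p ℕ.+ q ≤ n ℕ.+ n → coeff (B G x y) n ≡ 0#) → p ℕ.+ q ≡ h ℕ.+ h →
      - (coeff (B G x x) p * coeff (B G y y) q) ≡ σ * σ → σ ≢ 0# → ⊥
    no-square x y p q h σ x≈0 y≉0 hx wy small p+q≡ lead σ≢0 = definite (isotropic int u w (V 2F) h σ
        (λ i → trans (inverse-·ᵥ {V} {U} VU x 2F i) (x≈0 i))
        (λ z → y≉0 (λ i → trans (sym (inverse-·ᵥ {V} {U} VU y 2F i)) (z i)))
        (HasDegree-≉0 {a} ha)
        (λ i lt → trans (coeff-Δ i) (trans (cong₂ (λ s t → s + - t) (bb i (ℕₚ.<⇒≤ lt)) (ac i lt)) (-‿inverseʳ 0#)))
        (trans (coeff-Δ (h ℕ.+ h)) (trans (cong₂ (λ s t → s + - t) (bb (h ℕ.+ h) ℕₚ.≤-refl) top-ac) (trans (+-identityˡ _) lead))) σ≢0)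
      where
      u w : Triple
      u = U ·ᵥ x
      w = U ·ᵥ y
      a b c : Poly
      a = B n u u
      b = B n u w
      c = B n w w
      a≈ : B G x x ≈ₚ a
      a≈ i = sym (B-gramIn {n} n-sym U x x i)
      c≈ : c ≈ₚ B G y y
      c≈ = B-gramIn {n} n-sym U y y
      ha : HasDegree a p
      ha = HasDegree-cong {B G x x} {a} a≈ hx
      wc : Within q c
      wc i lt = trans (c≈ i) (wy i lt)
      coeff-Δ : ∀ i → coeff (discriminant int u w) i ≡ coeff (b *ₚ b) i + - coeff (a *ₚ c) i
      coeff-Δ i = trans (coeff-+ (b *ₚ b) (-ₚ (a *ₚ c)) i) (cong (coeff (b *ₚ b) i +_) (coeff-neg (a *ₚ c) i))
      b-small : ∀ i → h ≤ i → coeff b i ≡ 0#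
      b-small i le = trans (B-gramIn {n} n-sym U x y i) (small i (subst (_≤ i ℕ.+ i) (sym p+q≡) (ℕₚ.+-mono-≤ le le)))
      bb : ∀ i → h ℕ.+ h ≤ i → coeff (b *ₚ b) i ≡ 0#
      bb i le = coeff-*-zero b b i λ j l e → case j l e
        where
        case : ∀ j l → j ℕ.+ l ≡ i → coeff b j * coeff b l ≡ 0#
        case j l e with h ℕₚ.≤? j
        ... | yes h≤j = trans (cong (_* coeff b l) (b-small j h≤j)) (zeroˡ _)
        ... | no h≰j  = trans (cong (coeff b j *_) (b-small l (ℕₚ.<⇒≤ (ℕₚ.+-cancelˡ-< h _ _ (ℕₚ.≤-<-trans
                          (subst (h ℕ.+ h ≤_) (sym e) le) (ℕₚ.+-monoˡ-< l (ℕₚ.≰⇒> h≰j))))))) (zeroʳ _)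
      ac : ∀ i → h ℕ.+ h < i → coeff (a *ₚ c) i ≡ 0#
      ac i lt = Within-* {p} {q} {a} {c} (proj₂ ha) wc i (subst (_< i) (sym p+q≡) lt)
      top-ac : coeff (a *ₚ c) (h ℕ.+ h) ≡ coeff (B G x x) p * coeff (B G y y) q
      top-ac = trans (cong (coeff (a *ₚ c)) (sym p+q≡)) (trans (coeff-* a c (p ℕ.+ q)) (trans
        (⊛-single (coeff a) (coeff c) p q off) (cong₂ _*_ (sym (a≈ p)) (c≈ q))))
        where
        off : ∀ j l → j ℕ.+ l ≡ p ℕ.+ q → j ≢ p → coeff a j * coeff c l ≡ 0#
        off j l e ne with p ℕₚ.<? j
        ... | yes lt = trans (cong (_* coeff c l) (proj₂ ha j lt)) (zeroˡ _)
        ... | no nlt = trans (cong (coeff a j *_) (wc l (ℕₚ.≰⇒> λ le →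
                ℕₚ.<⇒≢ (ℕₚ.+-mono-<-≤ (ℕₚ.≤∧≢⇒< (ℕₚ.≮⇒≥ nlt) ne) le) e))) (zeroʳ _)

    module _ {μ : Fin 3 → ℕ} (red : ReducedGram G μ) where
      open ReducedGram red

      private
        lead≢0 : ∀ i → lead i ≢ 0#
        lead≢0 i = proj₁ (diagonal-degree i)

        e : Fin 3 → Triple
        e i = unit i 1ₚ

        degree-e : ∀ i → HasDegree (B G (e i) (e i)) (μ i)
        degree-e i = HasDegree-cong {G i i} {B G (e i) (e i)} (λ l → sym (B-unit-1 G i i l)) (diagonal-degree i)

        σ≢0 : ∀ {a b σ} → a ≢ 0# → b ≢ 0# → - (a * b) ≡ σ * σ → σ ≢ 0#
        σ≢0 {a} {b} a≢0 b≢0 eq refl = *-≢0 a≢0 b≢0 (trans (solve 2 (λ a b → a :* b := :- (:- (a :* b))) refl a b)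
          (trans (cong -_ (trans eq (zeroˡ 0#))) -0≡0))
          where open F-solver

        mono-degree : ∀ j → HasDegree (mono j) j
        mono-degree j = (λ z → 0≢1 (trans (sym z) (coeff-mono-≡ j))) , λ i lt → coeff-mono-≢ j i (ℕₚ.<⇒≢ lt)

      leads-nonsquare : ∀ i h → Fin.toℕ i < 2 → μ i ≤ μ 2F → μ i ℕ.+ μ 2F ≡ h ℕ.+ h → ¬ IsSquare (- (lead i * lead 2F))
      leads-nonsquare i h i<2 le e+ (σ , eq) = no-square (e i) (e 2F) (μ i) (μ 2F) h σ
        (off i i<2) (λ z → 0≢1 (sym (z 0))) (degree-e i) (proj₂ (degree-e 2F))
        (λ l le′ → trans (B-unit-1 G i 2F l) (upper i 2F l i<2 (double-≤ (ℕₚ.≤-trans (ℕₚ.+-monoʳ-≤ (μ i) le) le′)))) e+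
        (trans (cong -_ (cong₂ _*_ (B-unit-1 G i i (μ i)) (B-unit-1 G 2F 2F (μ 2F)))) (sym eq)) (σ≢0 (lead≢0 i) (lead≢0 2F) (sym eq))
        where
        off : ∀ i → Fin.toℕ i < 2 → e i 2F ≈ₚ 0ₚ
        off 0F _ _ = refl
        off 1F _ _ = refl
        off 2F (s≤s (s≤s ())) _

      -- A zero with c ≠ 0 would exhibit -a₀g₀ as the square of a₀ξ/c.
      anisotropic : ∀ h → μ 0F ≤ μ 2F → μ 0F ℕ.+ μ 2F ≡ h ℕ.+ h → ∀ ξ c →
        lead 0F * (ξ * ξ) + lead 2F * (c * c) ≡ 0# → ξ ≡ 0# × c ≡ 0#
      anisotropic h le e+ ξ c eq with c ≟ 0#
      ... | yes refl = ax²≡0⇒x≡0 (lead≢0 0F) (trans (sym (+-identityʳ _)) (trans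
              (cong (lead 0F * (ξ * ξ) +_) (sym (trans (cong (lead 2F *_) (zeroˡ 0#)) (zeroʳ _)))) eq)) , refl
      ... | no c≢0 = ⊥-elim (leads-nonsquare 0F h (s≤s z≤n) le e+ (lead 0F * ξ * inv c , (begin
              lead 0F * ξ * inv c * (lead 0F * ξ * inv c)
                ≡⟨ solve 4 (λ a g x i → a :* x :* i :* (a :* x :* i) := a :* (a :* (x :* x)) :* (i :* i)) refl (lead 0F) (lead 2F) ξ (inv c) ⟩
              lead 0F * (lead 0F * (ξ * ξ)) * (inv c * inv c)
                ≡⟨ cong (λ z → lead 0F * z * (inv c * inv c)) (trans (sym (+-identityʳ _)) (trans (cong (lead 0F * (ξ * ξ) +_) (sym (-‿inverseʳ (lead 2F * (c * c)))))
                     (trans (sym (+-assoc _ _ _)) (trans (cong (_+ - (lead 2F * (c * c))) eq) (+-identityˡ _))))) ⟩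
              lead 0F * (- (lead 2F * (c * c))) * (inv c * inv c)
                ≡⟨ solve 4 (λ a g c i → a :* (:- (g :* (c :* c))) :* (i :* i) := :- (a :* g) :* ((c :* i) :* (c :* i))) refl (lead 0F) (lead 2F) c (inv c) ⟩
              - (lead 0F * lead 2F) * ((c * inv c) * (c * inv c))
                ≡⟨ cong (λ z → - (lead 0F * lead 2F) * (z * z)) (inv-inverseʳ c≢0) ⟩
              - (lead 0F * lead 2F) * (1# * 1#)
                ≡⟨ trans (cong (- (lead 0F * lead 2F) *_) (*-identityˡ 1#)) (*-identityʳ _) ⟩
              - (lead 0F * lead 2F) ∎)))
        where open ≡-Reasoning
              open F-solver

      -- With all minima of one parity, a₀ξ² + d₀η² = -g₀ has a solution by counting, and it lifts to an isotropic plane.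
      minima-parity : ∀ i j → μ 1F ≡ μ 0F ℕ.+ (i ℕ.+ i) → μ 2F ≡ μ 1F ℕ.+ (j ℕ.+ j) → ⊥
      minima-parity i j μ₁≡ μ₂≡ with binary-universal (- lead 2F) (lead≢0 0F) (lead≢0 1F)
      ... | ξ , η , eq with ξ ≟ 0#
      -- For ξ = 0 the equation reads d₀η² = -g₀, so -d₀g₀ is the square of d₀η and the plane of v₂
      -- and v₃ suffices.
      ...   | yes refl = leads-nonsquare 1F (μ 1F ℕ.+ j) (s≤s (s≤s z≤n)) (subst (μ 1F ≤_) (sym μ₂≡) (ℕₚ.m≤m+n _ _))
              (trans (cong (μ 1F ℕ.+_) μ₂≡) (ℕ-solve (μ 1F) j))
              (lead 1F * η , trans (solve 2 (λ d x → d :* x :* (d :* x) := d :* (d :* (x :* x))) refl (lead 1F) η) (trans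
                (cong (lead 1F *_) (trans (sym (+-identityˡ _)) (trans (cong (_+ lead 1F * (η * η)) (sym (trans (cong (lead 0F *_) (zeroˡ 0#)) (zeroʳ _)))) eq)))
                (solve 2 (λ d g → d :* (:- g) := :- (d :* g)) refl (lead 1F) (lead 2F))))
        where
        open F-solver
        ℕ-solve : ∀ m j → m ℕ.+ (m ℕ.+ (j ℕ.+ j)) ≡ (m ℕ.+ j) ℕ.+ (m ℕ.+ j)
        ℕ-solve = +-*-Solver.solve 2 (λ m j → m ℕS.:+ (m ℕS.:+ (j ℕS.:+ j)) ℕS.:= (m ℕS.:+ j) ℕS.:+ (m ℕS.:+ j)) refl
          where module ℕS = +-*-Solver
      -- The vector y = η tʲ v₂ + v₃ has top coefficient d₀η² + g₀ = -a₀ξ². Against v₁ this produces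
      -- the square of a₀ξ.
      ...   | no ξ≢0 = no-square (e 0F) y (μ 0F) (μ 2F) (μ 0F ℕ.+ (i ℕ.+ j)) (lead 0F * ξ) (λ _ → refl) (λ z → 0≢1 (sym (trans (sym (y₂ 0)) (z 0))))
              (degree-e 0F) (λ l lt → trans (coeff-yy l) (trans (cong₂ (λ s t → s + t) (trans (cong (η * η *_) (proj₂ degree-11 l lt)) (zeroʳ _))
                (cong₂ (λ s t → s + t) (trans (cong ((η + η) *_) (small-12 l (ℕₚ.<⇒≤ lt))) (zeroʳ _)) (proj₂ (diagonal-degree 2F) l lt)))
                (trans (+-identityˡ _) (+-identityˡ _))))
              (λ l le → trans (coeff-0y l) (trans (cong₂ _+_ (trans (cong (η *_) (small-01 l (halve l le))) (zeroʳ η)) (upper 0F 2F l (s≤s z≤n) (ℕₚ.≤-trans (ℕₚ.m≤m+n _ _) (halve l le)))) (+-identityˡ _)))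
              total
              lead-eq
              (*-≢0 (lead≢0 0F) ξ≢0)
        where
        open F-solver
        module ℕS = +-*-Solver
        e₁ y : Triple
        e₁ = unit 1F (mono j)
        y  = η ∙ e₁ +ᵥ e 2F
        y₂ : y 2F ≈ₚ 1ₚ
        y₂ l = refl
        total : μ 0F ℕ.+ μ 2F ≡ (μ 0F ℕ.+ (i ℕ.+ j)) ℕ.+ (μ 0F ℕ.+ (i ℕ.+ j))
        total = trans (cong (μ 0F ℕ.+_) (trans μ₂≡ (cong (ℕ._+ (j ℕ.+ j)) μ₁≡)))
          (ℕS.solve 3 (λ m i j → m ℕS.:+ (m ℕS.:+ (i ℕS.:+ i) ℕS.:+ (j ℕS.:+ j)) ℕS.:= (m ℕS.:+ (i ℕS.:+ j)) ℕS.:+ (m ℕS.:+ (i ℕS.:+ j))) refl (μ 0F) i j)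
        halve : ∀ l → μ 0F ℕ.+ μ 2F ≤ l ℕ.+ l → μ 0F ℕ.+ (i ℕ.+ j) ≤ l
        halve l le = double-≤ (subst (_≤ l ℕ.+ l) total le)
        with-mono : ∀ s r → B G e₁ (unit s r) ≈ₚ G 1F s *ₚ (mono j *ₚ r)
        with-mono s r l = coeff-B-unit G 1F (mono j) s r l
        mono-zero : ∀ s N → (∀ l → N ≤ l → coeff (G 1F s) l ≡ 0#) → ∀ l → N ℕ.+ j ≤ l → coeff (B G e₁ (e s)) l ≡ 0#
        mono-zero s N z l le = trans (with-mono s 1ₚ l) (coeff-*-zero (G 1F s) (mono j *ₚ 1ₚ) l λ p q eq → case p q eq)
          where
          case : ∀ p q → p ℕ.+ q ≡ l → coeff (G 1F s) p * coeff (mono j *ₚ 1ₚ) q ≡ 0#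
          case p q eq with N ℕₚ.≤? p
          ... | yes N≤p = trans (cong (_* coeff (mono j *ₚ 1ₚ) q) (z p N≤p)) (zeroˡ _)
          ... | no N≰p  = trans (cong (coeff (G 1F s) p *_) (trans (P.*-identityʳ (mono j) q) (coeff-mono-≢ j q (ℕₚ.<⇒≢
                (ℕₚ.≰⇒> λ q≤j → ℕₚ.<⇒≱ (ℕₚ.+-mono-<-≤ (ℕₚ.≰⇒> N≰p) q≤j) (subst (N ℕ.+ j ≤_) (sym eq) le)))))) (zeroʳ _)
        small-01 : ∀ l → μ 0F ℕ.+ (i ℕ.+ j) ≤ l → coeff (B G e₁ (e 0F)) l ≡ 0#
        small-01 l le = mono-zero 0F (μ 0F) (λ l′ le′ → trans (symmetric 1F 0F l′) (upper 0F 1F l′ (s≤s z≤n) le′)) l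
          (ℕₚ.≤-trans (ℕₚ.+-monoʳ-≤ (μ 0F) (ℕₚ.m≤n+m j i)) le)
        small-12 : ∀ l → μ 2F ≤ l → coeff (B G e₁ (e 2F)) l ≡ 0#
        small-12 l le = mono-zero 2F (μ 1F) (λ l′ le′ → upper 1F 2F l′ (s≤s (s≤s z≤n)) le′) l
          (ℕₚ.≤-trans (subst (μ 1F ℕ.+ j ≤_) (sym μ₂≡) (ℕₚ.+-monoʳ-≤ (μ 1F) (ℕₚ.m≤m+n j j))) le)
        degree-11 : HasDegree (B G e₁ e₁) (μ 2F)
        degree-11 = subst (HasDegree (B G e₁ e₁)) (sym μ₂≡) (HasDegree-cong {G 1F 1F *ₚ (mono j *ₚ mono j)} {B G e₁ e₁}
          (λ l → sym (with-mono 1F (mono j) l)) (HasDegree-* {G 1F 1F} {mono j *ₚ mono j} (diagonal-degree 1F)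
            (HasDegree-* {mono j} {mono j} (mono-degree j) (mono-degree j))))
        top-11 : coeff (B G e₁ e₁) (μ 2F) ≡ lead 1F
        top-11 = trans (cong (coeff (B G e₁ e₁)) μ₂≡) (trans (with-mono 1F (mono j) (μ 1F ℕ.+ (j ℕ.+ j))) (trans
          (coeff₃-lead (G 1F 1F) (mono j) (μ 1F) j (proj₂ (diagonal-degree 1F)) (proj₂ (mono-degree j)))
          (trans (cong (λ z → lead 1F * (z * z)) (coeff-mono-≡ j)) (trans (cong (lead 1F *_) (*-identityˡ 1#)) (*-identityʳ _)))))
        coeff-y : ∀ z l → coeff (B G y z) l ≡ η * coeff (B G e₁ z) l + coeff (B G (e 2F) z) l
        coeff-y z l = trans (B-+ˡ G (η ∙ e₁) (e 2F) z l) (trans (coeff-+ (B G (η ∙ e₁) z) (B G (e 2F) z) l)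
          (cong (_+ coeff (B G (e 2F) z) l) (trans (B-∙ˡ G η e₁ z l) (coeff-scale η (B G e₁ z) l))))
        coeff-0y : ∀ l → coeff (B G (e 0F) y) l ≡ η * coeff (B G e₁ (e 0F)) l + coeff (G 0F 2F) l
        coeff-0y l = trans (B-sym {G} symmetric (e 0F) y l) (trans (coeff-y (e 0F) l)
          (cong (η * coeff (B G e₁ (e 0F)) l +_) (trans (B-unit-1 G 2F 0F l) (symmetric 2F 0F l))))
        coeff-yy : ∀ l → coeff (B G y y) l ≡ η * η * coeff (B G e₁ e₁) l + ((η + η) * coeff (B G e₁ (e 2F)) l + coeff (G 2F 2F) l)
        coeff-yy l = trans (coeff-y y l) (trans (cong₂ (λ s t → η * s + t)
            (trans (B-sym {G} symmetric e₁ y l) (trans (coeff-y e₁ l) (cong (η * coeff (B G e₁ e₁) l +_) (B-sym {G} symmetric (e 2F) e₁ l))))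
            (trans (B-sym {G} symmetric (e 2F) y l) (trans (coeff-y (e 2F) l) (cong (η * coeff (B G e₁ (e 2F)) l +_) (B-unit-1 G 2F 2F l)))))
          (solve 4 (λ h a b c → h :* (h :* a :+ b) :+ (h :* b :+ c) := h :* h :* a :+ ((h :+ h) :* b :+ c)) refl η _ _ _))
        lead-eq : - (coeff (B G (e 0F) (e 0F)) (μ 0F) * coeff (B G y y) (μ 2F)) ≡ lead 0F * ξ * (lead 0F * ξ)
        lead-eq = trans (cong -_ (cong₂ _*_ (B-unit-1 G 0F 0F (μ 0F)) (trans (coeff-yy (μ 2F)) (cong₂ (λ s t → η * η * s + ((η + η) * t + lead 2F)) top-11 (small-12 (μ 2F) ℕₚ.≤-refl)))))
          (trans (solve 5 (λ a d g x h → :- (a :* (h :* h :* d :+ ((h :+ h) :* con (ℤ.+ 0) :+ g)))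
              := a :* x :* (a :* x) :+ :- (a :* (a :* (x :* x) :+ d :* (h :* h) :+ g))) refl (lead 0F) (lead 1F) (lead 2F) ξ η)
          (trans (cong (λ z → lead 0F * ξ * (lead 0F * ξ) + - (lead 0F * z)) (trans (cong (_+ lead 2F) eq) (-‿inverseˡ _)))
            (trans (cong (λ z → lead 0F * ξ * (lead 0F * ξ) + - z) (zeroʳ _)) (trans (cong (lead 0F * ξ * (lead 0F * ξ) +_) -0≡0) (+-identityʳ _)))))
          where import Data.Integer as ℤ

-- From minima in ℤ to degrees of numerators.

halves : ∀ r → ∃ λ i → r ≡ i ℕ.+ i ⊎ suc r ≡ i ℕ.+ i
halves zero    = 0 , inj₁ refl
halves (suc r) with halves r
... | i , inj₁ e = suc i , inj₂ (cong suc (trans (cong suc e) (sym (ℕₚ.+-suc i i))))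
... | i , inj₂ e = i , inj₁ e

odd-5≤ : ∀ {n} → n ℕ.% 2 ≡ 1 → 3 < n → 4 < n
odd-5≤ {n} odd 3<n with ℕₚ.m≤n⇒m<n∨m≡n 3<n
... | inj₁ 4<n  = 4<n
odd-5≤ () _ | inj₂ refl

-- Distinct integers differ by at least 1, so a bound q > 2 + y - x with x < y gives q > 3, and
-- parity raises this to the five elements that `peel-line` needs.
3≤2+gap : ∀ {x y} → x ℤ.< y → ℤ.+ 3 ℤ.≤ ℤ.+ 2 ℤ.+ y ℤ.- x
3≤2+gap {x} {y} x<y = subst (ℤ._≤ ℤ.+ 2 ℤ.+ y ℤ.- x) start (ℤₚ.+-monoˡ-≤ (ℤ.- x) (ℤₚ.+-monoʳ-≤ (ℤ.+ 2) (ℤₚ.i<j⇒suc[i]≤j x<y)))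
  where
  start : ℤ.+ 2 ℤ.+ (ℤ.+ 1 ℤ.+ x) ℤ.- x ≡ ℤ.+ 3
  start = trans (cong (ℤ._- x) (sym (ℤₚ.+-assoc (ℤ.+ 2) (ℤ.+ 1) x))) (trans (ℤₚ.+-assoc (ℤ.+ 3) x (ℤ.- x))
    (trans (cong (λ z → ℤ.+ 3 ℤ.+ z) (ℤₚ.+-inverseʳ x)) (ℤₚ.+-identityʳ (ℤ.+ 3))))

module Minima (𝔽 : FiniteField) (odd : FiniteField.size 𝔽 ℕ.% 2 ≡ 1) where
  open FieldTheory 𝔽
  open Forms 𝔽
  open Reduction 𝔽
  open Definiteness 𝔽 odd

  -- Comparing degrees in num x · D = p · den x shows that deg x and deg p differ by the degree δ of
  -- D, and that one of x and p vanishes with the other.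
  fraction-degree : ∀ {x p D δ} → IsFraction x p D → HasDegree D δ →
    (degₖ x ≡ nothing × p ≈ₚ 0ₚ) ⊎ (∃ λ N → HasDegree p N × degₖ x ≡ just (ℤ.+ N ℤ.- ℤ.+ δ))
  fraction-degree {x} {p} {D} {δ} (vx , ex) hD with degₚ (num x) in en | degₚ (den x) in ed
  ... | _       | nothing = ⊥-elim (vx (degₚ-nothing (den x) ed))
  ... | nothing | just b  = inj₁ (refl , zero-p (decide-≈0 p))
    where
    zero-p : p ≈ₚ 0ₚ ⊎ ¬ (p ≈ₚ 0ₚ) → p ≈ₚ 0ₚ
    zero-p (inj₁ z)  = z
    zero-p (inj₂ nz) = ⊥-elim (*ₚ-≉0 {p} {den x} nz vx λ n → trans (sym (ex n))
      (*ₚ-cong {num x} {[]} {D} {D} (degₚ-nothing (num x) en) (λ _ → refl) n))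
  ... | just a  | just b  = inj₂ (N , hp , cong just (begin
      ℤ.+ a ℤ.- ℤ.+ b                            ≡⟨ cong (ℤ._- ℤ.+ b) (cancel a δ) ⟩
      ℤ.+ (a ℕ.+ δ) ℤ.- ℤ.+ δ ℤ.- ℤ.+ b          ≡⟨ cong (λ z → ℤ.+ z ℤ.- ℤ.+ δ ℤ.- ℤ.+ b) total ⟩
      ℤ.+ (N ℕ.+ b) ℤ.- ℤ.+ δ ℤ.- ℤ.+ b          ≡⟨ trans (ℤₚ.+-assoc (ℤ.+ (N ℕ.+ b)) (ℤ.- ℤ.+ δ) (ℤ.- ℤ.+ b)) (trans (cong (λ z → ℤ.+ (N ℕ.+ b) ℤ.+ z) (ℤₚ.+-comm (ℤ.- ℤ.+ δ) (ℤ.- ℤ.+ b)))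
                                                       (sym (ℤₚ.+-assoc (ℤ.+ (N ℕ.+ b)) (ℤ.- ℤ.+ b) (ℤ.- ℤ.+ δ)))) ⟩
      ℤ.+ (N ℕ.+ b) ℤ.- ℤ.+ b ℤ.- ℤ.+ δ          ≡⟨ cong (ℤ._- ℤ.+ δ) (sym (cancel N b)) ⟩
      ℤ.+ N ℤ.- ℤ.+ δ                            ∎))
    where
    open ≡-Reasoning
    cancel : ∀ a b → ℤ.+ a ≡ ℤ.+ (a ℕ.+ b) ℤ.- ℤ.+ b
    cancel a b = sym (trans (ℤₚ.+-assoc (ℤ.+ a) (ℤ.+ b) (ℤ.- ℤ.+ b)) (trans (cong (λ z → ℤ.+ a ℤ.+ z) (ℤₚ.+-inverseʳ (ℤ.+ b))) (ℤₚ.+-identityʳ _)))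
    hn = HasDegree-* {num x} {D} (degₚ-just (num x) en) hD
    p≉0 : ¬ (p ≈ₚ 0ₚ)
    p≉0 z = HasDegree-≉0 {num x *ₚ D} hn λ n → trans (ex n) (*ₚ-cong {p} {[]} {den x} {den x} z (λ _ → refl) n)
    N : ℕ
    N = proj₁ (≉0⇒HasDegree p p≉0)
    hp : HasDegree p N
    hp = proj₂ (≉0⇒HasDegree p p≉0)
    total : a ℕ.+ δ ≡ N ℕ.+ b
    total = HasDegree-unique {num x *ₚ D} hn (HasDegree-cong {p *ₚ den x} {num x *ₚ D} (λ n → sym (ex n))
      (HasDegree-* {p} {den x} hp (degₚ-just (den x) ed)))

  shift-sub : ∀ N δ m → ℤ.+ N ℤ.- ℤ.+ δ ≡ m → ℤ.+ N ≡ m ℤ.+ ℤ.+ δ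
  shift-sub N δ m refl = sym (trans (ℤₚ.+-assoc (ℤ.+ N) (ℤ.- ℤ.+ δ) (ℤ.+ δ)) (trans
    (cong (λ z → ℤ.+ N ℤ.+ z) (ℤₚ.+-inverseˡ (ℤ.+ δ))) (ℤₚ.+-identityʳ _)))

  degree-just : ∀ {x p D δ m} → IsFraction x p D → HasDegree D δ → degₖ x ≡ just m → ∃ λ N → HasDegree p N × ℤ.+ N ≡ m ℤ.+ ℤ.+ δ
  degree-just {x} {p} {D} {δ} {m} f hD e with fraction-degree {x} {p} {D} f hD
  ... | inj₁ (e′ , _)      with trans (sym e) e′
  ...   | ()
  degree-just {δ = δ} {m} f hD e | inj₂ (N , hp , e′) = N , hp , shift-sub N δ m (just-injective (trans (sym e′) e))

  degree-below : ∀ {x p D δ m M} → IsFraction x p D → HasDegree D δ → degₖ x <ᵈ just m → ℤ.+ M ≡ m ℤ.+ ℤ.+ δ →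
    ∀ l → M ≤ l → coeff p l ≡ 0#
  degree-below {x} {p} {D} {δ} {m} {M} f hD lt eM l M≤l with fraction-degree {x} {p} {D} f hD
  ... | inj₁ (_ , z)        = z l
  ... | inj₂ (N , hp , e)   = proj₂ hp l (ℕₚ.<-≤-trans (ℤₚ.drop‿+<+ (subst₂ ℤ._<_ (sym (shift-sub N δ _ refl)) (sym eM)
        (ℤₚ.+-monoˡ-< (ℤ.+ δ) (subst (_<ᵈ just m) e lt)))) M≤l)

  module _ {L : TernaryLattice} {D : Poly} (int : Integral L D) {δ : ℕ} (hD : HasDegree D δ) (U : Mat₃ Poly) where
    open Integral int

    minimum : ∀ {m} i → degₖ (gramOf L U i i) ≡ just m → ∃ λ N → HasDegree (gramIn n U i i) N × ℤ.+ N ≡ m ℤ.+ ℤ.+ δ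
    minimum i = degree-just {gramOf L U i i} {gramIn n U i i} {D} (halfB-fraction (col U i) (col U i)) hD

    reducedGram : Reduced (gramOf L U) → (μ : Fin 3 → ℕ) (μℤ : Fin 3 → ℤ) → (∀ i → degₖ (gramOf L U i i) ≡ just (μℤ i)) →
      (∀ i → ℤ.+ μ i ≡ μℤ i ℤ.+ ℤ.+ δ) → ReducedGram (gramIn n U) μ
    reducedGram red μ μℤ e eμ = record
      { symmetric = λ i j → B-sym {n} n-sym (col U i) (col U j)
      ; diagonal-degree = λ i → let (N , h , eN) = minimum i (e i) in
          subst (HasDegree (gramIn n U i i)) (ℤₚ.+-injective (trans eN (sym (eμ i)))) h
      ; upper = λ i j l i<j le → degree-below {gramOf L U i j} {gramIn n U i j} {D} (halfB-fraction (col U i) (col U j)) hD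
          (subst (degₖ (gramOf L U i j) <ᵈ_) (e i) (proj₂ red i j i<j)) (eμ i) l le }
      where open Bilinear 𝔽

-- Matching the two bases and building the isometry.

module Classification (𝔽 : FiniteField) (odd : FiniteField.size 𝔽 ℕ.% 2 ≡ 1) (4<size : 4 < FiniteField.size 𝔽) (wts : Weights) where
  open FieldTheory 𝔽
  open FieldCounting 𝔽 odd
  open Forms 𝔽
  open Degrees 𝔽
  open Bilinear 𝔽
  open Boxes 𝔽 odd 4<size wts using (module BoxLevel; w)
  open Core 𝔽 odd 4<size wts
  open Reduction 𝔽
  open Definiteness 𝔽 odd
  open Weights wts
  open F-solver

  m₁≤m₃ : m₁ ≤ m₃
  m₁≤m₃ = ℕₚ.<⇒≤ (ℕₚ.<-trans m₁<m₂ m₂<m₃)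

  m₁+m₃ : m₁ ℕ.+ m₃ ≡ (m₁ ℕ.+ ℓ) ℕ.+ (m₁ ℕ.+ ℓ)
  m₁+m₃ = trans (cong (m₁ ℕ.+_) m₃≡′) (ℕS.solve 2 (λ a l → a ℕS.:+ (a ℕS.:+ (l ℕS.:+ l)) ℕS.:= (a ℕS.:+ l) ℕS.:+ (a ℕS.:+ l)) refl m₁ ℓ)
    where
    module ℕS = +-*-Solver

  record Basis {L D} (int : Integral L D) : Set where
    open Integral int
    field
      U V     : Mat₃ Poly
      UV      : U ·ₘ V ≈ₘ Iₘ
      VU      : V ·ₘ U ≈ₘ Iₘ
      reduced : ReducedGram (gramIn n U) μ

    form : Gram
    form = gramIn n U

    to-basis : RespectsRep (λ v → B n v v) (λ v → B form v v)
    to-basis = transport-rep {λ v → B n v v} {λ v → B form v v} (V ·ᵥ_) (U ·ᵥ_)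
      (λ {u} {v} → ·ᵥ-cong V {u} {v}) (λ {u} {v} → ·ᵥ-cong U {u} {v}) (inverse-·ᵥ {V} {U} VU) (inverse-·ᵥ {U} {V} UV)
      (λ {u} {v} e → B-cong form {u} {v} {u} {v} e e)
      (λ v i → trans (sym (B-gramIn {n} n-sym U (V ·ᵥ v) (V ·ᵥ v) i))
        (B-cong n {U ·ᵥ (V ·ᵥ v)} {v} {U ·ᵥ (V ·ᵥ v)} {v} (inverse-·ᵥ {U} {V} UV v) (inverse-·ᵥ {U} {V} UV v) i))

    from-basis : RespectsRep (λ v → B form v v) (λ v → B n v v)
    from-basis = transport-rep {λ v → B form v v} {λ v → B n v v} (U ·ᵥ_) (V ·ᵥ_)
      (λ {u} {v} → ·ᵥ-cong U {u} {v}) (λ {u} {v} → ·ᵥ-cong V {u} {v}) (inverse-·ᵥ {U} {V} UV) (inverse-·ᵥ {V} {U} VU)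
      (λ {u} {v} e → B-cong n {u} {v} {u} {v} e e) (λ v → B-gramIn {n} n-sym U v v)

  open Basis

  shape : ∀ {L D} {int : Integral L D} → Definite L → (b : Basis int) → Shape wts (form b)
  shape {int = int} def b = record
    { symmetric = symmetric
    ; degree = λ i l lt → proj₂ (diagonal-degree i) l lt
    ; lead≢0 = λ i → proj₁ (diagonal-degree i)
    ; degree₀₁ = λ l → upper 0F 1F l (s≤s z≤n)
    ; degree₀₂ = λ l → upper 0F 2F l (s≤s z≤n)
    ; degree₁₂ = λ l → upper 1F 2F l (s≤s (s≤s z≤n))
    ; anisotropic = anisotropic def int {U b} {V b} (VU b) (reduced b) (m₁ ℕ.+ ℓ) m₁≤m₃ m₁+m₃ }
    where
    open ReducedGram (reduced b)

  rescaled : ∀ {L D} {int : Integral L D} (b : Basis int) s → (∀ i → s i ≢ 0#) →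
    Σ (Basis int) λ b′ → ∀ i j → form b′ i j ≈ₚ map ((s i * s j) *_) (form b i j)
  rescaled {int = int} b s s≢0 = record
    { U = rescale (U b) s ; V = proj₁ invertible ; UV = proj₁ (proj₂ invertible) ; VU = proj₂ (proj₂ invertible)
    ; reduced = record
      { symmetric = λ i j → B-sym {n} n-sym (col (rescale (U b) s) i) (col (rescale (U b) s) j)
      ; diagonal-degree = λ i → (λ e → *-≢0 (*-≢0 (s≢0 i) (s≢0 i)) (proj₁ (diagonal-degree i)) (trans (sym (entry i i (μ i))) e))
          , λ l lt → vanish i i l (proj₂ (diagonal-degree i) l lt)
      ; upper = λ i j l lt le → vanish i j l (upper i j l lt le) } } , scaled
    where
    open Integral int
    open ReducedGram (reduced b)
    invertible : Invertible (rescale (U b) s)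
    invertible = rescale-invertible {U b} s s≢0 (V b , UV b , VU b)
    scaled : ∀ i j → gramIn n (rescale (U b) s) i j ≈ₚ map ((s i * s j) *_) (form b i j)
    scaled = gramIn-rescale {n} n-sym (U b) s
    entry : ∀ i j l → coeff (gramIn n (rescale (U b) s) i j) l ≡ s i * s j * coeff (form b i j) l
    entry i j l = trans (scaled i j l) (coeff-scale (s i * s j) (form b i j) l)
    vanish : ∀ i j l → coeff (form b i j) l ≡ 0# → coeff (gramIn n (rescale (U b) s) i j) l ≡ 0#
    vanish i j l z = trans (entry i j l) (trans (cong (s i * s j *_) z) (zeroʳ _))

  sign : Fin 3 → Fin 3 → Carrier
  sign i j with i Fin.≟ j
  ... | yes _ = - 1#
  ... | no _  = 1#

  -1*-1 : - 1# * - 1# ≡ 1#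
  -1*-1 = trans (solve 1 (λ x → :- x :* :- x := x :* x) refl 1#) (*-identityˡ 1#)

  flipped : ∀ {L D} {int : Integral L D} (b : Basis int) k → Σ (Basis int) λ b′ →
    ∀ i j → (sign k i * sign k j ≡ 1# → form b′ i j ≈ₚ form b i j) × (sign k i * sign k j ≡ - 1# → form b′ i j ≈ₚ -ₚ form b i j)
  flipped b k = proj₁ flip , λ i j →
      (λ e l → trans (entry i j l) (trans (cong (_* coeff (form b i j) l) e) (*-identityˡ _)))
    , (λ e l → trans (entry i j l) (trans (cong (_* coeff (form b i j) l) e) (trans
        (solve 2 (λ o x → :- o :* x := :- (o :* x)) refl 1# (coeff (form b i j) l)) (trans (cong -_ (*-identityˡ _)) (sym (coeff-neg (form b i j) l))))))
    where
    sign≢0 : ∀ i → sign k i ≢ 0#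
    sign≢0 i e with k Fin.≟ i
    ... | yes _ = 0≢1 (trans (sym (zeroˡ _)) (trans (cong (_* - 1#) (sym e)) -1*-1))
    ... | no _  = 0≢1 (sym e)
    flip = rescaled b (sign k) sign≢0
    entry : ∀ i j l → coeff (form (proj₁ flip) i j) l ≡ sign k i * sign k j * coeff (form b i j) l
    entry i j l = trans (proj₂ flip i j l) (coeff-scale (sign k i * sign k j) (form b i j) l)

  module _ {L L′ D} (definite : Definite L) (definite′ : Definite L′) (int : Integral L D) (int′ : Integral L′ D)
    (isospectral : Isospectral L L′) where
    private
      module I  = Integral int
      module I′ = Integral int′

    -- Isospectrality enters here and in the converse `respects′`: the polynomial κ as a value of
    -- the integral form is κ/D as a value of the lattice.
    respects : (b : Basis int) (b′ : Basis int′) → RespectsRep (λ v → B (form b) v v) (λ v → B (form b′) v v)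
    respects b b′ κ N r = to-basis b′ κ N (I′.number⇒represents κ N (proj₁ (isospectral (κ / D) I.D≉0 N)
      (I.represents⇒number κ N (from-basis b κ N r))))

    respects′ : (b : Basis int) (b′ : Basis int′) → RespectsRep (λ v → B (form b′) v v) (λ v → B (form b) v v)
    respects′ b b′ κ N r = to-basis b κ N (I.number⇒represents κ N (proj₂ (isospectral (κ / D) I.D≉0 N)
      (I′.represents⇒number κ N (from-basis b′ κ N r))))

    -- The isometry reads off coordinates in the one basis and uses them in the other.
    equal-forms⇒isometric : (b : Basis int) (b′ : Basis int′) → (∀ i j → form b i j ≈ₚ form b′ i j) → Isometric L L′
    equal-forms⇒isometric b b′ e = U b′ ·ₘ V b , (U b ·ₘ V b′ , composite b b′ , composite b′ b) , λ v →
      proj₂ (IsFraction-≈ {Q L′ ((U b′ ·ₘ V b) ·ᵥ v)} {Q L v} {B I′.n (W v) (W v)} {B I.n v v} D I.D≉0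
        (I′.halfB-fraction (W v) (W v)) (I.halfB-fraction v v)) (value v)
      where
      composite : ∀ {L₁ L₂ D₁ D₂} {i₁ : Integral L₁ D₁} {i₂ : Integral L₂ D₂} (b₁ : Basis i₁) (b₂ : Basis i₂) →
        (U b₂ ·ₘ V b₁) ·ₘ (U b₁ ·ₘ V b₂) ≈ₘ Iₘ
      composite b₁ b₂ i j n = trans (·ₘ-·ᵥ (U b₂) (V b₁) (U b₁ ·ᵥ col (V b₂) j) i n) (trans
        (·ᵥ-cong (U b₂) {V b₁ ·ᵥ (U b₁ ·ᵥ col (V b₂) j)} {col (V b₂) j} (inverse-·ᵥ {V b₁} {U b₁} (VU b₁) (col (V b₂) j)) i n) (UV b₂ i j n))
      W : Triple → Triple
      W v = (U b′ ·ₘ V b) ·ᵥ v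
      value : ∀ v → B I′.n (W v) (W v) ≈ₚ B I.n v v
      value v n = begin
        coeff (B I′.n (W v) (W v)) n
          ≡⟨ B-cong I′.n {W v} {U b′ ·ᵥ x} {W v} {U b′ ·ᵥ x} (·ₘ-·ᵥ (U b′) (V b) v) (·ₘ-·ᵥ (U b′) (V b) v) n ⟩
        coeff (B I′.n (U b′ ·ᵥ x) (U b′ ·ᵥ x)) n
          ≡⟨ B-gramIn {I′.n} I′.n-sym (U b′) x x n ⟩
        coeff (B (form b′) x x) n
          ≡⟨ B-congᴳ {form b′} {form b} x x (λ i j → inj₁ (λ l → sym (e i j l))) n ⟩
        coeff (B (form b) x x) n
          ≡⟨ sym (B-gramIn {I.n} I.n-sym (U b) x x n) ⟩
        coeff (B I.n (U b ·ᵥ x) (U b ·ᵥ x)) n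
          ≡⟨ B-cong I.n {U b ·ᵥ x} {v} {U b ·ᵥ x} {v} (inverse-·ᵥ {U b} {V b} (UV b) v) (inverse-·ᵥ {U b} {V b} (UV b) v) n ⟩
        coeff (B I.n v v) n ∎
        where
        open ≡-Reasoning
        x : Triple
        x = V b ·ᵥ v

    module _ (b : Basis int) where
      private
        G : Gram
        G = form b
        sh : Shape wts G
        sh = shape definite b
        module Sh = Shape sh

      module _ (b′ : Basis int′) where
        private
          G′ : Gram
          G′ = form b′
          sh′ : Shape wts G′
          sh′ = shape definite′ b′
          module Sh′ = Shape sh′

          w-top : w (position₁ k ℓ) ≡ m₃
          w-top = trans (cong (weight m₁ m₂) (slot-position₁ k ℓ)) (sym m₃≡′)

          module Full = BoxLevel (position₁ k ℓ) (ℕₚ.≤-reflexive w-top) elems elems-unique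
            (λ c _ lt → ⊥-elim (ℕₚ.<⇒≢ lt w-top)) (λ c _ → ∈-elems c)

          -- Each diagonal entry of G is a value of the first form, hence of the second. The degree
          -- of the value bounds the weight of the representing vector, which confines its
          -- coordinates.
          value : ∀ i → ∃ λ v → B G′ v v ≈ₚ G i i
          value i = proj₁ found , λ l → trans (proj₂ found l) (B-unit-1 G i i l)
            where
            μ≤m₃ : ∀ i → μ i ≤ m₃
            μ≤m₃ 0F = m₁≤m₃
            μ≤m₃ 1F = ℕₚ.<⇒≤ m₂<m₃
            μ≤m₃ 2F = ℕₚ.≤-refl
            found = Full.level-value {G} {G′} sh (respects b b′) (unit i 1ₚ) (λ N lt → trans (B-unit-1 G i i N)
              (Sh.degree i N (ℕₚ.≤-<-trans (μ≤m₃ i) (subst (_< N) w-top lt))))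

          bounded : ∀ i → Bounded wts (μ i) (proj₁ (value i))
          bounded i = degree⇒bounded wts sh′ (proj₁ (value i)) (μ i) (λ l lt → trans (proj₂ (value i) l) (Sh.degree i l lt))

          μ+0 : ∀ i → μ i ≡ μ i ℕ.+ (0 ℕ.+ 0)
          μ+0 i = sym (ℕₚ.+-identityʳ (μ i))

          higher : ∀ {m m′} → m < m′ → ∀ l → m ≢ m′ ℕ.+ (l ℕ.+ l)
          higher lt l e = ℕₚ.<⇒≱ lt (subst (_ ≤_) (sym e) (ℕₚ.m≤m+n _ (l ℕ.+ l)))

          c η : Carrier
          c = coeff (proj₁ (value 0F) 0F) 0
          η = coeff (proj₁ (value 1F) 1F) 0

          -- Weight at most m₁ leaves only the constant multiples of the first basis vector, so the
          -- whole polynomial a is matched up to the factor c².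
          a₀≈ : ∀ l → coeff (G 0F 0F) l ≡ c * c * coeff (G′ 0F 0F) l
          a₀≈ l = begin
            coeff (G 0F 0F) l                      ≡⟨ sym (proj₂ (value 0F) l) ⟩
            coeff (B G′ v v) l                     ≡⟨ B-cong G′ {v} {c ∙ u} {v} {c ∙ u} v≈ v≈ l ⟩
            coeff (B G′ (c ∙ u) (c ∙ u)) l         ≡⟨ trans (B-∙ˡ G′ c u (c ∙ u) l) (coeff-scale c (B G′ u (c ∙ u)) l) ⟩
            c * coeff (B G′ u (c ∙ u)) l           ≡⟨ cong (c *_) (trans (B-sym {G′} Sh′.symmetric u (c ∙ u) l)
                                                        (trans (B-∙ˡ G′ c u u l) (coeff-scale c (B G′ u u) l))) ⟩
            c * (c * coeff (B G′ u u) l)           ≡⟨ trans (sym (*-assoc _ _ _)) (cong (c * c *_) (B-unit-1 G′ 0F 0F l)) ⟩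
            c * c * coeff (G′ 0F 0F) l             ∎
            where
            open ≡-Reasoning
            v u : Triple
            v = proj₁ (value 0F)
            u = unit 0F 1ₚ
            v≈ : v ≈ᵥ c ∙ u
            v≈ 0F zero    = sym (*-identityʳ c)
            v≈ 0F (suc l) = bounded 0F 0F (suc l) (ℕₚ.m<m+n m₁ (s≤s z≤n))
            v≈ 1F l       = bounded 0F 1F l (ℕₚ.<-≤-trans m₁<m₂ (ℕₚ.m≤m+n m₂ _))
            v≈ 2F l       = bounded 0F 2F l (ℕₚ.<-≤-trans (ℕₚ.<-trans m₁<m₂ m₂<m₃) (ℕₚ.m≤m+n m₃ _))

          -- At degree m₂ the first coordinate is excluded by parity and the third by size; only the
          -- constant coefficient η of the second is seen.
          d₀≡ : Sh.lead 1F ≡ η * η * Sh′.lead 1F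
          d₀≡ = begin
            Sh.lead 1F                                  ≡⟨ sym (proj₂ (value 1F) m₂) ⟩
            coeff (B G′ v v) m₂                         ≡⟨ B-top wts sh′ {v} (bounded 1F) ⟩
            Σ₃ _+_ (diagonal wts sh′ v m₂)              ≡⟨ cong₂ (λ x y → x + (diagonal wts sh′ v m₂ 1F + y))
                                                             (diagonal-none wts sh′ {v} 0F (bounded 1F) (λ l e → parity₁₂ l 0 (trans (sym e) (μ+0 1F))))
                                                             (diagonal-none wts sh′ {v} 2F (bounded 1F) (higher m₂<m₃)) ⟩
            0# + (diagonal wts sh′ v m₂ 1F + 0#)        ≡⟨ trans (+-identityˡ _) (+-identityʳ _) ⟩
            diagonal wts sh′ v m₂ 1F                    ≡⟨ diagonal-lead wts sh′ {v} 1F 0 (bounded 1F) (μ+0 1F) ⟩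
            Sh′.lead 1F * (η * η)                       ≡⟨ *-comm _ _ ⟩
            η * η * Sh′.lead 1F                         ∎
            where
            open ≡-Reasoning
            v : Triple
            v = proj₁ (value 1F)

          factor≢0 : ∀ {x y z} → x ≢ 0# → x ≡ y * y * z → y ≢ 0#
          factor≢0 x≢0 e refl = x≢0 (trans e (trans (cong (_* _) (zeroˡ 0#)) (zeroˡ _)))

          c≢0 : c ≢ 0#
          c≢0 = factor≢0 (Sh.lead≢0 0F) (a₀≈ m₁)
          η≢0 : η ≢ 0#
          η≢0 = factor≢0 (Sh.lead≢0 1F) d₀≡

          -- Values of degree m₃ mix a₀ and g₀, so g₀ is reached through the product -a₀g₀. It is a
          -- nonsquare for both forms, and two nonsquares differ by a square factor.
          ratio : ∃ λ s → - (Sh′.lead 0F * Sh′.lead 2F) * (s * s) ≡ - (Sh.lead 0F * Sh.lead 2F)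
          ratio = nonsquare-ratio
            (leads-nonsquare definite′ int′ {U b′} {V b′} (VU b′) (reduced b′) 0F (m₁ ℕ.+ ℓ) (s≤s z≤n) m₁≤m₃ m₁+m₃)
            (leads-nonsquare definite int {U b} {V b} (VU b) (reduced b) 0F (m₁ ℕ.+ ℓ) (s≤s z≤n) m₁≤m₃ m₁+m₃)

          s : Carrier
          s = proj₁ ratio

          -- From a₀ = c²a₀′ and a₀g₀ = s²a₀′g₀′ follows g₀ = (s/c)²g₀′.
          θ : Carrier
          θ = s * inv c

          g₀≡ : Sh.lead 2F ≡ θ * θ * Sh′.lead 2F
          g₀≡ = sym (*-cancelˡ (*-≢0 (*-≢0 c≢0 c≢0) (Sh′.lead≢0 0F)) (begin
            c * c * a′ * (θ * θ * g′)
              ≡⟨ F-solver.solve 5 (λ c a s i g → c :* c :* a :* (s :* i :* (s :* i) :* g) := :- (:- (a :* g) :* (s :* s)) :* ((c :* i) :* (c :* i))) refl c a′ s (inv c) g′ ⟩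
            - (- (a′ * g′) * (s * s)) * ((c * inv c) * (c * inv c))
              ≡⟨ cong₂ (λ x y → - x * (y * y)) (proj₂ ratio) (inv-inverseʳ c≢0) ⟩
            - (- (Sh.lead 0F * Sh.lead 2F)) * (1# * 1#)
              ≡⟨ trans (cong (- (- (Sh.lead 0F * Sh.lead 2F)) *_) (*-identityˡ 1#)) (*-identityʳ _) ⟩
            - (- (Sh.lead 0F * Sh.lead 2F))
              ≡⟨ solve 1 (λ x → :- (:- x) := x) refl (Sh.lead 0F * Sh.lead 2F) ⟩
            Sh.lead 0F * Sh.lead 2F
              ≡⟨ cong (_* Sh.lead 2F) (a₀≈ m₁) ⟩
            c * c * a′ * Sh.lead 2F ∎))
            where
            open ≡-Reasoning
            a′ = Sh′.lead 0F
            g′ = Sh′.lead 2F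

          scale : Fin 3 → Carrier
          scale 0F = c
          scale 1F = η
          scale 2F = θ

          scale≢0 : ∀ i → scale i ≢ 0#
          scale≢0 0F = c≢0
          scale≢0 1F = η≢0
          scale≢0 2F = factor≢0 (Sh.lead≢0 2F) g₀≡

        normalised : Σ (Basis int′) λ b″ → G 0F 0F ≈ₚ form b″ 0F 0F × Sh.lead 1F ≡ coeff (form b″ 1F 1F) m₂ × Sh.lead 2F ≡ coeff (form b″ 2F 2F) m₃
        normalised = proj₁ r , (λ l → trans (a₀≈ l) (sym (entry 0F l))) , trans d₀≡ (sym (entry 1F m₂)) , trans g₀≡ (sym (entry 2F m₃))
          where
          r = rescaled b′ scale scale≢0
          entry : ∀ i l → coeff (form (proj₁ r) i i) l ≡ scale i * scale i * coeff (G′ i i) l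
          entry i l = trans (proj₂ r i i l) (coeff-scale (scale i * scale i) (G′ i i) l)

      1*1 : 1# * 1# ≡ 1#
      1*1 = *-identityˡ 1#
      1*-1 : 1# * - 1# ≡ - 1#
      1*-1 = *-identityˡ (- 1#)
      -1*1 : - 1# * 1# ≡ - 1#
      -1*1 = *-identityʳ (- 1#)

      second : ∀ b′ → G 0F 0F ≈ₚ form b′ 0F 0F × Sh.lead 1F ≡ coeff (form b′ 1F 1F) m₂ × Sh.lead 2F ≡ coeff (form b′ 2F 2F) m₃ →
        Σ (Basis int′) λ b″ → G 0F 0F ≈ₚ form b″ 0F 0F × G 0F 1F ≈ₚ form b″ 0F 1F × G 1F 1F ≈ₚ form b″ 1F 1F × Sh.lead 2F ≡ coeff (form b″ 2F 2F) m₃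
      second b′ (a≈ , d₀ , g₀) = choose Sec.b≈±
        where
        module Sec = SecondMinimum sh (shape definite′ b′) (respects b b′) (respects′ b b′) a≈ d₀
        choose : G 0F 1F ≈ₚ form b′ 0F 1F ⊎ G 0F 1F ≈ₚ -ₚ form b′ 0F 1F → _
        choose (inj₁ b≈) = b′ , a≈ , b≈ , Sec.d≈ , g₀
        -- Negating the second basis vector changes the signs of b and f alone, and f has not been
        -- compared yet.
        choose (inj₂ b≈) = let b″ , e = flipped b′ 1F in b″
          , (λ l → trans (a≈ l) (sym (proj₁ (e 0F 0F) 1*1 l)))
          , (λ l → trans (b≈ l) (sym (proj₂ (e 0F 1F) 1*-1 l)))
          , (λ l → trans (Sec.d≈ l) (sym (proj₁ (e 1F 1F) -1*-1 l)))
          , trans g₀ (sym (proj₁ (e 2F 2F) 1*1 m₃))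

      Agree : Basis int′ → Set
      Agree b′ = G 0F 0F ≈ₚ form b′ 0F 0F × G 0F 1F ≈ₚ form b′ 0F 1F × G 1F 1F ≈ₚ form b′ 1F 1F ×
                 G 2F 2F ≈ₚ form b′ 2F 2F × G 0F 2F ≈ₚ form b′ 0F 2F

      third : ∀ b′ → G 0F 0F ≈ₚ form b′ 0F 0F × G 0F 1F ≈ₚ form b′ 0F 1F × G 1F 1F ≈ₚ form b′ 1F 1F × Sh.lead 2F ≡ coeff (form b′ 2F 2F) m₃ →
        Σ (Basis int′) Agree
      third b′ (a≈ , b≈ , d≈ , g₀) = choose T.e≈±
        where
        module T = ThirdMinimum sh (shape definite′ b′) (respects b b′) (respects′ b b′) a≈ b≈ d≈ g₀
        choose : G 0F 2F ≈ₚ form b′ 0F 2F ⊎ G 0F 2F ≈ₚ -ₚ form b′ 0F 2F → Σ (Basis int′) Agree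
        choose (inj₁ e≈) = b′ , a≈ , b≈ , d≈ , T.g≈ , e≈
        choose (inj₂ e≈) = let b″ , e = flipped b′ 2F in b″
          , (λ l → trans (a≈ l) (sym (proj₁ (e 0F 0F) 1*1 l)))
          , (λ l → trans (b≈ l) (sym (proj₁ (e 0F 1F) 1*1 l)))
          , (λ l → trans (d≈ l) (sym (proj₁ (e 1F 1F) 1*1 l)))
          , (λ l → trans (T.g≈ l) (sym (proj₁ (e 2F 2F) -1*-1 l)))
          , (λ l → trans (e≈ l) (sym (proj₂ (e 0F 2F) 1*-1 l)))

      neg-zero : ∀ {p r t} → p ≈ₚ 0ₚ → p ≈ₚ r → t ≈ₚ -ₚ r → p ≈ₚ t
      neg-zero {p} {r} z e e′ l = trans (z l) (sym (trans (e′ l) (trans (coeff-neg r l) (trans (cong -_ (trans (sym (e l)) (z l))) -0≡0))))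

      -- If only f has the wrong sign, negate v₂ when b = 0 and v₃ when e = 0. Either move corrects
      -- f, and the other off-diagonal entry that changes sign is zero.
      last-entry : ∀ b′ → Agree b′ → Σ (Basis int′) λ b″ → Agree b″ × G 1F 2F ≈ₚ form b″ 1F 2F
      last-entry b′ (a≈ , b≈ , d≈ , g≈ , e≈) = choose (T.f≈± e≈)
        where
        module T = ThirdMinimum sh (shape definite′ b′) (respects b b′) (respects′ b b′) a≈ b≈ d≈ (g≈ m₃)
        choose : G 1F 2F ≈ₚ form b′ 1F 2F ⊎ (G 1F 2F ≈ₚ -ₚ form b′ 1F 2F × (G 0F 1F ≈ₚ 0ₚ ⊎ G 0F 2F ≈ₚ 0ₚ)) →
          Σ (Basis int′) λ b″ → Agree b″ × G 1F 2F ≈ₚ form b″ 1F 2F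
        choose (inj₁ f≈) = b′ , (a≈ , b≈ , d≈ , g≈ , e≈) , f≈
        choose (inj₂ (f≈ , inj₁ b≈0)) = let b″ , e = flipped b′ 1F in b″
          , ( (λ l → trans (a≈ l) (sym (proj₁ (e 0F 0F) 1*1 l)))
            , neg-zero {G 0F 1F} {form b′ 0F 1F} {form b″ 0F 1F} b≈0 b≈ (proj₂ (e 0F 1F) 1*-1)
            , (λ l → trans (d≈ l) (sym (proj₁ (e 1F 1F) -1*-1 l)))
            , (λ l → trans (g≈ l) (sym (proj₁ (e 2F 2F) 1*1 l)))
            , (λ l → trans (e≈ l) (sym (proj₁ (e 0F 2F) 1*1 l))))
          , (λ l → trans (f≈ l) (sym (proj₂ (e 1F 2F) -1*1 l)))
        choose (inj₂ (f≈ , inj₂ e≈0)) = let b″ , e = flipped b′ 2F in b″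
          , ( (λ l → trans (a≈ l) (sym (proj₁ (e 0F 0F) 1*1 l)))
            , (λ l → trans (b≈ l) (sym (proj₁ (e 0F 1F) 1*1 l)))
            , (λ l → trans (d≈ l) (sym (proj₁ (e 1F 1F) 1*1 l)))
            , (λ l → trans (g≈ l) (sym (proj₁ (e 2F 2F) -1*-1 l)))
            , neg-zero {G 0F 2F} {form b′ 0F 2F} {form b″ 0F 2F} e≈0 e≈ (proj₂ (e 0F 2F) 1*-1))
          , (λ l → trans (f≈ l) (sym (proj₂ (e 1F 2F) 1*-1 l)))

    isometric : Basis int → Basis int′ → Isometric L L′
    isometric b b′₀ = conclude (last-entry b b₂ ag)
      where
      b₁ = second b (proj₁ (normalised b b′₀)) (proj₂ (normalised b b′₀))
      b₂ = proj₁ (third b (proj₁ b₁) (proj₂ b₁))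
      ag = proj₂ (third b (proj₁ b₁) (proj₂ b₁))
      conclude : (Σ (Basis int′) λ b″ → Agree b b″ × form b 1F 2F ≈ₚ form b″ 1F 2F) → Isometric L L′
      conclude (b″ , (a≈ , b≈ , d≈ , g≈ , e≈) , f≈) = equal-forms⇒isometric b b″ entries
        where
        swap : ∀ i j → form b i j ≈ₚ form b″ i j → form b j i ≈ₚ form b″ j i
        swap i j e l = trans (ReducedGram.symmetric (reduced b) j i l) (trans (e l) (ReducedGram.symmetric (reduced b″) i j l))
        entries : ∀ i j → form b i j ≈ₚ form b″ i j
        entries 0F 0F = a≈
        entries 0F 1F = b≈
        entries 0F 2F = e≈
        entries 1F 0F = swap 0F 1F b≈
        entries 1F 1F = d≈
        entries 1F 2F = f≈
        entries 2F 0F = swap 0F 2F e≈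
        entries 2F 1F = swap 1F 2F f≈
        entries 2F 2F = g≈

-- Parities of the gaps, and the theorem.

even-gap : ∀ {m n} → m ≤ n → ℤ.+ 2 ∣ (ℤ.+ n ℤ.- ℤ.+ m) → ∃ λ i → n ≡ m ℕ.+ (i ℕ.+ i)
even-gap {m} {n} m≤n d with subst (2 ℕ∣.∣_) (cong ℤ.∣_∣ (trans (ℤₚ.m-n≡m⊖n n m) (ℤₚ.⊖-≥ m≤n))) d
... | ℕ∣.divides i e = i , trans (sym (ℕₚ.m+[n∸m]≡n m≤n)) (cong (m ℕ.+_) (trans e (trans (ℕₚ.*-comm i 2) (cong (i ℕ.+_) (ℕₚ.+-identityʳ i)))))

-- The second minimum has the other parity, so the gaps below and above it are odd.
weights : ∀ (μ : Fin 3 → ℕ) → μ 0F < μ 1F → μ 1F < μ 2F → (∃ λ h → μ 2F ≡ μ 0F ℕ.+ (h ℕ.+ h)) →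
  (∀ i j → μ 1F ≡ μ 0F ℕ.+ (i ℕ.+ i) → μ 2F ≡ μ 1F ℕ.+ (j ℕ.+ j) → ⊥) →
  Σ Weights λ wts → ∀ i → Weights.μ wts i ≡ μ i
weights μ lt lt′ (h , eh) parity with halves (μ 1F ℕ.∸ μ 0F) | halves (μ 2F ℕ.∸ μ 1F)
... | p , e | r , e′ = split e e′
  where
  rest : ∀ {a b} → a < b → b ≡ a ℕ.+ (b ℕ.∸ a)
  rest a<b = sym (ℕₚ.m+[n∸m]≡n (ℕₚ.<⇒≤ a<b))
  even : ∀ {a b} i → a < b → b ℕ.∸ a ≡ i ℕ.+ i → b ≡ a ℕ.+ (i ℕ.+ i)
  even {a} i a<b e = trans (rest a<b) (cong (a ℕ.+_) e)
  odd : ∀ {a b} i → a < b → suc (b ℕ.∸ a) ≡ i ℕ.+ i → suc b ≡ a ℕ.+ (i ℕ.+ i)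
  odd {a} i a<b e = trans (cong suc (rest a<b)) (trans (sym (ℕₚ.+-suc a _)) (cong (a ℕ.+_) e))
  total : ∀ {i j} → μ 2F ≡ μ 1F ℕ.+ j → μ 1F ≡ μ 0F ℕ.+ i → i ℕ.+ j ≡ h ℕ.+ h
  total {i} {j} ej ei = ℕₚ.+-cancelˡ-≡ (μ 0F) (i ℕ.+ j) (h ℕ.+ h) (trans (sym (ℕₚ.+-assoc (μ 0F) i j)) (trans (cong (ℕ._+ j) (sym ei)) (trans (sym ej) eh)))
  gaps : (μ 1F ℕ.∸ μ 0F) ℕ.+ (μ 2F ℕ.∸ μ 1F) ≡ h ℕ.+ h
  gaps = total (rest lt′) (rest lt)
  interchange : ∀ i j → (i ℕ.+ i) ℕ.+ (j ℕ.+ j) ≡ (i ℕ.+ j) ℕ.+ (i ℕ.+ j)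
  interchange = solve 2 (λ i j → (i :+ i) :+ (j :+ j) := (i :+ j) :+ (i :+ j)) refl
    where open +-*-Solver
  positive : ∀ {x i} → suc x ≡ i ℕ.+ i → 0 < i
  positive {i = suc _} _ = s≤s z≤n
  split : (μ 1F ℕ.∸ μ 0F ≡ p ℕ.+ p ⊎ suc (μ 1F ℕ.∸ μ 0F) ≡ p ℕ.+ p) → (μ 2F ℕ.∸ μ 1F ≡ r ℕ.+ r ⊎ suc (μ 2F ℕ.∸ μ 1F) ≡ r ℕ.+ r) →
    Σ Weights λ wts → ∀ i → Weights.μ wts i ≡ μ i
  split (inj₁ e) (inj₁ e′) = ⊥-elim (parity p r (even p lt e) (even r lt′ e′))
  -- One even and one odd gap would add up to an odd number, but the sum of the gaps is 2h.
  split (inj₁ e) (inj₂ e′) = ⊥-elim (odd≢even h (p ℕ.+ r) (trans (cong suc (sym gaps)) (trans (sym (ℕₚ.+-suc (μ 1F ℕ.∸ μ 0F) _)) (trans (cong₂ ℕ._+_ e e′) (interchange p r)))))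
  split (inj₂ e) (inj₁ e′) = ⊥-elim (odd≢even h (p ℕ.+ r) (trans (cong suc (sym gaps)) (trans (cong₂ ℕ._+_ e e′) (interchange p r))))
  split (inj₂ e) (inj₂ e′) = record
    { m₁ = μ 0F ; m₂ = μ 1F ; m₃ = μ 2F ; k = p ; m = r ; ℓ = ℕ.pred (p ℕ.+ r)
    ; m₂≡ = odd p lt e ; m₃≡ = odd r lt′ e′ ; ℓ≡ = ℕₚ.suc-pred (p ℕ.+ r) {{ℕ.>-nonZero (ℕₚ.<-≤-trans (positive e) (ℕₚ.m≤m+n p r))}}
    ; 0<k = positive e ; 0<m = positive e′ }
    , λ { 0F → refl ; 1F → refl ; 2F → refl }

theorem6p18 : (𝔽 : FiniteField) → FiniteField.size 𝔽 % 2 ≡ 1 →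
  (L L' : Over.TernaryLattice 𝔽) →
  Over.Definite 𝔽 L → Over.Definite 𝔽 L' → Over.Isospectral 𝔽 L L' →
  (μ₁ μ₂ μ₃ : ℤ) →
  Over.SuccessiveMinima 𝔽 L μ₁ μ₂ μ₃ → Over.SuccessiveMinima 𝔽 L' μ₁ μ₂ μ₃ →
  μ₁ ℤ.< μ₂ → μ₂ ℤ.< μ₃ → ℤ.+ 2 ∣ (μ₃ ℤ.- μ₁) →
  ℤ.+ 2 ℤ.+ μ₃ ℤ.- μ₂ ℤ.< ℤ.+ FiniteField.size 𝔽 → ℤ.+ 2 ℤ.+ μ₂ ℤ.- μ₁ ℤ.< ℤ.+ FiniteField.size 𝔽 →
  Over.Isometric 𝔽 L L'
theorem6p18 𝔽 odd L L' definite definite' isospectral μ₁ μ₂ μ₃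
  (U , (V , UV , VU) , red , e₁ , e₂ , e₃) (U' , (V' , UV' , VU') , red' , e₁' , e₂' , e₃') μ₁<μ₂ μ₂<μ₃ even bound _ =
  Classification.isometric 𝔽 odd 4<size (proj₁ wts) definite definite' int int' isospectral
    (record { U = U ; V = V ; UV = UV ; VU = VU ; reduced = subst-gram (reducedGram int (proj₂ deg-D) U red μ μℤ e eμ) })
    (record { U = U' ; V = V' ; UV = UV' ; VU = VU' ; reduced = subst-gram (reducedGram int' (proj₂ deg-D) U' red' μ μℤ e' eμ) })
  where
  open Over 𝔽
  open Forms 𝔽
  open Reduction 𝔽
  open Definiteness 𝔽 odd
  open Minima 𝔽 odd
  open FieldTheory 𝔽 using (module P)

  module C  = CommonDenominator L
  module C' = CommonDenominator L'

  D : Poly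
  D = C.denominator *ₚ C'.denominator
  int : Integral L D
  int = C.integral C'.denominator C'.denominator≉0 D (λ _ → refl)
  int' : Integral L' D
  int' = C'.integral C.denominator C.denominator≉0 D (P.*-comm C.denominator C'.denominator)
  deg-D : ∃ (HasDegree D)
  deg-D = ≉0⇒HasDegree D (Integral.D≉0 int)
  δ : ℕ
  δ = proj₁ deg-D

  μℤ : Fin 3 → ℤ
  μℤ 0F = μ₁
  μℤ 1F = μ₂
  μℤ 2F = μ₃
  e : ∀ i → degₖ (gramOf L U i i) ≡ just (μℤ i)
  e 0F = e₁
  e 1F = e₂
  e 2F = e₃
  e' : ∀ i → degₖ (gramOf L' U' i i) ≡ just (μℤ i)
  e' 0F = e₁'
  e' 1F = e₂'
  e' 2F = e₃'

  μ : Fin 3 → ℕ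
  μ i = proj₁ (minimum int (proj₂ deg-D) U i (e i))
  eμ : ∀ i → ℤ.+ μ i ≡ μℤ i ℤ.+ ℤ.+ δ
  eμ i = proj₂ (proj₂ (minimum int (proj₂ deg-D) U i (e i)))

  increasing : ∀ i j → μℤ i ℤ.< μℤ j → μ i < μ j
  increasing i j lt = ℤₚ.drop‿+<+ (subst₂ ℤ._<_ (sym (eμ i)) (sym (eμ j)) (ℤₚ.+-monoˡ-< (ℤ.+ δ) lt))

  difference : ℤ.+ μ 2F ℤ.- ℤ.+ μ 0F ≡ μ₃ ℤ.- μ₁
  difference = trans (cong₂ ℤ._-_ (eμ 2F) (eμ 0F)) (ℤ-solve μ₃ μ₁ (ℤ.+ δ))
    where
    open Data.Integer.Solver.+-*-Solver
    ℤ-solve : ∀ x y d → (x ℤ.+ d) ℤ.- (y ℤ.+ d) ≡ x ℤ.- y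
    ℤ-solve = solve 3 (λ x y d → (x :+ d) :- (y :+ d) := x :- y) refl

  wts : Σ Weights λ wts → ∀ i → Weights.μ wts i ≡ μ i
  wts = weights μ (increasing 0F 1F μ₁<μ₂) (increasing 1F 2F μ₂<μ₃)
    (even-gap (ℕₚ.<⇒≤ (ℕₚ.<-trans (increasing 0F 1F μ₁<μ₂) (increasing 1F 2F μ₂<μ₃))) (subst (ℤ.+ 2 ∣_) (sym difference) even))
    (minima-parity definite int {U} {V} VU (reducedGram int (proj₂ deg-D) U red μ μℤ e eμ))

  4<size : 4 < FiniteField.size 𝔽
  4<size = odd-5≤ odd (ℤₚ.drop‿+<+ (ℤₚ.≤-<-trans (3≤2+gap μ₂<μ₃) bound))

  subst-gram : ∀ {G} → ReducedGram G μ → ReducedGram G (Weights.μ (proj₁ wts))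
  subst-gram {G} r = record
    { symmetric = symmetric
    ; diagonal-degree = λ i → subst (HasDegree (G i i)) (sym (proj₂ wts i)) (diagonal-degree i)
    ; upper = λ i j l lt le → upper i j l lt (subst (_≤ l) (proj₂ wts i) le) }
    where open ReducedGram r
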